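{- Let $p$ be a prime, $n\ge1$, and $(n_1,\dots,n_s)$ a partition of $n$. For each $1\le i\le s$ let $\omega_i\in\mathbb{F}_{p^{n_i}}$ be such that $1,\omega_i,\dots,\omega_i^{n_i-1}$ is a basis of $\mathbb{F}_{p^{n_i}}$ over $\mathbb{F}_p$. Let $L_{i,j}$ ($1\le i\le s$, $1\le j\le n_i$) be $n$ linear forms in $\mathbb{F}_p[X_1,\dots,X_n]$ that are linearly independent over $\mathbb{F}_p$, and set $\lambda_i(\mathbf{x})=L_{i,1}(\mathbf{x})+L_{i,2}(\mathbf{x})\omega_i+\dots+L_{i,n_i}(\mathbf{x})\omega_i^{n_i-1}\in\mathbb{F}_{p^{n_i}}$ for $\mathbf{x}\in\mathbb{Z}^n$. Let $1\le H\le p^{1/2}$ be an integer, $\mathbf{N}\in\mathbb{Z}^n$, and $\mathbf{H}=(H_1,\dots,H_n)$ integers with $H\le H_i\le2H$ for all $i$. Then for every $\varepsilon>0$, $$E((\mathbf{N},\mathbf{N}+\mathbf{H}])\ll_{n,\varepsilon}H^{2n}p^{\varepsilon},$$ where $E((\mathbf{N},\mathbf{N}+\mathbf{H}])=\#\{(\mathbf{x},\mathbf{x}',\mathbf{y},\mathbf{y}')\in(\mathbf{N},\mathbf{N}+\mathbf{H}]^4:\ \lambda_i(\mathbf{x})\lambda_i(\mathbf{y}')=\lambda_i(\mathbf{x}')\lambda_i(\mathbf{y})\text{ in }\mathbb{F}_{p^{n_i}}\text{ for all }1\le i\le s\}$, and the implied constant depends only on $n,\varepsilon$ (uniform in $p$,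 the partition, the $\omega_i$, the forms $L_{i,j}$ and $\mathbf{N}$).
   Context: $(a,b]$ denotes integers $x$ with $a<x\le b$; $(\mathbf{N},\mathbf{N}+\mathbf{H}]=\prod_i(N_i,N_i+H_i]$. Linear forms are evaluated at integer vectors by reducing mod $p$. -}

module Defs where

open import Algebra.Apartness.Bundles using (HeytingField)
open import Algebra.Bundles using (Semiring; Ring; CommutativeRing)
open import Algebra.Module.Bundles using (LeftModule)
open import Algebra.Morphism.Structures using (module RingMorphisms)
import Algebra.Construct.Pointwise as Pointwise
import Algebra.Definitions.RawMonoid as RawMonoidDefs
import Algebra.Definitions.RawSemiring as RawSemiringDefs
open import Data.Fin.Base using (Fin; zero; suc; toℕ)
import Data.Fin.Properties as Fin
open import Data.Integer.Base as ℤ using (ℤ; +_)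
import Data.Integer.Properties as ℤ
open import Data.Integer.Divisibility.Signed
  using (_∣_; ∣m∣n⇒∣m+n; ∣m⇒∣-m; ∣n⇒∣m*n; ∣m⇒∣m*n)
  renaming (divides to ∣-divides)
open import Data.Integer.Solver using (module +-*-Solver)
open import Data.List.Base
  using (List; []; _∷_; applyUpTo; cartesianProduct; cartesianProductWith; filter; length)
open import Data.List.Membership.Propositional using (_∈_)
open import Data.List.Membership.Propositional.Properties
  using (∈-applyUpTo⁺; ∈-applyUpTo⁻; ∈-cartesianProductWith⁺; ∈-cartesianProductWith⁻)
open import Data.List.Relation.Unary.All using ([])
open import Data.List.Relation.Unary.AllPairs using ([]; _∷_)
open import Data.List.Relation.Unary.Any using (here)
open import Data.List.Relation.Unary.Unique.Propositional using (Unique)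
import Data.List.Relation.Unary.Unique.Propositional.Properties as Unique
open import Data.Nat.Base as ℕ using (ℕ; zero; suc; _≤_; _^_; z≤n; s≤s)
open import Data.Product.Base using (∃; _×_; _,_)
open import Data.Rational.Base using (ℚ; ↥_; ↧ₙ_)
open import Data.Vec.Base using (Vec; []; _∷_; lookup)
open import Data.Vec.Functional as Vector using (Vector)
import Data.Vec.Properties as Vec
open import Function.Base using (_∘_)
open import Function.Bundles using (Inverse; _⇔_; mk⇔)
import Function.Properties.Inverse as Inverse
open import Level using (Level; 0ℓ; _⊔_) renaming (suc to lsuc)
open import Relation.Binary.PropositionalEquality
  using (_≡_; refl; sym; trans; cong; subst)
  renaming (setoid to ≡-setoid)
open import Relation.Nullary.Decidable using (Dec; via-injection)

private
  variable
    a c ℓ ℓ₁ ℓ₂ r ℓr m ℓm : Level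

-- The field 𝔽ₚ as ℤ modulo p.  The carrier is ℤ itself, so reducing an
-- integer modulo p is the identity on carriers.

module _ (p : ℕ) where

  infix 4 _≡ₚ_

  _≡ₚ_ : ℤ → ℤ → Set
  x ≡ₚ y = + p ∣ x ℤ.- y

  private
    ≡⇒≡ₚ : ∀ {x y} → x ≡ y → x ≡ₚ y
    ≡⇒≡ₚ {x} refl = ∣-divides (+ 0) (ℤ.+-inverseʳ x)

    via : ∀ {x y} → x ≡ y → + p ∣ y → + p ∣ x
    via eq = subst (+ p ∣_) (sym eq)

    open +-*-Solver

    ≡ₚ-sym : ∀ {x y} → x ≡ₚ y → y ≡ₚ x
    ≡ₚ-sym {x} {y} d = via
      (solve 2 (λ x y → y :- x := :- (x :- y)) refl x y) (∣m⇒∣-m d)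

    ≡ₚ-trans : ∀ {x y z} → x ≡ₚ y → y ≡ₚ z → x ≡ₚ z
    ≡ₚ-trans {x} {y} {z} d e = via
      (solve 3 (λ x y z → x :- z := (x :- y) :+ (y :- z)) refl x y z)
      (∣m∣n⇒∣m+n d e)

    +-congₚ : ∀ {x y u v} → x ≡ₚ y → u ≡ₚ v → x ℤ.+ u ≡ₚ y ℤ.+ v
    +-congₚ {x} {y} {u} {v} d e = via
      (solve 4 (λ x y u v → (x :+ u) :- (y :+ v) := (x :- y) :+ (u :- v))
             refl x y u v)
      (∣m∣n⇒∣m+n d e)

    *-congₚ : ∀ {x y u v} → x ≡ₚ y → u ≡ₚ v → x ℤ.* u ≡ₚ y ℤ.* v
    *-congₚ {x} {y} {u} {v} d e = via
      (solve 4 (λ x y u v → (x :* u) :- (y :* v) := (x :- y) :* u :+ y :* (u :- v))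
             refl x y u v)
      (∣m∣n⇒∣m+n (∣m⇒∣m*n u d) (∣n⇒∣m*n y e))

    neg-congₚ : ∀ {x y} → x ≡ₚ y → ℤ.- x ≡ₚ ℤ.- y
    neg-congₚ {x} {y} d = via
      (solve 2 (λ x y → (:- x) :- (:- y) := :- (x :- y)) refl x y) (∣m⇒∣-m d)

  𝔽ₚ : CommutativeRing 0ℓ 0ℓ
  𝔽ₚ = record
    { Carrier = ℤ
    ; _≈_ = _≡ₚ_
    ; _+_ = ℤ._+_
    ; _*_ = ℤ._*_
    ; -_  = ℤ.-_
    ; 0#  = + 0
    ; 1#  = + 1
    ; isCommutativeRing = record
      { isRing = record
        { +-isAbelianGroup = record
          { isGroup = record
            { isMonoid = record
              { isSemigroup = record
                { isMagma = record
                  { isEquivalence = record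
                    { refl = λ {x} → ≡⇒≡ₚ {x} refl
                    ; sym = λ {x} {y} → ≡ₚ-sym {x} {y}
                    ; trans = λ {x} {y} {z} → ≡ₚ-trans {x} {y} {z}
                    }
                  ; ∙-cong = λ {x} {y} {u} {v} → +-congₚ {x} {y} {u} {v}
                  }
                ; assoc = λ x y z → ≡⇒≡ₚ (ℤ.+-assoc x y z)
                }
              ; identity = (λ x → ≡⇒≡ₚ (ℤ.+-identityˡ x))
                         , (λ x → ≡⇒≡ₚ (ℤ.+-identityʳ x))
              }
            ; inverse = (λ x → ≡⇒≡ₚ (ℤ.+-inverseˡ x))
                      , (λ x → ≡⇒≡ₚ (ℤ.+-inverseʳ x))
            ; ⁻¹-cong = λ {x} {y} → neg-congₚ {x} {y}
            }
          ; comm = λ x y → ≡⇒≡ₚ (ℤ.+-comm x y)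
          }
        ; *-cong = λ {x} {y} {u} {v} → *-congₚ {x} {y} {u} {v}
        ; *-assoc = λ x y z → ≡⇒≡ₚ (ℤ.*-assoc x y z)
        ; *-identity = (λ x → ≡⇒≡ₚ (ℤ.*-identityˡ x))
                     , (λ x → ≡⇒≡ₚ (ℤ.*-identityʳ x))
        ; distrib = (λ x y z → ≡⇒≡ₚ (ℤ.*-distribˡ-+ x y z))
                  , (λ x y z → ≡⇒≡ₚ (ℤ.*-distribʳ-+ x y z))
        }
      ; *-comm = λ x y → ≡⇒≡ₚ (ℤ.*-comm x y)
      }
    }

module _ {R : Ring r ℓr} (M : LeftModule R m ℓm) where
  open Ring R using (0#; _≈_) renaming (Carrier to S)
  open LeftModule M
  open RawMonoidDefs +ᴹ-rawMonoid using (sum)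

  linearCombination : ∀ {k} → Vector S k → Vector Carrierᴹ k → Carrierᴹ
  linearCombination c v = sum (λ j → c j *ₗ v j)

  LinearlyIndependent : ∀ {k} → Vector Carrierᴹ k → Set (r ⊔ ℓr ⊔ ℓm)
  LinearlyIndependent v =
    ∀ c → linearCombination c v ≈ᴹ 0ᴹ → ∀ j → c j ≈ 0#

  Spanning : ∀ {k} → Vector Carrierᴹ k → Set (r ⊔ m ⊔ ℓm)
  Spanning v = ∀ x → ∃ λ c → x ≈ᴹ linearCombination c v

  IsBasis : ∀ {k} → Vector Carrierᴹ k → Set (r ⊔ ℓr ⊔ m ⊔ ℓm)
  IsBasis v = LinearlyIndependent v × Spanning v

freeModule : (R : CommutativeRing r ℓr) (n : ℕ) →
             LeftModule (CommutativeRing.ring R) r ℓr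
freeModule R n = record
  { Carrierᴹ = Vector R.Carrier n
  ; _≈ᴹ_ = λ u v → ∀ k → u k R.≈ v k
  ; _+ᴹ_ = λ u v k → u k R.+ v k
  ; _*ₗ_ = λ x v k → x R.* v k
  ; 0ᴹ = λ _ → R.0#
  ; -ᴹ_ = λ v k → R.- v k
  ; isLeftModule = record
    { isLeftSemimodule = record
      { +ᴹ-isCommutativeMonoid = Pw.isCommutativeMonoid R.+-isCommutativeMonoid
      ; isPreleftSemimodule = record
        { *ₗ-cong = λ x≈y u≈v k → R.*-cong x≈y (u≈v k)
        ; *ₗ-zeroˡ = λ v k → R.zeroˡ (v k)
        ; *ₗ-distribʳ = λ v x y k → R.distribʳ (v k) x y
        ; *ₗ-identityˡ = λ v k → R.*-identityˡ (v k)
        ; *ₗ-assoc = λ x y v k → R.*-assoc x y (v k)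
        ; *ₗ-zeroʳ = λ x k → R.zeroʳ x
        ; *ₗ-distribˡ = λ x u v k → R.distribˡ x (u k) (v k)
        }
      }
    ; -ᴹ‿cong = λ u≈v k → R.-‿cong (u≈v k)
    ; -ᴹ‿inverse = (λ v k → R.-‿inverseˡ (v k)) , (λ v k → R.-‿inverseʳ (v k))
    }
  }
  where
  module R = CommutativeRing R
  module Pw = Pointwise (Fin n)

-- A finite field with pᵏ elements, as an extension of 𝔽ₚ.  Such a field
-- has decidable equality, so that the apartness relation of the Heyting
-- field is the negation of equality.  The embedding of 𝔽ₚ carries no
-- information: a ring homomorphism out of 𝔽ₚ is unique if it exists.

record GaloisField (p k : ℕ) c ℓ₁ ℓ₂ : Set (lsuc (c ⊔ ℓ₁ ⊔ ℓ₂)) where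
  field
    heytingField : HeytingField c ℓ₁ ℓ₂

  open HeytingField heytingField public

  commutativeRing : CommutativeRing c ℓ₁
  commutativeRing = record { isCommutativeRing = isCommutativeRing }

  open RawSemiringDefs (Semiring.rawSemiring (CommutativeRing.semiring commutativeRing)) public
    using () renaming (_^_ to _^ᶠ_)
  open RingMorphisms (CommutativeRing.rawRing (𝔽ₚ p)) (CommutativeRing.rawRing commutativeRing)
    using (IsRingHomomorphism)

  field
    cardinality : Inverse setoid (≡-setoid (Fin (p ^ k)))
    ι           : ℤ → Carrier
    ι-isHom     : IsRingHomomorphism ι

  infix 4 _≟_

  _≟_ : ∀ x y → Dec (x ≈ y)
  _≟_ = via-injection (Inverse.Inverse⇒Injection cardinality) Fin._≟_

  vectorSpace : LeftModule (CommutativeRing.ring (𝔽ₚ p)) c ℓ₁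
  vectorSpace = record
    { Carrierᴹ = Carrier
    ; _≈ᴹ_ = _≈_
    ; _+ᴹ_ = _+_
    ; _*ₗ_ = λ x v → ι x * v
    ; 0ᴹ = 0#
    ; -ᴹ_ = -_
    ; isLeftModule = record
      { isLeftSemimodule = record
        { +ᴹ-isCommutativeMonoid = K.+-isCommutativeMonoid
        ; isPreleftSemimodule = record
          { *ₗ-cong = λ {x} {y} x≈y u≈v → K.*-cong (ι.⟦⟧-cong {x} {y} x≈y) u≈v
          ; *ₗ-zeroˡ = λ v → K.trans (K.*-congʳ ι.0#-homo) (K.zeroˡ v)
          ; *ₗ-distribʳ = λ v x y →
              K.trans (K.*-congʳ (ι.+-homo x y)) (K.distribʳ v (ι x) (ι y))
          ; *ₗ-identityˡ = λ v → K.trans (K.*-congʳ ι.1#-homo) (K.*-identityˡ v)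
          ; *ₗ-assoc = λ x y v →
              K.trans (K.*-congʳ (ι.*-homo x y)) (K.*-assoc (ι x) (ι y) v)
          ; *ₗ-zeroʳ = λ x → K.zeroʳ (ι x)
          ; *ₗ-distribˡ = λ x u v → K.distribˡ (ι x) u v
          }
        }
      ; -ᴹ‿cong = K.-‿cong
      ; -ᴹ‿inverse = K.-‿inverse
      }
    }
    where
    module K = CommutativeRing commutativeRing
    module ι = RingMorphisms.IsRingHomomorphism ι-isHom

  powers : Carrier → Vector Carrier k
  powers ω j = ω ^ᶠ toℕ j

infix 4 _IsPartitionOf_

_IsPartitionOf_ : ∀ {s} → Vector ℕ s → ℕ → Set
ns IsPartitionOf n = (∀ i → 1 ≤ ns i) × Vector.foldr ℕ._+_ 0 ns ≡ n

flatten : ∀ {A : Set a} {s} {ns : Vector ℕ s} →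
          (∀ i → Vector A (ns i)) → Vector A (Vector.foldr ℕ._+_ 0 ns)
flatten {s = zero}  L = Vector.[]
flatten {s = suc _} L = L zero Vector.++ flatten (L ∘ suc)

-- A linear form in 𝔽ₚ[X₁,…,Xₙ] is given by its vector of coefficients.

LinearForm : ℕ → ℕ → Set
LinearForm p n = LeftModule.Carrierᴹ (freeModule (𝔽ₚ p) n)

evaluate : ∀ p {n} → LinearForm p n → Vec ℤ n → CommutativeRing.Carrier (𝔽ₚ p)
evaluate p L x = sum (λ k → L k * lookup x k)
  where
  open CommutativeRing (𝔽ₚ p) using (_*_; +-rawMonoid)
  open RawMonoidDefs +-rawMonoid using (sum)

-- The integers of (a , a + h] and the integer points of (N , N + H], each
-- listed exactly once: see ∈-interval, ∈-box and box-unique below.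

interval : ℤ → ℕ → List ℤ
interval a h = applyUpTo (λ t → a ℤ.+ + suc t) h

box : ∀ {n} → Vec ℤ n → Vec ℕ n → List (Vec ℤ n)
box []      []      = [] ∷ []
box (a ∷ N) (h ∷ H) = cartesianProductWith _∷_ (interval a h) (box N H)

∈-interval : ∀ {a h x} → x ∈ interval a h ⇔ (a ℤ.< x × x ℤ.≤ a ℤ.+ + h)
∈-interval {a} {h} {x} = mk⇔ to from
  where
  open +-*-Solver

  to : x ∈ interval a h → a ℤ.< x × x ℤ.≤ a ℤ.+ + h
  to x∈ with ∈-applyUpTo⁻ (λ t → a ℤ.+ + suc t) x∈
  ... | t , t<h , refl =
      subst (ℤ._< a ℤ.+ + suc t) (ℤ.+-identityʳ a)
        (ℤ.+-monoʳ-< a (ℤ.+<+ (s≤s z≤n)))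
    , ℤ.+-monoʳ-≤ a (ℤ.+≤+ t<h)

  offset : ∀ {d} → ℤ.0ℤ ℤ.< d → d ℤ.≤ + h → ∃ λ t → t ℕ.< h × d ≡ + suc t
  offset {+ suc t} _           (ℤ.+≤+ t<h) = t , t<h , refl
  offset {+ zero}  (ℤ.+<+ ()) _

  a+[x-a]≡x : a ℤ.+ (x ℤ.- a) ≡ x
  a+[x-a]≡x = solve 2 (λ a x → a :+ (x :- a) := x) refl a x

  from : a ℤ.< x × x ℤ.≤ a ℤ.+ + h → x ∈ interval a h
  from (a<x , x≤a+h) with offset {x ℤ.- a}
         (subst (ℤ._< x ℤ.- a) (ℤ.+-inverseʳ a) (ℤ.+-monoˡ-< (ℤ.- a) a<x))
         (subst (x ℤ.- a ℤ.≤_)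
           (solve 2 (λ a h → (a :+ h) :- a := h) refl a (+ h))
           (ℤ.+-monoˡ-≤ (ℤ.- a) x≤a+h))
  ... | t , t<h , eq = subst (_∈ interval a h)
          (trans (cong (λ d → a ℤ.+ d) (sym eq)) a+[x-a]≡x)
          (∈-applyUpTo⁺ (λ t → a ℤ.+ + suc t) t<h)

∈-box : ∀ {n} {N : Vec ℤ n} {H : Vec ℕ n} {x : Vec ℤ n} →
        x ∈ box N H ⇔
        (∀ k → lookup N k ℤ.< lookup x k × lookup x k ℤ.≤ lookup N k ℤ.+ + lookup H k)
∈-box {N = N} {H} {x} = mk⇔ (to N H x) (from N H x)
  where
  open Function.Bundles.Equivalence using () renaming (to to fwd; from to bwd)

  InBox : ∀ {n} → Vec ℤ n → Vec ℕ n → Vec ℤ n → Set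
  InBox N H x =
    ∀ k → lookup N k ℤ.< lookup x k × lookup x k ℤ.≤ lookup N k ℤ.+ + lookup H k

  to : ∀ {n} (N : Vec ℤ n) H x → x ∈ box N H → InBox N H x
  to []      []      []      _ ()
  to (a ∷ N) (h ∷ H) x x∈ k
    with ∈-cartesianProductWith⁻ _∷_ (interval a h) (box N H) x∈
  to (a ∷ N) (h ∷ H) x x∈ zero    | y , ys , y∈ , ys∈ , refl = fwd ∈-interval y∈
  to (a ∷ N) (h ∷ H) x x∈ (suc k) | y , ys , y∈ , ys∈ , refl = to N H ys ys∈ k

  from : ∀ {n} (N : Vec ℤ n) H x → InBox N H x → x ∈ box N H
  from []      []      []      _  = here refl
  from (a ∷ N) (h ∷ H) (y ∷ x) in-box =
    ∈-cartesianProductWith⁺ _∷_ (bwd ∈-interval (in-box zero))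
                                (from N H x (in-box ∘ suc))

box-unique : ∀ {n} (N : Vec ℤ n) (H : Vec ℕ n) → Unique (box N H)
box-unique []      []      = [] ∷ []
box-unique (a ∷ N) (h ∷ H) =
  Unique.cartesianProductWith⁺ _∷_ Vec.∷-injective
    (Unique.applyUpTo⁺₁ _ h λ i<j _ eq →
      ℤ.<-irrefl eq (ℤ.+-monoʳ-< a (ℤ.+<+ (s≤s i<j))))
    (box-unique N H)

module _ {p n s : ℕ} {ns : Vector ℕ s}
         (K : ∀ i → GaloisField p (ns i) c ℓ₁ ℓ₂)
         (ω : ∀ i → GaloisField.Carrier (K i))
         (L : ∀ i → Vector (LinearForm p n) (ns i))
         where

  λᴸ : ∀ i → Vec ℤ n → GaloisField.Carrier (K i)
  λᴸ i x = linearCombination vectorSpace (λ j → evaluate p (L i j) x) (powers (ω i))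
    where open GaloisField (K i)

  Quadruple : Set
  Quadruple = Vec ℤ n × Vec ℤ n × Vec ℤ n × Vec ℤ n

  Solution : Quadruple → Set ℓ₁
  Solution (x , x′ , y , y′) = ∀ i → let open GaloisField (K i) in
    λᴸ i x * λᴸ i y′ ≈ λᴸ i x′ * λᴸ i y

  solution? : ∀ q → Dec (Solution q)
  solution? (x , x′ , y , y′) = Fin.all? λ i → let open GaloisField (K i) in
    λᴸ i x * λᴸ i y′ ≟ λᴸ i x′ * λᴸ i y

  E : Vec ℤ n → Vec ℕ n → ℕ
  E N H = length (filter solution? (cartesianProduct B (cartesianProduct B (cartesianProduct B B))))
    where B = box N H

-- For a positive rational ε = u / v, the inequality e ≤ m · p ^ ε between
-- real numbers, with both sides raised to the power v.  A bound ≪ p ^ ε for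
-- every real ε > 0 follows from the bounds for rational ε > 0, by density.

infix 4 _≤_·_^ᵠ_

_≤_·_^ᵠ_ : ℕ → ℕ → ℕ → ℚ → Set
e ≤ m · p ^ᵠ ε = e ^ ↧ₙ ε ≤ m ^ ↧ₙ ε ℕ.* p ^ ℤ.∣ ↥ ε ∣

-- For z in the product A of the fields let V_z be the set of integer x with λ(x) = z λ(x') for some
-- integer x', seen as pairs (x , x'): a lattice of index pⁿ in ℤ²ⁿ.  The energy counts quadruples in which
-- two pairs lie on a common line of A², so it is governed by Σ_z a_z², a_z being the number of points of
-- V_z in a box, and differencing replaces the box by one centred at 0.  The number of points of V_z at scale
-- Lⁱ is log-convex in i, and its growth is tied to that of the dual lattice by a second moment argument,
-- so V_z or its dual grows with exponent at most n up to scale √p.  At the first scale where V_z has a point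
-- (x , x') with no vanishing component, that point determines z, which bounds the number of such z, and the
-- slow growth bounds a_z from there on.  Together they give H²ⁿ up to a fixed power of L, and L ≈ p^(1/k)
-- absorbs it into p^ε.  Points with a vanishing component are handled by eliminating coordinates and
-- induction on the number of fields.
module Submission where

open import Data.Nat using (ℕ)
open import Data.Nat.Primality using (Prime)

-- Counting over finite lists

-- The relation `∥` is transitive only through a pair without vanishing components, so only such
-- generic pairs can label lines, and the other, degenerate, points need separate treatment. They
-- also drive the estimate: if a line has no generic point at one level but some at the next, its
-- points at the lower level are all degenerate, and up to a constant they are at most as many as
-- the generic points of a ball slightly larger than that of the next level. Hence the square of
-- their number is at most a product of a generic and a degenerate count. Summed over lines, these
-- products are bounded by the number of pairs on a common line with a vanishing component, which
-- one field fewer controls.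
--
-- When the dual lattice is the slow one, pairs arise with one point in each of two coordinate
-- systems; hence the inductive statement concerns two systems `φ` and `ψ`. Duality uses no additive
-- characters but a sign, plus on residues in (0 , p / 2) and minus on their negatives: its mean is
-- zero, so incongruent forms are uncorrelated, and everything stays in the natural numbers.

module Counting where

  open import Data.Bool.Base using (if_then_else_)
  open import Data.Empty using (⊥-elim)
  open import Data.List.Base using (List; []; _∷_; length; _++_; map; filter; cartesianProductWith)
  open import Data.List.Membership.Propositional using (_∈_)
  open import Data.List.Relation.Unary.Any using (here; there)
  open import Data.List.Relation.Unary.All as All using (All; []; _∷_)
  open import Data.List.Relation.Unary.AllPairs using ([]; _∷_)
  open import Data.List.Relation.Unary.Unique.Propositional using (Unique)
  open import Data.Nat
  open import Data.Nat.Properties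
  open import Data.Nat.Solver using (module +-*-Solver)
  open import Data.Product hiding (map)
  open import Function.Base using (_∘_)
  open import Relation.Binary.PropositionalEquality
  open import Relation.Nullary
  open import Relation.Nullary.Decidable using (_×-dec_)
  open import Relation.Unary using (Decidable; Pred)
  open import Level using (Level)

  private variable
    a b ℓ ℓ′ : Level
    A : Set a
    B : Set b

  ∑ : List A → (A → ℕ) → ℕ
  ∑ []       f = 0
  ∑ (x ∷ xs) f = f x + ∑ xs f

  infix 5 ∑
  syntax ∑ xs (λ x → e) = ∑[ x ∈ xs ] e

  module _ {P : Set ℓ} where

    𝟙 : Dec P → ℕ
    𝟙 d = if does d then 1 else 0

    𝟙≤1 : (d : Dec P) → 𝟙 d ≤ 1
    𝟙≤1 (yes _) = ≤-refl
    𝟙≤1 (no _)  = z≤n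

    𝟙-yes : (d : Dec P) → P → 𝟙 d ≡ 1
    𝟙-yes (yes _) _ = refl
    𝟙-yes (no ¬p) p = ⊥-elim (¬p p)

    𝟙-no : (d : Dec P) → ¬ P → 𝟙 d ≡ 0
    𝟙-no (yes p) ¬p = ⊥-elim (¬p p)
    𝟙-no (no _)  _  = refl

    𝟙-≤ : ∀ {m} (d : Dec P) → (P → 1 ≤ m) → 𝟙 d ≤ m
    𝟙-≤ (yes p) f = f p
    𝟙-≤ (no _)  _ = z≤n

    𝟙*-mono : ∀ {m n} (d : Dec P) → (P → m ≤ n) → 𝟙 d * m ≤ 𝟙 d * n
    𝟙*-mono (yes p) f = *-monoʳ-≤ 1 (f p)
    𝟙*-mono (no _)  _ = z≤n

  𝟙-mono : ∀ {P : Set ℓ} {Q : Set ℓ′} (d : Dec P) (e : Dec Q) → (P → Q) → 𝟙 d ≤ 𝟙 e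
  𝟙-mono d e f = 𝟙-≤ d (λ p → ≤-reflexive (sym (𝟙-yes e (f p))))

  𝟙-cong : ∀ {P : Set ℓ} {Q : Set ℓ′} (d : Dec P) (e : Dec Q) → (P → Q) → (Q → P) → 𝟙 d ≡ 𝟙 e
  𝟙-cong d e f g = ≤-antisym (𝟙-mono d e f) (𝟙-mono e d g)

  𝟙-× : ∀ {P : Set ℓ} {Q : Set ℓ′} (d : Dec P) (e : Dec Q) → 𝟙 (d ×-dec e) ≡ 𝟙 d * 𝟙 e
  𝟙-× (yes _) (yes _) = refl
  𝟙-× (yes _) (no _)  = refl
  𝟙-× (no _)  _       = refl

  ∑-cong : ∀ (xs : List A) {f g} → (∀ x → f x ≡ g x) → ∑ xs f ≡ ∑ xs g
  ∑-cong []       e = refl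
  ∑-cong (x ∷ xs) e = cong₂ _+_ (e x) (∑-cong xs e)

  ∑-mono : ∀ (xs : List A) {f g} → (∀ {x} → x ∈ xs → f x ≤ g x) → ∑ xs f ≤ ∑ xs g
  ∑-mono []       le = z≤n
  ∑-mono (x ∷ xs) le = +-mono-≤ (le (here refl)) (∑-mono xs (le ∘ there))

  ∑-mono′ : ∀ (xs : List A) {f g} → (∀ x → f x ≤ g x) → ∑ xs f ≤ ∑ xs g
  ∑-mono′ xs le = ∑-mono xs (λ {x} _ → le x)

  ∑-const : ∀ (xs : List A) c → ∑[ x ∈ xs ] c ≡ length xs * c
  ∑-const []       c = refl
  ∑-const (x ∷ xs) c = cong (c +_) (∑-const xs c)

  ∑-≤const : ∀ (xs : List A) {f} c → (∀ {x} → x ∈ xs → f x ≤ c) → ∑ xs f ≤ length xs * c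
  ∑-≤const xs c le = ≤-trans (∑-mono xs le) (≤-reflexive (∑-const xs c))

  ∑-zero : ∀ (xs : List A) {f} → (∀ {x} → x ∈ xs → f x ≡ 0) → ∑ xs f ≡ 0
  ∑-zero xs e = n≤0⇒n≡0 (≤-trans (∑-≤const xs 0 (λ x∈ → ≤-reflexive (e x∈))) (≤-reflexive (*-zeroʳ (length xs))))

  open +-*-Solver

  ∑-cong∈ : ∀ (xs : List A) {f g} → (∀ {x} → x ∈ xs → f x ≡ g x) → ∑ xs f ≡ ∑ xs g
  ∑-cong∈ []       e = refl
  ∑-cong∈ (x ∷ xs) e = cong₂ _+_ (e (here refl)) (∑-cong∈ xs (e ∘ there))

  ∑-+ : ∀ (xs : List A) f g → ∑[ x ∈ xs ] (f x + g x) ≡ ∑ xs f + ∑ xs g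
  ∑-+ []       f g = refl
  ∑-+ (x ∷ xs) f g = trans (cong (f x + g x +_) (∑-+ xs f g))
    (solve 4 (λ a b c d → a :+ b :+ (c :+ d) := a :+ c :+ (b :+ d)) refl (f x) (g x) (∑ xs f) (∑ xs g))

  ∑-*ˡ : ∀ (xs : List A) c f → ∑[ x ∈ xs ] (c * f x) ≡ c * ∑ xs f
  ∑-*ˡ []       c f = sym (*-zeroʳ c)
  ∑-*ˡ (x ∷ xs) c f = trans (cong (c * f x +_) (∑-*ˡ xs c f)) (sym (*-distribˡ-+ c (f x) _))

  ∑-*ʳ : ∀ (xs : List A) c f → ∑[ x ∈ xs ] (f x * c) ≡ ∑ xs f * c
  ∑-*ʳ xs c f = trans (∑-cong xs (λ x → *-comm (f x) c)) (trans (∑-*ˡ xs c f) (*-comm c _))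

  ∑-swap : ∀ (xs : List A) (ys : List B) (f : A → B → ℕ) → ∑[ x ∈ xs ] (∑[ y ∈ ys ] f x y) ≡ ∑[ y ∈ ys ] (∑[ x ∈ xs ] f x y)
  ∑-swap []       ys f = sym (∑-zero ys (λ _ → refl))
  ∑-swap (x ∷ xs) ys f = trans (cong (∑ ys (f x) +_) (∑-swap xs ys f)) (sym (∑-+ ys (f x) (λ y → ∑ xs (λ x → f x y))))

  ∑-++ : ∀ (xs ys : List A) f → ∑ (xs ++ ys) f ≡ ∑ xs f + ∑ ys f
  ∑-++ []       ys f = refl
  ∑-++ (x ∷ xs) ys f = trans (cong (f x +_) (∑-++ xs ys f)) (sym (+-assoc (f x) _ _))

  ∑-map : ∀ (h : A → B) (xs : List A) (f : B → ℕ) → ∑ (map h xs) f ≡ ∑[ x ∈ xs ] f (h x)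
  ∑-map h []       f = refl
  ∑-map h (x ∷ xs) f = cong (f (h x) +_) (∑-map h xs f)

  module _ {c} {C : Set c} where
    ∑-product : ∀ (h : A → B → C) (xs : List A) (ys : List B) (f : C → ℕ) → ∑ (cartesianProductWith h xs ys) f ≡ ∑[ x ∈ xs ] (∑[ y ∈ ys ] f (h x y))
    ∑-product h []       ys f = refl
    ∑-product h (x ∷ xs) ys f = trans (∑-++ (map (h x) ys) _ f) (cong₂ _+_ (∑-map (h x) ys f) (∑-product h xs ys f))

  ∑-∈ : ∀ {xs : List A} {x} f → x ∈ xs → f x ≤ ∑ xs f
  ∑-∈ {xs = y ∷ xs} f (here refl) = m≤m+n (f y) _
  ∑-∈ {xs = y ∷ xs} f (there x∈)  = ≤-trans (∑-∈ f x∈) (m≤n+m _ (f y))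

  length-filter-∑ : ∀ {P : Pred A ℓ} (P? : Decidable P) xs → length (filter P? xs) ≡ ∑[ x ∈ xs ] 𝟙 (P? x)
  length-filter-∑ P? []       = refl
  length-filter-∑ P? (x ∷ xs) with P? x
  ... | yes _ = cong suc (length-filter-∑ P? xs)
  ... | no _  = length-filter-∑ P? xs

  #≤1 : ∀ {P : Pred A ℓ} (P? : Decidable P) {xs} → Unique xs →
        (∀ {x y} → x ∈ xs → y ∈ xs → P x → P y → x ≡ y) → ∑[ x ∈ xs ] 𝟙 (P? x) ≤ 1
  #≤1 P? {[]}     _        _  = z≤n
  #≤1 P? {x ∷ xs} (x∉ ∷ u) eq with P? x
  ... | no _  = #≤1 P? u (λ x∈ y∈ → eq (there x∈) (there y∈))
  ... | yes p = ≤-reflexive (cong suc (∑-zero xs (λ {y} y∈ → 𝟙-no (P? y) (λ q → All.lookup x∉ y∈ (eq (here refl) (there y∈) p q)))))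

  #-image : ∀ {P : Pred A ℓ} {Q : Pred B ℓ′} (P? : Decidable P) (Q? : Decidable Q)
            (_≟_ : (x y : B) → Dec (x ≡ y)) (g : A → B) {xs ys} m →
            (∀ {x} → x ∈ xs → P x → g x ∈ ys × Q (g x)) →
            (∀ {y} → y ∈ ys → Q y → ∑[ x ∈ xs ] 𝟙 (P? x ×-dec (g x ≟ y)) ≤ m) →
            ∑[ x ∈ xs ] 𝟙 (P? x) ≤ (∑[ y ∈ ys ] 𝟙 (Q? y)) * m
  #-image P? Q? _≟_ g {xs} {ys} m into fibre = begin
    ∑[ x ∈ xs ] 𝟙 (P? x)
      ≤⟨ ∑-mono xs (λ {x} x∈ → 𝟙-≤ (P? x) (λ p → let gx∈ , q = into x∈ p in
          ≤-trans (≤-reflexive (sym (cong₂ _*_ (𝟙-yes (Q? (g x)) q) (𝟙-yes (P? x ×-dec (g x ≟ g x)) (p , refl)))))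
            (∑-∈ (λ y → 𝟙 (Q? y) * 𝟙 (P? x ×-dec (g x ≟ y))) gx∈))) ⟩
    ∑[ x ∈ xs ] (∑[ y ∈ ys ] 𝟙 (Q? y) * 𝟙 (P? x ×-dec (g x ≟ y)))
      ≡⟨ ∑-swap xs ys _ ⟩
    ∑[ y ∈ ys ] (∑[ x ∈ xs ] 𝟙 (Q? y) * 𝟙 (P? x ×-dec (g x ≟ y)))
      ≤⟨ ∑-mono ys (λ {y} y∈ → ≤-trans (≤-reflexive (∑-*ˡ xs (𝟙 (Q? y)) _)) (𝟙*-mono (Q? y) (fibre y∈))) ⟩
    ∑[ y ∈ ys ] (𝟙 (Q? y) * m)
      ≡⟨ ∑-*ʳ ys m _ ⟩
    (∑[ y ∈ ys ] 𝟙 (Q? y)) * m ∎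
    where open ≤-Reasoning

  #-inj : ∀ {P : Pred A ℓ} {Q : Pred B ℓ′} (P? : Decidable P) (Q? : Decidable Q)
          (_≟_ : (x y : B) → Dec (x ≡ y)) (g : A → B) {xs ys} → Unique xs →
          (∀ {x} → x ∈ xs → P x → g x ∈ ys × Q (g x)) →
          (∀ {x y} → x ∈ xs → y ∈ xs → P x → P y → g x ≡ g y → x ≡ y) →
          ∑[ x ∈ xs ] 𝟙 (P? x) ≤ ∑[ y ∈ ys ] 𝟙 (Q? y)
  #-inj P? Q? _≟_ g u into inj = ≤-trans
    (#-image P? Q? _≟_ g 1 into (λ {y} _ _ → #≤1 (λ x → P? x ×-dec (g x ≟ y)) u (λ x∈ x′∈ (p , e) (p′ , e′) → inj x∈ x′∈ p p′ (trans e (sym e′)))))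
    (≤-reflexive (*-identityʳ _))

  ∑-inj : (_≟_ : (x y : B) → Dec (x ≡ y)) (g : A → B) (f : B → ℕ) {xs : List A} {ys : List B} → Unique xs →
          (∀ {x} → x ∈ xs → g x ∈ ys) → (∀ {x y} → x ∈ xs → y ∈ xs → g x ≡ g y → x ≡ y) →
          ∑[ x ∈ xs ] f (g x) ≤ ∑ ys f
  ∑-inj _≟_ g f {xs} {ys} u into inj = begin
    ∑[ x ∈ xs ] f (g x)
      ≤⟨ ∑-mono xs (λ {x} x∈ → ≤-trans (≤-reflexive (sym (trans (cong (_* f (g x)) (𝟙-yes (g x ≟ g x) refl)) (+-identityʳ _))))
           (∑-∈ (λ y → 𝟙 (g x ≟ y) * f y) (into x∈))) ⟩
    ∑[ x ∈ xs ] (∑[ y ∈ ys ] 𝟙 (g x ≟ y) * f y)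
      ≡⟨ ∑-swap xs ys _ ⟩
    ∑[ y ∈ ys ] (∑[ x ∈ xs ] 𝟙 (g x ≟ y) * f y)
      ≤⟨ ∑-mono′ ys (λ y → ≤-trans (≤-reflexive (∑-*ʳ xs (f y) _)) (≤-trans (*-monoˡ-≤ (f y)
           (#≤1 (λ x → g x ≟ y) u (λ x∈ x′∈ e e′ → inj x∈ x′∈ (trans e (sym e′))))) (≤-reflexive (+-identityʳ _)))) ⟩
    ∑ ys f ∎
    where open ≤-Reasoning

  ∑-*-∑ : ∀ (xs : List A) (ys : List B) f g → ∑ xs f * ∑ ys g ≡ ∑[ x ∈ xs ] (∑[ y ∈ ys ] f x * g y)
  ∑-*-∑ xs ys f g = trans (sym (∑-*ʳ xs (∑ ys g) f)) (∑-cong xs (λ x → sym (∑-*ˡ ys (f x) g)))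

  #-empty : ∀ {P : Pred A ℓ} (P? : Decidable P) {xs} → ¬ (∃ λ x → x ∈ xs × P x) → ∑[ x ∈ xs ] 𝟙 (P? x) ≡ 0
  #-empty P? {xs} none = ∑-zero xs (λ {x} x∈ → 𝟙-no (P? x) (λ p → none (x , x∈ , p)))

  #-witness : ∀ {P : Pred A ℓ} (P? : Decidable P) xs → 1 ≤ ∑[ x ∈ xs ] 𝟙 (P? x) → ∃ λ x → x ∈ xs × P x
  #-witness P? (x ∷ xs) pos with P? x
  ... | yes p = x , here refl , p
  ... | no _  = let y , y∈ , q = #-witness P? xs pos in y , there y∈ , q

-- Boxes and lattices in ℤᵐ

module Balls where

  open Counting
  open import Defs using (interval; box; ∈-box; box-unique)
  open import Data.Fin.Base using (Fin; zero; suc)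
  open import Data.Integer.Base as ℤ using (ℤ; +_; -[1+_]; ∣_∣)
  import Data.Integer.Properties as ℤ
  import Data.Integer.Solver as ℤ
  open import Algebra.Bundles using (AbelianGroup)
  import Algebra.Properties.Group (AbelianGroup.group ℤ.+-0-abelianGroup) as ℤG
  open import Data.List.Base using (List; applyUpTo)
  open import Data.List.Membership.Propositional using (_∈_)
  open import Data.List.Relation.Unary.Unique.Propositional using (Unique)
  open import Data.Nat
  open import Data.Nat.Properties
  open import Data.Nat.Solver using (module +-*-Solver)
  open import Data.Product using (_×_; _,_)
  open import Data.Vec.Base as Vec using (Vec; []; _∷_; lookup; replicate; zipWith)
  import Data.Vec.Properties as Vec
  open import Function.Base using (_∘_)
  open import Function.Bundles using (module Equivalence)
  open import Level using (Level) renaming (suc to lsuc)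
  open import Relation.Binary.PropositionalEquality
  open import Relation.Nullary
  open import Relation.Nullary.Decidable using (_×-dec_)
  open import Relation.Unary using (Decidable; Pred)

  private variable
    ℓ ℓ′ : Level
    m : ℕ

  infix 4 _≟ᵛ_
  infixl 6 _⊕_ _⊖_
  infixl 7 _⊙_

  _⊕_ _⊖_ : Vec ℤ m → Vec ℤ m → Vec ℤ m
  _⊕_ = zipWith ℤ._+_
  _⊖_ = zipWith ℤ._-_

  _⊙_ : ℤ → Vec ℤ m → Vec ℤ m
  c ⊙ x = Vec.map (c ℤ.*_) x

  𝟎 : Vec ℤ m
  𝟎 = replicate _ (+ 0)

  vec-ext : ∀ {x y : Vec ℤ m} → (∀ k → lookup x k ≡ lookup y k) → x ≡ y
  vec-ext {x = []}    {[]}    e = refl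
  vec-ext {x = _ ∷ _} {_ ∷ _} e = cong₂ _∷_ (e zero) (vec-ext (e ∘ suc))

  module _ (k : Fin m) where
    lookup-⊕ : ∀ x y → lookup (x ⊕ y) k ≡ lookup x k ℤ.+ lookup y k
    lookup-⊕ = Vec.lookup-zipWith ℤ._+_ k

    lookup-⊖ : ∀ x y → lookup (x ⊖ y) k ≡ lookup x k ℤ.- lookup y k
    lookup-⊖ = Vec.lookup-zipWith ℤ._-_ k

    lookup-⊙ : ∀ c x → lookup (c ⊙ x) k ≡ c ℤ.* lookup x k
    lookup-⊙ c = Vec.lookup-map k (c ℤ.*_)

    lookup-𝟎 : lookup 𝟎 k ≡ + 0
    lookup-𝟎 = Vec.lookup-replicate k (+ 0)

  abstract
    _≟ᵛ_ : (x y : Vec ℤ m) → Dec (x ≡ y)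
    _≟ᵛ_ = Vec.≡-dec ℤ._≟_

  -- Strictness makes the difference of two points of a half-open box of side M small for the same
  -- M, and leaves `𝟎` as the only vector that is small for M = 1.
  record Small (M : ℕ) (x : Vec ℤ m) : Set where
    constructor small
    field entry : ∀ k → ∣ lookup x k ∣ < M

  open Small public

  -- The 2 M - 1 integers above -M are those of absolute value below M; truncated subtraction makes
  -- the range empty at M = 0.
  Ball : ∀ m → ℕ → List (Vec ℤ m)
  Ball m M = box (replicate m (ℤ.- (+ M))) (replicate m (2 * M ∸ 1))

  Ball-unique : ∀ m M → Unique (Ball m M)
  Ball-unique m M = box-unique (replicate m (ℤ.- (+ M))) (replicate m (2 * M ∸ 1))

  private
    top : ∀ M → (ℤ.- (+ suc M)) ℤ.+ + (2 * suc M ∸ 1) ≡ + M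
    top M = begin
      (ℤ.- (+ suc M)) ℤ.+ + (M + suc (M + 0))
        ≡⟨ cong (λ h → (ℤ.- (+ suc M)) ℤ.+ + h) (trans (+-suc M (M + 0)) (cong (λ h → suc (M + h)) (+-identityʳ M))) ⟩
      (ℤ.- (+ suc M)) ℤ.+ (+ suc M ℤ.+ + M)
        ≡⟨ solve 2 (λ a b → (:- a) :+ (a :+ b) := b) refl (+ suc M) (+ M) ⟩
      + M ∎
      where
      open ≡-Reasoning
      open ℤ.+-*-Solver

    abs-fwd : ∀ M x → ∣ x ∣ < M → ℤ.- (+ M) ℤ.< x × x ℤ.≤ (ℤ.- (+ M)) ℤ.+ + (2 * M ∸ 1)
    abs-fwd (suc M) (+ a)      (s≤s le) = ℤ.-<+ , subst (+ a ℤ.≤_) (sym (top M)) (ℤ.+≤+ le)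
    abs-fwd (suc M) -[1+ a ]   (s≤s le) = ℤ.-<- le , subst (-[1+ a ] ℤ.≤_) (sym (top M)) ℤ.-≤+

    abs-bwd : ∀ M x → ℤ.- (+ M) ℤ.< x → x ℤ.≤ (ℤ.- (+ M)) ℤ.+ + (2 * M ∸ 1) → ∣ x ∣ < M
    abs-bwd zero    (+ zero)  (ℤ.+<+ ()) _
    abs-bwd zero    (+ suc a) _ (ℤ.+≤+ ())
    abs-bwd zero    -[1+ a ]  () _
    abs-bwd (suc M) (+ a)    _ le with subst (+ a ℤ.≤_) (top M) le
    ... | ℤ.+≤+ le′ = s≤s le′
    abs-bwd (suc M) -[1+ a ] (ℤ.-<- lt) _ = s≤s lt

  ∈-Ball⁺ : ∀ {M} {x : Vec ℤ m} → Small M x → x ∈ Ball m M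
  ∈-Ball⁺ {m} {M} {x} sm = Equivalence.from (∈-box {N = replicate m (ℤ.- (+ M))} {replicate m (2 * M ∸ 1)} {x}) (λ k →
    subst₂ (λ N H → N ℤ.< lookup x k × lookup x k ℤ.≤ N ℤ.+ + H)
      (sym (Vec.lookup-replicate k (ℤ.- (+ M)))) (sym (Vec.lookup-replicate k (2 * M ∸ 1))) (abs-fwd M (lookup x k) (entry sm k)))

  ∈-Ball⁻ : ∀ {M} {x : Vec ℤ m} → x ∈ Ball m M → Small M x
  ∈-Ball⁻ {m} {M} {x} x∈ = small λ k →
    let lo , hi = subst₂ (λ N H → N ℤ.< lookup x k × lookup x k ℤ.≤ N ℤ.+ + H)
                    (Vec.lookup-replicate k (ℤ.- (+ M))) (Vec.lookup-replicate k (2 * M ∸ 1))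
                    (Equivalence.to (∈-box {N = replicate m (ℤ.- (+ M))} {replicate m (2 * M ∸ 1)} {x}) x∈ k)
    in abs-bwd M (lookup x k) lo hi

  box-diff : ∀ (N : Vec ℤ m) (H : Vec ℕ m) {M x y} → (∀ k → lookup H k ≤ M) → x ∈ box N H → y ∈ box N H → Small M (x ⊖ y)
  box-diff N H {M} {x} {y} H≤ x∈ y∈ = small λ k →
    let x> , x≤ = Equivalence.to (∈-box {N = N} {H} {x}) x∈ k
        y> , y≤ = Equivalence.to (∈-box {N = N} {H} {y}) y∈ k
    in subst (λ z → ∣ z ∣ < M) (sym (lookup-⊖ k x y))
         (close {lookup N k} {lookup H k} x> x≤ y> y≤ (H≤ k))
    where
    open ℤ.+-*-Solver
    sub< : ∀ {a b h} → a ℤ.< b → h ℤ.≤ a ℤ.+ + M → h ℤ.- b ℤ.< + M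
    sub< {a} {b} {h} lt le = subst (h ℤ.- b ℤ.<_) (solve 2 (λ a m → a :+ m :- a := m) refl a (+ M))
      (ℤ.+-mono-≤-< le (ℤ.neg-mono-< lt))
    abs< : ∀ d → d ℤ.< + M → ℤ.- d ℤ.< + M → ∣ d ∣ < M
    abs< (+ a)    (ℤ.+<+ lt) _ = lt
    abs< -[1+ a ] _ (ℤ.+<+ lt) = lt
    close : ∀ {a h x y} → a ℤ.< x → x ℤ.≤ a ℤ.+ + h → a ℤ.< y → y ℤ.≤ a ℤ.+ + h → h ≤ M → ∣ x ℤ.- y ∣ < M
    close {a} {h} {x} {y} x> x≤ y> y≤ h≤ = abs< (x ℤ.- y) (sub< y> (up x≤))
      (subst (ℤ._< + M) (solve 2 (λ x y → y :- x := :- (x :- y)) refl x y) (sub< x> (up y≤)))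
      where
      up : ∀ {z} → z ℤ.≤ a ℤ.+ + h → z ℤ.≤ a ℤ.+ + M
      up le = ℤ.≤-trans le (ℤ.+-monoʳ-≤ a (ℤ.+≤+ h≤))

  Small-⊕ : ∀ {M M′} {x y : Vec ℤ m} → Small M x → Small M′ y → Small (M + M′) (x ⊕ y)
  Small-⊕ {x = x} {y} sx sy = small λ k → subst (λ z → ∣ z ∣ < _) (sym (lookup-⊕ k x y))
    (≤-<-trans (ℤ.∣i+j∣≤∣i∣+∣j∣ (lookup x k) (lookup y k)) (+-mono-< (entry sx k) (entry sy k)))

  Small-⊖ : ∀ {M M′} {x y : Vec ℤ m} → Small M x → Small M′ y → Small (M + M′) (x ⊖ y)
  Small-⊖ {x = x} {y} sx sy = small λ k → subst (λ z → ∣ z ∣ < _) (sym (lookup-⊖ k x y))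
    (≤-<-trans (ℤ.∣i-j∣≤∣i∣+∣j∣ (lookup x k) (lookup y k)) (+-mono-< (entry sx k) (entry sy k)))

  Small-⊙ : ∀ {M} c {x : Vec ℤ m} → Small M x → Small (suc c * M) (+ suc c ⊙ x)
  Small-⊙ {M = M} c {x} sx = small λ k → subst (λ z → ∣ z ∣ < suc c * M) (sym (lookup-⊙ k (+ suc c) x))
    (subst (_< suc c * M) (sym (ℤ.abs-* (+ suc c) (lookup x k))) (*-monoʳ-< (suc c) (entry sx k)))

  Small-mono : ∀ {M M′} {x : Vec ℤ m} → M ≤ M′ → Small M x → Small M′ x
  Small-mono le sx = small λ k → <-≤-trans (entry sx k) le

  Small-𝟎 : ∀ {M} → 1 ≤ M → Small M (𝟎 {m})
  Small-𝟎 {m} {M} 1≤ = small λ k → subst (λ z → ∣ z ∣ < M) (sym (lookup-𝟎 k)) 1≤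

  ⊖-cancelʳ : ∀ {x y z : Vec ℤ m} → x ⊖ z ≡ y ⊖ z → x ≡ y
  ⊖-cancelʳ {x = x} {y} {z} e = vec-ext (λ k → ℤG.∙-cancelʳ (ℤ.- lookup z k) _ _
    (trans (sym (lookup-⊖ k x z)) (trans (cong (λ v → lookup v k) e) (lookup-⊖ k y z))))

  ⊕-cancelˡ : ∀ {z x y : Vec ℤ m} → z ⊕ x ≡ z ⊕ y → x ≡ y
  ⊕-cancelˡ {z = z} {x} {y} e = vec-ext (λ k → ℤG.∙-cancelˡ (lookup z k) _ _
    (trans (sym (lookup-⊕ k z x)) (trans (cong (λ v → lookup v k) e) (lookup-⊕ k z y))))

  -- Subtracting one fixed counted element is injective. This is how every translate, of a box or of
  -- a lattice condition, is traded for a centred one.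
  #-diff : ∀ {P : Pred (Vec ℤ m) ℓ} {Q : Pred (Vec ℤ m) ℓ′} (P? : Decidable P) (Q? : Decidable Q) {xs ys} → Unique xs →
           (∀ {x y} → x ∈ xs → y ∈ xs → P x → P y → x ⊖ y ∈ ys × Q (x ⊖ y)) →
           ∑[ x ∈ xs ] 𝟙 (P? x) ≤ ∑[ y ∈ ys ] 𝟙 (Q? y)
  #-diff P? Q? {xs} u into with 1 ≤? ∑ xs (𝟙 ∘ P?)
  ... | no ≰1 = ≤-trans (<⇒≤pred (≰⇒> ≰1)) z≤n
  ... | yes 1≤ = let x₀ , x₀∈ , p₀ = #-witness P? xs 1≤ in
    #-inj P? Q? _≟ᵛ_ (_⊖ x₀) u (λ x∈ p → into x∈ x₀∈ p p₀) (λ _ _ _ _ → ⊖-cancelʳ)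

  private
    ∑-applyUpTo-cong : ∀ {A : Set} {f f′ : ℕ → A} g n → (∀ t → f t ≡ f′ t) → ∑ (applyUpTo f n) g ≡ ∑ (applyUpTo f′ n) g
    ∑-applyUpTo-cong g zero    e = refl
    ∑-applyUpTo-cong g (suc n) e = cong₂ _+_ (cong g (e 0)) (∑-applyUpTo-cong g n (e ∘ suc))

    ∑-applyUpTo-+ : ∀ {A : Set} (f : ℕ → A) g m n → ∑ (applyUpTo f (m + n)) g ≡ ∑ (applyUpTo f m) g + ∑ (applyUpTo (λ t → f (m + t)) n) g
    ∑-applyUpTo-+ f g zero    n = refl
    ∑-applyUpTo-+ f g (suc m) n = trans (cong (λ z → g (f 0) + z) (∑-applyUpTo-+ (f ∘ suc) g m n)) (sym (+-assoc (g (f 0)) _ _))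

  ∑-interval-+ : ∀ a h h′ f → ∑ (interval a (h + h′)) f ≡ ∑ (interval a h) f + ∑ (interval (a ℤ.+ + h) h′) f
  ∑-interval-+ a h h′ f = trans (∑-applyUpTo-+ _ f h h′) (cong (λ z → ∑ (interval a h) f + z)
    (∑-applyUpTo-cong f h′ (λ t → trans (cong (λ d → a ℤ.+ + d) (sym (+-suc h t))) (sym (ℤ.+-assoc a (+ h) (+ suc t))))))

  ∑-box-∷ : ∀ a (N : Vec ℤ m) h H f → ∑ (box (a ∷ N) (h ∷ H)) f ≡ ∑[ t ∈ interval a h ] (∑[ x ∈ box N H ] f (t ∷ x))
  ∑-box-∷ a N h H f = ∑-product _∷_ (interval a h) (box N H) f

  ∑-box-mono : ∀ (N : Vec ℤ m) H H′ f → (∀ k → lookup H k ≤ lookup H′ k) → ∑ (box N H) f ≤ ∑ (box N H′) f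
  ∑-box-mono []      []      []        f le = ≤-refl
  ∑-box-mono (a ∷ N) (h ∷ H) (h′ ∷ H′) f le = begin
    ∑ (box (a ∷ N) (h ∷ H)) f                                    ≡⟨ ∑-box-∷ a N h H f ⟩
    ∑[ t ∈ interval a h ] (∑[ x ∈ box N H ] f (t ∷ x))          ≤⟨ ∑-mono′ (interval a h) (λ t → ∑-box-mono N H H′ (f ∘ (t ∷_)) (le ∘ suc)) ⟩
    ∑ (interval a h) F                                           ≤⟨ m≤m+n _ _ ⟩
    ∑ (interval a h) F + ∑ (interval (a ℤ.+ + h) (h′ ∸ h)) F     ≡⟨ ∑-interval-+ a h (h′ ∸ h) F ⟨
    ∑ (interval a (h + (h′ ∸ h))) F                              ≡⟨ cong (λ d → ∑ (interval a d) F) (m+[n∸m]≡n (le zero)) ⟩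
    ∑ (interval a h′) F                                          ≡⟨ ∑-box-∷ a N h′ H′ f ⟨
    ∑ (box (a ∷ N) (h′ ∷ H′)) f                                  ∎
    where
    open ≤-Reasoning
    F : ℤ → ℕ
    F t = ∑[ x ∈ box N H′ ] f (t ∷ x)

  ∑-interval-* : ∀ c M f A → (∀ a → ∑ (interval a M) f ≤ A) → ∀ a → ∑ (interval a (c * M)) f ≤ c * A
  ∑-interval-* zero    M f A le a = z≤n
  ∑-interval-* (suc c) M f A le a = ≤-trans (≤-reflexive (∑-interval-+ a M (c * M) f))
    (+-mono-≤ (le a) (∑-interval-* c M f A le (a ℤ.+ + M)))

  -- Tiling by c ^ m boxes of side M, one coordinate at a time. The tiles lie in different places,
  -- so A has to bound every translate.
  ∑-box-* : ∀ m c M (f : Vec ℤ m → ℕ) A → (∀ N → ∑ (box N (replicate m M)) f ≤ A) →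
            ∀ N → ∑ (box N (replicate m (c * M))) f ≤ c ^ m * A
  ∑-box-* zero    c M f A le [] = ≤-trans (le []) (≤-reflexive (sym (*-identityˡ A)))
  ∑-box-* (suc m) c M f A le (a ∷ N) = begin
    ∑ (box (a ∷ N) (c * M ∷ replicate m (c * M))) f  ≡⟨ ∑-box-∷ a N (c * M) _ f ⟩
    ∑ (interval a (c * M)) F                          ≤⟨ ∑-interval-* c M F (c ^ m * A) slab a ⟩
    c * (c ^ m * A)                                   ≡⟨ *-assoc c (c ^ m) A ⟨
    c ^ suc m * A                                     ∎
    where
    open ≤-Reasoning
    F : ℤ → ℕ
    F t = ∑[ x ∈ box N (replicate m (c * M)) ] f (t ∷ x)
    slab : ∀ a → ∑ (interval a M) F ≤ c ^ m * A
    slab a = ≤-trans (≤-reflexive (∑-swap (interval a M) (box N _) (λ t x → f (t ∷ x))))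
      (∑-box-* m c M (λ x → ∑[ t ∈ interval a M ] f (t ∷ x)) A (λ N′ →
        ≤-trans (≤-reflexive (trans (∑-swap (box N′ _) (interval a M) (λ x t → f (t ∷ x))) (sym (∑-box-∷ a N′ M _ f)))) (le (a ∷ N′))) N)

  ∑-Ball-* : ∀ m c M (f : Vec ℤ m → ℕ) A → (∀ N → ∑ (box N (replicate m M)) f ≤ A) →
             ∑ (Ball m (c * M)) f ≤ (2 * c) ^ m * A
  ∑-Ball-* m c M f A le = ≤-trans
    (∑-box-mono N (replicate m (2 * (c * M) ∸ 1)) (replicate m (2 * c * M)) f (λ k → subst₂ _≤_ (sym (Vec.lookup-replicate k (2 * (c * M) ∸ 1))) (sym (Vec.lookup-replicate k (2 * c * M)))
      (≤-trans (m∸n≤m (2 * (c * M)) 1) (≤-reflexive (sym (*-assoc 2 c M))))))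
    (∑-box-* m (2 * c) M f A le N)
    where N = replicate m (ℤ.- (+ (c * M)))

  record Lattice (m : ℕ) ℓ : Set (lsuc ℓ) where
    field
      Member   : Pred (Vec ℤ m) ℓ
      member?  : Decidable Member
      𝟎-closed : Member 𝟎
      ⊖-closed : ∀ {x y} → Member x → Member y → Member (x ⊖ y)

    ⊕-closed : ∀ {x y} → Member x → Member y → Member (x ⊕ y)
    ⊕-closed {x} {y} mx my = subst Member (vec-ext (λ k → trans (lookup-⊖ k x (𝟎 ⊖ y))
        (trans (cong (λ z → lookup x k ℤ.- z) (trans (lookup-⊖ k 𝟎 y) (cong (ℤ._- lookup y k) (lookup-𝟎 k))))
        (trans (solve 2 (λ a b → a :- (con (+ 0) :- b) := a :+ b) refl (lookup x k) (lookup y k)) (sym (lookup-⊕ k x y))))))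
      (⊖-closed mx (⊖-closed 𝟎-closed my))
      where open ℤ.+-*-Solver

    ⊙-closed : ∀ c {x} → Member x → Member (+ c ⊙ x)
    ⊙-closed zero    {x} mx = subst Member (vec-ext (λ k → trans (lookup-𝟎 k) (sym (lookup-⊙ k (+ 0) x)))) 𝟎-closed
    ⊙-closed (suc c) {x} mx = subst Member (vec-ext (λ k → trans (lookup-⊕ k x (+ c ⊙ x))
      (trans (cong (λ z → lookup x k ℤ.+ z) (lookup-⊙ k (+ c) x))
      (trans (sym (ℤ.suc-* (+ c) (lookup x k))) (sym (lookup-⊙ k (+ suc c) x))))))
      (⊕-closed mx (⊙-closed c mx))

    points : ℕ → ℕ
    points M = ∑[ x ∈ Ball m M ] 𝟙 (member? x)

    points-mono : ∀ {M M′} → M ≤ M′ → points M ≤ points M′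
    points-mono le = #-inj member? member? _≟ᵛ_ (λ x → x) (Ball-unique m _)
      (λ x∈ mx → ∈-Ball⁺ (Small-mono le (∈-Ball⁻ x∈)) , mx) (λ _ _ _ _ e → e)

    1≤points : ∀ {M} → 1 ≤ M → 1 ≤ points M
    1≤points {M} 1≤ = ≤-trans (≤-reflexive (sym (𝟙-yes (member? 𝟎) 𝟎-closed)))
      (∑-∈ (𝟙 ∘ member?) (∈-Ball⁺ (Small-𝟎 1≤)))

    -- The larger ball is covered by (2 c) ^ m boxes of side M, and differencing inside a box bounds
    -- its lattice points by those of the ball of radius M.
    points-dilate : ∀ c M → points (c * M) ≤ (2 * c) ^ m * points M
    points-dilate c M = ∑-Ball-* m c M (𝟙 ∘ member?) (points M) (λ N →
      #-diff member? member? (box-unique N (replicate m M)) (λ x∈ y∈ mx my →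
        ∈-Ball⁺ (box-diff N (replicate m M) (λ k → ≤-reflexive (Vec.lookup-replicate k M)) x∈ y∈) , ⊖-closed mx my))

    -- The fibres of (u , w) ↦ w + (c + 1) u have at most points M₀ elements.
    points-convex : ∀ c M₀ M₁ M₂ → 2 * M₂ ≤ suc c * M₀ →
                    points M₁ * points M₂ ≤ points (M₂ + suc c * M₁) * points M₀
    points-convex c M₀ M₁ M₂ le = begin
      points M₁ * points M₂
        ≡⟨ ∑-*ʳ (Ball m M₁) (points M₂) _ ⟨
      ∑[ u ∈ Ball m M₁ ] (𝟙 (member? u) * points M₂)
        ≤⟨ ∑-mono (Ball m M₁) (λ {u} u∈ → 𝟙*-mono (member? u) (translate u∈)) ⟩
      ∑[ u ∈ Ball m M₁ ] (𝟙 (member? u) * (∑[ y ∈ Ball m M ] 𝟙 (E? u y)))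
        ≡⟨ ∑-cong (Ball m M₁) (λ u → sym (∑-*ˡ (Ball m M) (𝟙 (member? u)) _)) ⟩
      ∑[ u ∈ Ball m M₁ ] (∑[ y ∈ Ball m M ] 𝟙 (member? u) * 𝟙 (E? u y))
        ≡⟨ ∑-swap (Ball m M₁) (Ball m M) _ ⟩
      ∑[ y ∈ Ball m M ] (∑[ u ∈ Ball m M₁ ] 𝟙 (member? u) * 𝟙 (E? u y))
        ≤⟨ ∑-mono′ (Ball m M) fibre ⟩
      ∑[ y ∈ Ball m M ] (𝟙 (member? y) * points M₀)
        ≡⟨ ∑-*ʳ (Ball m M) (points M₀) _ ⟩
      points M * points M₀ ∎
      where
      open ≤-Reasoning
      M = M₂ + suc c * M₁
      small? : ∀ {n} K (x : Vec ℤ n) → Dec (Small K x)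
      small? K []      = yes (small λ ())
      small? K (x ∷ v) with ∣ x ∣ <? K | small? K v
      ... | yes a | yes b = yes (small λ { zero → a ; (suc k) → entry b k })
      ... | no ¬a | _     = no λ s → ¬a (entry s zero)
      ... | _     | no ¬b = no λ s → ¬b (small (entry s ∘ suc))
      -- For fixed `u` the admissible `y` are the points w + (c + 1) u. Membership of `y` is
      -- recorded as well, so that after swapping the sums only lattice points `y` have a nonempty
      -- fibre.
      E? : ∀ u y → Dec (Member y × Small M₂ (y ⊖ + suc c ⊙ u))
      E? u y = member? y ×-dec small? M₂ (y ⊖ + suc c ⊙ u)
      back : ∀ w u → w ⊕ + suc c ⊙ u ⊖ + suc c ⊙ u ≡ w
      back w u = vec-ext (λ k → trans (lookup-⊖ k (w ⊕ + suc c ⊙ u) (+ suc c ⊙ u))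
        (trans (cong (ℤ._- lookup (+ suc c ⊙ u) k) (lookup-⊕ k w (+ suc c ⊙ u)))
               (solve 2 (λ a b → a :+ b :- b := a) refl (lookup w k) (lookup (+ suc c ⊙ u) k))))
        where open ℤ.+-*-Solver
      translate : ∀ {u} → u ∈ Ball m M₁ → Member u → points M₂ ≤ ∑[ y ∈ Ball m M ] 𝟙 (E? u y)
      translate {u} u∈ mu = #-inj member? (E? u) _≟ᵛ_ (_⊕ + suc c ⊙ u) (Ball-unique m M₂)
        (λ {w} w∈ mw → ∈-Ball⁺ (Small-⊕ (∈-Ball⁻ w∈) (Small-⊙ c (∈-Ball⁻ u∈))) , ⊕-closed mw (⊙-closed (suc c) mu)
                       , subst (Small M₂) (sym (back w u)) (∈-Ball⁻ w∈))
        (λ {w} {w′} _ _ _ _ e → trans (sym (back w u)) (trans (cong (_⊖ + suc c ⊙ u) e) (back w′ u)))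
      scaled : ∀ y u u′ → (y ⊖ + suc c ⊙ u′) ⊖ (y ⊖ + suc c ⊙ u) ≡ + suc c ⊙ (u ⊖ u′)
      scaled y u u′ = vec-ext (λ k → trans (lookup-⊖ k (y ⊖ + suc c ⊙ u′) (y ⊖ + suc c ⊙ u))
        (trans (cong₂ ℤ._-_ (trans (lookup-⊖ k y (+ suc c ⊙ u′)) (cong (λ z → lookup y k ℤ.- z) (lookup-⊙ k (+ suc c) u′)))
                            (trans (lookup-⊖ k y (+ suc c ⊙ u)) (cong (λ z → lookup y k ℤ.- z) (lookup-⊙ k (+ suc c) u))))
        (trans (solve 4 (λ y c u u′ → y :- c :* u′ :- (y :- c :* u) := c :* (u :- u′)) refl (lookup y k) (+ suc c) (lookup u k) (lookup u′ k))
        (sym (trans (lookup-⊙ k (+ suc c) (u ⊖ u′)) (cong (+ suc c ℤ.*_) (lookup-⊖ k u u′)))))))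
        where open ℤ.+-*-Solver
      -- Two elements u , u′ of a fibre have (c + 1) (u - u′) with entries below 2 M₂ ≤ (c + 1) M₀,
      -- and the common factor cancels.
      unscale : ∀ {x} → Small (2 * M₂) (+ suc c ⊙ x) → Small M₀ x
      unscale {x} s = small λ k → *-cancelˡ-< (suc c) _ _ (<-≤-trans
        (subst (_< 2 * M₂) (trans (cong ∣_∣ (lookup-⊙ k (+ suc c) x)) (ℤ.abs-* (+ suc c) (lookup x k))) (entry s k)) le)
      fibre : ∀ y → ∑[ u ∈ Ball m M₁ ] 𝟙 (member? u) * 𝟙 (E? u y) ≤ 𝟙 (member? y) * points M₀
      fibre y with member? y
      ... | no _ = ≤-reflexive (∑-zero (Ball m M₁) (λ {u} _ → *-zeroʳ (𝟙 (member? u))))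
      ... | yes my = begin
        ∑[ u ∈ Ball m M₁ ] (𝟙 (member? u) * 𝟙 (yes my ×-dec small? M₂ (y ⊖ + suc c ⊙ u)))
          ≡⟨ ∑-cong (Ball m M₁) (λ u → sym (𝟙-× (member? u) (yes my ×-dec small? M₂ (y ⊖ + suc c ⊙ u)))) ⟩
        ∑[ u ∈ Ball m M₁ ] 𝟙 (member? u ×-dec (yes my ×-dec small? M₂ (y ⊖ + suc c ⊙ u)))
          ≤⟨ #-diff (λ u → member? u ×-dec (yes my ×-dec small? M₂ (y ⊖ + suc c ⊙ u))) member? (Ball-unique m M₁)
               (λ {u} {u′} _ _ (mu , _ , s) (mu′ , _ , s′) →
                 ∈-Ball⁺ (unscale (subst (Small (2 * M₂)) (scaled y u u′)
                   (Small-mono (≤-reflexive (cong (λ z → M₂ + z) (sym (+-identityʳ M₂))))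
                     (Small-⊖ {x = y ⊖ + suc c ⊙ u′} {y = y ⊖ + suc c ⊙ u} s′ s)))) , ⊖-closed mu mu′) ⟩
        points M₀  ≡⟨ +-identityʳ (points M₀) ⟨
        points M₀ + 0 ∎

-- Linear algebra over 𝔽ₚ

module Residues (p : ℕ) (prime : Prime p) where

  open Counting
  open Balls
  open import Algebra.Bundles using (CommutativeRing)
  open import Defs using (interval; box; box-unique; 𝔽ₚ; ∈-interval)
  open import Data.Empty using (⊥-elim)
  open import Data.Fin.Base using (Fin; zero; suc)
  import Data.Fin.Properties as Fin
  open import Data.Integer.Base as ℤ using (ℤ; +_; ∣_∣)
  import Data.Integer.Properties as ℤ
  import Data.Integer.Solver as ℤ
  open import Data.Integer.DivMod using (_%ℕ_; _/ℕ_; n%ℕd<d; a≡a%ℕn+[a/ℕn]*n)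
  open import Data.Integer.Divisibility.Signed using (_∣_; divides; _∣?_; ∣⇒∣ᵤ)
  open import Data.List.Base using (List; length)
  open import Data.List.Properties using (length-applyUpTo)
  open import Data.List.Membership.Propositional using (_∈_; lose; find)
  open import Data.List.Membership.Propositional.Properties using (∈-cartesianProductWith⁺)
  open import Data.List.Relation.Unary.Any using (any?)
  open import Data.List.Relation.Unary.Unique.Propositional using (Unique)
  open import Data.Nat using (zero; suc; _+_; _*_; _^_; _≤_; _<_; NonZero; z≤n; s≤s)
  open import Data.Nat.Divisibility using (∣⇒≤) renaming (_∣_ to _∣ⁿ_)
  open import Data.Nat.Properties
  open import Data.Nat.Coprimality using (prime⇒coprime; coprime-Bézout)
  open import Data.Nat.GCD using (module Bézout)
  open import Data.Nat.Primality using (prime⇒nonZero)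
  open import Data.Product using (∃; _×_; _,_)
  open import Data.Unit.Base using (tt)
  open import Data.Vec.Base as Vec using (Vec; []; _∷_; lookup; replicate)
  import Data.Vec.Properties as Vec
  open import Function.Base using (_∘_)
  open import Function.Bundles using (module Equivalence)
  open import Relation.Binary.PropositionalEquality
  open import Relation.Nullary
  open import Relation.Nullary.Decidable using (¬?) renaming (map′ to map-dec)

  private
    module F = CommutativeRing (𝔽ₚ p)
    variable
      m n : ℕ
    open ℤ.+-*-Solver

  instance
    p≢0 : NonZero p
    p≢0 = prime⇒nonZero prime

  infix 4 _∼_ _≋_ _∼?_ _≋?_

  record _∼_ (x y : ℤ) : Set where
    constructor mod
    field difference : + p ∣ x ℤ.- y

  open _∼_ public

  ∼-reflexive : ∀ {x y} → x ≡ y → x ∼ y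
  ∼-reflexive {x} refl = mod (divides (+ 0) (ℤ.+-inverseʳ x))

  ∼-refl : ∀ {x} → x ∼ x
  ∼-refl = ∼-reflexive refl

  ∼-sym : ∀ {x y} → x ∼ y → y ∼ x
  ∼-sym {x} {y} (mod d) = mod (F.sym {x} {y} d)

  ∼-trans : ∀ {x y z} → x ∼ y → y ∼ z → x ∼ z
  ∼-trans {x} {y} {z} (mod d) (mod e) = mod (F.trans {x} {y} {z} d e)

  +-∼ : ∀ {x y u v} → x ∼ y → u ∼ v → x ℤ.+ u ∼ y ℤ.+ v
  +-∼ {x} {y} {u} {v} (mod d) (mod e) = mod (F.+-cong {x} {y} {u} {v} d e)

  neg-∼ : ∀ {x y} → x ∼ y → ℤ.- x ∼ ℤ.- y
  neg-∼ {x} {y} (mod d) = mod (F.-‿cong {x} {y} d)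

  ─-∼ : ∀ {x y u v} → x ∼ y → u ∼ v → x ℤ.- u ∼ y ℤ.- v
  ─-∼ d e = +-∼ d (neg-∼ e)

  *-∼ : ∀ {x y u v} → x ∼ y → u ∼ v → x ℤ.* u ∼ y ℤ.* v
  *-∼ {x} {y} {u} {v} (mod d) (mod e) = mod (F.*-cong {x} {y} {u} {v} d e)

  _∼?_ : ∀ x y → Dec (x ∼ y)
  x ∼? y = map-dec mod difference (+ p ∣? (x ℤ.- y))

  p∼0 : + p ∼ + 0
  p∼0 = mod (divides (+ 1) (trans (ℤ.+-identityʳ (+ p)) (sym (ℤ.*-identityˡ (+ p)))))

  multiple∼0 : ∀ q → q ℤ.* + p ∼ + 0
  multiple∼0 q = ∼-trans (*-∼ (∼-refl {q}) p∼0) (∼-reflexive (ℤ.*-zeroʳ q))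

  ∼0⇒∼ : ∀ {x y} → x ℤ.- y ∼ + 0 → x ∼ y
  ∼0⇒∼ {x} {y} d = ∼-trans (∼-reflexive (solve 2 (λ x y → x := x :- y :+ y) refl x y))
    (∼-trans (+-∼ d (∼-refl {y})) (∼-reflexive (ℤ.+-identityˡ y)))

  ∼⇒∼0 : ∀ {x y} → x ∼ y → x ℤ.- y ∼ + 0
  ∼⇒∼0 {x} {y} d = ∼-trans (─-∼ d (∼-refl {y})) (∼-reflexive (ℤ.+-inverseʳ y))

  ∼-close : ∀ {x y} → x ∼ y → ∣ x ℤ.- y ∣ < p → x ≡ y
  ∼-close {x} {y} (mod d) lt with ∣ x ℤ.- y ∣ in eq | ∣⇒∣ᵤ d
  ... | zero  | _ = ℤ.i-j≡0⇒i≡j x y (ℤ.∣i∣≡0⇒i≡0 eq)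
  ... | suc k | d′ = ⊥-elim (≤⇒≯ (∣⇒≤ d′) lt)

  small∼0 : ∀ k → 0 < k → k < p → ¬ (+ k ∼ + 0)
  small∼0 k 0<k k<p d = >⇒≢ 0<k (ℤ.+-injective (∼-close d (subst (λ z → ∣ z ∣ < p) (sym (ℤ.+-identityʳ (+ k))) k<p)))

  1≁0 : ¬ (+ 1 ∼ + 0)
  1≁0 = small∼0 1 (s≤s z≤n) (nonTrivial⇒n>1 p)
    where
    open import Data.Nat.Base using (nonTrivial⇒n>1)
    open import Data.Nat.Primality using (prime⇒nonTrivial)
    instance _ = prime⇒nonTrivial prime

  res : ℤ → ℤ
  res t = + (t %ℕ p)

  res∼ : ∀ t → res t ∼ t
  res∼ t = ∼-sym (∼-trans (∼-reflexive (a≡a%ℕn+[a/ℕn]*n t p))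
    (∼-trans (+-∼ (∼-refl {res t}) (multiple∼0 (t /ℕ p))) (∼-reflexive (ℤ.+-identityʳ _))))

  inverse : ∀ {d} → ¬ d ∼ + 0 → ∃ λ d′ → d′ ℤ.* d ∼ + 1
  inverse {d} d≁0 with d %ℕ p in eq | n%ℕd<d d p
  ... | zero  | _   = ⊥-elim (d≁0 (∼-trans (∼-sym (res∼ d)) (∼-reflexive (cong +_ eq))))
  ... | suc r | r<p with coprime-Bézout (prime⇒coprime prime r<p)
  ... | Bézout.+- x y e = ℤ.- (+ y) , ∼-trans (*-∼ (∼-refl {ℤ.- (+ y)}) d∼) (∼-trans (∼-reflexive id₁) (∼-trans (─-∼ (∼-refl {+ 1}) (multiple∼0 (+ x))) ∼-refl))
    where
    d∼ : d ∼ + suc r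
    d∼ = ∼-trans (∼-sym (res∼ d)) (∼-reflexive (cong +_ eq))
    id₁ : ℤ.- (+ y) ℤ.* + suc r ≡ + 1 ℤ.- + x ℤ.* + p
    id₁ = trans (solve 2 (λ y r → (:- y) :* r := con (+ 1) :- (con (+ 1) :+ y :* r)) refl (+ y) (+ suc r))
      (cong (λ z → + 1 ℤ.- z) (trans (cong (λ z → + 1 ℤ.+ z) (sym (ℤ.pos-* y (suc r)))) (trans (cong +_ e) (ℤ.pos-* x p))))
  ... | Bézout.-+ x y e = + y , ∼-trans (*-∼ (∼-refl {+ y}) d∼) (∼-trans (∼-reflexive id₁) (∼-trans (+-∼ (∼-refl {+ 1}) (multiple∼0 (+ x))) (∼-reflexive refl)))
    where
    d∼ : d ∼ + suc r
    d∼ = ∼-trans (∼-sym (res∼ d)) (∼-reflexive (cong +_ eq))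
    id₁ : + y ℤ.* + suc r ≡ + 1 ℤ.+ + x ℤ.* + p
    id₁ = trans (sym (ℤ.pos-* y (suc r))) (trans (cong +_ (sym e)) (cong (λ z → + 1 ℤ.+ z) (ℤ.pos-* x p)))

  -- A half-open interval starting at -1 consists of 0 , ... , p - 1, the range of `res`.
  residues : List ℤ
  residues = interval ℤ.-1ℤ p

  ∈-residues⁺ : ∀ k → k < p → + k ∈ residues
  ∈-residues⁺ k k<p = Equivalence.from (∈-interval {ℤ.-1ℤ} {p} {+ k}) (ℤ.-<+ , ℤ.i<j⇒i≤pred[j] (ℤ.+<+ k<p))

  res∈ : ∀ t → res t ∈ residues
  res∈ t = ∈-residues⁺ (t %ℕ p) (n%ℕd<d t p)

  record _≋_ (x y : Vec ℤ m) : Set where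
    constructor congruent
    field at : ∀ k → lookup x k ∼ lookup y k

  open _≋_ public

  ≋-refl : ∀ {x : Vec ℤ m} → x ≋ x
  ≋-refl = congruent λ k → ∼-refl

  ≋-reflexive : ∀ {x y : Vec ℤ m} → x ≡ y → x ≋ y
  ≋-reflexive refl = ≋-refl

  ≋-sym : ∀ {x y : Vec ℤ m} → x ≋ y → y ≋ x
  ≋-sym e = congruent λ k → ∼-sym (at e k)

  ≋-trans : ∀ {x y z : Vec ℤ m} → x ≋ y → y ≋ z → x ≋ z
  ≋-trans e f = congruent λ k → ∼-trans (at e k) (at f k)

  ⊕-≋ : ∀ {x y u v : Vec ℤ m} → x ≋ y → u ≋ v → x ⊕ u ≋ y ⊕ v
  ⊕-≋ {x = x} {y} {u} {v} e f = congruent λ k → ∼-trans (∼-reflexive (lookup-⊕ k x u))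
    (∼-trans (+-∼ (at e k) (at f k)) (∼-reflexive (sym (lookup-⊕ k y v))))

  ⊖-≋ : ∀ {x y u v : Vec ℤ m} → x ≋ y → u ≋ v → x ⊖ u ≋ y ⊖ v
  ⊖-≋ {x = x} {y} {u} {v} e f = congruent λ k → ∼-trans (∼-reflexive (lookup-⊖ k x u))
    (∼-trans (─-∼ (at e k) (at f k)) (∼-reflexive (sym (lookup-⊖ k y v))))

  ⊖-≋𝟎 : ∀ {x y : Vec ℤ m} → x ≋ y → x ⊖ y ≋ 𝟎
  ⊖-≋𝟎 {x = x} {y} e = congruent λ k → ∼-trans (∼-reflexive (lookup-⊖ k x y)) (∼-trans (∼⇒∼0 (at e k)) (∼-reflexive (sym (lookup-𝟎 k))))

  ⊖-≋𝟎⁻ : ∀ {x y : Vec ℤ m} → x ⊖ y ≋ 𝟎 → x ≋ y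
  ⊖-≋𝟎⁻ {x = x} {y} e = congruent λ k → ∼0⇒∼ (∼-trans (∼-reflexive (sym (lookup-⊖ k x y))) (∼-trans (at e k) (∼-reflexive (lookup-𝟎 k))))

  abstract
    _≋?_ : ∀ (x y : Vec ℤ m) → Dec (x ≋ y)
    x ≋? y = map-dec congruent at (Fin.all? (λ k → lookup x k ∼? lookup y k))

  ≋-close : ∀ {M} {x y : Vec ℤ m} → x ≋ y → Small M (x ⊖ y) → M ≤ p → x ≡ y
  ≋-close {x = x} {y} e s le = vec-ext (λ k → ∼-close (at e k) (subst (λ z → ∣ z ∣ < p) (lookup-⊖ k x y) (<-≤-trans (entry s k) le)))

  Res : ∀ m → List (Vec ℤ m)
  Res m = box (replicate m ℤ.-1ℤ) (replicate m p)

  Res-unique : ∀ m → Unique (Res m)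
  Res-unique m = box-unique (replicate m ℤ.-1ℤ) (replicate m p)

  red : Vec ℤ m → Vec ℤ m
  red = Vec.map res

  red∈ : ∀ (x : Vec ℤ m) → red x ∈ Res m
  red∈ []      = Data.List.Relation.Unary.Any.here refl
    where import Data.List.Relation.Unary.Any
  red∈ (t ∷ x) = ∈-cartesianProductWith⁺ _∷_ (res∈ t) (red∈ x)

  red≋ : ∀ (x : Vec ℤ m) → red x ≋ x
  red≋ x = congruent λ k → ∼-trans (∼-reflexive (Vec.lookup-map k res x)) (res∼ (lookup x k))

  Res-injective : ∀ {x y : Vec ℤ m} → x ∈ Res m → y ∈ Res m → x ≋ y → x ≡ y
  Res-injective {m} x∈ y∈ e = ≋-close e (box-diff (replicate m ℤ.-1ℤ) (replicate m p) (λ k → ≤-reflexive (Vec.lookup-replicate k p)) x∈ y∈) ≤-refl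

  red-injective : ∀ {x y : Vec ℤ m} → red x ≡ red y → x ≋ y
  red-injective {x = x} {y} e = ≋-trans (≋-sym (red≋ x)) (≋-trans (≋-reflexive e) (red≋ y))

  ∑-box-const : ∀ m (N : Vec ℤ m) h c → ∑[ x ∈ box N (replicate m h) ] c ≡ h ^ m * c
  ∑-box-const zero    []      h c = refl
  ∑-box-const (suc m) (a ∷ N) h c = begin
    ∑[ x ∈ box (a ∷ N) (h ∷ replicate m h) ] c          ≡⟨ ∑-box-∷ a N h _ (λ _ → c) ⟩
    ∑[ t ∈ interval a h ] (∑[ x ∈ box N (replicate m h) ] c)  ≡⟨ ∑-cong (interval a h) (λ _ → ∑-box-const m N h c) ⟩
    ∑[ t ∈ interval a h ] (h ^ m * c)                   ≡⟨ ∑-const (interval a h) _ ⟩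
    length (interval a h) * (h ^ m * c)                 ≡⟨ cong (_* (h ^ m * c)) (length-applyUpTo _ h) ⟩
    h * (h ^ m * c)                                     ≡⟨ *-assoc h (h ^ m) c ⟨
    h ^ suc m * c                                       ∎
    where open ≡-Reasoning

  ∑-Res-const : ∀ m c → ∑[ x ∈ Res m ] c ≡ p ^ m * c
  ∑-Res-const m c = ∑-box-const m (replicate m ℤ.-1ℤ) p c

  module _ {f : Vec ℤ m → Vec ℤ n} (f-injective : ∀ {x y} → f x ≋ f y → x ≋ y) where

    private
      g-injective : ∀ {x y} → x ∈ Res m → y ∈ Res m → red (f x) ≡ red (f y) → x ≡ y
      g-injective x∈ y∈ e = Res-injective x∈ y∈ (f-injective (red-injective e))

    injective⇒^≤ : p ^ m ≤ p ^ n
    injective⇒^≤ = begin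
      p ^ m                             ≡⟨ *-identityʳ (p ^ m) ⟨
      p ^ m * 1                         ≡⟨ ∑-Res-const m 1 ⟨
      ∑[ x ∈ Res m ] 1                  ≤⟨ ∑-inj _≟ᵛ_ (red ∘ f) (λ _ → 1) (Res-unique m) (λ _ → red∈ _) g-injective ⟩
      ∑[ y ∈ Res n ] 1                  ≡⟨ ∑-Res-const n 1 ⟩
      p ^ n * 1                         ≡⟨ *-identityʳ (p ^ n) ⟩
      p ^ n                             ∎
      where open ≤-Reasoning

    -- Pigeonhole on representatives: if y were missed, `red ∘ f` would embed pᵐ vectors into the pⁿ
    -- - 1 vectors other than `red y`. This takes the place of rank arguments.
    injective⇒surjective : m ≡ n → ∀ y → ∃ λ x → x ∈ Res m × f x ≋ y
    injective⇒surjective m≡n y with any? (λ x → f x ≋? y) (Res m)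
    ... | yes hit = let x , x∈ , e = find hit in x , x∈ , e
    ... | no miss = ⊥-elim (<-irrefl (cong (p ^_) m≡n) (begin-strict
      p ^ m                                              ≡⟨ trans (sym (*-identityʳ (p ^ m))) (sym (∑-Res-const m 1)) ⟩
      ∑[ x ∈ Res m ] 1                                   ≤⟨ #-inj (λ _ → yes tt) (λ u → ¬? (u ≟ᵛ red y)) _≟ᵛ_ (red ∘ f) (Res-unique m)
                                                              (λ x∈ _ → red∈ _ , λ e → miss (lose x∈ (red-injective e)))
                                                              (λ x∈ y∈ _ _ → g-injective x∈ y∈) ⟩
      ∑[ u ∈ Res n ] 𝟙 (¬? (u ≟ᵛ red y))                 <⟨ m<m+n _ (≤-trans (≤-reflexive (sym (𝟙-yes (red y ≟ᵛ red y) refl))) (∑-∈ (λ u → 𝟙 (u ≟ᵛ red y)) (red∈ y))) ⟩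
      (∑[ u ∈ Res n ] 𝟙 (¬? (u ≟ᵛ red y))) + (∑[ u ∈ Res n ] 𝟙 (u ≟ᵛ red y))
                                                         ≡⟨ ∑-+ (Res n) _ _ ⟨
      ∑[ u ∈ Res n ] (𝟙 (¬? (u ≟ᵛ red y)) + 𝟙 (u ≟ᵛ red y)) ≡⟨ ∑-cong (Res n) (λ u → complement (u ≟ᵛ red y)) ⟩
      ∑[ u ∈ Res n ] 1                                   ≡⟨ trans (∑-Res-const n 1) (*-identityʳ (p ^ n)) ⟩
      p ^ n                                              ∎))
      where
      open ≤-Reasoning
      complement : ∀ {P : Set} (d : Dec P) → 𝟙 (¬? d) + 𝟙 d ≡ 1
      complement (yes _) = refl
      complement (no _)  = refl

  injective⇒≤ : ∀ {f : Vec ℤ m → Vec ℤ n} → (∀ {x y} → f x ≋ f y → x ≋ y) → m ≤ n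
  injective⇒≤ {m} {n} inj = ≮⇒≥ (λ n<m → ≤⇒≯ (injective⇒^≤ inj) (^-monoʳ-< p (nonTrivial⇒n>1 p) n<m))
    where
    open import Data.Nat.Base using (nonTrivial⇒n>1)
    open import Data.Nat.Primality using (prime⇒nonTrivial)
    instance _ = prime⇒nonTrivial prime

-- Duality by a second moment

module Discrepancy (p : ℕ) (prime : Prime p) where

  open Counting
  open Balls
  open Residues p prime
  open import Defs using (interval)
  open import Data.Empty using (⊥-elim)
  open import Data.Fin.Base using (zero; suc)
  open import Data.Integer.Base as ℤ using (ℤ; +_; -[1+_]; ∣_∣)
  import Data.Integer.Properties as ℤ
  import Data.Integer.Solver as ℤ
  open import Data.Integer.DivMod using (_%ℕ_)
  open import Data.List.Base using (List; []; _∷_; length; filter)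
  open import Data.List.Properties using (length-applyUpTo)
  open import Data.List.Membership.Propositional using (_∈_; lose; find)
  open import Data.List.Membership.Propositional.Properties using (∈-cartesianProductWith⁺; ∈-filter⁻; ∈-applyUpTo⁻)
  open import Data.List.Relation.Unary.Any using (Any; any?; here)
  open import Data.List.Relation.Unary.Unique.Propositional using (Unique)
  import Data.List.Relation.Unary.Unique.Propositional.Properties as Unique
  open import Data.Nat using (zero; suc; _+_; _*_; _^_; _∸_; _≤_; _<_; z≤n; s≤s; s≤s⁻¹; _≤?_; _<?_; ∣_-_∣; >-nonZero)
  open import Data.Nat.DivMod using (m<n⇒m%n≡m)
  open import Data.Nat.Properties
  import Data.Nat.Solver as ℕ
  open import Data.Product using (∃; _×_; _,_; proj₁; proj₂)
  open import Data.Sum using (inj₁; inj₂)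
  open import Data.Vec.Base as Vec using (Vec; []; _∷_; lookup; replicate)
  open import Function.Base using (_∘_)
  open import Relation.Binary.PropositionalEquality
  open import Relation.Nullary
  open import Relation.Nullary.Decidable using (_×-dec_)

  private variable
    m : ℕ

  dot : Vec ℤ m → Vec ℤ m → ℤ
  dot []      []      = + 0
  dot (a ∷ w) (b ∷ y) = a ℤ.* b ℤ.+ dot w y

  dot-⊕ʳ : ∀ (w x y : Vec ℤ m) → dot w (x ⊕ y) ≡ dot w x ℤ.+ dot w y
  dot-⊕ʳ []      []      []      = refl
  dot-⊕ʳ (a ∷ w) (b ∷ x) (c ∷ y) = trans (cong (λ z → a ℤ.* (b ℤ.+ c) ℤ.+ z) (dot-⊕ʳ w x y))
    (solve 5 (λ a b c d e → a :* (b :+ c) :+ (d :+ e) := (a :* b :+ d) :+ (a :* c :+ e)) refl a b c (dot w x) (dot w y))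
    where open ℤ.+-*-Solver

  dot-≋ : ∀ (w : Vec ℤ m) {y y′} → y ≋ y′ → dot w y ∼ dot w y′
  dot-≋ []      {[]}    {[]}    e = ∼-refl
  dot-≋ (a ∷ w) {_ ∷ _} {_ ∷ _} e = +-∼ (*-∼ (∼-refl {a}) (at e zero)) (dot-≋ w (congruent (at e ∘ suc)))

  ∣dot∣≤ : ∀ {M Q} {w y : Vec ℤ m} → Small M w → Small Q y → ∣ dot w y ∣ ≤ m * (M * Q)
  ∣dot∣≤ {w = []}    {[]}    _  _  = z≤n
  ∣dot∣≤ {M = M} {Q} {a ∷ w} {b ∷ y} sw sy = ≤-trans (ℤ.∣i+j∣≤∣i∣+∣j∣ (a ℤ.* b) (dot w y))
    (+-mono-≤ (≤-trans (≤-reflexive (ℤ.abs-* a b)) (*-mono-≤ (<⇒≤ (entry sw zero)) (<⇒≤ (entry sy zero))))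
      (∣dot∣≤ {w = w} {y} (small (entry sw ∘ suc)) (small (entry sy ∘ suc))))

  residues-unique : Unique residues
  residues-unique = Unique.applyUpTo⁺₁ _ p λ i<j _ eq → ℤ.<-irrefl eq (ℤ.+-monoʳ-< ℤ.-1ℤ (ℤ.+<+ (s≤s i<j)))

  residues-injective : ∀ {x y} → x ∈ residues → y ∈ residues → x ∼ y → x ≡ y
  residues-injective {x} {y} x∈ y∈ d = cong Vec.head (Res-injective {1} {x ∷ []} {y ∷ []}
    (∈-cartesianProductWith⁺ _∷_ x∈ (here refl)) (∈-cartesianProductWith⁺ _∷_ y∈ (here refl)) (congruent λ { zero → d }))

  Periodic : (ℤ → ℕ) → Set
  Periodic f = ∀ {x y} → x ∼ y → f x ≡ f y

  private
    affine-≤ : ∀ {f} → Periodic f → ∀ {d} e → ¬ d ∼ + 0 → ∑[ t ∈ residues ] f (d ℤ.* t ℤ.+ e) ≤ ∑ residues f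
    affine-≤ {f} per {d} e d≁0 = ≤-trans
      (≤-reflexive (∑-cong residues (λ t → per (∼-sym (res∼ (d ℤ.* t ℤ.+ e))))))
      (∑-inj ℤ._≟_ (λ t → res (d ℤ.* t ℤ.+ e)) f residues-unique (λ {x} _ → res∈ (d ℤ.* x ℤ.+ e))
        (λ {x} {y} x∈ y∈ eq → residues-injective x∈ y∈ (cancel x y
          (∼-trans (∼-sym (res∼ (d ℤ.* x ℤ.+ e))) (∼-trans (∼-reflexive eq) (res∼ (d ℤ.* y ℤ.+ e)))))))
      where
      open ℤ.+-*-Solver
      d′ = proj₁ (inverse d≁0)
      undo : ∀ x → d′ ℤ.* (d ℤ.* x ℤ.+ e ℤ.- e) ∼ x
      undo x = ∼-trans (∼-reflexive (solve 4 (λ d′ d x e → d′ :* (d :* x :+ e :- e) := (d′ :* d) :* x) refl d′ d x e))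
        (∼-trans (*-∼ (proj₂ (inverse d≁0)) (∼-refl {x})) (∼-reflexive (ℤ.*-identityˡ x)))
      cancel : ∀ x y → d ℤ.* x ℤ.+ e ∼ d ℤ.* y ℤ.+ e → x ∼ y
      cancel x y eq = ∼-trans (∼-sym (undo x)) (∼-trans (*-∼ (∼-refl {d′}) (─-∼ eq (∼-refl {e}))) (undo y))

  -- The map t ↦ d t + e permutes the residues. The reverse inequality is `affine-≤` for the inverse
  -- map t ↦ d′ t - d′ e.
  ∑-affine : ∀ {f} → Periodic f → ∀ {d} e → ¬ d ∼ + 0 → ∑[ t ∈ residues ] f (d ℤ.* t ℤ.+ e) ≡ ∑ residues f
  ∑-affine {f} per {d} e d≁0 = ≤-antisym (affine-≤ per e d≁0) (≤-trans
    (≤-reflexive (∑-cong residues (λ t → per (∼-sym (redo t)))))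
    (affine-≤ {λ t → f (d ℤ.* t ℤ.+ e)} (λ eq → per (+-∼ (*-∼ (∼-refl {d}) eq) (∼-refl {e}))) (ℤ.- (d′ ℤ.* e)) d′≁0))
    where
    open ℤ.+-*-Solver
    d′ = proj₁ (inverse d≁0)
    d′d∼1 = proj₂ (inverse d≁0)
    d′≁0 : ¬ d′ ∼ + 0
    d′≁0 z = 1≁0 (∼-trans (∼-sym d′d∼1) (∼-trans (*-∼ z (∼-refl {d})) (∼-reflexive (ℤ.*-zeroˡ d))))
    redo : ∀ t → d ℤ.* (d′ ℤ.* t ℤ.+ ℤ.- (d′ ℤ.* e)) ℤ.+ e ∼ t
    redo t = ∼-trans (∼-reflexive (solve 4 (λ d′ d t e → d :* (d′ :* t :+ (:- (d′ :* e))) :+ e := (d′ :* d) :* (t :- e) :+ e) refl d′ d t e))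
      (∼-trans (+-∼ (*-∼ d′d∼1 (∼-refl {t ℤ.- e})) (∼-refl {e}))
        (∼-reflexive (solve 2 (λ t e → con (+ 1) :* (t :- e) :+ e := t) refl t e)))

  -- The common shift `c` is averaged along with `y`, so that the forms enter only through their
  -- difference w - w′, also when one of them vanishes.
  correlation : (F G : ℤ → ℕ) (w w′ : Vec ℤ m) (a a′ : ℤ) → ℕ
  correlation {m} F G w w′ a a′ = ∑[ y ∈ Res m ] (∑[ c ∈ residues ] F (dot w y ℤ.+ a ℤ.+ c) * G (dot w′ y ℤ.+ a′ ℤ.+ c))

  module _ {F G : ℤ → ℕ} (F-periodic : Periodic F) (G-periodic : Periodic G) where

    private
      open ℤ.+-*-Solver

      product-periodic : ∀ b → Periodic (λ c → F (b ℤ.+ c) * G c)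
      product-periodic b eq = cong₂ _*_ (F-periodic (+-∼ (∼-refl {b}) eq)) (G-periodic eq)

    -- Substituting for `c` removes `y` from the argument of G and leaves (w - w′) y in that of F;
    -- then y alone runs F through a complete residue system.
    correlation₁ : ∀ {w w′} a a′ → ¬ w ∼ w′ →
      ∑[ y ∈ residues ] (∑[ c ∈ residues ] F (w ℤ.* y ℤ.+ a ℤ.+ c) * G (w′ ℤ.* y ℤ.+ a′ ℤ.+ c)) ≡ ∑ residues F * ∑ residues G
    correlation₁ {w} {w′} a a′ w≁w′ = begin
      ∑[ y ∈ residues ] (∑[ c ∈ residues ] F (w ℤ.* y ℤ.+ a ℤ.+ c) * G (w′ ℤ.* y ℤ.+ a′ ℤ.+ c))
        ≡⟨ ∑-cong residues (λ y → trans (∑-cong residues (λ c → cong₂ (λ s t → F s * G t)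
             (solve 6 (λ w w′ y a a′ c → w :* y :+ a :+ c := ((w :- w′) :* y :+ (a :- a′)) :+ (con (+ 1) :* c :+ (w′ :* y :+ a′))) refl w w′ y a a′ c)
             (solve 4 (λ w′ y a′ c → w′ :* y :+ a′ :+ c := con (+ 1) :* c :+ (w′ :* y :+ a′)) refl w′ y a′ c)))
           (∑-affine (product-periodic ((w ℤ.- w′) ℤ.* y ℤ.+ (a ℤ.- a′))) (w′ ℤ.* y ℤ.+ a′) 1≁0)) ⟩
      ∑[ y ∈ residues ] (∑[ c ∈ residues ] F ((w ℤ.- w′) ℤ.* y ℤ.+ (a ℤ.- a′) ℤ.+ c) * G c)
        ≡⟨ ∑-swap residues residues _ ⟩
      ∑[ c ∈ residues ] (∑[ y ∈ residues ] F ((w ℤ.- w′) ℤ.* y ℤ.+ (a ℤ.- a′) ℤ.+ c) * G c)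
        ≡⟨ ∑-cong residues (λ c → trans (∑-*ʳ residues (G c) _) (cong (_* G c) (trans
             (∑-cong residues (λ y → cong F (ℤ.+-assoc ((w ℤ.- w′) ℤ.* y) (a ℤ.- a′) c)))
             (∑-affine F-periodic (a ℤ.- a′ ℤ.+ c) (w≁w′ ∘ ∼0⇒∼))))) ⟩
      ∑[ c ∈ residues ] (∑ residues F * G c)
        ≡⟨ ∑-*ˡ residues (∑ residues F) G ⟩
      ∑ residues F * ∑ residues G ∎
      where open ≡-Reasoning

  -- Incongruent forms are jointly equidistributed, so that only the total mass of G matters.
  module _ {F G G′ : ℤ → ℕ} (F-per : Periodic F) (G-per : Periodic G) (G′-per : Periodic G′) (mass : ∑ residues G ≡ ∑ residues G′) where

    private
      open ℤ.+-*-Solver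

      split : ∀ H (w w′ : Vec ℤ m) w₀ w₀′ a a′ → correlation F H (w₀ ∷ w) (w₀′ ∷ w′) a a′ ≡
              ∑[ y₀ ∈ residues ] correlation F H w w′ (w₀ ℤ.* y₀ ℤ.+ a) (w₀′ ℤ.* y₀ ℤ.+ a′)
      split {m} H w w′ w₀ w₀′ a a′ = trans (∑-box-∷ ℤ.-1ℤ (replicate m ℤ.-1ℤ) p (replicate m p) _)
        (∑-cong residues (λ y₀ → ∑-cong (Res m) (λ y → ∑-cong residues (λ c → cong₂ (λ s t → F s * H t)
          (regroup w₀ y₀ (dot w y) a c) (regroup w₀′ y₀ (dot w′ y) a′ c)))))
        where
        regroup : ∀ w y d a c → w ℤ.* y ℤ.+ d ℤ.+ a ℤ.+ c ≡ d ℤ.+ (w ℤ.* y ℤ.+ a) ℤ.+ c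
        regroup = solve 5 (λ w y d a c → w :* y :+ d :+ a :+ c := d :+ (w :* y :+ a) :+ c) refl

      column : ∀ {H} → Periodic H → ∀ (w w′ : Vec ℤ m) w₀ w₀′ a a′ → ¬ w₀ ∼ w₀′ →
               correlation F H (w₀ ∷ w) (w₀′ ∷ w′) a a′ ≡ ∑[ y ∈ Res m ] (∑ residues F * ∑ residues H)
      column {m} {H} H-per w w′ w₀ w₀′ a a′ w₀≁ = trans (split H w w′ w₀ w₀′ a a′) (trans (∑-swap residues (Res m) _)
        (∑-cong (Res m) (λ y → trans
          (∑-cong residues (λ y₀ → ∑-cong residues (λ c → cong₂ (λ s t → F s * H t)
            (regroup w₀ y₀ (dot w y) a c) (regroup w₀′ y₀ (dot w′ y) a′ c))))
          (correlation₁ F-per H-per (dot w y ℤ.+ a) (dot w′ y ℤ.+ a′) w₀≁))))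
        where
        regroup : ∀ w y d a c → d ℤ.+ (w ℤ.* y ℤ.+ a) ℤ.+ c ≡ w ℤ.* y ℤ.+ (d ℤ.+ a) ℤ.+ c
        regroup = solve 5 (λ w y d a c → d :+ (w :* y :+ a) :+ c := w :* y :+ (d :+ a) :+ c) refl

    -- Congruent leading coefficients are absorbed into the constants a , a′. At the first
    -- incongruent pair, the sum over that one coordinate already decouples F from G.
    correlation-mass : ∀ (w w′ : Vec ℤ m) a a′ → ¬ w ≋ w′ → correlation F G w w′ a a′ ≡ correlation F G′ w w′ a a′
    correlation-mass []       []         a a′ w≇w′ = ⊥-elim (w≇w′ ≋-refl)
    correlation-mass {suc m} (w₀ ∷ w) (w₀′ ∷ w′) a a′ w≇w′ with w₀ ∼? w₀′
    ... | no w₀≁  = trans (column G-per w w′ w₀ w₀′ a a′ w₀≁) (trans (∑-cong (Res m) (λ _ → cong (∑ residues F *_) mass))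
                      (sym (column G′-per w w′ w₀ w₀′ a a′ w₀≁)))
    ... | yes w₀∼ = trans (split G w w′ w₀ w₀′ a a′) (trans
      (∑-cong residues (λ y₀ → correlation-mass w w′ (w₀ ℤ.* y₀ ℤ.+ a) (w₀′ ℤ.* y₀ ℤ.+ a′)
        (λ e → w≇w′ (congruent λ { zero → w₀∼ ; (suc k) → at e k }))))
      (sym (split G′ w w′ w₀ w₀′ a a′)))

  -- Indicator of the residues strictly between 0 and p / 2. The difference of `half` and `half⁻` is
  -- a sign of mean zero, which does the work of an additive character.
  half : ℤ → ℕ
  half t = 𝟙 ((1 ≤? t %ℕ p) ×-dec (2 * (t %ℕ p) <? p))

  half⁻ : ℤ → ℕ
  half⁻ t = half (ℤ.- t)

  half-periodic : Periodic half
  half-periodic {x} {y} e = cong (λ r → 𝟙 ((1 ≤? r) ×-dec (2 * r <? p))) (ℤ.+-injective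
    (residues-injective (res∈ x) (res∈ y) (∼-trans (res∼ x) (∼-trans e (∼-sym (res∼ y))))))

  half⁻-periodic : Periodic half⁻
  half⁻-periodic e = half-periodic (neg-∼ e)

  half-mass : ∑ residues half ≡ ∑ residues half⁻
  half-mass = sym (trans (∑-cong residues (λ t → cong half (solve 1 (λ t → :- t := con (ℤ.- (+ 1)) :* t :+ con (+ 0)) refl t)))
    (∑-affine {half} half-periodic {ℤ.- (+ 1)} (+ 0) (λ e → 1≁0 (neg-∼ e))))
    where open ℤ.+-*-Solver

  half-disjoint : ∀ t → half t + half⁻ t ≤ 1
  half-disjoint t = bound ((1 ≤? t %ℕ p) ×-dec (2 * (t %ℕ p) <? p)) ((1 ≤? (ℤ.- t) %ℕ p) ×-dec (2 * ((ℤ.- t) %ℕ p) <? p))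
    where
    open ℤ.+-*-Solver
    r r′ : ℕ
    r  = t %ℕ p
    r′ = (ℤ.- t) %ℕ p
    bound : (d : Dec (1 ≤ r × 2 * r < p)) (d′ : Dec (1 ≤ r′ × 2 * r′ < p)) → 𝟙 d + 𝟙 d′ ≤ 1
    bound (no _)  d′     = 𝟙≤1 d′
    bound (yes _) (no _) = ≤-refl
    -- Otherwise r + r′ would be a positive number below p that is congruent to t - t.
    bound (yes (1≤r , 2r<p)) (yes (_ , 2r′<p)) = ⊥-elim (small∼0 (r + r′) (≤-trans 1≤r (m≤m+n r r′))
      (*-cancelˡ-< 2 _ _ (≤-trans (s≤s (≤-reflexive (*-distribˡ-+ 2 r r′))) (≤-trans (+-mono-< 2r<p 2r′<p) (≤-reflexive (cong (λ z → p + z) (sym (+-identityʳ p)))))))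
      (∼-trans (+-∼ (res∼ t) (res∼ (ℤ.- t))) (∼-reflexive (ℤ.+-inverseʳ t))))

  half-one : ∀ k → 1 ≤ k → 2 * k < p → half (+ k) ≡ 1 × half⁻ (+ k) ≡ 0
  half-one k 1≤k 2k<p = h≡1 , n≤0⇒n≡0 (s≤s⁻¹ (≤-trans (≤-reflexive (cong (_+ half⁻ (+ k)) (sym h≡1))) (half-disjoint (+ k))))
    where
    k%p : k Data.Nat.DivMod.% p ≡ k
    k%p = m<n⇒m%n≡m (≤-<-trans (m≤m+n k (k + 0)) 2k<p)
    h≡1 : half (+ k) ≡ 1
    h≡1 = 𝟙-yes ((1 ≤? (+ k) %ℕ p) ×-dec (2 * ((+ k) %ℕ p) <? p)) (subst (λ r → 1 ≤ r × 2 * r < p) (sym k%p) (1≤k , 2k<p))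

  half-square : ∀ t → half t * half t + half⁻ t * half⁻ t ≤ 1
  half-square t with half t | half⁻ t | half-disjoint t
  ... | zero  | zero  | _ = z≤n
  ... | zero  | suc zero | _ = ≤-refl
  ... | suc zero | zero | _ = ≤-refl
  ... | zero  | suc (suc _) | s≤s ()
  ... | suc (suc _) | _ | s≤s ()
  ... | suc zero | suc _ | s≤s ()

  -- Square of a difference within the natural numbers, the cross terms being kept on the left.
  dist-square : ∀ a b → ∣ a - b ∣ * ∣ a - b ∣ + (a * b + b * a) ≡ a * a + b * b
  dist-square a b with ≤-total a b
  ... | inj₁ a≤b = subst (λ b → ∣ a - b ∣ * ∣ a - b ∣ + (a * b + b * a) ≡ a * a + b * b) (m+[n∸m]≡n a≤b) (go a (b ∸ a))
    where
    open ℕ.+-*-Solver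
    go : ∀ a d → ∣ a - a + d ∣ * ∣ a - a + d ∣ + (a * (a + d) + (a + d) * a) ≡ a * a + (a + d) * (a + d)
    go a d rewrite ∣m-m+n∣≡n a d = solve 2 (λ a d → d :* d :+ (a :* (a :+ d) :+ (a :+ d) :* a) := a :* a :+ (a :+ d) :* (a :+ d)) refl a d
  ... | inj₂ b≤a = subst (λ a → ∣ a - b ∣ * ∣ a - b ∣ + (a * b + b * a) ≡ a * a + b * b) (m+[n∸m]≡n b≤a) (go b (a ∸ b))
    where
    open ℕ.+-*-Solver
    go : ∀ b d → ∣ b + d - b ∣ * ∣ b + d - b ∣ + ((b + d) * b + b * (b + d)) ≡ (b + d) * (b + d) + b * b
    go b d rewrite ∣-∣-comm (b + d) b | ∣m-m+n∣≡n b d = solve 2 (λ b d → d :* d :+ ((b :+ d) :* b :+ b :* (b :+ d)) := (b :+ d) :* (b :+ d) :+ b :* b) refl b d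

  private
    plane : ∀ m → (Vec ℤ m → ℤ → ℕ) → ℕ
    plane m f = ∑[ y ∈ Res m ] (∑[ c ∈ residues ] f y c)

    plane-+ : ∀ m f g → plane m (λ y c → f y c + g y c) ≡ plane m f + plane m g
    plane-+ m f g = trans (∑-cong (Res m) (λ y → ∑-+ residues (f y) (g y))) (∑-+ (Res m) _ _)

    plane-∑ : ∀ m {A : Set} (xs : List A) (f : A → Vec ℤ m → ℤ → ℕ) → plane m (λ y c → ∑[ x ∈ xs ] f x y c) ≡ ∑[ x ∈ xs ] plane m (f x)
    plane-∑ m xs f = trans (∑-cong (Res m) (λ y → ∑-swap residues xs _)) (∑-swap (Res m) xs _)

  module SecondMoment {W : List (Vec ℤ m)} (W-unique : Unique W) (W-incongruent : ∀ {w w′} → w ∈ W → w′ ∈ W → w ≋ w′ → w ≡ w′) where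

    above below discrepancy : Vec ℤ m → ℤ → ℕ
    above y c = ∑[ w ∈ W ] half (dot w y ℤ.+ + 0 ℤ.+ c)
    below y c = ∑[ w ∈ W ] half⁻ (dot w y ℤ.+ + 0 ℤ.+ c)
    discrepancy y c = ∣ above y c - below y c ∣ * ∣ above y c - below y c ∣

    private
      corr : (F G : ℤ → ℕ) → Vec ℤ m → Vec ℤ m → ℕ
      corr F G w w′ = correlation F G w w′ (+ 0) (+ 0)

      expand : ∀ F G → plane m (λ y c → (∑[ w ∈ W ] F (dot w y ℤ.+ + 0 ℤ.+ c)) * (∑[ w ∈ W ] G (dot w y ℤ.+ + 0 ℤ.+ c)))
               ≡ ∑[ w ∈ W ] (∑[ w′ ∈ W ] corr F G w w′)
      expand F G = trans (∑-cong (Res m) (λ y → ∑-cong residues (λ c → ∑-*-∑ W W _ _)))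
        (trans (plane-∑ m W _) (∑-cong W (λ w → plane-∑ m W _)))

      diagonal : ∀ w → corr half half w w + corr half⁻ half⁻ w w ≤ p ^ m * p
      diagonal w = begin
        corr half half w w + corr half⁻ half⁻ w w
          ≡⟨ plane-+ m _ _ ⟨
        plane m (λ y c → half (dot w y ℤ.+ + 0 ℤ.+ c) * half (dot w y ℤ.+ + 0 ℤ.+ c) + half⁻ (dot w y ℤ.+ + 0 ℤ.+ c) * half⁻ (dot w y ℤ.+ + 0 ℤ.+ c))
          ≤⟨ ∑-mono′ (Res m) (λ y → ∑-mono′ residues (λ c → half-square (dot w y ℤ.+ + 0 ℤ.+ c))) ⟩
        plane m (λ _ _ → 1)
          ≡⟨ ∑-cong (Res m) (λ y → trans (∑-const residues 1) (trans (*-identityʳ _) (length-applyUpTo (λ t → ℤ.-1ℤ ℤ.+ + suc t) p))) ⟩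
        ∑[ y ∈ Res m ] p
          ≡⟨ ∑-Res-const m p ⟩
        p ^ m * p ∎
        where open ≤-Reasoning

      -- For distinct w and w′ the equal masses of `half` and `half⁻` make correlations of equal
      -- signs match those of opposite signs. On the diagonal disjointness leaves at most 1 for each
      -- (y , c).
      pair : ∀ {w w′} → w ∈ W → w′ ∈ W → corr half half w w′ + corr half⁻ half⁻ w w′ ≤
             corr half half⁻ w w′ + corr half⁻ half w w′ + 𝟙 (w ≟ᵛ w′) * (p ^ m * p)
      pair {w} {w′} w∈ w′∈ with w ≟ᵛ w′
      ... | yes refl = ≤-trans (diagonal w) (≤-trans (≤-reflexive (sym (+-identityʳ _))) (m≤n+m (1 * (p ^ m * p)) (corr half half⁻ w w + corr half⁻ half w w)))
      ... | no w≢w′ = ≤-trans (≤-reflexive (cong₂ _+_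
        (correlation-mass half-periodic half-periodic half⁻-periodic half-mass w w′ (+ 0) (+ 0) (w≢w′ ∘ W-incongruent w∈ w′∈))
        (correlation-mass half⁻-periodic half⁻-periodic half-periodic (sym half-mass) w w′ (+ 0) (+ 0) (w≢w′ ∘ W-incongruent w∈ w′∈))))
        (m≤m+n _ 0)

      merge : ∀ F G F′ G′ → (∑[ w ∈ W ] (∑[ w′ ∈ W ] corr F G w w′)) + (∑[ w ∈ W ] (∑[ w′ ∈ W ] corr F′ G′ w w′))
              ≡ ∑[ w ∈ W ] (∑[ w′ ∈ W ] (corr F G w w′ + corr F′ G′ w w′))
      merge F G F′ G′ = sym (trans (∑-cong W (λ w → ∑-+ W _ _)) (∑-+ W _ _))

    -- The variance of a sum of pairwise uncorrelated signs: only the `length W` diagonal terms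
    -- survive. The products of `above` and `below` are added to both sides, so that no subtraction
    -- occurs, and cancelled at the end.
    second-moment : plane m discrepancy ≤ length W * (p ^ m * p)
    second-moment = +-cancelʳ-≤ (plane m (λ y c → above y c * below y c + below y c * above y c)) _ _ (begin
      plane m discrepancy + plane m (λ y c → above y c * below y c + below y c * above y c)
        ≡⟨ plane-+ m _ _ ⟨
      plane m (λ y c → discrepancy y c + (above y c * below y c + below y c * above y c))
        ≡⟨ ∑-cong (Res m) (λ y → ∑-cong residues (λ c → dist-square (above y c) (below y c))) ⟩
      plane m (λ y c → above y c * above y c + below y c * below y c)
        ≡⟨ trans (plane-+ m _ _) (trans (cong₂ _+_ (expand half half) (expand half⁻ half⁻)) (merge half half half⁻ half⁻)) ⟩
      ∑[ w ∈ W ] (∑[ w′ ∈ W ] (corr half half w w′ + corr half⁻ half⁻ w w′))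
        ≤⟨ ∑-mono W (λ w∈ → ∑-mono W (λ w′∈ → pair w∈ w′∈)) ⟩
      ∑[ w ∈ W ] (∑[ w′ ∈ W ] (corr half half⁻ w w′ + corr half⁻ half w w′ + 𝟙 (w ≟ᵛ w′) * (p ^ m * p)))
        ≡⟨ trans (∑-cong W (λ w → ∑-+ W _ _)) (∑-+ W _ _) ⟩
      (∑[ w ∈ W ] (∑[ w′ ∈ W ] (corr half half⁻ w w′ + corr half⁻ half w w′))) + (∑[ w ∈ W ] (∑[ w′ ∈ W ] 𝟙 (w ≟ᵛ w′) * (p ^ m * p)))
        ≤⟨ +-monoʳ-≤ _ (∑-≤const W (p ^ m * p) (λ {w} _ → ≤-trans (≤-reflexive (∑-*ʳ W (p ^ m * p) _))
             (≤-trans (*-monoˡ-≤ (p ^ m * p) (#≤1 (w ≟ᵛ_) W-unique (λ _ _ e e′ → trans (sym e) e′))) (≤-reflexive (+-identityʳ _))))) ⟩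
      (∑[ w ∈ W ] (∑[ w′ ∈ W ] (corr half half⁻ w w′ + corr half⁻ half w w′))) + length W * (p ^ m * p)
        ≡⟨ cong (_+ length W * (p ^ m * p)) (sym (trans (plane-+ m _ _) (trans (cong₂ _+_ (expand half half⁻) (expand half⁻ half)) (merge half half⁻ half⁻ half)))) ⟩
      plane m (λ y c → above y c * below y c + below y c * above y c) + length W * (p ^ m * p)
        ≡⟨ +-comm _ (length W * (p ^ m * p)) ⟩
      length W * (p ^ m * p) + plane m (λ y c → above y c * below y c + below y c * above y c) ∎)
      where open ≤-Reasoning

  module Duality {ℓ ℓ′} (V : Lattice m ℓ) (V⊥ : Lattice m ℓ′)
    (orthogonal : ∀ {w y} → Lattice.Member V w → Lattice.Member V⊥ y → dot w y ∼ + 0)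
    (V⊥-periodic : ∀ {x y} → x ≋ y → Lattice.Member V⊥ x → Lattice.Member V⊥ y)
    {T : List (Vec ℤ m)} (T⊆V⊥ : ∀ {t} → t ∈ T → Lattice.Member V⊥ t)
    (T-incongruent : ∀ z → ∑[ t ∈ T ] 𝟙 (t ≋? z) ≤ 1)
    (M Q e : ℕ) (1≤M : 1 ≤ M) (2M≤p : 2 * M ≤ p) (mMQ<e : m * (M * Q) < e) (6e≤p : 6 * e ≤ p)
    where

    private
      module V  = Lattice V
      module V⊥ = Lattice V⊥

      W : List (Vec ℤ m)
      W = filter V.member? (Ball m M)

      #W : length W ≡ V.points M
      #W = length-filter-∑ V.member? (Ball m M)

      W-unique : Unique W
      W-unique = Unique.filter⁺ V.member? (Ball-unique m M)

      W-small : ∀ {w} → w ∈ W → Small M w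
      W-small w∈ = ∈-Ball⁻ (proj₁ (∈-filter⁻ V.member? {xs = Ball m M} w∈))

      W-incongruent : ∀ {w w′} → w ∈ W → w′ ∈ W → w ≋ w′ → w ≡ w′
      W-incongruent {w} {w′} w∈ w′∈ eq = ≋-close eq (Small-⊖ {x = w} {w′} (W-small w∈) (W-small w′∈))
        (≤-trans (≤-reflexive (cong (λ z → M + z) (sym (+-identityʳ M)))) 2M≤p)

      open SecondMoment W-unique W-incongruent

      square : ℕ
      square = length W * length W

      translate : ∀ {t} y c → t ∈ T → discrepancy (y ⊕ t) c ≡ discrepancy y c
      translate {t} y c t∈ = cong₂ (λ a b → ∣ a - b ∣ * ∣ a - b ∣)
        (∑-cong∈ W (λ w∈ → half-periodic (same w∈))) (∑-cong∈ W (λ w∈ → half⁻-periodic (same w∈)))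
        where
        same : ∀ {w} → w ∈ W → dot w (y ⊕ t) ℤ.+ + 0 ℤ.+ c ∼ dot w y ℤ.+ + 0 ℤ.+ c
        same {w} w∈ = +-∼ (+-∼ (∼-trans (∼-reflexive (dot-⊕ʳ w y t)) (∼-trans
          (+-∼ (∼-refl {dot w y}) (orthogonal (proj₂ (∈-filter⁻ V.member? {xs = Ball m M} w∈)) (T⊆V⊥ t∈))) (∼-reflexive (ℤ.+-identityʳ (dot w y)))))
          (∼-refl {+ 0})) (∼-refl {c})

      discrepancy-periodic : ∀ {y y′} c → y ≋ y′ → discrepancy y c ≡ discrepancy y′ c
      discrepancy-periodic {y} {y′} c eq = cong₂ (λ a b → ∣ a - b ∣ * ∣ a - b ∣)
        (∑-cong W (λ w → half-periodic (same w))) (∑-cong W (λ w → half⁻-periodic (same w)))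
        where
        same : ∀ w → dot w y ℤ.+ + 0 ℤ.+ c ∼ dot w y′ ℤ.+ + 0 ℤ.+ c
        same w = +-∼ (+-∼ (dot-≋ w eq) (∼-refl {+ 0})) (∼-refl {c})

      -- If s is small and c lies in [e , 2e) then s + c lies strictly between 0 and p / 2.
      window : ∀ s k → ∣ s ∣ < e → k < e → half (s ℤ.+ + 0 ℤ.+ (+ (e + k))) ≡ 1 × half⁻ (s ℤ.+ + 0 ℤ.+ (+ (e + k))) ≡ 0
      window s k ∣s∣<e k<e = subst (λ t → half t ≡ 1 × half⁻ t ≡ 0) eq (half-one (∣ t ∣) 1≤t (<-≤-trans (*-monoʳ-< 2 t<3e) (≤-trans (≤-reflexive (sym (*-assoc 2 3 e))) 6e≤p)))
        where
        t = s ℤ.+ + 0 ℤ.+ (+ (e + k))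
        bounds : ∀ s → ∣ s ∣ < e → ∃ λ r → s ℤ.+ + 0 ℤ.+ (+ (e + k)) ≡ + r × 1 ≤ r × r < 3 * e
        bounds (+ a) a<e = a + 0 + (e + k) , refl , ≤-trans (≤-trans (s≤s z≤n) a<e) (≤-trans (m≤m+n e k) (m≤n+m _ (a + 0))) ,
          ≤-trans (s≤s (≤-reflexive (cong (_+ (e + k)) (+-identityʳ a)))) (≤-trans (+-mono-<-≤ a<e (+-monoʳ-≤ e (<⇒≤ k<e))) (≤-reflexive (cong (λ z → e + (e + z)) (sym (+-identityʳ e)))))
        bounds -[1+ a ] a<e = e + k ∸ suc a , ℤ.⊖-≥ {e + k} {suc a} (≤-trans (<⇒≤ a<e) (m≤m+n e k)) ,
          m<n⇒0<n∸m (≤-trans a<e (m≤m+n e k)) ,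
          ≤-<-trans (m∸n≤m (e + k) (suc a)) (<-≤-trans (+-monoʳ-< e k<e) (≤-trans (m≤m+n (e + e) e) (≤-reflexive (trans (+-assoc e e e) (cong (λ z → e + (e + z)) (sym (+-identityʳ e)))))))
        r = proj₁ (bounds s ∣s∣<e)
        t≡r = proj₁ (proj₂ (bounds s ∣s∣<e))
        ∣t∣≡r : ∣ t ∣ ≡ r
        ∣t∣≡r = cong ∣_∣ t≡r
        eq : + ∣ t ∣ ≡ t
        eq = trans (cong +_ ∣t∣≡r) (sym t≡r)
        1≤t : 1 ≤ ∣ t ∣
        1≤t = subst (1 ≤_) (sym ∣t∣≡r) (proj₁ (proj₂ (proj₂ (bounds s ∣s∣<e))))
        t<3e : ∣ t ∣ < 3 * e
        t<3e = subst (_< 3 * e) (sym ∣t∣≡r) (proj₂ (proj₂ (proj₂ (bounds s ∣s∣<e))))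

      extreme : ∀ {y} k → y ∈ Ball m Q → k < e → discrepancy y (+ (e + k)) ≡ square
      extreme {y} k y∈ k<e = trans (cong₂ (λ a b → ∣ a - b ∣ * ∣ a - b ∣)
        (trans (∑-cong∈ W (λ w∈ → proj₁ (good w∈))) (trans (∑-const W 1) (*-identityʳ (length W)))) (∑-zero W (λ w∈ → proj₂ (good w∈))))
        (cong₂ _*_ (∣-∣-identityʳ (length W)) (∣-∣-identityʳ (length W)))
        where
        good : ∀ {w} → w ∈ W → half (dot w y ℤ.+ + 0 ℤ.+ (+ (e + k))) ≡ 1 × half⁻ (dot w y ℤ.+ + 0 ℤ.+ (+ (e + k))) ≡ 0
        good {w} w∈ = window (dot w y) k (≤-<-trans (∣dot∣≤ {w = w} {y} (W-small w∈) (∈-Ball⁻ y∈)) mMQ<e) k<e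

      columns : ∀ {y} → y ∈ Ball m Q → e * square ≤ ∑[ c ∈ residues ] discrepancy y c
      columns {y} y∈ = begin
        e * square
          ≡⟨ cong (_* square) (length-applyUpTo (λ t → ℤ.-1ℤ ℤ.+ + e ℤ.+ + suc t) e) ⟨
        length (interval (ℤ.-1ℤ ℤ.+ + e) e) * square
          ≡⟨ ∑-const (interval (ℤ.-1ℤ ℤ.+ + e) e) square ⟨
        ∑[ c ∈ interval (ℤ.-1ℤ ℤ.+ + e) e ] square
          ≡⟨ ∑-cong∈ (interval (ℤ.-1ℤ ℤ.+ + e) e) (λ c∈ → sym (value c∈)) ⟩
        ∑ (interval (ℤ.-1ℤ ℤ.+ + e) e) (discrepancy y)
          -- The window [e , 2 e) is completed to all residues, by p - 2 e values above it and then
          -- e values below it.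
          ≤⟨ ≤-trans (m≤m+n _ (∑ (interval (ℤ.-1ℤ ℤ.+ + e ℤ.+ + e) (p ∸ (e + e))) (discrepancy y))) (≤-reflexive (sym (∑-interval-+ (ℤ.-1ℤ ℤ.+ + e) e (p ∸ (e + e)) (discrepancy y)))) ⟩
        ∑ (interval (ℤ.-1ℤ ℤ.+ + e) (e + (p ∸ (e + e)))) (discrepancy y)
          ≤⟨ ≤-trans (m≤n+m _ (∑ (interval ℤ.-1ℤ e) (discrepancy y))) (≤-reflexive (sym (∑-interval-+ ℤ.-1ℤ e (e + (p ∸ (e + e))) (discrepancy y)))) ⟩
        ∑ (interval ℤ.-1ℤ (e + (e + (p ∸ (e + e))))) (discrepancy y)
          ≡⟨ cong (λ h → ∑ (interval ℤ.-1ℤ h) (discrepancy y)) (trans (sym (+-assoc e e _)) (m+[n∸m]≡n (≤-trans (≤-trans (≤-reflexive (cong (λ z → e + z) (sym (+-identityʳ e)))) (*-monoˡ-≤ e {2} {6} (s≤s (s≤s z≤n)))) 6e≤p))) ⟩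
        ∑[ c ∈ residues ] discrepancy y c ∎
        where
        open ≤-Reasoning
        value : ∀ {c} → c ∈ interval (ℤ.-1ℤ ℤ.+ + e) e → discrepancy y c ≡ square
        value c∈ with ∈-applyUpTo⁻ (λ t → ℤ.-1ℤ ℤ.+ + e ℤ.+ + suc t) c∈
        ... | k , k<e , refl = trans (cong (discrepancy y) (solve 2 (λ e k → con (ℤ.- (+ 1)) :+ e :+ (con (+ 1) :+ k) := e :+ k) refl (+ e) (+ k)))
                                 (extreme k y∈ k<e)
          where open ℤ.+-*-Solver

      -- Given z, each y admits at most one t, since T is incongruent. Two admissible y differ
      -- modulo p by a difference of elements of T, hence by a member of V⊥, and this difference is
      -- small for 2 Q.
      multiplicity : ∀ z → ∑[ y ∈ Ball m Q ] (∑[ t ∈ T ] 𝟙 (y ⊕ t ≋? z)) ≤ V⊥.points (2 * Q)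
      multiplicity z = ≤-trans
        (∑-mono′ (Ball m Q) (λ y → one y (hit? y)))
        (#-diff hit? V⊥.member? (Ball-unique m Q) (λ {y} {y′} y∈ y′∈ h h′ →
          let t , t∈ , eq = find h ; t′ , t′∈ , eq′ = find h′ in
          ∈-Ball⁺ (Small-mono (≤-reflexive (cong (λ z → Q + z) (sym (+-identityʳ Q)))) (Small-⊖ {x = y} {y′} (∈-Ball⁻ y∈) (∈-Ball⁻ y′∈))) ,
          V⊥-periodic (congruent λ k → ∼-trans (∼-reflexive (lookup-⊖ k t′ t))
            (∼-trans (swap {lookup y k} {lookup y′ k} (∼-trans (∼-reflexive (sym (lookup-⊕ k y t))) (∼-trans (at eq k) (∼-trans (∼-sym (at eq′ k)) (∼-reflexive (lookup-⊕ k y′ t′))))))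
            (∼-reflexive (sym (lookup-⊖ k y y′))))) (V⊥.⊖-closed (T⊆V⊥ t′∈) (T⊆V⊥ t∈))))
        where
        open ℤ.+-*-Solver
        hit? : ∀ y → Dec (Any (λ t → y ⊕ t ≋ z) T)
        hit? y = any? (λ t → y ⊕ t ≋? z) T
        swap : ∀ {y y′ t t′} → y ℤ.+ t ∼ y′ ℤ.+ t′ → t′ ℤ.- t ∼ y ℤ.- y′
        swap {y} {y′} {t} {t′} eq = ∼-trans (∼-reflexive (solve 3 (λ y′ t t′ → t′ :- t := (y′ :+ t′) :- (y′ :+ t)) refl y′ t t′))
          (∼-trans (─-∼ (∼-sym eq) (∼-refl {y′ ℤ.+ t})) (∼-reflexive (solve 3 (λ y y′ t → (y :+ t) :- (y′ :+ t) := y :- y′) refl y y′ t)))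
        one : ∀ y (h : Dec (Any (λ t → y ⊕ t ≋ z) T)) → ∑[ t ∈ T ] 𝟙 (y ⊕ t ≋? z) ≤ 𝟙 h
        one y (no ¬h) = ≤-reflexive (∑-zero T (λ {t} t∈ → 𝟙-no (y ⊕ t ≋? z) (λ eq → ¬h (lose t∈ eq))))
        one y (yes _) = ≤-trans (∑-mono′ T (λ t → 𝟙-mono (y ⊕ t ≋? z) (t ≋? (z ⊖ y)) (λ eq → congruent λ k →
          ∼-trans (∼-reflexive (solve 2 (λ y t → t := (y :+ t) :- y) refl (lookup y k) (lookup t k)))
          (∼-trans (─-∼ (∼-trans (∼-reflexive (sym (lookup-⊕ k y t))) (at eq k)) (∼-refl {lookup y k})) (∼-reflexive (sym (lookup-⊖ k z y)))))))
          (T-incongruent (z ⊖ y))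

    -- For y in the ball of radius Q and c in the window all signs agree, so the discrepancy takes
    -- its maximum `square`, and it keeps this value on translating y by V⊥. The second moment
    -- leaves little room for such places, so if V has many points of size M the balls around T
    -- overlap heavily, which produces short vectors in V⊥.
    duality : V.points M * (length T * (length (Ball m Q) * e)) ≤ V⊥.points (2 * Q) * (p ^ m * p)
    duality = *-cancelˡ-≤ (length W) {{>-nonZero (subst (1 ≤_) (sym #W) (V.1≤points 1≤M))}} (begin
      length W * (V.points M * (length T * (length (Ball m Q) * e)))
        ≡⟨ trans (cong (λ α → length W * (α * (length T * (length (Ball m Q) * e)))) (sym #W))
             (solve 4 (λ w t q e → w :* (w :* (t :* (q :* e))) := q :* (t :* (e :* (w :* w)))) refl (length W) (length T) (length (Ball m Q)) e) ⟩
      length (Ball m Q) * (length T * (e * square))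
        ≡⟨ trans (sym (∑-const (Ball m Q) _)) (∑-cong (Ball m Q) (λ _ → sym (∑-const T _))) ⟩
      ∑[ y ∈ Ball m Q ] (∑[ t ∈ T ] (e * square))
        ≤⟨ ∑-mono (Ball m Q) (λ {y} y∈ → ∑-mono T (λ {t} t∈ → ≤-trans (columns y∈) (≤-trans
             (≤-reflexive (∑-cong residues (λ c → trans (sym (translate y c t∈)) (discrepancy-periodic c (≋-sym (red≋ (y ⊕ t)))))))
             (≤-trans (≤-reflexive (sym (trans (cong (_* D (red (y ⊕ t))) (𝟙-yes (y ⊕ t ≋? red (y ⊕ t)) (≋-sym (red≋ (y ⊕ t))))) (+-identityʳ _))))
               (∑-∈ (λ z → 𝟙 (y ⊕ t ≋? z) * D z) (red∈ (y ⊕ t))))))) ⟩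
      ∑[ y ∈ Ball m Q ] (∑[ t ∈ T ] (∑[ z ∈ Res m ] 𝟙 (y ⊕ t ≋? z) * D z))
        ≡⟨ trans (∑-cong (Ball m Q) (λ y → ∑-swap T (Res m) _)) (∑-swap (Ball m Q) (Res m) _) ⟩
      ∑[ z ∈ Res m ] (∑[ y ∈ Ball m Q ] (∑[ t ∈ T ] 𝟙 (y ⊕ t ≋? z) * D z))
        ≤⟨ ∑-mono′ (Res m) (λ z → ≤-trans (≤-reflexive (trans (∑-cong (Ball m Q) (λ y → ∑-*ʳ T (D z) _)) (∑-*ʳ (Ball m Q) (D z) _))) (*-monoˡ-≤ (D z) (multiplicity z))) ⟩
      ∑[ z ∈ Res m ] (V⊥.points (2 * Q) * D z)
        ≡⟨ ∑-*ˡ (Res m) (V⊥.points (2 * Q)) D ⟩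
      V⊥.points (2 * Q) * ∑ (Res m) D
        ≤⟨ *-monoʳ-≤ (V⊥.points (2 * Q)) second-moment ⟩
      V⊥.points (2 * Q) * (length W * (p ^ m * p))
        ≡⟨ solve 3 (λ a b c → a :* (b :* c) := b :* (a :* c)) refl (V⊥.points (2 * Q)) (length W) (p ^ m * p) ⟩
      length W * (V⊥.points (2 * Q) * (p ^ m * p)) ∎)
      where
      open ≤-Reasoning
      open ℕ.+-*-Solver
      D : Vec ℤ m → ℕ
      D z = ∑[ c ∈ residues ] discrepancy z c

-- Products of fields

module Fields (p : ℕ) (prime : Prime p) where

  open Balls
  open Residues p prime
  open import Algebra.Bundles using (CommutativeRing)
  import Algebra.Properties.Ring as RingProperties
  import Algebra.Properties.CommutativeSemigroup as CommutativeSemigroupProperties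
  open import Data.Empty using (⊥-elim)
  open import Data.Fin.Base using (Fin; zero; suc; punchIn)
  import Data.Fin.Properties as Fin
  open import Data.Integer.Base as ℤ using (ℤ; +_)
  import Data.Integer.Solver as ℤ
  open import Data.Nat.Base using (zero; suc; _≤_; _+_)
  open import Data.Product using (∃; _×_; _,_; proj₁; proj₂)
  open import Data.Vec.Base as Vec using (Vec; _∷_; lookup; take; drop)
  import Data.Vec.Properties as Vec
  open import Function.Base using (_∘_)
  open import Level using (Level; _⊔_) renaming (suc to lsuc)
  open import Relation.Binary.PropositionalEquality as ≡ using (_≡_)
  open import Relation.Nullary
  open import Relation.Nullary.Decidable using (_×-dec_; ¬?)

  private variable
    a c ℓ : Level
    m n s : ℕ

  -- What the argument uses of a finite field. The functional `τ` to 𝔽ₚ only has to make (x , y) ↦ τ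
  -- (x y) nondegenerate, so any nonzero linear functional can stand in for the trace.
  record Fld c ℓ : Set (lsuc (c ⊔ ℓ)) where
    field commutativeRing : CommutativeRing c ℓ

    open CommutativeRing commutativeRing public
      hiding (_-_) renaming (_+_ to _+ᶠ_; _*_ to _*ᶠ_; -_ to -ᶠ_)

    infix 4 _≟_
    field
      _≟_           : ∀ x y → Dec (x ≈ y)
      domain        : ∀ {x y} → x *ᶠ y ≈ 0# → ¬ x ≈ 0# → y ≈ 0#
      τ             : Carrier → ℤ
      τ-cong        : ∀ {x y} → x ≈ y → τ x ∼ τ y
      τ-+           : ∀ x y → τ (x +ᶠ y) ∼ τ x ℤ.+ τ y
      nondegenerate : ∀ y → ¬ y ≈ 0# → ∃ λ x → ¬ τ (x *ᶠ y) ∼ + 0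

    open RingProperties ring public using (-‿distribʳ-*; -‿distribˡ-*; +-cancelʳ; x≈y⇒x∙y⁻¹≈ε; x∙y⁻¹≈ε⇒x≈y; -‿+-comm)
    open CommutativeSemigroupProperties *-commutativeSemigroup public using (x∙yz≈y∙xz; x∙yz≈xz∙y)

    *-cancel : ∀ {y a b} → ¬ y ≈ 0# → y *ᶠ a ≈ y *ᶠ b → a ≈ b
    *-cancel {y} {a} {b} y≉0 eq = x∙y⁻¹≈ε⇒x≈y a b (domain
      (trans (distribˡ y a (-ᶠ b)) (trans (+-congˡ (sym (-‿distribʳ-* y b))) (x≈y⇒x∙y⁻¹≈ε eq))) y≉0)

  -- Insertion for dependent families, as the components of an element of the product lie in
  -- different fields.
  ins : ∀ {C : Fin (suc s) → Set a} i → C i → (∀ j → C (punchIn i j)) → ∀ j → C j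
  ins zero x f zero = x
  ins zero x f (suc j) = f j
  ins {suc s} (suc i) x f zero = f zero
  ins {suc s} {C = C} (suc i) x f (suc j) = ins {C = C ∘ suc} i x (f ∘ suc) j

  ins-≡ : ∀ {C : Fin (suc s) → Set a} i x (f : ∀ j → C (punchIn i j)) → ins {C = C} i x f i ≡ x
  ins-≡ zero x f = ≡.refl
  ins-≡ {suc s} {C = C} (suc i) x f = ins-≡ {C = C ∘ suc} i x (f ∘ suc)

  ins-punchIn : ∀ {C : Fin (suc s) → Set a} i x (f : ∀ j → C (punchIn i j)) j → ins {C = C} i x f (punchIn i j) ≡ f j
  ins-punchIn zero x f j = ≡.refl
  ins-punchIn {suc s} (suc i) x f zero = ≡.refl
  ins-punchIn {suc s} {C = C} (suc i) x f (suc j) = ins-punchIn {C = C ∘ suc} i x (f ∘ suc) j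

  take-𝟎 : ∀ n {m} → take n (𝟎 {n + m}) ≡ 𝟎
  take-𝟎 zero    = ≡.refl
  take-𝟎 (suc n) = ≡.cong (_ ∷_) (take-𝟎 n)

  drop-𝟎 : ∀ n {m} → drop n (𝟎 {n + m}) ≡ 𝟎
  drop-𝟎 zero    = ≡.refl
  drop-𝟎 (suc n) = drop-𝟎 n

  module Algebra {s} (F : Fin s → Fld c ℓ) where

    open module F (i : Fin s) = Fld (F i) using (Carrier)

    A A² : Set c
    A = ∀ i → Carrier i
    A² = A × A

    infix 4 _≈ᴬ_ _∥_ _∥?_
    infixl 6 _+ᴬ_ _-ᴬ_

    _≈ᴬ_ : A → A → Set ℓ
    X ≈ᴬ Y = ∀ i → F._≈_ i (X i) (Y i)

    _+ᴬ_ : A → A → A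
    (X +ᴬ Y) i = F._+ᶠ_ i (X i) (Y i)

    _-ᴬ_ : A → A → A
    (X -ᴬ Y) i = F._+ᶠ_ i (X i) (F.-ᶠ_ i (Y i))

    0ᴬ : A
    0ᴬ i = F.0# i

    -- A vanishing 2 × 2 determinant in every component; a pair that vanishes in a component
    -- satisfies the condition there for trivial reasons.
    _∥_ : A² → A² → Set ℓ
    (X , X′) ∥ (Y , Y′) = ∀ i → F._≈_ i (F._*ᶠ_ i (X i) (Y′ i)) (F._*ᶠ_ i (X′ i) (Y i))

    abstract
      _∥?_ : ∀ X Y → Dec (X ∥ Y)
      (X , X′) ∥? (Y , Y′) = Fin.all? (λ i → F._≟_ i (F._*ᶠ_ i (X i) (Y′ i)) (F._*ᶠ_ i (X′ i) (Y i)))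

    ∥-sym : ∀ {X Y} → X ∥ Y → Y ∥ X
    ∥-sym {X , X′} {Y , Y′} e i = let open F i in
      trans (*-comm (Y i) (X′ i)) (trans (sym (e i)) (*-comm (X i) (Y′ i)))

    ∥-refl : ∀ {X} → X ∥ X
    ∥-refl {X , X′} i = F.*-comm i (X i) (X′ i)

    ∥-resp : ∀ {X X′ Y Y′ Z} → X ≈ᴬ Y → X′ ≈ᴬ Y′ → (X , X′) ∥ Z → (Y , Y′) ∥ Z
    ∥-resp e e′ q i = let open F i in trans (*-congʳ (sym (e i))) (trans (q i) (*-congʳ (e′ i)))

    ∥-⊖ : ∀ {X X′ Z Z′ Y} → (X , X′) ∥ Y → (Z , Z′) ∥ Y → (X -ᴬ Z , X′ -ᴬ Z′) ∥ Y
    ∥-⊖ {X} {X′} {Z} {Z′} {Y , Y′} e f i = trans (expand (X i) (Z i) (Y′ i))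
      (trans (+-cong (e i) (-‿cong (f i))) (sym (expand (X′ i) (Z′ i) (Y i))))
      where
      open F i
      expand : ∀ x z y → (x +ᶠ -ᶠ z) *ᶠ y ≈ x *ᶠ y +ᶠ -ᶠ (z *ᶠ y)
      expand x z y = trans (distribʳ y x (-ᶠ z)) (+-congˡ (sym (-‿distribˡ-* z y)))

    +-cancel-⊖ : ∀ X Z O → (X +ᴬ O) -ᴬ (Z +ᴬ O) ≈ᴬ X -ᴬ Z
    +-cancel-⊖ X Z O i = trans (+-congˡ (sym (-‿+-comm (Z i) (O i)))) (trans (+-assoc (X i) (O i) _)
      (+-congˡ (trans (+-congˡ (+-comm (-ᶠ Z i) (-ᶠ O i))) (trans (sym (+-assoc (O i) (-ᶠ O i) (-ᶠ Z i)))
        (trans (+-congʳ (-‿inverseʳ (O i))) (+-identityˡ (-ᶠ Z i)))))))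
      where open F i

    Zero : Fin s → A² → Set ℓ
    Zero i (X , X′) = F._≈_ i (X i) (F.0# i) × F._≈_ i (X′ i) (F.0# i)

    abstract
      zero? : ∀ i X → Dec (Zero i X)
      zero? i (X , X′) = F._≟_ i (X i) (F.0# i) ×-dec F._≟_ i (X′ i) (F.0# i)

    Generic : A² → Set ℓ
    Generic X = ∀ i → ¬ Zero i X

    abstract
      generic? : ∀ X → Dec (Generic X)
      generic? X = Fin.all? (λ i → ¬? (zero? i X))

    -- In each component, genericity of the middle pair supplies a nonzero entry to cancel by.
    ∥-trans : ∀ {X Y Z} → Generic Y → X ∥ Y → Y ∥ Z → X ∥ Z
    ∥-trans {X , X′} {Y , Y′} {Z , Z′} gen e f i = cases (Y i ≟ 0#) (Y′ i ≟ 0#)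
      where
      open F i
      cases : Dec (Y i ≈ 0#) → Dec (Y′ i ≈ 0#) → X i *ᶠ Z′ i ≈ X′ i *ᶠ Z i
      cases (yes y) (yes y′) = ⊥-elim (gen i (y , y′))
      cases _ (no y′) = *-cancel y′ (trans (x∙yz≈y∙xz (Y′ i) (X i) (Z′ i)) (trans (sym (*-assoc (X i) (Y′ i) (Z′ i)))
        (trans (*-congʳ (e i)) (trans (*-assoc (X′ i) (Y i) (Z′ i)) (trans (*-congˡ (f i)) (x∙yz≈y∙xz (X′ i) (Y′ i) (Z i)))))))
      cases (no y) _ = *-cancel y (trans (x∙yz≈y∙xz (Y i) (X i) (Z′ i)) (trans (*-congˡ (f i))
        (trans (sym (*-assoc (X i) (Y′ i) (Z i))) (trans (*-congʳ (e i)) (trans (*-assoc (X′ i) (Y i) (Z i)) (x∙yz≈y∙xz (X′ i) (Y i) (Z i)))))))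

    -- A linear map from 𝔽ₚⁿ to the product, presented on integer vectors so that sizes of arguments
    -- make sense.
    record Hom (n : ℕ) : Set (c ⊔ ℓ) where
      field
        φ      : Vec ℤ n → A
        φ-⊕    : ∀ x y → φ (x ⊕ y) ≈ᴬ φ x +ᴬ φ y
        φ-null : ∀ {x} → x ≋ 𝟎 → φ x ≈ᴬ 0ᴬ

      φ-⊖ : ∀ x y i → let open F i in φ (x ⊖ y) i ≈ φ x i +ᶠ -ᶠ φ y i
      φ-⊖ x y i = +-cancelʳ (φ y i) _ _ (trans (sym (φ-⊕ (x ⊖ y) y i)) (trans (reflexive (≡.cong (λ z → φ z i) back))
        (sym (trans (+-assoc (φ x i) (-ᶠ φ y i) (φ y i)) (trans (+-congˡ (-‿inverseˡ (φ y i))) (+-identityʳ (φ x i)))))))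
        where
        open F i
        open ℤ.+-*-Solver
        back : (x ⊖ y) ⊕ y ≡ x
        back = vec-ext (λ k → ≡.trans (lookup-⊕ k (x ⊖ y) y) (≡.trans (≡.cong (ℤ._+ lookup y k) (lookup-⊖ k x y))
          (solve 2 (λ x y → x :- y :+ y := x) ≡.refl (lookup x k) (lookup y k))))

      φ-cong : ∀ {x y} → x ≋ y → φ x ≈ᴬ φ y
      φ-cong {x} {y} e i = let open F i in x∙y⁻¹≈ε⇒x≈y _ _ (trans (sym (φ-⊖ x y i)) (φ-null (⊖-≋𝟎 e) i))

      Injective Surjective : Set _
      Injective  = ∀ {x} → φ x ≈ᴬ 0ᴬ → x ≋ 𝟎
      Surjective = ∀ X → ∃ λ x → φ x ≈ᴬ X

      kernel : ∀ i → Lattice n ℓ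
      kernel i = record
        { Member   = λ x → φ x i ≈ 0#
        ; member?  = λ x → φ x i ≟ 0#
        ; 𝟎-closed = φ-null ≋-refl i
        ; ⊖-closed = λ {x} {y} ex ey → trans (φ-⊖ x y i) (trans (+-cong ex (-‿cong ey)) (-‿inverseʳ 0#))
        }
        where open F i

      φ² : Vec ℤ (n + n) → A²
      φ² w = φ (take n w) , φ (drop n w)

      φ²-⊖ : ∀ {w v Y} → φ² w ∥ Y → φ² v ∥ Y → φ² (w ⊖ v) ∥ Y
      φ²-⊖ {w} {v} ew ev = ∥-resp
        (λ i → F.trans i (F.sym i (φ-⊖ (take n w) (take n v) i)) (F.reflexive i (≡.cong (λ z → φ z i) (≡.sym (Vec.take-zipWith {m = n} ℤ._-_ w v)))))
        (λ i → F.trans i (F.sym i (φ-⊖ (drop n w) (drop n v) i)) (F.reflexive i (≡.cong (λ z → φ z i) (≡.sym (Vec.drop-zipWith {m = n} ℤ._-_ w v)))))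
        (∥-⊖ ew ev)

      line : A² → Lattice (n + n) ℓ
      line Y = record
        { Member   = λ w → φ² w ∥ Y
        ; member?  = λ w → φ² w ∥? Y
        ; 𝟎-closed = λ i → let open F i in
            trans (*-congʳ (trans (reflexive (≡.cong (λ z → φ z i) (take-𝟎 n))) (φ-null ≋-refl i))) (trans (zeroˡ _)
            (sym (trans (*-congʳ (trans (reflexive (≡.cong (λ z → φ z i) (drop-𝟎 n))) (φ-null ≋-refl i))) (zeroˡ _))))
        ; ⊖-closed = λ {w} {v} → φ²-⊖ {w} {v}
        }

    record Coord (n : ℕ) : Set (c ⊔ ℓ) where
      field
        hom        : Hom n
        injective  : Hom.Injective hom
        surjective : Hom.Surjective hom
      open Hom hom public

      injective′ : ∀ {x y} → φ x ≈ᴬ φ y → x ≋ y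
      injective′ {x} {y} e = ⊖-≋𝟎⁻ (injective (λ i → let open F i in trans (φ-⊖ x y i) (x≈y⇒x∙y⁻¹≈ε (e i))))

    coordinates-unique : Coord m → Coord n → m ≤ n
    coordinates-unique φ ψ = injective⇒≤ {f = λ x → proj₁ (ψ.surjective (φ.φ x))} λ {x} {y} e →
      φ.injective′ (λ i → let open F i in trans (sym (proj₂ (ψ.surjective (φ.φ x)) i)) (trans (ψ.φ-cong e i) (proj₂ (ψ.surjective (φ.φ y)) i)))
      where
      module φ = Coord φ
      module ψ = Coord ψ

-- Eliminating coordinates

module Slicing (p : ℕ) (prime : Prime p) where

  open Counting
  open Balls
  open Residues p prime
  open Fields p prime
  open import Defs using (interval; box)
  open import Data.Empty using (⊥-elim)
  open import Data.Fin.Base using (Fin; zero; suc; punchIn)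
  import Data.Fin.Properties as Fin
  open import Data.Integer.Base as ℤ using (ℤ; +_; ∣_∣)
  import Data.Integer.Properties as ℤ
  import Data.Integer.Solver as ℤ
  open import Data.Integer.DivMod using (_%ℕ_)
  open import Data.List.Base using (length)
  open import Data.List.Properties using (length-applyUpTo)
  open import Data.List.Membership.Propositional using (_∈_; lose; find)
  open import Data.List.Relation.Unary.Any using (any?)
  open import Data.Nat using (zero; suc; _+_; _*_; _^_; _∸_; _≤_; _<_)
  open import Data.Nat.Properties
  open import Data.Product using (∃; _×_; _,_; proj₁; proj₂; Σ-syntax)
  open import Data.Vec.Base as Vec using (Vec; []; _∷_; lookup; replicate; tabulate; insertAt; take; drop)
  import Data.Vec.Properties as Vec
  open import Function.Base using (_∘_; id)
  open import Level using (Level) renaming (suc to lsuc)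
  open import Relation.Binary.PropositionalEquality
  open import Relation.Nullary
  open import Relation.Nullary.Decidable using (_×-dec_; ¬?; decidable-stable)

  private variable
    a c ℓ : Level
    m n s : ℕ

  insertAt-⊕ : ∀ (k : Fin (suc n)) x y a b → insertAt x k a ⊕ insertAt y k b ≡ insertAt (x ⊕ y) k (a ℤ.+ b)
  insertAt-⊕ zero    x       y       a b = refl
  insertAt-⊕ (suc k) (_ ∷ x) (_ ∷ y) a b = cong (_ ∷_) (insertAt-⊕ k x y a b)

  ∑-box-insertAt : ∀ n (k : Fin (suc n)) a h f → ∑ (box (replicate (suc n) a) (replicate (suc n) h)) f ≡
                   ∑[ t ∈ interval a h ] (∑[ x ∈ box (replicate n a) (replicate n h) ] f (insertAt x k t))
  ∑-box-insertAt n       zero    a h f = ∑-box-∷ a (replicate n a) h (replicate n h) f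
  ∑-box-insertAt (suc n) (suc k) a h f = begin
    ∑ (box (replicate (suc (suc n)) a) (replicate (suc (suc n)) h)) f
      ≡⟨ ∑-box-∷ a (replicate (suc n) a) h (replicate (suc n) h) f ⟩
    ∑[ u ∈ interval a h ] (∑[ x ∈ box (replicate (suc n) a) (replicate (suc n) h) ] f (u ∷ x))
      ≡⟨ ∑-cong (interval a h) (λ u → ∑-box-insertAt n k a h (f ∘ (u ∷_))) ⟩
    ∑[ u ∈ interval a h ] (∑[ t ∈ interval a h ] (∑[ x ∈ box (replicate n a) (replicate n h) ] f (u ∷ insertAt x k t)))
      ≡⟨ ∑-swap (interval a h) (interval a h) _ ⟩
    ∑[ t ∈ interval a h ] (∑[ u ∈ interval a h ] (∑[ x ∈ box (replicate n a) (replicate n h) ] f (u ∷ insertAt x k t)))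
      ≡⟨ ∑-cong (interval a h) (λ t → sym (∑-box-∷ a (replicate n a) h (replicate n h) (λ x → f (insertAt x (suc k) t)))) ⟩
    ∑[ t ∈ interval a h ] (∑[ x ∈ box (replicate (suc n) a) (replicate (suc n) h) ] f (insertAt x (suc k) t)) ∎
    where open ≡-Reasoning

  unit : Fin m → ℤ → Vec ℤ m
  unit zero    t = t ∷ 𝟎
  unit (suc k) t = + 0 ∷ unit k t

  generate : ∀ (P : Vec ℤ m → Set a) → P 𝟎 → (∀ {x y} → P x → P y → P (x ⊕ y)) → (∀ k t → P (unit k t)) → ∀ y → P y
  generate {m = zero}  P p₀ p⊕ pu []      = p₀
  generate {m = suc m} P p₀ p⊕ pu (t ∷ y) = subst P (cong₂ _∷_ (ℤ.+-identityʳ t) (vec-ext (λ k → trans (lookup-⊕ k 𝟎 y)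
    (trans (cong (ℤ._+ lookup y k) (lookup-𝟎 k)) (ℤ.+-identityˡ (lookup y k))))))
    (p⊕ (pu zero t) (generate (λ y → P (+ 0 ∷ y)) p₀ p⊕ (pu ∘ suc) y))

  sel : (Fin m → Fin n) → Vec ℤ n → Vec ℤ m
  sel σ x = tabulate (lookup x ∘ σ)

  lookup-sel : ∀ (σ : Fin m → Fin n) x k → lookup (sel σ x) k ≡ lookup x (σ k)
  lookup-sel σ x = Vec.lookup∘tabulate (lookup x ∘ σ)

  Small-sel : ∀ {M} (σ : Fin m → Fin n) {x} → Small M x → Small M (sel σ x)
  Small-sel σ {x} sx = small λ k → subst (λ z → ∣ z ∣ < _) (sym (lookup-sel σ x k)) (entry sx (σ k))

  Small-++ : ∀ {M} {x : Vec ℤ m} {y : Vec ℤ n} → Small M x → Small M y → Small M (x Vec.++ y)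
  Small-++ {x = []}    sx sy = sy
  Small-++ {x = a ∷ x} sx sy = small λ { zero → entry sx zero ; (suc k) → entry (Small-++ {x = x} (small (entry sx ∘ suc)) sy) k }

  Small-take : ∀ {M} m {v : Vec ℤ (m + n)} → Small M v → Small M (take m v)
  Small-take zero            sv = small λ ()
  Small-take (suc m) {a ∷ v} sv = small λ { zero → entry sv zero ; (suc k) → entry (Small-take m {v} (small (entry sv ∘ suc))) k }

  Small-drop : ∀ {M} m {v : Vec ℤ (m + n)} → Small M v → Small M (drop m v)
  Small-drop zero            sv = sv
  Small-drop (suc m) {a ∷ v} sv = Small-drop m {v} (small (entry sv ∘ suc))

  take-++ : ∀ (x : Vec ℤ m) (y : Vec ℤ n) → take m (x Vec.++ y) ≡ x
  take-++ []      y = refl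
  take-++ (a ∷ x) y = cong (a ∷_) (take-++ x y)

  drop-++ : ∀ (x : Vec ℤ m) (y : Vec ℤ n) → drop m (x Vec.++ y) ≡ y
  drop-++ []      y = refl
  drop-++ (a ∷ x) y = drop-++ x y

  ∑-box-++ : ∀ m n a h f → ∑ (box (replicate (m + n) a) (replicate (m + n) h)) f ≡
             ∑[ x ∈ box (replicate m a) (replicate m h) ] (∑[ y ∈ box (replicate n a) (replicate n h) ] f (x Vec.++ y))
  ∑-box-++ zero    n a h f = sym (+-identityʳ _)
  ∑-box-++ (suc m) n a h f = begin
    ∑ (box (replicate (suc m + n) a) (replicate (suc m + n) h)) f
      ≡⟨ ∑-box-∷ a (replicate (m + n) a) h (replicate (m + n) h) f ⟩
    ∑[ t ∈ interval a h ] (∑[ x ∈ box (replicate (m + n) a) (replicate (m + n) h) ] f (t ∷ x))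
      ≡⟨ ∑-cong (interval a h) (λ t → ∑-box-++ m n a h (f ∘ (t ∷_))) ⟩
    ∑[ t ∈ interval a h ] (∑[ x ∈ box (replicate m a) (replicate m h) ] (∑[ y ∈ box (replicate n a) (replicate n h) ] f (t ∷ x Vec.++ y)))
      ≡⟨ ∑-box-∷ a (replicate m a) h (replicate m h) _ ⟨
    ∑[ x ∈ box (replicate (suc m) a) (replicate (suc m) h) ] (∑[ y ∈ box (replicate n a) (replicate n h) ] f (x Vec.++ y)) ∎
    where open ≡-Reasoning

  ∑-Ball-++ : ∀ m n M f → ∑ (Ball (m + n) M) f ≡ ∑[ x ∈ Ball m M ] (∑[ y ∈ Ball n M ] f (x Vec.++ y))
  ∑-Ball-++ m n M f = ∑-box-++ m n _ _ f

  module _ {s} {F : Fin s → Fld c ℓ} where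
    open Algebra F

    private
      reduce : ∀ {n} (φ : Hom n) {x} → Hom.φ φ x ≈ᴬ 0ᴬ → Hom.φ φ (red x) ≈ᴬ 0ᴬ
      reduce φ {x} e i = F.trans i (Hom.φ-cong φ (red≋ x) i) (e i)

    -- As long as φ has a kernel vector x with x k ≢ 0, the k-th coordinate is redundant and is summed over trivially.
    slice : ∀ (φ : Hom n) → Hom.Surjective φ → ∃ λ m → m ≤ n × Σ[ ψ ∈ Coord m ]
      (∀ M (f : A → ℕ) → (∀ {X Y} → X ≈ᴬ Y → f X ≡ f Y) → ∀ B →
       (∀ O → ∑[ x ∈ Ball m M ] f (Coord.φ ψ x +ᴬ O) ≤ B) → ∀ O → ∑[ x ∈ Ball n M ] f (Hom.φ φ x +ᴬ O) ≤ (2 * M) ^ (n ∸ m) * B)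
    slice {n} φ surj with any? (λ x → Fin.all? (λ i → F._≟_ i (Hom.φ φ x i) (F.0# i)) ×-dec ¬? (x ≋? 𝟎)) (Res n)
    ... | no none = n , ≤-refl , record { hom = φ ; surjective = surj ; injective = λ {x} e → decidable-stable (x ≋? 𝟎)
            (λ x≇𝟎 → none (lose (red∈ x) (reduce φ e , λ r → x≇𝟎 (≋-trans (≋-sym (red≋ x)) r)))) } ,
          λ M f resp B le O → ≤-trans (le O) (≤-reflexive (sym (trans (cong (λ d → (2 * M) ^ d * B) (n∸n≡0 n)) (+-identityʳ B))))
    slice {zero}  φ surj | yes some = let x , _ , _ , x≇ = find some in ⊥-elim (x≇ (congruent λ ()))
    slice {suc n} φ surj | yes some = m′ , m≤n⇒m≤1+n m′≤n , ψ , bound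
      where
      open Hom φ using () renaming (φ to φ₀)
      x = proj₁ (find some)
      x-null : φ₀ x ≈ᴬ 0ᴬ
      x-null = proj₁ (proj₂ (proj₂ (find some)))
      nonzero : ∃ λ k → ¬ lookup x k ∼ lookup (𝟎 {suc n}) k
      nonzero = Fin.¬∀⟶∃¬ _ _ (λ k → lookup x k ∼? lookup (𝟎 {suc n}) k) (λ e → proj₂ (proj₂ (proj₂ (find some))) (congruent e))
      k = proj₁ nonzero
      x≁0 : ¬ lookup x k ∼ + 0
      x≁0 e = proj₂ nonzero (∼-trans e (∼-reflexive (sym (lookup-𝟎 k))))
      split : ∀ y t → insertAt y k t ≡ insertAt y k (+ 0) ⊕ insertAt 𝟎 k t
      split y t = sym (trans (insertAt-⊕ k y 𝟎 (+ 0) t) (cong₂ (λ z u → insertAt z k u)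
        (vec-ext (λ j → trans (lookup-⊕ j y 𝟎) (trans (cong (λ z → lookup y j ℤ.+ z) (lookup-𝟎 j)) (ℤ.+-identityʳ (lookup y j))))) (ℤ.+-identityˡ t)))
      φ₁ : Hom n
      φ₁ = record
        { φ      = λ y → φ₀ (insertAt y k (+ 0))
        ; φ-⊕    = λ y z i → F.trans i (F.reflexive i (cong (λ w → φ₀ w i) (sym (insertAt-⊕ k y z (+ 0) (+ 0))))) (Hom.φ-⊕ φ _ _ i)
        ; φ-null = λ {y} e → Hom.φ-null φ (congruent (ins k
            (∼-reflexive (trans (Vec.insertAt-lookup y k (+ 0)) (sym (lookup-𝟎 k))))
            (λ j → ∼-trans (∼-reflexive (Vec.insertAt-punchIn y k (+ 0) j)) (∼-trans (at e j) (∼-reflexive (trans (lookup-𝟎 j) (sym (lookup-𝟎 (punchIn k j)))))))))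
        }
      surj₁ : Hom.Surjective φ₁
      surj₁ X = y , λ i → let open F i using () renaming (trans to transᶠ; sym to symᶠ) in
        transᶠ (Hom.φ-cong φ same i) (transᶠ (Hom.φ-⊖ φ y₀ (+ q ⊙ x) i) (transᶠ (F.+-congˡ i (F.-‿cong i (Lattice.⊙-closed (Hom.kernel φ i) q (x-null i))))
          (transᶠ (F.+-congˡ i (transᶠ (symᶠ (F.+-identityˡ i _)) (F.-‿inverseʳ i (F.0# i)))) (transᶠ (F.+-identityʳ i _) (proj₂ (surj X) i)))))
        where
        y₀ = proj₁ (surj X)
        x⁻¹ = proj₁ (inverse x≁0)
        -- Subtracting q x, a kernel vector, clears coordinate k of y₀ without changing the image.
        -- The coefficient is reduced to a natural number because lattices are closed under natural
        -- multiples.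
        q = (lookup y₀ k ℤ.* x⁻¹) %ℕ p
        z = y₀ ⊖ + q ⊙ x
        z-k : lookup z k ∼ + 0
        z-k = ∼-trans (∼-reflexive (trans (lookup-⊖ k y₀ (+ q ⊙ x)) (cong (λ w → lookup y₀ k ℤ.- w) (lookup-⊙ k (+ q) x))))
          (∼-trans (─-∼ (∼-refl {lookup y₀ k}) (∼-trans (*-∼ (res∼ (lookup y₀ k ℤ.* x⁻¹)) (∼-refl {lookup x k}))
            (∼-trans (∼-reflexive (ℤ.*-assoc (lookup y₀ k) x⁻¹ (lookup x k))) (∼-trans (*-∼ (∼-refl {lookup y₀ k}) (proj₂ (inverse x≁0))) (∼-reflexive (ℤ.*-identityʳ (lookup y₀ k)))))))
            (∼-reflexive (ℤ.+-inverseʳ (lookup y₀ k))))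
        y = sel (punchIn k) z
        same : insertAt y k (+ 0) ≋ z
        same = congruent (ins k (∼-trans (∼-reflexive (Vec.insertAt-lookup y k (+ 0))) (∼-sym z-k))
          (λ j → ∼-reflexive (trans (Vec.insertAt-punchIn y k (+ 0) j) (lookup-sel (punchIn k) z j))))
      rec = slice φ₁ surj₁
      m′ = proj₁ rec
      m′≤n = proj₁ (proj₂ rec)
      ψ = proj₁ (proj₂ (proj₂ rec))
      bound : ∀ M (f : A → ℕ) → (∀ {X Y} → X ≈ᴬ Y → f X ≡ f Y) → ∀ B → (∀ O → ∑[ x ∈ Ball m′ M ] f (Coord.φ ψ x +ᴬ O) ≤ B) →
              ∀ O → ∑[ x ∈ Ball (suc n) M ] f (φ₀ x +ᴬ O) ≤ (2 * M) ^ (suc n ∸ m′) * B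
      bound M f resp B le O = begin
        ∑[ x ∈ Ball (suc n) M ] f (φ₀ x +ᴬ O)
          ≡⟨ ∑-box-insertAt n k (ℤ.- (+ M)) (2 * M ∸ 1) _ ⟩
        ∑[ t ∈ I ] (∑[ y ∈ Ball n M ] f (φ₀ (insertAt y k t) +ᴬ O))
          -- The eliminated coordinate contributes a constant to the argument of f. It joins the
          -- offset O, which is why the hypothesis is uniform in O.
          ≡⟨ ∑-cong I (λ t → ∑-cong (Ball n M) (λ y → resp (λ i → F.trans i (F.+-congʳ i (F.trans i
               (F.reflexive i (cong (λ z → φ₀ z i) (split y t))) (Hom.φ-⊕ φ (insertAt y k (+ 0)) (insertAt 𝟎 k t) i))) (F.+-assoc i _ _ _)))) ⟩
        ∑[ t ∈ I ] (∑[ y ∈ Ball n M ] f (Hom.φ φ₁ y +ᴬ (φ₀ (insertAt 𝟎 k t) +ᴬ O)))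
          ≤⟨ ∑-≤const I _ (λ {t} _ → proj₂ (proj₂ (proj₂ rec)) M f resp B le (φ₀ (insertAt 𝟎 k t) +ᴬ O)) ⟩
        length I * ((2 * M) ^ (n ∸ m′) * B)
          ≤⟨ *-monoˡ-≤ _ (≤-trans (≤-reflexive (length-applyUpTo _ (2 * M ∸ 1))) (m∸n≤m (2 * M) 1)) ⟩
        2 * M * ((2 * M) ^ (n ∸ m′) * B)
          ≡⟨ trans (sym (*-assoc (2 * M) _ B)) (cong (λ d → (2 * M) ^ d * B) (sym (+-∸-assoc 1 m′≤n))) ⟩
        (2 * M) ^ (suc n ∸ m′) * B ∎
        where
        open ≤-Reasoning
        I = interval (ℤ.- (+ M)) (2 * M ∸ 1)

  lookup-unit : ∀ (k : Fin m) t j → lookup (unit k t) j ≡ t ℤ.* lookup (unit k (+ 1)) j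
  lookup-unit zero    t zero    = sym (ℤ.*-identityʳ t)
  lookup-unit zero    t (suc j) = trans (lookup-𝟎 j) (sym (trans (cong (t ℤ.*_) (lookup-𝟎 j)) (ℤ.*-zeroʳ t)))
  lookup-unit (suc k) t zero    = sym (ℤ.*-zeroʳ t)
  lookup-unit (suc k) t (suc j) = lookup-unit k t j

  unit-same : ∀ (k : Fin m) t → lookup (unit k t) k ≡ t
  unit-same zero    t = refl
  unit-same (suc k) t = unit-same k t

  unit-punchIn : ∀ (k : Fin (suc m)) t j → lookup (unit k t) (punchIn k j) ≡ + 0
  unit-punchIn zero t j = lookup-𝟎 j
  unit-punchIn (suc k) t zero = refl
  unit-punchIn (suc k) t (suc j) = unit-punchIn k t j

  module _ {s} {F : Fin (suc s) → Fld c ℓ} (i : Fin (suc s)) {n} (φ : Algebra.Coord F n) where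
    open Algebra F
    private
      module A⁻ = Algebra (F ∘ punchIn i)
      open module φ = Coord φ using () renaming (φ to φ₀)
      module Λ = Lattice (φ.kernel i)

      sel-⊕ : ∀ {m} (σ : Fin m → Fin n) x y → sel σ (x ⊕ y) ≡ sel σ x ⊕ sel σ y
      sel-⊕ σ x y = vec-ext (λ k → trans (lookup-sel σ (x ⊕ y) k) (trans (lookup-⊕ (σ k) x y)
        (sym (trans (lookup-⊕ k (sel σ x) (sel σ y)) (cong₂ ℤ._+_ (lookup-sel σ x k) (lookup-sel σ y k))))))

      sel-⊖ : ∀ {m} (σ : Fin m → Fin n) x y → sel σ (x ⊖ y) ≡ sel σ x ⊖ sel σ y
      sel-⊖ σ x y = vec-ext (λ k → trans (lookup-sel σ (x ⊖ y) k) (trans (lookup-⊖ (σ k) x y)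
        (sym (trans (lookup-⊖ k (sel σ x) (sel σ y)) (cong₂ ℤ._-_ (lookup-sel σ x k) (lookup-sel σ y k))))))

      sel-≋ : ∀ {m} (σ : Fin m → Fin n) {x y} → x ≋ y → sel σ x ≋ sel σ y
      sel-≋ σ {x} {y} e = congruent λ k → ∼-trans (∼-reflexive (lookup-sel σ x k)) (∼-trans (at e (σ k)) (∼-reflexive (sym (lookup-sel σ y k))))

      sel-𝟎 : ∀ {m} (σ : Fin m → Fin n) → sel σ 𝟎 ≡ 𝟎
      sel-𝟎 σ = vec-ext (λ k → trans (lookup-sel σ 𝟎 k) (trans (lookup-𝟎 (σ k)) (sym (lookup-𝟎 k))))

      Λ-≋ : ∀ {x y} → x ≋ y → Λ.Member x → Λ.Member y
      Λ-≋ e mx = F.trans i (F.sym i (φ.φ-cong e i)) mx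

      Separating : ∀ {m} → (Fin m → Fin n) → Set _
      Separating σ = ∀ {x} → Λ.Member x → sel σ x ≋ 𝟎 → x ≋ 𝟎

      Hit : ∀ {m} (σ : Fin m → Fin n) → Vec ℤ m → Set _
      Hit σ y = ∃ λ x → Λ.Member x × sel σ x ≋ y

      hit-⊕ : ∀ {m} (σ : Fin m → Fin n) {y z} → Hit σ y → Hit σ z → Hit σ (y ⊕ z)
      hit-⊕ σ (x , mx , e) (x′ , mx′ , e′) = x ⊕ x′ , Λ.⊕-closed mx mx′ , ≋-trans (≋-reflexive (sel-⊕ σ x x′)) (⊕-≋ e e′)

      hit-unit : ∀ {m} (σ : Fin m → Fin n) k t → Hit σ (unit k (+ 1)) → Hit σ (unit k t)
      hit-unit σ k t (x , mx , e) = + q ⊙ x , Λ.⊙-closed q mx , congruent λ j →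
        ∼-trans (∼-reflexive (trans (lookup-sel σ (+ q ⊙ x) j) (trans (lookup-⊙ (σ j) (+ q) x) (cong (+ q ℤ.*_) (sym (lookup-sel σ x j))))))
        (∼-trans (*-∼ (res∼ t) (at e j)) (∼-reflexive (sym (lookup-unit k t j))))
        where q = t %ℕ p

      module _ {m} (σ : Fin m → Fin n) (separating : Separating σ) (hits : ∀ k → Hit σ (unit k (+ 1))) where

        lift : ∀ y → Hit σ y
        lift = generate (Hit σ) (𝟎 , Λ.𝟎-closed , ≋-reflexive (sel-𝟎 σ)) (hit-⊕ σ) (λ k t → hit-unit σ k t (hits k))

        lift≋ : ∀ {y x} → Λ.Member x → sel σ x ≋ y → proj₁ (lift y) ≋ x
        lift≋ {y} {x} mx e = let x′ , mx′ , e′ = lift y in ⊖-≋𝟎⁻ (separating (Λ.⊖-closed mx′ mx)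
          (≋-trans (≋-reflexive (sel-⊖ σ x′ x)) (⊖-≋𝟎 (≋-trans e′ (≋-sym e)))))

        ψ₀ : Vec ℤ m → A⁻.A
        ψ₀ y j = φ₀ (proj₁ (lift y)) (punchIn i j)

        ψ₀-sel : ∀ x → Λ.Member x → ∀ j → F._≈_ (punchIn i j) (ψ₀ (sel σ x) j) (φ₀ x (punchIn i j))
        ψ₀-sel x mx j = φ.φ-cong (lift≋ mx ≋-refl) (punchIn i j)

        restricted : A⁻.Coord m
        restricted = record
          { hom = record
            { φ      = ψ₀
            ; φ-⊕    = λ y z j → let x , mx , e = lift y ; x′ , mx′ , e′ = lift z in
                F.trans (punchIn i j) (φ.φ-cong (lift≋ (Λ.⊕-closed mx mx′) (≋-trans (≋-reflexive (sel-⊕ σ x x′)) (⊕-≋ e e′))) (punchIn i j))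
                                      (φ.φ-⊕ x x′ (punchIn i j))
            ; φ-null = λ {y} e j → φ.φ-null (separating (proj₁ (proj₂ (lift y))) (≋-trans (proj₂ (proj₂ (lift y))) e)) (punchIn i j)
            }
          ; injective  = λ {y} e → ≋-trans (≋-sym (proj₂ (proj₂ (lift y))))
              (≋-trans (sel-≋ σ (φ.injective (ins i (proj₁ (proj₂ (lift y))) e))) (≋-reflexive (sel-𝟎 σ)))
          ; surjective = λ X →
              let x , e = φ.surjective (ins i (F.0# i) X)
                  mx = F.trans i (e i) (F.reflexive i (ins-≡ i (F.0# i) X))
              in sel σ x , λ j → F.trans (punchIn i j) (ψ₀-sel x mx j)
                   (F.trans (punchIn i j) (e (punchIn i j)) (F.reflexive (punchIn i j) (ins-punchIn i (F.0# i) X j)))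
          }

      -- Elimination inside the kernel: a coordinate whose unit vector is missed is dropped, and the
      -- remaining ones still separate. At the end `sel σ` is a bijection from the kernel modulo p
      -- to 𝔽ₚᵐ. Selecting coordinates, unlike a general change of basis, never makes a vector
      -- larger.
      search : ∀ m (σ : Fin m → Fin n) → Separating σ → ∃ λ m → Σ[ σ ∈ (Fin m → Fin n) ] Separating σ × (∀ k → Hit σ (unit k (+ 1)))
      search m σ sep with Fin.all? (λ k → any? (λ x → Λ.member? x ×-dec (sel σ x ≋? unit k (+ 1))) (Res n))
      ... | yes hits = m , σ , sep , λ k → let x , _ , mx , e = find (hits k) in x , mx , e
      ... | no miss with Fin.¬∀⟶∃¬ _ _ (λ k → any? (λ x → Λ.member? x ×-dec (sel σ x ≋? unit k (+ 1))) (Res n)) miss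
      search (suc m) σ sep | no _ | k , none = search m (σ ∘ punchIn k) sep′
        where
        -- Otherwise a multiple of x would hit the k-th unit vector.
        sep′ : Separating (σ ∘ punchIn k)
        sep′ {x} mx e = sep mx (congruent (ins k x-k off))
          where
          off : ∀ j → lookup (sel σ x) (punchIn k j) ∼ lookup 𝟎 (punchIn k j)
          off j = ∼-trans (∼-reflexive (trans (lookup-sel σ x (punchIn k j)) (sym (lookup-sel (σ ∘ punchIn k) x j))))
            (∼-trans (at e j) (∼-reflexive (trans (lookup-𝟎 j) (sym (lookup-𝟎 (punchIn k j))))))
          x-k : lookup (sel σ x) k ∼ lookup 𝟎 k
          x-k = decidable-stable (lookup (sel σ x) k ∼? lookup 𝟎 k) λ x≁ →
            let x⁻¹ , inv = inverse (λ z → x≁ (∼-trans z (∼-reflexive (sym (lookup-𝟎 k)))))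
                q = x⁻¹ %ℕ p
            in none (lose (red∈ (+ q ⊙ x)) (Λ-≋ (≋-sym (red≋ (+ q ⊙ x))) (Λ.⊙-closed q mx) ,
                 ≋-trans (sel-≋ σ (red≋ (+ q ⊙ x))) (congruent (ins k
                   (∼-trans (∼-reflexive (scaled q k)) (∼-trans (*-∼ (res∼ x⁻¹) ∼-refl) (∼-trans inv (∼-reflexive (sym (unit-same k (+ 1)))))))
                   (λ j → ∼-trans (∼-reflexive (scaled q (punchIn k j))) (∼-trans (*-∼ (∼-refl {+ q}) (off j))
                     (∼-reflexive (trans (cong (+ q ℤ.*_) (lookup-𝟎 (punchIn k j))) (trans (ℤ.*-zeroʳ (+ q)) (sym (unit-punchIn k (+ 1) j)))))))))))
            where
            scaled : ∀ q j → lookup (sel σ (+ q ⊙ x)) j ≡ + q ℤ.* lookup (sel σ x) j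
            scaled q j = trans (lookup-sel σ (+ q ⊙ x) j) (trans (lookup-⊙ (σ j) (+ q) x) (cong (+ q ℤ.*_) (sym (lookup-sel σ x j))))

    -- The vectors killed in component `i`, read through selected coordinates, form a coordinate
    -- system for the product of the other fields and stay as small as they were.
    restrict : ∃ λ m → Σ[ ψ ∈ A⁻.Coord m ] Σ[ σ ∈ (Fin m → Fin n) ]
               (∀ x → F._≈_ i (φ₀ x i) (F.0# i) → ∀ j → F._≈_ (punchIn i j) (A⁻.Coord.φ ψ (sel σ x) j) (φ₀ x (punchIn i j)))
    restrict = let m , σ , sep , hits = search n id (λ {x} _ e → ≋-trans (≋-reflexive (vec-ext (λ k → sym (lookup-sel id x k)))) e)
               in m , restricted σ sep hits , σ , ψ₀-sel σ sep hits

    project : Hom n → A⁻.Hom n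
    project ψ = record { φ = λ x j → Hom.φ ψ x (punchIn i j) ; φ-⊕ = λ x y j → Hom.φ-⊕ ψ x y (punchIn i j) ; φ-null = λ e j → Hom.φ-null ψ e (punchIn i j) }

-- Energies of two coordinate systems, and pairs with a vanishing component

module Energies (p : ℕ) (prime : Prime p) where

  open Counting
  open Balls
  open Residues p prime
  open Fields p prime
  open Slicing p prime
  open import Data.Fin.Base using (Fin; punchIn)
  open import Data.Integer.Base as ℤ using (ℤ)
  open import Data.List.Membership.Propositional using (_∈_)
  open import Data.Nat using (suc; _+_; _*_; _^_; _∸_; _≤_)
  open import Data.Nat.Properties
  open import Data.Product using (∃; _×_; _,_; proj₁; proj₂; Σ-syntax)
  open import Data.Vec.Base as Vec using (Vec; take; drop)
  import Data.Vec.Properties as Vec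
  open import Function.Base using (_∘_)
  open import Level using (Level)
  open import Relation.Binary.PropositionalEquality
  open import Relation.Nullary
  open import Relation.Nullary.Decidable using (_×-dec_)

  private variable
    c ℓ : Level
    n s : ℕ

  take-drop-injective : ∀ n {m} {w v : Vec ℤ (n + m)} → take n w ≡ take n v → drop n w ≡ drop n v → w ≡ v
  take-drop-injective n {_} {w} {v} e e′ = trans (sym (Vec.take++drop≡id n w)) (trans (cong₂ Vec._++_ e e′) (Vec.take++drop≡id n v))

  module _ {s} {F : Fin s → Fld c ℓ} where
    open Algebra F

    energy : (φ ψ : Hom n) → ℕ → ℕ
    energy {n} φ ψ M = ∑[ w ∈ Ball (n + n) M ] (∑[ v ∈ Ball (n + n) M ] 𝟙 (Hom.φ² φ w ∥? Hom.φ² ψ v))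

    -- Elimination in both halves of the vector. The offsets left behind are removed by
    -- differencing, whence the doubled radius.
    slice² : ∀ (φ : Hom n) → Hom.Surjective φ → ∃ λ m → m ≤ n × Σ[ ψ ∈ Coord m ]
      (∀ M Y → Lattice.points (Hom.line φ Y) M ≤ ((2 * M) ^ (n ∸ m) * (2 * M) ^ (n ∸ m)) * Lattice.points (Coord.line ψ Y) (2 * M))
    slice² {n} φ surj with slice φ surj
    ... | m , m≤n , ψ , sliced = m , m≤n , ψ , bound
      where
      module φ = Hom φ
      module ψ = Coord ψ
      open ≤-Reasoning

      bound : ∀ M Y → Lattice.points (φ.line Y) M ≤ ((2 * M) ^ (n ∸ m) * (2 * M) ^ (n ∸ m)) * Lattice.points (ψ.line Y) (2 * M)
      bound M Y = begin
        ∑[ w ∈ Ball (n + n) M ] 𝟙 (φ.φ² w ∥? Y)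
          ≡⟨ ∑-Ball-++ n n M _ ⟩
        ∑[ x ∈ Ball n M ] (∑[ x′ ∈ Ball n M ] 𝟙 (φ.φ² (x Vec.++ x′) ∥? Y))
          ≡⟨ ∑-cong (Ball n M) (λ x → ∑-cong (Ball n M) (λ x′ → trans
               (cong₂ (λ a b → h (φ.φ a) (φ.φ b)) (take-++ x x′) (drop-++ x x′)) (h-resp (+0ᴬ _) (+0ᴬ _)))) ⟩
        ∑[ x ∈ Ball n M ] (∑[ x′ ∈ Ball n M ] h (φ.φ x +ᴬ 0ᴬ) (φ.φ x′ +ᴬ 0ᴬ))
          ≤⟨ sliced M (λ X → ∑[ x′ ∈ Ball n M ] h X (φ.φ x′ +ᴬ 0ᴬ))
               (λ e → ∑-cong (Ball n M) (λ _ → h-resp e (λ i → F.refl i))) _ inner 0ᴬ ⟩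
        (2 * M) ^ (n ∸ m) * ((2 * M) ^ (n ∸ m) * Lattice.points (ψ.line Y) (2 * M))
          ≡⟨ *-assoc ((2 * M) ^ (n ∸ m)) _ _ ⟨
        (2 * M) ^ (n ∸ m) * (2 * M) ^ (n ∸ m) * Lattice.points (ψ.line Y) (2 * M) ∎
        where
        h : A → A → ℕ
        h X X′ = 𝟙 ((X , X′) ∥? Y)
        h-resp : ∀ {X Z X′ Z′} → X ≈ᴬ Z → X′ ≈ᴬ Z′ → h X X′ ≡ h Z Z′
        h-resp {X} {Z} {X′} {Z′} e e′ = 𝟙-cong ((X , X′) ∥? Y) ((Z , Z′) ∥? Y) (∥-resp e e′) (∥-resp (λ i → F.sym i (e i)) (λ i → F.sym i (e′ i)))
        +0ᴬ : ∀ X → X ≈ᴬ X +ᴬ 0ᴬ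
        +0ᴬ X i = F.sym i (F.+-identityʳ i (X i))
        core : ∀ O O′ → ∑[ x′ ∈ Ball m M ] (∑[ x ∈ Ball m M ] h (ψ.φ x +ᴬ O) (ψ.φ x′ +ᴬ O′)) ≤ Lattice.points (ψ.line Y) (2 * M)
        core O O′ = begin
          ∑[ x′ ∈ Ball m M ] (∑[ x ∈ Ball m M ] h (ψ.φ x +ᴬ O) (ψ.φ x′ +ᴬ O′))
            ≡⟨ ∑-swap (Ball m M) (Ball m M) _ ⟩
          ∑[ x ∈ Ball m M ] (∑[ x′ ∈ Ball m M ] h (ψ.φ x +ᴬ O) (ψ.φ x′ +ᴬ O′))
            ≡⟨ ∑-cong (Ball m M) (λ x → ∑-cong (Ball m M) (λ x′ →
                 cong₂ (λ a b → h (ψ.φ a +ᴬ O) (ψ.φ b +ᴬ O′)) (sym (take-++ x x′)) (sym (drop-++ x x′)))) ⟩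
          ∑[ x ∈ Ball m M ] (∑[ x′ ∈ Ball m M ] h (ψ.φ (take m (x Vec.++ x′)) +ᴬ O) (ψ.φ (drop m (x Vec.++ x′)) +ᴬ O′))
            ≡⟨ ∑-Ball-++ m m M _ ⟨
          ∑[ w ∈ Ball (m + m) M ] h (ψ.φ (take m w) +ᴬ O) (ψ.φ (drop m w) +ᴬ O′)
            ≤⟨ #-diff (λ w → (ψ.φ (take m w) +ᴬ O , ψ.φ (drop m w) +ᴬ O′) ∥? Y) (λ w → ψ.φ² w ∥? Y) (Ball-unique (m + m) M)
                 (λ {w} {v} w∈ v∈ e e′ → ∈-Ball⁺ (Small-mono (≤-reflexive (cong (λ z → M + z) (sym (+-identityʳ M)))) (Small-⊖ {x = w} {v} (∈-Ball⁻ w∈) (∈-Ball⁻ v∈))) ,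
                   ∥-resp (λ i → F.trans i (+-cancel-⊖ (ψ.φ (take m w)) (ψ.φ (take m v)) O i) (F.trans i (F.sym i (ψ.φ-⊖ (take m w) (take m v) i)) (F.reflexive i (cong (λ z → ψ.φ z i) (sym (Vec.take-zipWith {m = m} ℤ._-_ w v))))))
                          (λ i → F.trans i (+-cancel-⊖ (ψ.φ (drop m w)) (ψ.φ (drop m v)) O′ i) (F.trans i (F.sym i (ψ.φ-⊖ (drop m w) (drop m v) i)) (F.reflexive i (cong (λ z → ψ.φ z i) (sym (Vec.drop-zipWith {m = m} ℤ._-_ w v))))))
                          (∥-⊖ e e′)) ⟩
          Lattice.points (ψ.line Y) (2 * M) ∎
        inner : ∀ O → ∑[ x ∈ Ball m M ] (∑[ x′ ∈ Ball n M ] h (ψ.φ x +ᴬ O) (φ.φ x′ +ᴬ 0ᴬ)) ≤ (2 * M) ^ (n ∸ m) * Lattice.points (ψ.line Y) (2 * M)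
        inner O = ≤-trans (≤-reflexive (∑-swap (Ball m M) (Ball n M) _))
          (sliced M (λ X′ → ∑[ x ∈ Ball m M ] h (ψ.φ x +ᴬ O) X′)
            (λ e → ∑-cong (Ball m M) (λ _ → h-resp (λ i → F.refl i) e)) _ (core O) 0ᴬ)

  module _ {s} {F : Fin (suc s) → Fld c ℓ} where
    open Algebra F

    degenerate : (i : Fin (suc s)) (φ ψ : Hom n) → ℕ → ℕ
    degenerate {n} i φ ψ M = ∑[ w ∈ Ball (n + n) M ] (∑[ v ∈ Ball (n + n) M ] 𝟙 ((Hom.φ² φ w ∥? Hom.φ² ψ v) ×-dec zero? i (Hom.φ² ψ v)))

    module Degenerate (i : Fin (suc s)) {n m} (φ ψ : Coord n)
      (φ′ ψ′ : Algebra.Coord (F ∘ punchIn i) m) (σ : Fin m → Fin n)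
      (sliced : ∀ M Y → Lattice.points (Algebra.Hom.line (project i φ (Coord.hom φ)) Y) M ≤ ((2 * M) ^ (n ∸ m) * (2 * M) ^ (n ∸ m)) * Lattice.points (Algebra.Coord.line φ′ Y) (2 * M))
      (agree : ∀ x → F._≈_ i (Coord.φ ψ x i) (F.0# i) → ∀ j → F._≈_ (punchIn i j) (Algebra.Coord.φ ψ′ (sel σ x) j) (Coord.φ ψ x (punchIn i j)))
      where
      module A⁻ = Algebra (F ∘ punchIn i)
      open ≤-Reasoning
      module φ = Coord φ
      module ψ = Coord ψ
      module φ′ = A⁻.Coord φ′
      module ψ′ = A⁻.Coord ψ′
      φ⁻ : A⁻.Hom n
      φ⁻ = project i φ φ.hom
      K : ℕ → ℕ
      K M = (2 * M) ^ (n ∸ m) * (2 * M) ^ (n ∸ m)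
      g : Vec ℤ (n + n) → Vec ℤ (m + m)
      g v = sel σ (take n v) Vec.++ sel σ (drop n v)
      fst : ∀ v → Zero i (ψ.φ² v) → ∀ j → F._≈_ (punchIn i j) (ψ′.φ (take m (g v)) j) (ψ.φ (take n v) (punchIn i j))
      fst v (z , _) j = F.trans (punchIn i j) (F.reflexive (punchIn i j) (cong (λ x → ψ′.φ x j) (take-++ (sel σ (take n v)) _))) (agree (take n v) z j)
      snd : ∀ v → Zero i (ψ.φ² v) → ∀ j → F._≈_ (punchIn i j) (ψ′.φ (drop m (g v)) j) (ψ.φ (drop n v) (punchIn i j))
      snd v (_ , z) j = F.trans (punchIn i j) (F.reflexive (punchIn i j) (cong (λ x → ψ′.φ x j) (drop-++ (sel σ (take n v)) _))) (agree (drop n v) z j)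
      same : ∀ {M} {x y : Vec ℤ n} → 2 * M ≤ p → Small M x → Small M y → (∀ j → F._≈_ j (ψ.φ x j) (ψ.φ y j)) → x ≡ y
      same {M} {x} {y} 2M≤p sx sy e = ≋-close (ψ.injective′ e) (Small-⊖ {x = x} {y} sx sy) (≤-trans (≤-reflexive (cong (λ z → M + z) (sym (+-identityʳ M)))) 2M≤p)
      -- The selected coordinates fix the other components of `ψ`, and component `i` is 0, so they
      -- fix the vector modulo p; below p / 2 that fixes the vector itself.
      injective-g : ∀ {M v v′} → 2 * M ≤ p → v ∈ Ball (n + n) M → v′ ∈ Ball (n + n) M → Zero i (ψ.φ² v) → Zero i (ψ.φ² v′) → g v ≡ g v′ → v ≡ v′
      injective-g {M} {v} {v′} 2M≤p v∈ v′∈ z z′ e = take-drop-injective n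
        (same 2M≤p (Small-take n (∈-Ball⁻ v∈)) (Small-take n (∈-Ball⁻ v′∈)) (ins i (F.trans i (proj₁ z) (F.sym i (proj₁ z′)))
          (λ j → F.trans (punchIn i j) (F.sym (punchIn i j) (fst v z j)) (F.trans (punchIn i j) (F.reflexive (punchIn i j) (cong (λ x → ψ′.φ (take m x) j) e)) (fst v′ z′ j)))))
        (same 2M≤p (Small-drop n (∈-Ball⁻ v∈)) (Small-drop n (∈-Ball⁻ v′∈)) (ins i (F.trans i (proj₂ z) (F.sym i (proj₂ z′)))
          (λ j → F.trans (punchIn i j) (F.sym (punchIn i j) (snd v z j)) (F.trans (punchIn i j) (F.reflexive (punchIn i j) (cong (λ x → ψ′.φ (drop m x) j) e)) (snd v′ z′ j)))))

      -- Here v lies in the kernel of component `i` and is encoded by m coordinates, whereas w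
      -- merely loses its condition there and gains n - m free coordinates in each half. The factor
      -- (2 M) ^ (2 (n - m)) and an energy of order M ^ (2 m) combine to the desired M ^ (2 n).
      bound : ∀ M → 2 * M ≤ p → degenerate i φ.hom ψ.hom M ≤ K M * energy φ′.hom ψ′.hom (2 * M)
      bound M 2M≤p = begin
        ∑[ w ∈ Ball (n + n) M ] (∑[ v ∈ Ball (n + n) M ] 𝟙 ((φ.φ² w ∥? ψ.φ² v) ×-dec zero? i (ψ.φ² v)))
          ≤⟨ ∑-mono′ (Ball (n + n) M) (λ w → #-inj (λ v → (φ.φ² w ∥? ψ.φ² v) ×-dec zero? i (ψ.φ² v)) (λ u → A⁻.Hom.φ² φ⁻ w A⁻.∥? ψ′.φ² u)
               _≟ᵛ_ g (Ball-unique (n + n) M)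
               (λ {v} v∈ (e , z) → ∈-Ball⁺ (Small-++ (Small-sel σ (Small-take n (∈-Ball⁻ v∈))) (Small-sel σ (Small-drop n (∈-Ball⁻ v∈)))) ,
                 A⁻.∥-sym (A⁻.∥-resp (λ j → F.sym (punchIn i j) (fst v z j)) (λ j → F.sym (punchIn i j) (snd v z j)) (A⁻.∥-sym (λ j → e (punchIn i j)))))
               (λ {v} {v′} v∈ v′∈ (_ , z) (_ , z′) e → injective-g 2M≤p v∈ v′∈ z z′ e)) ⟩
        ∑[ w ∈ Ball (n + n) M ] (∑[ u ∈ Ball (m + m) M ] 𝟙 (A⁻.Hom.φ² φ⁻ w A⁻.∥? ψ′.φ² u))
          ≡⟨ ∑-swap (Ball (n + n) M) (Ball (m + m) M) _ ⟩
        ∑[ u ∈ Ball (m + m) M ] (∑[ w ∈ Ball (n + n) M ] 𝟙 (A⁻.Hom.φ² φ⁻ w A⁻.∥? ψ′.φ² u))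
          ≤⟨ ∑-mono′ (Ball (m + m) M) (λ u → sliced M (ψ′.φ² u)) ⟩
        ∑[ u ∈ Ball (m + m) M ] (K M * (∑[ w ∈ Ball (m + m) (2 * M) ] 𝟙 (φ′.φ² w A⁻.∥? ψ′.φ² u)))
          ≡⟨ ∑-*ˡ (Ball (m + m) M) (K M) _ ⟩
        K M * (∑[ u ∈ Ball (m + m) M ] (∑[ w ∈ Ball (m + m) (2 * M) ] 𝟙 (φ′.φ² w A⁻.∥? ψ′.φ² u)))
          ≤⟨ *-monoʳ-≤ (K M) (∑-inj _≟ᵛ_ (λ u → u) (λ u → ∑[ w ∈ Ball (m + m) (2 * M) ] 𝟙 (φ′.φ² w A⁻.∥? ψ′.φ² u)) (Ball-unique (m + m) M) (λ u∈ → ∈-Ball⁺ (Small-mono (m≤m+n M (M + 0)) (∈-Ball⁻ u∈))) (λ _ _ e → e)) ⟩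
        K M * (∑[ u ∈ Ball (m + m) (2 * M) ] (∑[ w ∈ Ball (m + m) (2 * M) ] 𝟙 (φ′.φ² w A⁻.∥? ψ′.φ² u)))
          ≡⟨ cong (K M *_) (∑-swap (Ball (m + m) (2 * M)) (Ball (m + m) (2 * M)) _) ⟩
        K M * energy φ′.hom ψ′.hom (2 * M) ∎

    DegenerateBound : (i : Fin (suc s)) → Coord n → Coord n → Set _
    DegenerateBound {n} i φ ψ = ∃ λ m → m ≤ n × Σ[ φ′ ∈ Algebra.Coord (F ∘ punchIn i) m ] Σ[ ψ′ ∈ Algebra.Coord (F ∘ punchIn i) m ]
      (∀ M → 2 * M ≤ p → degenerate i (Coord.hom φ) (Coord.hom ψ) M ≤
        ((2 * M) ^ (n ∸ m) * (2 * M) ^ (n ∸ m)) * energy (Algebra.Coord.hom φ′) (Algebra.Coord.hom ψ′) (2 * M))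

    degenerate-≤ : ∀ i (φ ψ : Coord n) → DegenerateBound i φ ψ
    degenerate-≤ {n} i φ ψ =
      let m , m≤n , φ′ , sliced = slice² (project i φ (Coord.hom φ)) surj
          m₁ , ψ′ , σ , agree = restrict i ψ
      in assemble m≤n φ′ sliced ψ′ σ agree
           -- Projection and restriction both give coordinates of the same product of fields, so
           -- their dimensions agree.
           (≤-antisym (Algebra.coordinates-unique (F ∘ punchIn i) φ′ ψ′) (Algebra.coordinates-unique (F ∘ punchIn i) ψ′ φ′))
      where
      surj : Algebra.Hom.Surjective (project i φ (Coord.hom φ))
      surj X = let x , e = Coord.surjective φ (ins i (F.0# i) X) in
        x , λ j → F.trans (punchIn i j) (e (punchIn i j)) (F.reflexive (punchIn i j) (ins-punchIn i (F.0# i) X j))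
      assemble : ∀ {m m₁} → m ≤ n → (φ′ : Algebra.Coord (F ∘ punchIn i) m) →
        (∀ M Y → Lattice.points (Algebra.Hom.line (project i φ (Coord.hom φ)) Y) M ≤ ((2 * M) ^ (n ∸ m) * (2 * M) ^ (n ∸ m)) * Lattice.points (Algebra.Coord.line φ′ Y) (2 * M)) →
        (ψ′ : Algebra.Coord (F ∘ punchIn i) m₁) (σ : Fin m₁ → Fin n) →
        (∀ x → F._≈_ i (Coord.φ ψ x i) (F.0# i) → ∀ j → F._≈_ (punchIn i j) (Algebra.Coord.φ ψ′ (sel σ x) j) (Coord.φ ψ x (punchIn i j))) →
        m ≡ m₁ → DegenerateBound i φ ψ
      assemble {m} m≤n φ′ sliced ψ′ σ agree refl = m , m≤n , φ′ , ψ′ , Degenerate.bound i φ ψ φ′ ψ′ σ sliced agree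

-- Dual coordinates

module DualLines (p : ℕ) (prime : Prime p) where

  open Counting
  open Balls
  open Residues p prime
  open Discrepancy p prime
  open Fields p prime
  open Slicing p prime
  open import Data.Fin.Base using (Fin; zero; suc; punchIn)
  open import Data.Integer.Base as ℤ using (ℤ; +_)
  import Data.Integer.Properties as ℤ
  import Data.Integer.Solver as ℤ
  open import Data.Integer.DivMod using (_%ℕ_)
  open import Data.List.Base using (List; length; map)
  open import Data.List.Properties using (length-map)
  open import Data.List.Membership.Propositional using (_∈_)
  open import Data.List.Membership.Propositional.Properties using (∈-map⁻)
  open import Data.Nat using (zero; suc; _+_; _*_; _^_; _≤_; _<_)
  open import Data.Nat.Properties
  open import Data.Product using (∃; _×_; _,_; proj₁; proj₂)
  open import Data.Vec.Base as Vec using (Vec; []; _∷_; lookup; tabulate; take; drop)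
  import Data.Vec.Properties as Vec
  open import Function.Base using (_∘_)
  open import Level using (Level)
  open import Relation.Binary.PropositionalEquality
  open import Relation.Nullary
  open import Relation.Nullary.Decidable using (decidable-stable)

  private variable
    c ℓ : Level
    m n s : ℕ

  total : (Fin s → ℤ) → ℤ
  total {zero}  f = + 0
  total {suc s} f = f zero ℤ.+ total (f ∘ suc)

  total-∼ : ∀ {f g : Fin s → ℤ} → (∀ i → f i ∼ g i) → total f ∼ total g
  total-∼ {zero}  e = ∼-refl
  total-∼ {suc s} e = +-∼ (e zero) (total-∼ (e ∘ suc))

  total-+ : ∀ (f g : Fin s → ℤ) → total (λ i → f i ℤ.+ g i) ≡ total f ℤ.+ total g
  total-+ {zero}  f g = refl
  total-+ {suc s} f g = trans (cong (λ z → f zero ℤ.+ g zero ℤ.+ z) (total-+ (f ∘ suc) (g ∘ suc)))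
    (solve 4 (λ a b c d → a :+ b :+ (c :+ d) := a :+ c :+ (b :+ d)) refl (f zero) (g zero) (total (f ∘ suc)) (total (g ∘ suc)))
    where open ℤ.+-*-Solver

  total-zero : ∀ {f : Fin s → ℤ} → (∀ i → f i ∼ + 0) → total f ∼ + 0
  total-zero {zero}  e = ∼-refl
  total-zero {suc s} e = +-∼ (e zero) (total-zero (e ∘ suc))

  total-single : ∀ {f : Fin (suc s) → ℤ} i → (∀ j → f (punchIn i j) ∼ + 0) → total f ∼ f i
  total-single {f = f} zero e = ∼-trans (+-∼ (∼-refl {f zero}) (total-zero e)) (∼-reflexive (ℤ.+-identityʳ (f zero)))
  total-single {suc s} {f} (suc i) e = ∼-trans (+-∼ (e zero) (total-single {f = f ∘ suc} i (e ∘ suc))) (∼-reflexive (ℤ.+-identityˡ (f (suc i))))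

  Additive : (Vec ℤ m → ℤ) → Set
  Additive h = ∀ x y → h (x ⊕ y) ∼ h x ℤ.+ h y

  additive-𝟎 : ∀ {h : Vec ℤ m → ℤ} → Additive h → h 𝟎 ∼ + 0
  additive-𝟎 {h = h} add = ∼-trans (∼-reflexive (solve 1 (λ a → a := (a :+ a) :- a) refl (h 𝟎)))
    (∼-trans (─-∼ (∼-trans (∼-sym (add 𝟎 𝟎)) (∼-reflexive (cong h (vec-ext (λ k → trans (lookup-⊕ k 𝟎 𝟎)
      (trans (cong₂ ℤ._+_ (lookup-𝟎 k) (lookup-𝟎 k)) (sym (lookup-𝟎 k)))))))) (∼-refl {h 𝟎})) (∼-reflexive (ℤ.+-inverseʳ (h 𝟎))))
    where open ℤ.+-*-Solver

  additive-⊙ : ∀ {h : Vec ℤ m → ℤ} → Additive h → ∀ q x → h (+ q ⊙ x) ∼ + q ℤ.* h x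
  additive-⊙ {h = h} add zero    x = ∼-trans (∼-reflexive (cong h (vec-ext (λ k → trans (lookup-⊙ k (+ 0) x) (sym (lookup-𝟎 k))))))
    (∼-trans (additive-𝟎 {h = h} add) (∼-reflexive (sym (ℤ.*-zeroˡ (h x)))))
  additive-⊙ {h = h} add (suc q) x = ∼-trans (∼-reflexive (cong h (vec-ext (λ k → trans (lookup-⊙ k (+ suc q) x)
      (trans (ℤ.suc-* (+ q) (lookup x k)) (sym (trans (lookup-⊕ k x (+ q ⊙ x)) (cong (λ z → lookup x k ℤ.+ z) (lookup-⊙ k (+ q) x)))))))))
    (∼-trans (add x (+ q ⊙ x)) (∼-trans (+-∼ (∼-refl {h x}) (additive-⊙ {h = h} add q x)) (∼-reflexive (sym (ℤ.suc-* (+ q) (h x))))))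

  dot-⊕ˡ : ∀ (x y w : Vec ℤ m) → dot (x ⊕ y) w ≡ dot x w ℤ.+ dot y w
  dot-⊕ˡ []      []      []      = refl
  dot-⊕ˡ (a ∷ x) (b ∷ y) (c ∷ w) = trans (cong (λ z → (a ℤ.+ b) ℤ.* c ℤ.+ z) (dot-⊕ˡ x y w))
    (solve 5 (λ a b c d e → (a :+ b) :* c :+ (d :+ e) := (a :* c :+ d) :+ (b :* c :+ e)) refl a b c (dot x w) (dot y w))
    where open ℤ.+-*-Solver

  dot-𝟎ˡ : ∀ (w : Vec ℤ m) → dot 𝟎 w ≡ + 0
  dot-𝟎ˡ []      = refl
  dot-𝟎ˡ (c ∷ w) = trans (cong₂ ℤ._+_ (ℤ.*-zeroˡ c) (dot-𝟎ˡ w)) refl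

  dot-comm : ∀ (x w : Vec ℤ m) → dot x w ≡ dot w x
  dot-comm []      []      = refl
  dot-comm (a ∷ x) (c ∷ w) = cong₂ ℤ._+_ (ℤ.*-comm a c) (dot-comm x w)

  dot-unit : ∀ (k : Fin m) t w → dot (unit k t) w ≡ t ℤ.* lookup w k
  dot-unit zero    t (c ∷ w) = trans (cong (λ z → t ℤ.* c ℤ.+ z) (dot-𝟎ˡ w)) (ℤ.+-identityʳ (t ℤ.* c))
  dot-unit (suc k) t (c ∷ w) = trans (cong₂ ℤ._+_ (ℤ.*-zeroˡ c) (dot-unit k t w)) (ℤ.+-identityˡ (t ℤ.* lookup w k))

  dot-++ : ∀ n (w y : Vec ℤ (n + m)) → dot w y ≡ dot (take n w) (take n y) ℤ.+ dot (drop n w) (drop n y)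
  dot-++ zero    w       y       = sym (ℤ.+-identityˡ (dot w y))
  dot-++ (suc n) (a ∷ w) (b ∷ y) = trans (cong (λ z → a ℤ.* b ℤ.+ z) (dot-++ n w y)) (sym (ℤ.+-assoc (a ℤ.* b) _ _))

  additive-dot : ∀ {h : Vec ℤ m → ℤ} → Additive h → (∀ {x y} → x ≋ y → h x ∼ h y) → ∀ x → h x ∼ dot x (tabulate (λ k → h (unit k (+ 1))))
  additive-dot {m} {h} add per = generate (λ x → h x ∼ dot x w)
    (∼-trans (additive-𝟎 {h = h} add) (∼-reflexive (sym (dot-𝟎ˡ w))))
    (λ {x} {y} e f → ∼-trans (add x y) (∼-trans (+-∼ e f) (∼-reflexive (sym (dot-⊕ˡ x y w)))))
    (λ k t → ∼-trans (per (multiple k t)) (∼-trans (additive-⊙ {h = h} add (t %ℕ p) (unit k (+ 1)))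
      (∼-trans (*-∼ (res∼ t) (∼-reflexive (sym (Vec.lookup∘tabulate (λ k → h (unit k (+ 1))) k)))) (∼-reflexive (sym (dot-unit k t w))))))
    where
    w = tabulate (λ k → h (unit k (+ 1)))
    multiple : ∀ k t → unit k t ≋ + (t %ℕ p) ⊙ unit k (+ 1)
    multiple k t = congruent λ j → ∼-trans (∼-reflexive (lookup-unit k t j)) (∼-trans (*-∼ (∼-sym (res∼ t)) (∼-refl {lookup (unit k (+ 1)) j}))
      (∼-reflexive (sym (lookup-⊙ j (+ (t %ℕ p)) (unit k (+ 1))))))

  module TraceForm {s} (F : Fin s → Fld c ℓ) where
    open Algebra F

    ⟨_,_⟩ : A → A → ℤ
    ⟨ X , Y ⟩ = total (λ i → F.τ i (F._*ᶠ_ i (X i) (Y i)))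

    ⟨⟩-cong : ∀ {X X′ Y Y′} → (∀ i → F._≈_ i (F._*ᶠ_ i (X i) (Y i)) (F._*ᶠ_ i (X′ i) (Y′ i))) → ⟨ X , Y ⟩ ∼ ⟨ X′ , Y′ ⟩
    ⟨⟩-cong e = total-∼ (λ i → F.τ-cong i (e i))

    ⟨⟩-comm : ∀ X Y → ⟨ X , Y ⟩ ∼ ⟨ Y , X ⟩
    ⟨⟩-comm X Y = ⟨⟩-cong (λ i → F.*-comm i (X i) (Y i))

    ⟨⟩-+ʳ : ∀ X Y Z → ⟨ X , Y +ᴬ Z ⟩ ∼ ⟨ X , Y ⟩ ℤ.+ ⟨ X , Z ⟩
    ⟨⟩-+ʳ X Y Z = ∼-trans (total-∼ (λ i → ∼-trans (F.τ-cong i (F.distribˡ i (X i) (Y i) (Z i))) (F.τ-+ i _ _)))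
      (∼-reflexive (total-+ (λ i → F.τ i (F._*ᶠ_ i (X i) (Y i))) (λ i → F.τ i (F._*ᶠ_ i (X i) (Z i)))))

    ⟨⟩-+ˡ : ∀ X Y Z → ⟨ X +ᴬ Y , Z ⟩ ∼ ⟨ X , Z ⟩ ℤ.+ ⟨ Y , Z ⟩
    ⟨⟩-+ˡ X Y Z = ∼-trans (⟨⟩-comm (X +ᴬ Y) Z) (∼-trans (⟨⟩-+ʳ Z X Y) (+-∼ (⟨⟩-comm Z X) (⟨⟩-comm Z Y)))

    τ-0 : ∀ i → F.τ i (F.0# i) ∼ + 0
    τ-0 i = ∼-trans (∼-reflexive (solve 1 (λ a → a := (a :+ a) :- a) refl t₀))
      (∼-trans (─-∼ (∼-trans (∼-sym (F.τ-+ i _ _)) (F.τ-cong i (F.+-identityʳ i _))) (∼-refl {t₀})) (∼-reflexive (ℤ.+-inverseʳ t₀)))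
      where
      open ℤ.+-*-Solver
      t₀ = F.τ i (F.0# i)

  -- Test vectors concentrated in one component isolate the functional of that field.
  ⟨⟩-nondegenerate : ∀ {s} (F : Fin s → Fld c ℓ) Y → (∀ X → TraceForm.⟨_,_⟩ F X Y ∼ + 0) → Algebra._≈ᴬ_ F Y (Algebra.0ᴬ F)
  ⟨⟩-nondegenerate {s = suc s} F Y null i = decidable-stable (F._≟_ i (Y i) (F.0# i)) λ Y≉0 →
    let x , τ≁0 = F.nondegenerate i (Y i) Y≉0
        X = ins i x (λ j → F.0# (punchIn i j))
    in τ≁0 (∼-trans (F.τ-cong i (F.*-congʳ i (F.reflexive i (sym (ins-≡ {C = F.Carrier} i x (λ j → F.0# (punchIn i j)))))))
         (∼-trans (∼-sym (total-single {f = λ j → F.τ j (F._*ᶠ_ j (X j) (Y j))} i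
           (λ j → ∼-trans (F.τ-cong (punchIn i j) (F.trans (punchIn i j)
             (F.*-congʳ (punchIn i j) (F.reflexive (punchIn i j) (ins-punchIn {C = F.Carrier} i x (λ j → F.0# (punchIn i j)) j))) (F.zeroˡ (punchIn i j) (Y (punchIn i j))))) (τ-0 (punchIn i j)))))
           (null X)))
    where
    open Algebra F
    open TraceForm F

  module _ {s} {F : Fin s → Fld c ℓ} where
    open Algebra F
    open TraceForm F

    Dual : Coord n → Coord n → Set
    Dual φ ψ = ∀ x y → dot x y ∼ ⟨ Coord.φ φ x , Coord.φ ψ y ⟩

    Dual-sym : ∀ {φ ψ : Coord n} → Dual φ ψ → Dual ψ φ
    Dual-sym d x y = ∼-trans (∼-reflexive (dot-comm x y)) (∼-trans (d y x) (⟨⟩-comm _ _))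

    module _ (φ : Coord n) where
      private
        open module φ = Coord φ using () renaming (φ to φ₀)

        -- The Gram matrix of the bilinear form in the coordinates φ, applied to y.
        gram : Vec ℤ n → Vec ℤ n
        gram y = tabulate (λ k → ⟨ φ₀ (unit k (+ 1)) , φ₀ y ⟩)

        gram-dot : ∀ x y → ⟨ φ₀ x , φ₀ y ⟩ ∼ dot x (gram y)
        gram-dot x y = additive-dot {h = λ x → ⟨ φ₀ x , φ₀ y ⟩}
          (λ u v → ∼-trans (⟨⟩-cong (λ i → F.*-congʳ i (φ.φ-⊕ u v i))) (⟨⟩-+ˡ (φ₀ u) (φ₀ v) (φ₀ y)))
          (λ e → ⟨⟩-cong (λ i → F.*-congʳ i (φ.φ-cong e i))) x

        lookup-gram : ∀ y k → lookup (gram y) k ≡ ⟨ φ₀ (unit k (+ 1)) , φ₀ y ⟩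
        lookup-gram y = Vec.lookup∘tabulate (λ k → ⟨ φ₀ (unit k (+ 1)) , φ₀ y ⟩)

        gram-⊕ : ∀ y z → gram (y ⊕ z) ≋ gram y ⊕ gram z
        gram-⊕ y z = congruent λ k → ∼-trans (∼-reflexive (lookup-gram (y ⊕ z) k))
          (∼-trans (⟨⟩-cong (λ i → F.*-congˡ i (φ.φ-⊕ y z i))) (∼-trans (⟨⟩-+ʳ _ _ _)
          (∼-reflexive (sym (trans (lookup-⊕ k (gram y) (gram z)) (cong₂ ℤ._+_ (lookup-gram y k) (lookup-gram z k)))))))

        gram-≋ : ∀ {y z} → y ≋ z → gram y ≋ gram z
        gram-≋ {y} {z} e = congruent λ k → ∼-trans (∼-reflexive (lookup-gram y k))
          (∼-trans (⟨⟩-cong (λ i → F.*-congˡ i (φ.φ-cong e i))) (∼-reflexive (sym (lookup-gram z k))))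

        gram-null : ∀ {y} → gram y ≋ 𝟎 → y ≋ 𝟎
        gram-null {y} e = φ.injective (⟨⟩-nondegenerate F (φ₀ y) λ X → let x , ex = φ.surjective X in
          ∼-trans (⟨⟩-cong (λ i → F.*-congʳ i (F.sym i (ex i)))) (∼-trans (gram-dot x y)
            (∼-trans (dot-≋ x e) (∼-reflexive (trans (dot-comm x 𝟎) (dot-𝟎ˡ x))))))

        gram-injective : ∀ {y z} → gram y ≋ gram z → y ≋ z
        gram-injective {y} {z} e = ⊖-≋𝟎⁻ (gram-null (congruent λ k →
          ∼-trans (∼-reflexive (solve 2 (λ a b → a := (a :+ b) :- b) refl (lookup (gram (y ⊖ z)) k) (lookup (gram z) k)))
          (∼-trans (─-∼ (∼-trans (∼-reflexive (sym (lookup-⊕ k (gram (y ⊖ z)) (gram z)))) (∼-trans (∼-sym (at (gram-⊕ (y ⊖ z) z) k))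
             (∼-trans (at (gram-≋ (≋-reflexive back)) k) (at e k)))) (∼-refl {lookup (gram z) k}))
          (∼-trans (∼-reflexive (ℤ.+-inverseʳ (lookup (gram z) k))) (∼-reflexive (sym (lookup-𝟎 k)))))))
          where
          open ℤ.+-*-Solver
          back : (y ⊖ z) ⊕ z ≡ y
          back = vec-ext (λ k → trans (lookup-⊕ k (y ⊖ z) z) (trans (cong (ℤ._+ lookup z k) (lookup-⊖ k y z))
            (solve 2 (λ y z → y :- z :+ z := y) refl (lookup y k) (lookup z k))))

        abstract
          solution : ∀ y → ∃ λ x → x ∈ Res n × gram x ≋ y
          solution = injective⇒surjective {f = gram} gram-injective refl

        gram⁻¹ : Vec ℤ n → Vec ℤ n
        gram⁻¹ y = proj₁ (solution y)

        gram-gram⁻¹ : ∀ y → gram (gram⁻¹ y) ≋ y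
        gram-gram⁻¹ y = proj₂ (proj₂ (solution y))

        gram-𝟎 : gram 𝟎 ≋ 𝟎
        gram-𝟎 = congruent λ k → ∼-trans (∼-reflexive (lookup-gram 𝟎 k)) (∼-trans (⟨⟩-comm _ _)
          (∼-trans (gram-dot 𝟎 (unit k (+ 1))) (∼-reflexive (trans (dot-𝟎ˡ (gram (unit k (+ 1)))) (sym (lookup-𝟎 k))))))

      -- Coordinates with respect to the dual basis, that is φ composed with the inverse of the Gram
      -- matrix.
      dual : Coord n
      dual = record
        { hom = record
          { φ      = λ y → φ₀ (gram⁻¹ y)
          ; φ-⊕    = λ y z i → F.trans i (φ.φ-cong (gram-injective (≋-trans (gram-gram⁻¹ (y ⊕ z))
                       (≋-trans (⊕-≋ (≋-sym (gram-gram⁻¹ y)) (≋-sym (gram-gram⁻¹ z))) (≋-sym (gram-⊕ (gram⁻¹ y) (gram⁻¹ z)))))) i)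
                       (φ.φ-⊕ (gram⁻¹ y) (gram⁻¹ z) i)
          ; φ-null = λ {y} e → φ.φ-null (gram-null (≋-trans (gram-gram⁻¹ y) e))
          }
        ; injective  = λ {y} e → ≋-trans (≋-sym (gram-gram⁻¹ y)) (≋-trans (gram-≋ (φ.injective e)) gram-𝟎)
        ; surjective = λ X → let x , ex = φ.surjective X in
            gram x , λ i → F.trans i (φ.φ-cong (gram-injective (gram-gram⁻¹ (gram x))) i) (ex i)
        }

      dual-Dual : Dual φ dual
      dual-Dual x y = ∼-sym (∼-trans (gram-dot x (gram⁻¹ y)) (dot-≋ x (gram-gram⁻¹ y)))

  neg : Vec ℤ m → Vec ℤ m
  neg x = 𝟎 ⊖ x

  lookup-neg : ∀ (x : Vec ℤ m) k → lookup (neg x) k ≡ ℤ.- lookup x k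
  lookup-neg x k = trans (lookup-⊖ k 𝟎 x) (trans (cong (ℤ._- lookup x k) (lookup-𝟎 k)) (ℤ.+-identityˡ _))

  neg-neg : ∀ (x : Vec ℤ m) → neg (neg x) ≡ x
  neg-neg x = vec-ext (λ k → trans (lookup-neg (neg x) k) (trans (cong ℤ.-_ (lookup-neg x k)) (ℤ.neg-involutive (lookup x k))))

  Small-neg : ∀ {M} {x : Vec ℤ m} → Small M x → Small M (neg x)
  Small-neg {x = x} sx = small λ k → subst (_< _) (sym (trans (cong ℤ.∣_∣ (lookup-neg x k)) (ℤ.∣-i∣≡∣i∣ (lookup x k)))) (entry sx k)

  neg-≋ : ∀ {x y : Vec ℤ m} → x ≋ y → neg x ≋ neg y
  neg-≋ e = ⊖-≋ ≋-refl e

  take-⊖ : ∀ n (x y : Vec ℤ (n + m)) → take n (x ⊖ y) ≡ take n x ⊖ take n y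
  take-⊖ n x y = Vec.take-zipWith {m = n} ℤ._-_ x y

  drop-⊖ : ∀ n (x y : Vec ℤ (n + m)) → drop n (x ⊖ y) ≡ drop n x ⊖ drop n y
  drop-⊖ n x y = Vec.drop-zipWith {m = n} ℤ._-_ x y

  take-≋ : ∀ n {x y : Vec ℤ (n + m)} → x ≋ y → take n x ≋ take n y
  take-≋ n {x} {y} e = ⊖-≋𝟎⁻ (≋-trans (≋-reflexive (sym (take-⊖ n x y))) (take-null n (⊖-≋𝟎 e)))
    where
    take-null : ∀ n {z : Vec ℤ (n + m)} → z ≋ 𝟎 → take n z ≋ 𝟎
    take-null zero    e = congruent λ ()
    take-null (suc n) {a ∷ z} e = congruent λ { zero → at e zero ; (suc k) → at (take-null n {z} (congruent (at e ∘ suc))) k }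

  drop-≋ : ∀ n {x y : Vec ℤ (n + m)} → x ≋ y → drop n x ≋ drop n y
  drop-≋ zero    e = e
  drop-≋ (suc n) {_ ∷ x} {_ ∷ y} e = drop-≋ n {x} {y} (congruent (at e ∘ suc))

  ++-≋ˡ : ∀ {x x′ : Vec ℤ m} {y y′ : Vec ℤ n} → x Vec.++ y ≋ x′ Vec.++ y′ → x ≋ x′
  ++-≋ˡ {m} {x = x} {x′} {y} {y′} e = ≋-trans (≋-reflexive (sym (take-++ x y))) (≋-trans (take-≋ m e) (≋-reflexive (take-++ x′ y′)))

  ++-≋ʳ : ∀ {x x′ : Vec ℤ m} {y y′ : Vec ℤ n} → x Vec.++ y ≋ x′ Vec.++ y′ → y ≋ y′
  ++-≋ʳ {m} {x = x} {x′} {y} {y′} e = ≋-trans (≋-reflexive (sym (drop-++ x y))) (≋-trans (drop-≋ m e) (≋-reflexive (drop-++ x′ y′)))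

  -- The orthogonal complement of a line is the same line in the dual coordinates, turned by a quarter.
  module _ {s} {F : Fin s → Fld c ℓ} where
    open Algebra F
    open TraceForm F

    module LineDuality (φ ψ : Coord n) (dual : Dual φ ψ) (Y : A²) (Y-generic : Generic Y) where
      private
        module φ = Coord φ
        module ψ = Coord ψ
        y₁ = proj₁ Y
        y₂ = proj₂ Y

      turned : Vec ℤ (n + n) → A²
      turned y = ψ.φ (drop n y) , ψ.φ (neg (take n y))

      turned-⊖ : ∀ {x y Z} → turned x ∥ Z → turned y ∥ Z → turned (x ⊖ y) ∥ Z
      turned-⊖ {x} {y} ex ey = ∥-resp
        (λ i → F.trans i (F.sym i (ψ.φ-⊖ (drop n x) (drop n y) i)) (F.reflexive i (cong (λ z → ψ.φ z i) (sym (drop-⊖ n x y)))))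
        (λ i → F.trans i (F.sym i (ψ.φ-⊖ (neg (take n x)) (neg (take n y)) i)) (ψ.φ-cong (≋-reflexive (vec-ext (λ k →
          trans (lookup-⊖ k (neg (take n x)) (neg (take n y))) (trans (cong₂ ℤ._-_ (lookup-neg (take n x) k) (lookup-neg (take n y) k))
          (trans (solve 2 (λ a b → :- a :- :- b := :- (a :- b)) refl (lookup (take n x) k) (lookup (take n y) k))
          (trans (cong ℤ.-_ (trans (sym (lookup-⊖ k (take n x) (take n y))) (cong (λ z → lookup z k) (sym (take-⊖ n x y)))))
            (sym (lookup-neg (take n (x ⊖ y)) k)))))))) i))
        (∥-⊖ ex ey)
        where open ℤ.+-*-Solver

      complement : Lattice (n + n) ℓ
      complement = record
        { Member   = λ y → turned y ∥ Y
        ; member?  = λ y → turned y ∥? Y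
        ; 𝟎-closed = ∥-resp {X = 0ᴬ} {X′ = 0ᴬ} (λ i → F.sym i (ψ.φ-null (≋-reflexive (drop-𝟎 n)) i))
            (λ i → F.sym i (ψ.φ-null (≋-trans (neg-≋ (≋-reflexive (take-𝟎 n))) (⊖-≋𝟎 ≋-refl)) i))
            (λ i → F.trans i (F.zeroˡ i _) (F.sym i (F.zeroˡ i _)))
        ; ⊖-closed = turned-⊖
        }

      points-complement : ∀ M → Lattice.points complement M ≤ Lattice.points (ψ.line Y) M
      points-complement M = #-inj (λ y → turned y ∥? Y) (λ y → ψ.φ² y ∥? Y) _≟ᵛ_ turn (Ball-unique (n + n) M)
        (λ {y} y∈ e → ∈-Ball⁺ (Small-++ (Small-drop n (∈-Ball⁻ y∈)) (Small-neg (Small-take n (∈-Ball⁻ y∈)))) ,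
          ∥-resp (λ i → F.reflexive i (cong (λ z → ψ.φ z i) (sym (take-++ (drop n y) (neg (take n y))))))
                 (λ i → F.reflexive i (cong (λ z → ψ.φ z i) (sym (drop-++ (drop n y) (neg (take n y)))))) e)
        (λ {x} {y} _ _ _ _ e → take-drop n
          (trans (sym (neg-neg (take n x))) (trans (cong neg (trans (sym (drop-++ (drop n x) (neg (take n x)))) (trans (cong (drop n) e) (drop-++ (drop n y) (neg (take n y)))))) (neg-neg (take n y))))
          (trans (sym (take-++ (drop n x) (neg (take n x)))) (trans (cong (take n) e) (take-++ (drop n y) (neg (take n y))))))
        where
        turn : Vec ℤ (n + n) → Vec ℤ (n + n)
        turn y = drop n y Vec.++ neg (take n y)
        take-drop : ∀ n {m} {w v : Vec ℤ (n + m)} → take n w ≡ take n v → drop n w ≡ drop n v → w ≡ v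
        take-drop n {w = w} {v} e e′ = trans (sym (Vec.take++drop≡id n w)) (trans (cong₂ Vec._++_ e e′) (Vec.take++drop≡id n v))

      -- Both pairs are parallel to the generic Y, hence to each other. Applying the form to that
      -- identity makes the two halves of the dot product cancel; the quarter turn supplies the
      -- sign.
      orthogonal : ∀ {w y} → φ.φ² w ∥ Y → turned y ∥ Y → dot w y ∼ + 0
      orthogonal {w} {y} ew ey = ∼-trans (∼-reflexive (trans (dot-++ n w y) (cong (ℤ._+ dot (drop n w) (drop n y)) flip)))
        (∼-trans (+-∼ (neg-∼ (dual (take n w) (neg (take n y)))) (dual (drop n w) (drop n y)))
        (∼-trans (+-∼ (neg-∼ (⟨⟩-cong (∥-trans {X = φ.φ² w} {Z = turned y} Y-generic ew (∥-sym ey)))) (∼-refl {⟨ φ.φ (drop n w) , ψ.φ (drop n y) ⟩}))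
          (∼-reflexive (ℤ.+-inverseˡ ⟨ φ.φ (drop n w) , ψ.φ (drop n y) ⟩))))
        where
        dot-neg : ∀ {m} (x z : Vec ℤ m) → dot x (neg z) ≡ ℤ.- dot x z
        dot-neg []      []      = refl
        dot-neg (a ∷ x) (b ∷ z) = trans (cong (λ u → a ℤ.* (+ 0 ℤ.- b) ℤ.+ u) (dot-neg x z))
          (solve 3 (λ a b d → a :* (con (+ 0) :- b) :+ (:- d) := :- (a :* b :+ d)) refl a b (dot x z))
          where open ℤ.+-*-Solver
        flip : dot (take n w) (take n y) ≡ ℤ.- dot (take n w) (neg (take n y))
        flip = sym (trans (cong ℤ.-_ (dot-neg (take n w) (take n y))) (ℤ.neg-involutive _))

      private
        ψ⁻¹ : A → Vec ℤ n
        ψ⁻¹ X = proj₁ (ψ.surjective X)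

        scaled : Vec ℤ n → A → A
        scaled x Z i = F._*ᶠ_ i (φ.φ x i) (Z i)

        -- Built so that its turned image is φ x times Y. As x varies this gives pⁿ members of the
        -- complement that are incongruent to one another.
        representative : Vec ℤ n → Vec ℤ (n + n)
        representative x = neg (ψ⁻¹ (scaled x y₂)) Vec.++ ψ⁻¹ (scaled x y₁)

      T : List (Vec ℤ (n + n))
      T = map representative (Res n)

      length-T : length T ≡ p ^ n
      length-T = trans (length-map representative (Res n)) (trans (sym (*-identityʳ _)) (trans (sym (∑-const (Res n) 1)) (trans (∑-Res-const n 1) (*-identityʳ _))))

      T⊆ : ∀ {t} → t ∈ T → turned t ∥ Y
      T⊆ t∈ with ∈-map⁻ representative t∈
      ... | x , _ , refl = ∥-resp
        (λ i → F.sym i (F.trans i (F.reflexive i (cong (λ z → ψ.φ z i) (drop-++ (neg (ψ⁻¹ (scaled x y₂))) _))) (proj₂ (ψ.surjective (scaled x y₁)) i)))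
        (λ i → F.sym i (F.trans i (F.reflexive i (cong (λ z → ψ.φ z i) (trans (cong neg (take-++ (neg (ψ⁻¹ (scaled x y₂))) _)) (neg-neg _)))) (proj₂ (ψ.surjective (scaled x y₂)) i)))
        (λ i → F.trans i (F.*-assoc i _ _ _) (F.trans i (F.*-congˡ i (F.*-comm i _ _)) (F.sym i (F.*-assoc i _ _ _))))

      private
        -- In a component where φ x and φ x′ differ, both entries of Y would have to vanish.
        scaled-injective : ∀ {x x′} → scaled x y₁ ≈ᴬ scaled x′ y₁ → scaled x y₂ ≈ᴬ scaled x′ y₂ → x ≋ x′
        scaled-injective {x} {x′} e₁ e₂ = φ.injective′ λ i → decidable-stable (F._≟_ i (φ.φ x i) (φ.φ x′ i)) λ x≉ →
          Y-generic i (zero-at i e₁ x≉ , zero-at i e₂ x≉)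
          where
          zero-at : ∀ {Z} i → scaled x Z ≈ᴬ scaled x′ Z → ¬ F._≈_ i (φ.φ x i) (φ.φ x′ i) → F._≈_ i (Z i) (F.0# i)
          zero-at {Z} i e x≉ = decidable-stable (F._≟_ i (Z i) (F.0# i)) λ Z≉ → x≉ (F.*-cancel i Z≉
            (F.trans i (F.*-comm i _ _) (F.trans i (e i) (F.*-comm i _ _))))

        ψ⁻¹-injective : ∀ {X X′} → ψ⁻¹ X ≋ ψ⁻¹ X′ → X ≈ᴬ X′
        ψ⁻¹-injective {X} {X′} e i = F.trans i (F.sym i (proj₂ (ψ.surjective X) i)) (F.trans i (ψ.φ-cong e i) (proj₂ (ψ.surjective X′) i))

        representative-injective : ∀ {x x′} → representative x ≋ representative x′ → x ≋ x′
        representative-injective {x} {x′} e = scaled-injective (ψ⁻¹-injective (++-≋ʳ {x = neg (ψ⁻¹ (scaled x y₂))} {neg (ψ⁻¹ (scaled x′ y₂))} e))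
          (ψ⁻¹-injective (≋-trans (≋-reflexive (sym (neg-neg _))) (≋-trans (neg-≋ (++-≋ˡ e)) (≋-reflexive (neg-neg _)))))

      T-incongruent : ∀ z → ∑[ t ∈ T ] 𝟙 (t ≋? z) ≤ 1
      T-incongruent z = ≤-trans (≤-reflexive (∑-map representative (Res n) _)) (#≤1 (λ x → representative x ≋? z) (Res-unique n)
        (λ x∈ x′∈ e e′ → Res-injective x∈ x′∈ (representative-injective (≋-trans e (≋-sym e′)))))

      line-duality : ∀ M Q e → 1 ≤ M → 2 * M ≤ p → (n + n) * (M * Q) < e → 6 * e ≤ p →
        Lattice.points (φ.line Y) M * (p ^ n * (length (Ball (n + n) Q) * e)) ≤ Lattice.points (ψ.line Y) (2 * Q) * (p ^ (n + n) * p)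
      line-duality M Q e 1≤M 2M≤p lt 6e≤p = ≤-trans
        (≤-reflexive (cong (λ t → Lattice.points (φ.line Y) M * (t * (length (Ball (n + n) Q) * e))) (sym length-T)))
        (≤-trans (Duality.duality (φ.line Y) complement (λ {w} {y} → orthogonal {w} {y})
           (λ {x} {y} eq → ∥-resp (ψ.φ-cong (drop-≋ n eq)) (ψ.φ-cong (neg-≋ (take-≋ n eq))))
           T⊆ T-incongruent M Q e 1≤M 2M≤p lt 6e≤p)
          (*-monoˡ-≤ (p ^ (n + n) * p) (points-complement (2 * Q))))

-- Growth of lattice point counts

module Scales where

  open import Data.Nat
  open import Data.Nat.DivMod
  open import Data.Nat.Properties
  open import Data.Nat.Solver using (module +-*-Solver)
  open import Data.Product using (_×_; _,_)
  open import Data.Sum using (_⊎_; inj₁; inj₂)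
  open import Data.Empty using (⊥-elim)
  open import Relation.Binary.PropositionalEquality
  open import Relation.Nullary

  open +-*-Solver

  -- In module Dichotomy the sequences count the points of a lattice and of its dual at scales L ^ i, with P = L ^ n.
  module Dichotomy (α β : ℕ → ℕ) (α⁺ : ∀ i → 1 ≤ α i) (P pⁿ C D κ k : ℕ) (P⁺ : 1 ≤ P) (pⁿ⁺ : 1 ≤ pⁿ) (D⁺ : 1 ≤ D)
    (convex : ∀ j i → j ≤ i → α (suc j) * α i ≤ D * α (suc i) * α j)
    (α-dual : ∀ i j → i + j ≡ k → α i * pⁿ ≤ C * (P ^ i * P ^ i) * β j)
    (β-dual : ∀ i j → i + j ≡ k → β i * pⁿ ≤ C * (P ^ i * P ^ i) * α j)
    (Pᵏ≤ : P ^ k ≤ κ * pⁿ) where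

    private
      instance
        P≢0 : NonZero P
        P≢0 = >-nonZero P⁺
        pⁿ≢0 : NonZero pⁿ
        pⁿ≢0 = >-nonZero pⁿ⁺
        D≢0 : NonZero D
        D≢0 = >-nonZero D⁺
      open ≤-Reasoning

    -- The summand D pays for log-convexity in `growth`, the summand C² κ² for two uses of duality
    -- in `flat`; X pays for the single use in `transfer`.
    Y X : ℕ
    Y = D + C * C * (κ * κ)
    X = C * κ

    module _ {j} (steep : Y * P * α j ≤ α (suc j)) where

      -- Log-convexity carries the steep ratio at j to every later level. The constant D lost in
      -- this is part of Y.
      growth : ∀ i → j ≤ i → P * α i ≤ α (suc i)
      growth i j≤i = *-cancelˡ-≤ (D * α j) {{m*n≢0 D (α j) {{D≢0}} {{>-nonZero (α⁺ j)}}}} (begin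
        D * α j * (P * α i)        ≡⟨ solve 4 (λ d a p b → d :* a :* (p :* b) := d :* p :* a :* b) refl D (α j) P (α i) ⟩
        D * P * α j * α i          ≤⟨ *-monoˡ-≤ (α i) (*-monoˡ-≤ (α j) (*-monoˡ-≤ P (m≤m+n D _))) ⟩
        Y * P * α j * α i          ≤⟨ *-monoˡ-≤ (α i) steep ⟩
        α (suc j) * α i            ≤⟨ convex j i j≤i ⟩
        D * α (suc i) * α j        ≡⟨ solve 3 (λ d a b → d :* a :* b := d :* b :* a) refl D (α (suc i)) (α j) ⟩
        D * α j * α (suc i)        ∎)

      growth* : ∀ t h → j ≤ h → P ^ t * α h ≤ α (h + t)
      growth* zero    h j≤h = ≤-reflexive (trans (+-identityʳ _) (cong α (sym (+-identityʳ h))))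
      growth* (suc t) h j≤h = begin
        P * P ^ t * α h            ≡⟨ *-assoc P (P ^ t) (α h) ⟩
        P * (P ^ t * α h)          ≤⟨ *-monoʳ-≤ P (growth* t h j≤h) ⟩
        P * α (h + t)              ≤⟨ growth (h + t) (≤-trans j≤h (m≤m+n h t)) ⟩
        α (suc (h + t))            ≡⟨ cong α (+-suc h t) ⟨
        α (h + suc t)              ∎

      -- From level h the count climbs at rate P to level h + t, whose dual level is h again. Since
      -- 2 (h + t) = t + k, the factor P ^ t gained in the climb cancels that lost to duality.
      transfer : ∀ h t → j ≤ h → h + t + h ≡ k → α h ≤ X * β h
      transfer h t j≤h eq = *-cancelˡ-≤ (P ^ t * pⁿ) {{m*n≢0 (P ^ t) pⁿ {{m^n≢0 P t}}}} (begin
        P ^ t * pⁿ * α h                        ≡⟨ solve 3 (λ a b c → a :* b :* c := a :* c :* b) refl (P ^ t) pⁿ (α h) ⟩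
        P ^ t * α h * pⁿ                        ≤⟨ *-monoˡ-≤ pⁿ (growth* t h j≤h) ⟩
        α (h + t) * pⁿ                          ≤⟨ α-dual (h + t) h eq ⟩
        C * (P ^ (h + t) * P ^ (h + t)) * β h   ≡⟨ cong (λ z → C * z * β h) split ⟩
        C * (P ^ t * P ^ k) * β h               ≤⟨ *-monoˡ-≤ (β h) (*-monoʳ-≤ C (*-monoʳ-≤ (P ^ t) Pᵏ≤)) ⟩
        C * (P ^ t * (κ * pⁿ)) * β h            ≡⟨ solve 5 (λ c t k p b → c :* (t :* (k :* p)) :* b := t :* p :* (c :* k :* b)) refl C (P ^ t) κ pⁿ (β h) ⟩
        P ^ t * pⁿ * (X * β h)                  ∎)
        where
        split : P ^ (h + t) * P ^ (h + t) ≡ P ^ t * P ^ k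
        split = trans (sym (^-distribˡ-+-* P (h + t) (h + t))) (trans (cong (P ^_) (trans (solve 2 (λ h t → h :+ t :+ (h :+ t) := t :+ (h :+ t :+ h)) refl h t) (cong (λ z → t + z) eq)))
          (^-distribˡ-+-* P t k))

      -- Duality sends level j′ + 1 of β to level i of α, and level i + 1 of α back to level j′ of
      -- β. Growth of α by at least P in between becomes growth of β by at most Y P.
      flat : ∀ j′ i → j ≤ i → suc j′ + i ≡ k → β (suc j′) ≤ Y * P * β j′
      flat j′ i j≤i eq = *-cancelˡ-≤ (pⁿ * pⁿ * P) {{m*n≢0 (pⁿ * pⁿ) P {{m*n≢0 pⁿ pⁿ}}}} (begin
        pⁿ * pⁿ * P * β (suc j′)
          ≡⟨ solve 3 (λ p q b → p :* p :* q :* b := b :* p :* (p :* q)) refl pⁿ P (β (suc j′)) ⟩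
        β (suc j′) * pⁿ * (pⁿ * P)
          ≤⟨ *-monoˡ-≤ (pⁿ * P) (β-dual (suc j′) i eq) ⟩
        C * S * α i * (pⁿ * P)
          ≡⟨ solve 5 (λ c s a p q → c :* s :* a :* (p :* q) := c :* s :* (q :* a :* p)) refl C S (α i) pⁿ P ⟩
        C * S * (P * α i * pⁿ)
          ≤⟨ *-monoʳ-≤ (C * S) (≤-trans (*-monoˡ-≤ pⁿ (growth i j≤i)) (α-dual (suc i) j′ (trans (+-comm (suc i) j′) (trans (+-suc j′ i) eq)))) ⟩
        C * S * (C * S′ * β j′)
          ≡⟨ solve 4 (λ c s t b → c :* s :* (c :* t :* b) := c :* c :* (s :* t) :* b) refl C S S′ (β j′) ⟩
        C * C * (S * S′) * β j′
          ≡⟨ cong (λ z → C * C * z * β j′) split ⟩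
        C * C * (P ^ k * P ^ k * (P * P)) * β j′
          ≤⟨ *-monoˡ-≤ (β j′) (*-monoʳ-≤ (C * C) (*-monoˡ-≤ (P * P) (*-mono-≤ Pᵏ≤ Pᵏ≤))) ⟩
        C * C * (κ * pⁿ * (κ * pⁿ) * (P * P)) * β j′
          ≡⟨ solve 5 (λ c k p q b → c :* c :* (k :* p :* (k :* p) :* (q :* q)) :* b := p :* p :* q :* (c :* c :* (k :* k) :* q :* b)) refl C κ pⁿ P (β j′) ⟩
        pⁿ * pⁿ * P * (C * C * (κ * κ) * P * β j′)
          ≤⟨ *-monoʳ-≤ (pⁿ * pⁿ * P) (*-monoˡ-≤ (β j′) (*-monoˡ-≤ P (m≤n+m _ D))) ⟩
        pⁿ * pⁿ * P * (Y * P * β j′) ∎)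
        where
        S S′ : ℕ
        S  = P ^ suc j′ * P ^ suc j′
        S′ = P ^ suc i * P ^ suc i
        join : P ^ suc j′ * P ^ suc i ≡ P ^ k * P
        join = trans (sym (^-distribˡ-+-* P (suc j′) (suc i))) (trans (cong (P ^_) (trans (+-suc (suc j′) i) (cong suc eq))) (*-comm P (P ^ k)))
        split : S * S′ ≡ P ^ k * P ^ k * (P * P)
        split = trans (solve 2 (λ a b → a :* a :* (b :* b) := a :* b :* (a :* b)) refl (P ^ suc j′) (P ^ suc i))
          (trans (cong₂ _*_ join join) (solve 2 (λ a b → a :* b :* (a :* b) := a :* a :* (b :* b)) refl (P ^ k) P))

    Flat : (ℕ → ℕ) → ℕ → Set
    Flat f h = ∀ j → j < h → f (suc j) ≤ Y * P * f j

    -- A steep step of α below h makes α grow at all later levels. The levels of β up to h are dual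
    -- to levels of α that are at least h, since h + h ≤ k.
    dichotomy : ∀ h → h + h ≤ k → Flat α h ⊎ (Flat β h × α h ≤ X * β h)
    dichotomy h 2h≤k with allUpTo? (λ j → α (suc j) ≤? Y * P * α j) h
    ... | yes flat-α = inj₁ (λ j j<h → flat-α j<h)
    ... | no ¬flat with anyUpTo? (λ j → ¬? (α (suc j) ≤? Y * P * α j)) h
      where open import Relation.Nullary.Decidable using (¬?)
    ...   | no none = ⊥-elim (¬flat (λ {j} j<h → decidable-stable (α (suc j) ≤? Y * P * α j) (λ ¬le → none (j , j<h , ¬le))))
      where open import Relation.Nullary.Decidable using (decidable-stable)
    ...   | yes (j , j<h , ¬le) = inj₂
      ( (λ j′ j′<h → flat steep j′ (k ∸ suc j′) (≤-trans (<⇒≤ j<h) (m+n≤o⇒m≤o∸n h (≤-trans (+-monoʳ-≤ h j′<h) 2h≤k)))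
          (m+[n∸m]≡n (≤-trans (≤-trans j′<h (m≤m+n h h)) 2h≤k)))
      , transfer steep h (k ∸ (h + h)) (<⇒≤ j<h) (trans (solve 2 (λ h t → h :+ t :+ h := h :+ h :+ t) refl h (k ∸ (h + h))) (m+[n∸m]≡n 2h≤k)) )
      where
      steep : Y * P * α j ≤ α (suc j)
      steep = <⇒≤ (≰⇒> ¬le)

  *-^ : ∀ m n o → (m * n) ^ o ≡ m ^ o * n ^ o
  *-^ m n zero    = refl
  *-^ m n (suc o) = trans (cong (m * n *_) (*-^ m n o))
    (solve 4 (λ m n a b → m :* n :* (a :* b) := m :* a :* (n :* b)) refl m n (m ^ o) (n ^ o))

  floor-bound : ∀ m d .{{_ : NonZero d}} → m < d * suc (m / d)
  floor-bound m d = begin-strict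
    m                       ≡⟨ m≡m%n+[m/n]*n m d ⟩
    m % d + m / d * d       <⟨ +-monoˡ-< (m / d * d) (m%n<n m d) ⟩
    d + m / d * d           ≡⟨ *-comm (suc (m / d)) d ⟩
    d * suc (m / d)         ∎
    where open ≤-Reasoning

  module ScaledDuality (N K : ℕ) (K⁺ : 1 ≤ K) where

    -- With e = p / 6 one has p ≤ 12 e, and 2 N + 1 exceeds the dimension n + n; so c₀ M Q ≤ p
    -- forces (n + n) M Q < e.
    c₀ : ℕ
    c₀ = 12 * suc (2 * N)

    -- The three factors of the base come from dilating M₀ to M, from comparing p with M₀ Q₀, and
    -- from dilating Q to 2 Q₀; the 12 is that of p ≤ 12 e.
    dualityConstant : ℕ
    dualityConstant = 12 * (4 * c₀ * K * (2 * c₀) * (8 * K)) ^ (2 * N)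

    private
      instance
        K≢0 : NonZero K
        K≢0 = >-nonZero K⁺
        c₀K≢0 : NonZero (c₀ * K)
        c₀K≢0 = m*n≢0 c₀ K

    module _ (p n : ℕ) (n≤N : n ≤ N) (c₀≤p : c₀ ≤ p) (a b : ℕ → ℕ)
      (b-mono : ∀ {M M′} → M ≤ M′ → b M ≤ b M′) (a-mono : ∀ {M M′} → M ≤ M′ → a M ≤ a M′)
      (a-dilate : ∀ c M → a (c * M) ≤ (2 * c) ^ (n + n) * a M) (b-dilate : ∀ c M → b (c * M) ≤ (2 * c) ^ (n + n) * b M)
      (raw : ∀ M Q e → 1 ≤ M → 2 * M ≤ p → (n + n) * (M * Q) < e → 6 * e ≤ p → a M * (p ^ n * (Q ^ (n + n) * e)) ≤ b (2 * Q) * (p ^ (n + n) * p))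
      where

      private
        D : ℕ
        D = n + n
        D≤2N : D ≤ 2 * N
        D≤2N = ≤-trans (+-mono-≤ n≤N n≤N) (≤-reflexive (cong (λ z → N + z) (sym (+-identityʳ N))))
        instance
          p≢0 : NonZero p
          p≢0 = >-nonZero (≤-trans (s≤s z≤n) c₀≤p)
          pⁿ≢0 : NonZero (p ^ n)
          pⁿ≢0 = m^n≢0 p n
        open ≤-Reasoning

        base : ∀ M Q → 1 ≤ M → 1 ≤ Q → c₀ * (M * Q) ≤ p → a M * Q ^ D ≤ 12 * b (2 * Q) * p ^ n
        base M Q 1≤M 1≤Q le = *-cancelˡ-≤ (p ^ n * p) {{m*n≢0 (p ^ n) p}} (begin
          p ^ n * p * (a M * Q ^ D)            ≤⟨ *-monoˡ-≤ (a M * Q ^ D) (*-monoʳ-≤ (p ^ n) p≤12e) ⟩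
          p ^ n * (12 * e) * (a M * Q ^ D)     ≡⟨ solve 5 (λ p e a q t → p :* (t :* e) :* (a :* q) := t :* (a :* (p :* (q :* e)))) refl (p ^ n) e (a M) (Q ^ D) 12 ⟩
          12 * (a M * (p ^ n * (Q ^ D * e)))   ≤⟨ *-monoʳ-≤ 12 (raw M Q e 1≤M 2M≤p lt (≤-trans (≤-reflexive (*-comm 6 e)) (m/n*n≤m p 6))) ⟩
          12 * (b (2 * Q) * (p ^ D * p))       ≡⟨ cong (λ z → 12 * (b (2 * Q) * (z * p))) (^-distribˡ-+-* p n n) ⟩
          12 * (b (2 * Q) * (p ^ n * p ^ n * p)) ≡⟨ solve 4 (λ t b u p → t :* (b :* (u :* u :* p)) := u :* p :* (t :* b :* u)) refl 12 (b (2 * Q)) (p ^ n) p ⟩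
          p ^ n * p * (12 * b (2 * Q) * p ^ n) ∎)
          where
          e = p / 6
          instance
            MQ≢0 : NonZero (M * Q)
            MQ≢0 = m*n≢0 M Q {{>-nonZero 1≤M}} {{>-nonZero 1≤Q}}
          12≤c₀ : 12 ≤ c₀
          12≤c₀ = m≤m*n 12 (suc (2 * N))
          2M≤p : 2 * M ≤ p
          2M≤p = ≤-trans (*-mono-≤ {2} {c₀} (≤-trans (m≤m+n 2 10) 12≤c₀) (m≤m*n M Q {{>-nonZero 1≤Q}})) le
          1≤e : 1 ≤ e
          1≤e = m≥n⇒m/n>0 (≤-trans (≤-trans (m≤m+n 6 6) 12≤c₀) c₀≤p)
          p≤12e : p ≤ 12 * e
          p≤12e = ≤-trans (<⇒≤ (floor-bound p 6)) (≤-trans (*-monoʳ-≤ 6 (+-monoˡ-≤ e 1≤e)) (≤-reflexive (solve 1 (λ e → con 6 :* (e :+ e) := con 12 :* e) refl e)))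
          lt : D * (M * Q) < e
          lt = *-cancelˡ-< 12 _ _ (begin-strict
            12 * (D * (M * Q))                    <⟨ *-monoʳ-< 12 (*-monoˡ-< (M * Q) (s≤s D≤2N)) ⟩
            12 * (suc (2 * N) * (M * Q))          ≡⟨ *-assoc 12 (suc (2 * N)) (M * Q) ⟨
            c₀ * (M * Q)                          ≤⟨ le ⟩
            p                                     ≤⟨ p≤12e ⟩
            12 * e ∎)

      -- The second moment argument needs M Q below p by a constant factor, while here M Q is at
      -- least p. So both radii are shrunk by constants to M₀ and Q₀, and the counts are dilated
      -- back.
      scaled-duality : ∀ M Q → 1 ≤ M → M ≤ K * p → p ≤ M * Q → a M * p ^ n ≤ dualityConstant * M ^ (n + n) * b Q
      scaled-duality M Q 1≤M M≤Kp p≤MQ = *-cancelˡ-≤ (p ^ n) (begin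
        p ^ n * (a M * p ^ n)
          ≡⟨ trans (solve 2 (λ u a → u :* (a :* u) := a :* (u :* u)) refl (p ^ n) (a M)) (cong (a M *_) (sym (^-distribˡ-+-* p n n))) ⟩
        a M * p ^ D
          ≤⟨ *-mono-≤ (≤-trans (a-mono M≤) (a-dilate (2 * c₀ * K) M₀)) (^-monoˡ-≤ D p≤) ⟩
        (2 * (2 * c₀ * K)) ^ D * a M₀ * (2 * c₀ * (M₀ * Q₀)) ^ D
          ≡⟨ cong₂ (λ u v → u ^ D * a M₀ * v) (solve 2 (λ c k → con 2 :* (con 2 :* c :* k) := con 4 :* c :* k) refl c₀ K)
               (trans (*-^ (2 * c₀) (M₀ * Q₀) D) (cong ((2 * c₀) ^ D *_) (*-^ M₀ Q₀ D))) ⟩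
        (4 * c₀ * K) ^ D * a M₀ * ((2 * c₀) ^ D * (M₀ ^ D * Q₀ ^ D))
          ≡⟨ solve 5 (λ u a v m q → u :* a :* (v :* (m :* q)) := u :* v :* m :* (a :* q)) refl ((4 * c₀ * K) ^ D) (a M₀) ((2 * c₀) ^ D) (M₀ ^ D) (Q₀ ^ D) ⟩
        (4 * c₀ * K) ^ D * (2 * c₀) ^ D * M₀ ^ D * (a M₀ * Q₀ ^ D)
          ≤⟨ *-mono-≤ (*-monoʳ-≤ ((4 * c₀ * K) ^ D * (2 * c₀) ^ D) (^-monoˡ-≤ D M₀≤M)) (base M₀ Q₀ 1≤M₀ 1≤Q₀ fits) ⟩
        (4 * c₀ * K) ^ D * (2 * c₀) ^ D * M ^ D * (12 * b (2 * Q₀) * p ^ n)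
          ≤⟨ *-monoʳ-≤ ((4 * c₀ * K) ^ D * (2 * c₀) ^ D * M ^ D) (*-monoˡ-≤ (p ^ n) (*-monoʳ-≤ 12 (≤-trans (b-mono 2Q₀≤) (b-dilate (4 * K) Q)))) ⟩
        (4 * c₀ * K) ^ D * (2 * c₀) ^ D * M ^ D * (12 * ((2 * (4 * K)) ^ D * b Q) * p ^ n)
          ≡⟨ cong (λ z → (4 * c₀ * K) ^ D * (2 * c₀) ^ D * M ^ D * (12 * (z ^ D * b Q) * p ^ n)) (sym (*-assoc 2 4 K)) ⟩
        (4 * c₀ * K) ^ D * (2 * c₀) ^ D * M ^ D * (12 * ((8 * K) ^ D * b Q) * p ^ n)
          ≡⟨ solve 7 (λ u v m t w b p → u :* v :* m :* (t :* (w :* b) :* p) := p :* (t :* (u :* v :* w) :* m :* b)) refl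
               ((4 * c₀ * K) ^ D) ((2 * c₀) ^ D) (M ^ D) 12 ((8 * K) ^ D) (b Q) (p ^ n) ⟩
        p ^ n * (12 * ((4 * c₀ * K) ^ D * (2 * c₀) ^ D * (8 * K) ^ D) * M ^ D * b Q)
          ≡⟨ cong (λ z → p ^ n * (12 * z * M ^ D * b Q)) (sym (trans (*-^ (4 * c₀ * K * (2 * c₀)) (8 * K) D) (cong (_* (8 * K) ^ D) (*-^ (4 * c₀ * K) (2 * c₀) D)))) ⟩
        p ^ n * (12 * (4 * c₀ * K * (2 * c₀) * (8 * K)) ^ D * M ^ D * b Q)
          ≤⟨ *-monoʳ-≤ (p ^ n) (*-monoˡ-≤ (b Q) (*-monoˡ-≤ (M ^ D) (*-monoʳ-≤ 12 (^-monoʳ-≤ (4 * c₀ * K * (2 * c₀) * (8 * K)) {{base≢0}} D≤2N)))) ⟩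
        p ^ n * (dualityConstant * M ^ D * b Q) ∎)
        where
        base≢0 : NonZero (4 * c₀ * K * (2 * c₀) * (8 * K))
        base≢0 = m*n≢0 (4 * c₀ * K * (2 * c₀)) (8 * K) {{m*n≢0 (4 * c₀ * K) (2 * c₀) {{m*n≢0 (4 * c₀) K}}}} {{m*n≢0 8 K}}
        M₁ M₀ : ℕ
        M₁ = M / (c₀ * K)
        -- The maximum with 1 covers M below c₀ K, where the quotient is 0.
        M₀ = 1 ⊔ M₁
        1≤M₀ : 1 ≤ M₀
        1≤M₀ = m≤m⊔n 1 M₁
        instance
          M₀≢0 : NonZero M₀
          M₀≢0 = >-nonZero 1≤M₀
          c₀M₀≢0 : NonZero (c₀ * M₀)
          c₀M₀≢0 = m*n≢0 c₀ M₀
        Q₀ : ℕ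
        Q₀ = p / (c₀ * M₀)
        c₀M₁≤p : c₀ * M₁ ≤ p
        c₀M₁≤p = *-cancelˡ-≤ K (≤-trans (≤-reflexive (solve 3 (λ k c m → k :* (c :* m) := m :* (c :* k)) refl K c₀ M₁)) (≤-trans (m/n*n≤m M (c₀ * K)) M≤Kp))
        c₀M₀≤p : c₀ * M₀ ≤ p
        c₀M₀≤p with ⊔-sel 1 M₁
        ... | inj₁ e = ≤-trans (≤-reflexive (trans (cong (c₀ *_) e) (*-identityʳ c₀))) c₀≤p
        ... | inj₂ e = ≤-trans (≤-reflexive (cong (c₀ *_) e)) c₀M₁≤p
        M≤ : M ≤ 2 * c₀ * K * M₀
        M≤ = ≤-trans (<⇒≤ (floor-bound M (c₀ * K))) (≤-trans (*-monoʳ-≤ (c₀ * K) (+-mono-≤ 1≤M₀ (m≤n⊔m 1 M₁)))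
          (≤-reflexive (solve 3 (λ c k m → c :* k :* (m :+ m) := con 2 :* c :* k :* m) refl c₀ K M₀)))
        M₀≤M : M₀ ≤ M
        M₀≤M = ⊔-lub 1≤M (m/n≤m M (c₀ * K))
        1≤Q₀ : 1 ≤ Q₀
        1≤Q₀ = m≥n⇒m/n>0 c₀M₀≤p
        fits : c₀ * (M₀ * Q₀) ≤ p
        fits = ≤-trans (≤-reflexive (solve 3 (λ c m q → c :* (m :* q) := q :* (c :* m)) refl c₀ M₀ Q₀)) (m/n*n≤m p (c₀ * M₀))
        p≤ : p ≤ 2 * c₀ * (M₀ * Q₀)
        p≤ = ≤-trans (<⇒≤ (floor-bound p (c₀ * M₀))) (≤-trans (*-monoʳ-≤ (c₀ * M₀) (+-monoˡ-≤ Q₀ 1≤Q₀))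
          (≤-reflexive (solve 3 (λ c m q → c :* m :* (q :+ q) := con 2 :* c :* (m :* q)) refl c₀ M₀ Q₀)))
        2Q₀≤ : 2 * Q₀ ≤ 4 * K * Q
        2Q₀≤ = *-cancelˡ-≤ (c₀ * M₀) (begin
          c₀ * M₀ * (2 * Q₀)               ≡⟨ solve 3 (λ c m q → c :* m :* (con 2 :* q) := con 2 :* (c :* (m :* q))) refl c₀ M₀ Q₀ ⟩
          2 * (c₀ * (M₀ * Q₀))             ≤⟨ *-monoʳ-≤ 2 (≤-trans fits (≤-trans p≤MQ (*-monoˡ-≤ Q M≤))) ⟩
          2 * (2 * c₀ * K * M₀ * Q)        ≡⟨ solve 4 (λ c k m q → con 2 :* (con 2 :* c :* k :* m :* q) := c :* m :* (con 4 :* k :* q)) refl c₀ K M₀ Q ⟩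
          c₀ * M₀ * (4 * K * Q)            ∎)

-- Counts at powers of L, and generic and degenerate points of a line

module Filtration (p : ℕ) (prime : Prime p) where

  open Counting
  open Balls
  open Residues p prime
  open Fields p prime
  open DualLines p prime
  open Scales
  open import Data.Empty using (⊥-elim)
  open import Data.Fin.Base as Fin using (Fin; toℕ)
  import Data.Fin.Properties as Fin
  open import Data.Integer.Base as ℤ using (ℤ; +_)
  import Data.Integer.Properties as ℤ
  import Data.Integer.Solver as ℤ
  open import Data.Integer.DivMod using (_%ℕ_)
  open import Data.List.Base using (length; allFin)
  open import Data.List.Properties using (length-tabulate)
  open import Data.List.Membership.Propositional using (_∈_)
  open import Data.List.Membership.Propositional.Properties using (∈-allFin)
  open import Data.Nat using (zero; suc; _+_; _*_; _^_; _∸_; _≤_; _<_; NonZero; >-nonZero; pred)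
  open import Data.Nat.Properties
  open import Data.Nat.Solver using (module +-*-Solver)
  open import Data.Product using (∃; _,_; proj₁; proj₂)
  open import Data.Vec.Base as Vec using (Vec; lookup)
  import Data.Vec.Properties as Vec
  open import Function.Base using (id)
  open import Level using (Level)
  open import Relation.Binary.PropositionalEquality
  open import Relation.Nullary
  open import Relation.Nullary.Decidable using (_×-dec_; ¬?)

  private variable
    c ℓ : Level
    n s : ℕ

  module Levels (N K L k : ℕ) (K⁺ : 1 ≤ K) (L⁺ : 1 ≤ L) (p≤Lᵏ : p ≤ L ^ k) (Lᵏ≤Kp : L ^ k ≤ K * p) where

    open ScaledDuality N K K⁺

    -- D is the cost of a dilation by 3 in dimension at most 2 N; κ comes from (L ^ k) ^ n ≤ (K p) ^
    -- n.
    D κ : ℕ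
    D = 6 ^ (2 * N)
    κ = K ^ N

    private instance
      L≢0 : NonZero L
      L≢0 = >-nonZero L⁺
      K≢0 : NonZero K
      K≢0 = >-nonZero K⁺

    1≤Lⁱ : ∀ i → 1 ≤ L ^ i
    1≤Lⁱ i = m^n>0 L i

    power-swap : ∀ i n → (L ^ i) ^ (n + n) ≡ (L ^ n) ^ i * (L ^ n) ^ i
    power-swap i n = trans (^-distribˡ-+-* (L ^ i) n n) (cong₂ _*_ swap swap)
      where
      swap : (L ^ i) ^ n ≡ (L ^ n) ^ i
      swap = trans (^-*-assoc L i n) (trans (cong (L ^_) (*-comm i n)) (sym (^-*-assoc L n i)))

    module Line {s} {F : Fin s → Fld c ℓ} (n≤N : n ≤ N) (c₀≤p : c₀ ≤ p) (φ ψ : Algebra.Coord F n) (φψ : Dual φ ψ)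
      (Y : Algebra.A² F) (generic : Algebra.Generic F Y) where
      open Algebra F

      α β : ℕ → ℕ
      α i = Lattice.points (Coord.line φ Y) (L ^ i)
      β i = Lattice.points (Coord.line ψ Y) (L ^ i)

      private
        raw : ∀ (φ ψ : Coord n) → Dual φ ψ → ∀ M Q e → 1 ≤ M → 2 * M ≤ p → (n + n) * (M * Q) < e → 6 * e ≤ p →
              Lattice.points (Coord.line φ Y) M * (p ^ n * (Q ^ (n + n) * e)) ≤ Lattice.points (Coord.line ψ Y) (2 * Q) * (p ^ (n + n) * p)
        raw φ ψ d M Q e 1≤M 2M≤p lt 6e≤p = ≤-trans
          (*-monoʳ-≤ (Lattice.points (Coord.line φ Y) M) (*-monoʳ-≤ (p ^ n) (*-monoˡ-≤ e (many Q))))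
          (LineDuality.line-duality φ ψ d Y generic M Q e 1≤M 2M≤p lt 6e≤p)
          where
          pow : ∀ Q → Q ^ (n + n) ≤ (2 * Q ∸ 1) ^ (n + n)
          pow zero    = ≤-refl
          pow (suc Q) = ^-monoˡ-≤ (n + n) (≤-trans (m≤n+m (suc Q) Q) (≤-reflexive (cong (λ z → Q + suc z) (sym (+-identityʳ Q)))))
          many : ∀ Q → Q ^ (n + n) ≤ length (Ball (n + n) Q)
          many Q = ≤-trans (pow Q) (≤-reflexive (sym (trans (sym (*-identityʳ _)) (trans (sym (∑-const (Ball (n + n) Q) 1))
            (trans (∑-box-const (n + n) (Vec.replicate (n + n) (ℤ.- (+ Q))) (2 * Q ∸ 1) 1) (*-identityʳ _))))))

        dual-level : ∀ (φ ψ : Coord n) → Dual φ ψ → ∀ i j → i + j ≡ k →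
          Lattice.points (Coord.line φ Y) (L ^ i) * p ^ n ≤ dualityConstant * ((L ^ n) ^ i * (L ^ n) ^ i) * Lattice.points (Coord.line ψ Y) (L ^ j)
        dual-level φ ψ d i j i+j≡k = ≤-trans
          (scaled-duality p n n≤N c₀≤p a b (Lattice.points-mono (Coord.line ψ Y)) (Lattice.points-mono (Coord.line φ Y)) (Lattice.points-dilate (Coord.line φ Y)) (Lattice.points-dilate (Coord.line ψ Y))
            (raw φ ψ d) (L ^ i) (L ^ j) (1≤Lⁱ i) (≤-trans (^-monoʳ-≤ L (≤-trans (m≤m+n i j) (≤-reflexive i+j≡k))) Lᵏ≤Kp)
            (≤-trans p≤Lᵏ (≤-reflexive (trans (cong (L ^_) (sym i+j≡k)) (^-distribˡ-+-* L i j)))))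
          (≤-reflexive (cong (λ z → dualityConstant * z * b (L ^ j)) (power-swap i n)))
          where
          a b : ℕ → ℕ
          a = Lattice.points (Coord.line φ Y)
          b = Lattice.points (Coord.line ψ Y)

        convex : ∀ j i → j ≤ i → α (suc j) * α i ≤ D * α (suc i) * α j
        convex j i j≤i = ≤-trans (points-convex (pred ℓ₀) (L ^ j) (L ^ suc j) (L ^ i) (≤-reflexive scale))
          (*-monoˡ-≤ (α j) (≤-trans (points-mono top) (≤-trans (points-dilate 3 (L ^ suc i)) (*-monoˡ-≤ (α (suc i)) (^-monoʳ-≤ 6 2n≤2N)))))
          where
          open Lattice (Coord.line φ Y)
          open +-*-Solver
          2n≤2N : n + n ≤ 2 * N
          2n≤2N = ≤-trans (+-mono-≤ n≤N n≤N) (≤-reflexive (cong (λ z → N + z) (sym (+-identityʳ N))))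
          -- The multiplier 2 L ^ (i - j) meets the hypothesis of `points-convex` with equality, and
          -- the radius on the right is then L ^ i + 2 L ^ (i + 1), at most 3 L ^ (i + 1).
          ℓ₀ : ℕ
          ℓ₀ = 2 * L ^ (i ∸ j)
          ℓ₀≡ : suc (pred ℓ₀) ≡ ℓ₀
          ℓ₀≡ = suc-pred ℓ₀ {{m*n≢0 2 (L ^ (i ∸ j)) {{_}} {{m^n≢0 L (i ∸ j)}}}}
          join : L ^ (i ∸ j) * L ^ j ≡ L ^ i
          join = trans (sym (^-distribˡ-+-* L (i ∸ j) j)) (cong (L ^_) (m∸n+n≡m j≤i))
          scale : 2 * L ^ i ≡ suc (pred ℓ₀) * L ^ j
          scale = sym (trans (cong (_* L ^ j) ℓ₀≡) (trans (*-assoc 2 (L ^ (i ∸ j)) (L ^ j)) (cong (2 *_) join)))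
          top : L ^ i + suc (pred ℓ₀) * L ^ suc j ≤ 3 * L ^ suc i
          top = ≤-trans (+-mono-≤ (m≤n*m (L ^ i) L) (≤-reflexive (trans (cong (_* L ^ suc j) ℓ₀≡)
            (trans (solve 3 (λ a l b → con 2 :* a :* (l :* b) := con 2 :* (l :* (a :* b))) refl (L ^ (i ∸ j)) L (L ^ j)) (cong (λ z → 2 * (L * z)) join)))))
            (≤-reflexive (solve 1 (λ x → x :+ con 2 :* x := con 3 :* x) refl (L ^ suc i)))

      module Dich = Dichotomy α β (λ i → Lattice.1≤points (Coord.line φ Y) (1≤Lⁱ i)) (L ^ n) (p ^ n) dualityConstant D κ k
        (m^n>0 L n) (m^n>0 p n) (m^n>0 6 (2 * N)) convex (dual-level φ ψ φψ) (dual-level ψ φ (Dual-sym {φ = φ} {ψ} φψ))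
        (≤-trans (≤-reflexive (trans (^-*-assoc L n k) (trans (cong (L ^_) (*-comm n k)) (sym (^-*-assoc L k n)))))
          (≤-trans (^-monoˡ-≤ n Lᵏ≤Kp) (≤-trans (≤-reflexive (*-^ K p n)) (*-monoˡ-≤ (p ^ n) (^-monoʳ-≤ K n≤N)))))

  module _ {s} {F : Fin s → Fld c ℓ} (φ : Algebra.Hom F n) (Y : Algebra.A² F) where
    open Algebra F
    private
      module φ = Hom φ
      module V = Lattice (φ.line Y)

    genericPoints degeneratePoints : ℕ → ℕ
    genericPoints    M = ∑[ w ∈ Ball (n + n) M ] 𝟙 ((φ.φ² w ∥? Y) ×-dec generic? (φ.φ² w))
    degeneratePoints M = ∑[ w ∈ Ball (n + n) M ] 𝟙 ((φ.φ² w ∥? Y) ×-dec ¬? (generic? (φ.φ² w)))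

    points-split : ∀ M → V.points M ≡ genericPoints M + degeneratePoints M
    points-split M = trans (∑-cong (Ball (n + n) M) (λ w → cases (φ.φ² w ∥? Y) (generic? (φ.φ² w)))) (∑-+ (Ball (n + n) M) _ _)
      where
      cases : ∀ {P Q : Set _} (d : Dec P) (e : Dec Q) → 𝟙 d ≡ 𝟙 (d ×-dec e) + 𝟙 (d ×-dec ¬? e)
      cases (no _)  _       = refl
      cases (yes _) (yes _) = refl
      cases (yes _) (no _)  = refl

    module _ (s<p : s < p) where
      private
        Λ : Fin s → Lattice (n + n) _
        Λ i = record
          { Member   = λ w → Zero i (φ.φ² w)
          ; member?  = λ w → zero? i (φ.φ² w)
          ; 𝟎-closed = φ.φ-null (≋-reflexive (take-𝟎 n)) i , φ.φ-null (≋-reflexive (drop-𝟎 n)) i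
          ; ⊖-closed = λ {x} {y} (x₁ , x₂) (y₁ , y₂) →
              F.trans i (F.reflexive i (cong (λ z → φ.φ z i) (take-⊖ n x y))) (Lattice.⊖-closed (φ.kernel i) x₁ y₁) ,
              F.trans i (F.reflexive i (cong (λ z → φ.φ z i) (drop-⊖ n x y))) (Lattice.⊖-closed (φ.kernel i) x₂ y₂)
          }

        Λ-≋ : ∀ i {x y} → x ≋ y → Lattice.Member (Λ i) x → Lattice.Member (Λ i) y
        Λ-≋ i e (x₁ , x₂) = F.trans i (F.sym i (φ.φ-cong (take-≋ n e) i)) x₁ , F.trans i (F.sym i (φ.φ-cong (drop-≋ n e) i)) x₂

        -- The multipliers are 1 , ... , s + 1. Starting at 1 and not at 0 keeps the map injective
        -- in u.
        shift : Vec ℤ (n + n) → Fin (suc s) → Vec ℤ (n + n) → Vec ℤ (n + n)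
        shift w a u = w ⊕ + suc (toℕ a) ⊙ u

        -- The two shifts differ by (b - a) u, where b - a is invertible because it is positive and
        -- at most s < p. So u vanishes in component i, and with it w.
        vanish : ∀ i w u {a b} → a Fin.< b → Zero i (φ.φ² (shift w a u)) → Zero i (φ.φ² (shift w b u)) → Zero i (φ.φ² w)
        vanish i w u {a} {b} a<b za zb = subst (λ x → Zero i (φ.φ² x)) (vec-ext (λ j →
            trans (lookup-⊖ j (shift w a u) (+ suc (toℕ a) ⊙ u)) (trans (cong (ℤ._- lookup (+ suc (toℕ a) ⊙ u) j) (lookup-⊕ j w (+ suc (toℕ a) ⊙ u)))
            (solve 2 (λ x y → x :+ y :- y := x) refl (lookup w j) (lookup (+ suc (toℕ a) ⊙ u) j)))))
          (Λ.⊖-closed {shift w a u} {+ suc (toℕ a) ⊙ u} za (Λ.⊙-closed (suc (toℕ a)) {u} zu))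
          where
          module Λ = Lattice (Λ i)
          open ℤ.+-*-Solver
          d : ℕ
          d = toℕ b ∸ toℕ a
          d≁0 : ¬ + d ∼ + 0
          d≁0 = small∼0 d (m<n⇒0<n∸m a<b) (≤-<-trans (m∸n≤m (toℕ b) (toℕ a)) (≤-<-trans (Fin.toℕ≤pred[n] b) s<p))
          difference′ : + d ⊙ u ≡ shift w b u ⊖ shift w a u
          difference′ = vec-ext (λ j → trans (lookup-⊙ j (+ d) u) (sym (trans (lookup-⊖ j (shift w b u) (shift w a u))
            (trans (cong₂ ℤ._-_ (trans (lookup-⊕ j w _) (cong (λ z → lookup w j ℤ.+ z) (lookup-⊙ j (+ suc (toℕ b)) u)))
                                (trans (lookup-⊕ j w _) (cong (λ z → lookup w j ℤ.+ z) (lookup-⊙ j (+ suc (toℕ a)) u))))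
            (trans (cong (λ t → lookup w j ℤ.+ + suc t ℤ.* lookup u j ℤ.- (lookup w j ℤ.+ + suc (toℕ a) ℤ.* lookup u j)) (sym (m∸n+n≡m (<⇒≤ a<b))))
            (solve 4 (λ w d a u → w :+ (con (+ 1) :+ (d :+ a)) :* u :- (w :+ (con (+ 1) :+ a) :* u) := d :* u) refl (lookup w j) (+ d) (+ toℕ a) (lookup u j)))))))
          q : ℕ
          q = proj₁ (inverse d≁0) %ℕ p
          zdu : Zero i (φ.φ² (+ d ⊙ u))
          zdu = subst (λ x → Zero i (φ.φ² x)) (sym difference′) (Λ.⊖-closed {shift w b u} {shift w a u} zb za)
          zu : Zero i (φ.φ² u)
          zu = Λ-≋ i (congruent λ j → ∼-trans (∼-reflexive (trans (lookup-⊙ j (+ q) (+ d ⊙ u)) (trans (cong (+ q ℤ.*_) (lookup-⊙ j (+ d) u)) (sym (ℤ.*-assoc (+ q) (+ d) (lookup u j))))))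
            (∼-trans (*-∼ (∼-trans (*-∼ (res∼ (proj₁ (inverse d≁0))) (∼-refl {+ d})) (proj₂ (inverse d≁0))) (∼-refl {lookup u j})) (∼-reflexive (ℤ.*-identityˡ (lookup u j)))))
            (Λ.⊙-closed q {+ d ⊙ u} zdu)

        -- Each component of w + a u vanishes for at most one of the s + 1 values of a.
        some-generic : ∀ w u → Generic (φ.φ² w) → ∃ λ a → Generic (φ.φ² (shift w a u))
        some-generic w u gen with Fin.any? (λ a → generic? (φ.φ² (shift w a u)))
        ... | yes found = found
        ... | no none = ⊥-elim (let a , b , a<b , e = Fin.pigeonhole (n<1+n s) (λ a → proj₁ (zero-at a)) in
                gen (proj₁ (zero-at a)) (vanish _ w u a<b (proj₂ (zero-at a)) (subst (λ i → Zero i (φ.φ² (shift w b u))) (sym e) (proj₂ (zero-at b)))))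
          where
          zero-at : ∀ a → ∃ λ i → Zero i (φ.φ² (shift w a u))
          zero-at a with Fin.any? (λ i → zero? i (φ.φ² (shift w a u)))
          ... | yes z = z
          ... | no nz = ⊥-elim (none (a , λ i z → nz (i , z)))

      -- One generic point w makes generic points abundant: every point u is moved to a generic one
      -- by adding w to a suitable multiple of u. There are s + 1 multiples to choose from, and the
      -- radius grows at most by the factor 1 + (s + 1).
      full⇒points≤ : ∀ M → 1 ≤ genericPoints M → V.points M ≤ suc s * genericPoints ((2 + s) * M)
      full⇒points≤ M full = begin
        ∑[ u ∈ Ball (n + n) M ] 𝟙 (V.member? u)
          ≤⟨ ∑-mono′ (Ball (n + n) M) (λ u → 𝟙-≤ (V.member? u) (λ mu → let a , gen = some-generic w u w-generic in
               ≤-trans (≤-reflexive (sym (𝟙-yes (V.member? u ×-dec generic? (φ.φ² (shift w a u))) (mu , gen))))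
                 (∑-∈ (λ a → 𝟙 (V.member? u ×-dec generic? (φ.φ² (shift w a u)))) (∈-allFin a)))) ⟩
        ∑[ u ∈ Ball (n + n) M ] (∑[ a ∈ allFin (suc s) ] 𝟙 (V.member? u ×-dec generic? (φ.φ² (shift w a u))))
          ≡⟨ ∑-swap (Ball (n + n) M) (allFin (suc s)) _ ⟩
        ∑[ a ∈ allFin (suc s) ] (∑[ u ∈ Ball (n + n) M ] 𝟙 (V.member? u ×-dec generic? (φ.φ² (shift w a u))))
          ≤⟨ ∑-≤const (allFin (suc s)) _ (λ {a} _ → embed a) ⟩
        length (allFin (suc s)) * genericPoints ((2 + s) * M)
          ≡⟨ cong (_* genericPoints ((2 + s) * M)) (length-tabulate {n = suc s} id) ⟩
        suc s * genericPoints ((2 + s) * M) ∎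
        where
        open ≤-Reasoning
        open ℤ.+-*-Solver
        witness = #-witness (λ w → (φ.φ² w ∥? Y) ×-dec generic? (φ.φ² w)) (Ball (n + n) M) full
        w = proj₁ witness
        w∈ = proj₁ (proj₂ witness)
        w-member = proj₁ (proj₂ (proj₂ witness))
        w-generic = proj₂ (proj₂ (proj₂ witness))
        inj : ∀ a {u u′} → shift w a u ≡ shift w a u′ → u ≡ u′
        inj a {u} {u′} e = vec-ext (λ j → ℤ.*-cancelˡ-≡ (+ suc (toℕ a)) _ _ (trans (sym (lookup-⊙ j (+ suc (toℕ a)) u))
          (trans (cong (λ z → lookup z j) (⊕-cancelˡ {z = w} {x = + suc (toℕ a) ⊙ u} {y = + suc (toℕ a) ⊙ u′} e)) (lookup-⊙ j (+ suc (toℕ a)) u′))))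
        embed : ∀ a → ∑[ u ∈ Ball (n + n) M ] 𝟙 (V.member? u ×-dec generic? (φ.φ² (shift w a u))) ≤ genericPoints ((2 + s) * M)
        embed a = #-inj (λ u → V.member? u ×-dec generic? (φ.φ² (shift w a u))) (λ w → (φ.φ² w ∥? Y) ×-dec generic? (φ.φ² w)) _≟ᵛ_ (shift w a) (Ball-unique (n + n) M)
          (λ {u} u∈ (mu , gen) → ∈-Ball⁺ (Small-mono (+-monoʳ-≤ M (*-monoˡ-≤ M (Fin.toℕ<n a))) (Small-⊕ (∈-Ball⁻ w∈) (Small-⊙ (toℕ a) (∈-Ball⁻ u∈)))) ,
             V.⊕-closed {w} {+ suc (toℕ a) ⊙ u} w-member (V.⊙-closed (suc (toℕ a)) {u} mu) , gen)
          (λ {u} {u′} _ _ _ _ e → inj a e)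

-- Representatives of the lines, and the splitting of the energy

module LineClasses (p : ℕ) (prime : Prime p) where

  open Counting
  open Balls
  open Residues p prime
  open Fields p prime
  open Energies p prime
  open Filtration p prime
  open import Data.Empty using (⊥-elim)
  open import Data.Fin.Base as Fin using (Fin)
  import Data.Fin.Properties as Fin
  open import Data.Integer.Base using (ℤ)
  open import Data.List.Base using (List; []; _∷_; allFin; map; filter)
  open import Data.List.Membership.Propositional using (_∈_; find; lose)
  open import Data.List.Membership.Propositional.Properties using (∈-allFin; ∈-map⁺; ∈-filter⁺; ∈-filter⁻)
  open import Data.List.Relation.Unary.Any using (any?; here; there)
  open import Data.Nat using (suc; _+_; _*_; _^_; _≤_; z≤n)
  open import Data.Nat.Properties
  open import Data.Product using (∃; _×_; _,_; proj₂)
  open import Data.Vec.Base as Vec using (Vec; take; drop)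
  open import Function.Base using (_∘_; id)
  open import Level using (Level)
  open import Relation.Binary.PropositionalEquality
  open import Relation.Nullary
  open import Relation.Nullary.Decidable using (_×-dec_; ¬?)

  private variable
    c ℓ : Level
    n s : ℕ

  𝟙*𝟙≤ : ∀ {a b} {P : Set a} {Q : Set b} {m} (d : Dec P) (e : Dec Q) → (P → Q → 1 ≤ m) → 𝟙 d * 𝟙 e ≤ m
  𝟙*𝟙≤ (yes x) (yes y) f = f x y
  𝟙*𝟙≤ (yes _) (no _)  f = z≤n
  𝟙*𝟙≤ (no _)  _       f = z≤n

  #-Ball-mono : ∀ {a} {P : Vec ℤ n → Set a} (P? : ∀ x → Dec (P x)) {M M′} → M ≤ M′ → ∑[ x ∈ Ball n M ] 𝟙 (P? x) ≤ ∑[ x ∈ Ball n M′ ] 𝟙 (P? x)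
  #-Ball-mono {n} P? le = #-inj P? P? _≟ᵛ_ id (Ball-unique n _) (λ x∈ px → ∈-Ball⁺ (Small-mono le (∈-Ball⁻ x∈)) , px) (λ _ _ _ _ e → e)

  ∑-Ball-mono : ∀ (f : Vec ℤ n → ℕ) {M M′} → M ≤ M′ → ∑ (Ball n M) f ≤ ∑ (Ball n M′) f
  ∑-Ball-mono {n} f le = ∑-inj _≟ᵛ_ id f (Ball-unique n _) (λ x∈ → ∈-Ball⁺ (Small-mono le (∈-Ball⁻ x∈))) (λ _ _ e → e)

  module _ {s} {F : Fin s → Fld c ℓ} where
    open Algebra F

    -- For a list of generic pairs, a transversal of its classes under `∥`, which is an equivalence
    -- relation there.
    representatives : List A² → List A²
    representatives []       = []
    representatives (X ∷ Xs) with any? (X ∥?_) (representatives Xs)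
    ... | yes _ = representatives Xs
    ... | no _  = X ∷ representatives Xs

    representatives⊆ : ∀ {Xs Y} → Y ∈ representatives Xs → Y ∈ Xs
    representatives⊆ {X ∷ Xs} Y∈ with any? (X ∥?_) (representatives Xs)
    representatives⊆ {X ∷ Xs} Y∈         | yes _ = there (representatives⊆ Y∈)
    representatives⊆ {X ∷ Xs} (here e)   | no _  = here e
    representatives⊆ {X ∷ Xs} (there Y∈) | no _  = there (representatives⊆ Y∈)

    -- Two representatives parallel to W would be parallel to each other, W being the generic middle
    -- term.
    representatives-≤1 : ∀ Xs {W} → Generic W → ∑[ Y ∈ representatives Xs ] 𝟙 (W ∥? Y) ≤ 1
    representatives-≤1 []       gen = z≤n
    representatives-≤1 (X ∷ Xs) {W} gen with any? (X ∥?_) (representatives Xs)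
    ... | yes _ = representatives-≤1 Xs gen
    ... | no none with W ∥? X
    ...   | no _  = representatives-≤1 Xs gen
    ...   | yes e = ≤-reflexive (cong suc (∑-zero (representatives Xs) (λ {Y} Y∈ → 𝟙-no (W ∥? Y) (λ f → none (lose Y∈ (∥-trans {X = X} {Y = W} {Z = Y} gen (∥-sym e) f))))))

    representatives-cover : ∀ {Xs W X} → (∀ {Y} → Y ∈ Xs → Generic Y) → X ∈ Xs → W ∥ X → ∃ λ Y → Y ∈ representatives Xs × W ∥ Y
    representatives-cover {X₀ ∷ Xs} {W} gen X∈ e with any? (X₀ ∥?_) (representatives Xs)
    representatives-cover {X₀ ∷ Xs} {W} gen (here refl) e | yes hit = let Y , Y∈ , f = find hit in Y , Y∈ , ∥-trans {X = W} {Y = X₀} {Z = Y} (gen (here refl)) e f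
    representatives-cover {X₀ ∷ Xs} gen (there X∈) e | yes hit = representatives-cover (gen ∘ there) X∈ e
    representatives-cover {X₀ ∷ Xs} gen (here refl) e | no _ = X₀ , here refl , e
    representatives-cover {X₀ ∷ Xs} gen (there X∈) e | no _ = let Y , Y∈ , f = representatives-cover (gen ∘ there) X∈ e in Y , there Y∈ , f

    energy-mono : ∀ (φ ψ : Hom n) {M M′} → M ≤ M′ → energy φ ψ M ≤ energy φ ψ M′
    energy-mono {n} φ ψ {M} {M′} le = ≤-trans (∑-mono′ (Ball (n + n) M) (λ w → #-Ball-mono (λ v → Hom.φ² φ w ∥? Hom.φ² ψ v) le))
      (∑-Ball-mono (λ w → ∑[ v ∈ Ball (n + n) M′ ] 𝟙 (Hom.φ² φ w ∥? Hom.φ² ψ v)) le)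

    -- One argument at a time: with the other one fixed, the count is that of a lattice, so
    -- `points-dilate` applies.
    energy-dilate : ∀ (φ ψ : Hom n) t M → energy φ ψ (t * M) ≤ (2 * t) ^ (n + n) * ((2 * t) ^ (n + n) * energy φ ψ M)
    energy-dilate {n} φ ψ t M = begin
      ∑[ w ∈ Ball (n + n) (t * M) ] (∑[ v ∈ Ball (n + n) (t * M) ] 𝟙 (φ.φ² w ∥? ψ.φ² v))
        ≤⟨ ∑-mono′ (Ball (n + n) (t * M)) (λ w → ≤-trans (≤-reflexive (flip w (t * M)))
             (≤-trans (Lattice.points-dilate (ψ.line (φ.φ² w)) t M) (≤-reflexive (cong ((2 * t) ^ (n + n) *_) (sym (flip w M)))))) ⟩
      ∑[ w ∈ Ball (n + n) (t * M) ] ((2 * t) ^ (n + n) * (∑[ v ∈ Ball (n + n) M ] 𝟙 (φ.φ² w ∥? ψ.φ² v)))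
        ≡⟨ trans (∑-*ˡ (Ball (n + n) (t * M)) ((2 * t) ^ (n + n)) _) (cong ((2 * t) ^ (n + n) *_) (∑-swap (Ball (n + n) (t * M)) (Ball (n + n) M) _)) ⟩
      (2 * t) ^ (n + n) * (∑[ v ∈ Ball (n + n) M ] (∑[ w ∈ Ball (n + n) (t * M) ] 𝟙 (φ.φ² w ∥? ψ.φ² v)))
        ≤⟨ *-monoʳ-≤ ((2 * t) ^ (n + n)) (∑-mono′ (Ball (n + n) M) (λ v → Lattice.points-dilate (φ.line (ψ.φ² v)) t M)) ⟩
      (2 * t) ^ (n + n) * (∑[ v ∈ Ball (n + n) M ] ((2 * t) ^ (n + n) * (∑[ w ∈ Ball (n + n) M ] 𝟙 (φ.φ² w ∥? ψ.φ² v))))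
        ≡⟨ cong ((2 * t) ^ (n + n) *_) (trans (∑-*ˡ (Ball (n + n) M) ((2 * t) ^ (n + n)) _) (cong ((2 * t) ^ (n + n) *_) (∑-swap (Ball (n + n) M) (Ball (n + n) M) _))) ⟩
      (2 * t) ^ (n + n) * ((2 * t) ^ (n + n) * energy φ ψ M) ∎
      where
      open ≤-Reasoning
      module φ = Hom φ
      module ψ = Hom ψ
      flip : ∀ w M → ∑[ v ∈ Ball (n + n) M ] 𝟙 (φ.φ² w ∥? ψ.φ² v) ≡ Lattice.points (ψ.line (φ.φ² w)) M
      flip w M = ∑-cong (Ball (n + n) M) (λ v → 𝟙-cong (φ.φ² w ∥? ψ.φ² v) (ψ.φ² v ∥? φ.φ² w) (∥-sym {φ.φ² w} {ψ.φ² v}) (∥-sym {ψ.φ² v} {φ.φ² w}))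

  module _ {s} {F : Fin (suc s) → Fld c ℓ} where
    open Algebra F

    degenerate-mono : ∀ i (φ ψ : Hom n) {M M′} → M ≤ M′ → degenerate i φ ψ M ≤ degenerate i φ ψ M′
    degenerate-mono {n} i φ ψ {M} {M′} le = ≤-trans
      (∑-mono′ (Ball (n + n) M) (λ w → #-Ball-mono (λ v → (Hom.φ² φ w ∥? Hom.φ² ψ v) ×-dec zero? i (Hom.φ² ψ v)) le))
      (∑-Ball-mono (λ w → ∑[ v ∈ Ball (n + n) M′ ] 𝟙 ((Hom.φ² φ w ∥? Hom.φ² ψ v) ×-dec zero? i (Hom.φ² ψ v))) le)

    private
      zero-component : ∀ X → ¬ Generic X → ∃ λ i → Zero i X
      zero-component X ¬gen with Fin.any? (λ i → zero? i X)
      ... | yes z = z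
      ... | no nz = ⊥-elim (¬gen (λ i z → nz (i , z)))

    degenerates : (φ ψ : Hom n) → ℕ → ℕ
    degenerates φ ψ M = ∑[ i ∈ allFin (suc s) ] degenerate i φ ψ M

    private
      degenerates-inside : ∀ (φ ψ : Hom n) M → degenerates φ ψ M ≡
        ∑[ w ∈ Ball (n + n) M ] (∑[ v ∈ Ball (n + n) M ] (∑[ i ∈ allFin (suc s) ] 𝟙 ((Hom.φ² φ w ∥? Hom.φ² ψ v) ×-dec zero? i (Hom.φ² ψ v))))
      degenerates-inside {n} φ ψ M = trans (∑-swap (allFin (suc s)) (Ball (n + n) M) _) (∑-cong (Ball (n + n) M) (λ w → ∑-swap (allFin (suc s)) (Ball (n + n) M) _))

    module _ {Xs : List A²} (Xs-generic : ∀ {X} → X ∈ Xs → Generic X) where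

      -- A generic w selects at most one Y, and through Y it is parallel to v, whose vanishing
      -- component gives the index. The list Xs is unrelated to `φ` and `ψ`, so one family of lines
      -- serves a system and its dual alike.
      ∑-mixed : ∀ (φ ψ : Hom n) M → ∑[ Y ∈ representatives {F = F} Xs ] (genericPoints {F = F} φ Y M * degeneratePoints {F = F} ψ Y M) ≤ degenerates φ ψ M
      ∑-mixed {n} φ ψ M = begin
        ∑[ Y ∈ R ] (genericPoints {F = F} φ Y M * degeneratePoints {F = F} ψ Y M)
          ≡⟨ ∑-cong R (λ Y → ∑-*-∑ B B _ _) ⟩
        ∑[ Y ∈ R ] (∑[ w ∈ B ] (∑[ v ∈ B ] g Y w * z Y v))
          ≡⟨ trans (∑-swap R B _) (∑-cong B (λ w → ∑-swap R B _)) ⟩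
        ∑[ w ∈ B ] (∑[ v ∈ B ] (∑[ Y ∈ R ] g Y w * z Y v))
          ≤⟨ ∑-mono′ B (λ w → ∑-mono′ B (λ v → pointwise w v)) ⟩
        ∑[ w ∈ B ] (∑[ v ∈ B ] (∑[ i ∈ allFin (suc s) ] 𝟙 ((φ.φ² w ∥? ψ.φ² v) ×-dec zero? i (ψ.φ² v))))
          ≡⟨ degenerates-inside φ ψ M ⟨
        degenerates φ ψ M ∎
        where
        open ≤-Reasoning
        module φ = Hom φ
        module ψ = Hom ψ
        R = representatives {F = F} Xs
        B = Ball (n + n) M
        g z : A² → Vec ℤ (n + n) → ℕ
        g Y w = 𝟙 ((φ.φ² w ∥? Y) ×-dec generic? (φ.φ² w))
        z Y v = 𝟙 ((ψ.φ² v ∥? Y) ×-dec ¬? (generic? (ψ.φ² v)))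
        pointwise : ∀ w v → ∑[ Y ∈ R ] (g Y w * z Y v) ≤ ∑[ i ∈ allFin (suc s) ] 𝟙 ((φ.φ² w ∥? ψ.φ² v) ×-dec zero? i (ψ.φ² v))
        pointwise w v = cases (generic? (φ.φ² w)) (φ.φ² w ∥? ψ.φ² v) (generic? (ψ.φ² v))
          where
          vanishes : (∀ {Y} → Y ∈ R → φ.φ² w ∥ Y → Generic (φ.φ² w) → ψ.φ² v ∥ Y → ¬ Generic (ψ.φ² v) → 1 ≤ 0) → ∑[ Y ∈ R ] (g Y w * z Y v) ≤ 0
          vanishes f = ≤-reflexive (∑-zero R (λ {Y} Y∈ → n≤0⇒n≡0 (𝟙*𝟙≤ ((φ.φ² w ∥? Y) ×-dec generic? (φ.φ² w)) ((ψ.φ² v ∥? Y) ×-dec ¬? (generic? (ψ.φ² v)))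
            (λ (e , gw) (e′ , gv) → f Y∈ e gw e′ gv))))
          cases : Dec (Generic (φ.φ² w)) → Dec (φ.φ² w ∥ ψ.φ² v) → Dec (Generic (ψ.φ² v)) →
                  ∑[ Y ∈ R ] (g Y w * z Y v) ≤ ∑[ i ∈ allFin (suc s) ] 𝟙 ((φ.φ² w ∥? ψ.φ² v) ×-dec zero? i (ψ.φ² v))
          cases (no ¬gw) _ _ = ≤-trans (vanishes (λ _ _ gw _ _ → ⊥-elim (¬gw gw))) z≤n
          cases (yes _) (no ¬e) _ = ≤-trans (vanishes (λ {Y} Y∈ e _ e′ _ → ⊥-elim (¬e (∥-trans {X = φ.φ² w} {Y = Y} {Z = ψ.φ² v} (Xs-generic (representatives⊆ {F = F} Y∈)) e (∥-sym {ψ.φ² v} {Y} e′))))) z≤n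
          cases (yes _) (yes _) (yes gv) = ≤-trans (vanishes (λ _ _ _ _ ¬gv → ⊥-elim (¬gv gv))) z≤n
          cases (yes gw) (yes e) (no ¬gv) = let i , zi = zero-component (ψ.φ² v) ¬gv in begin
            ∑[ Y ∈ R ] (g Y w * z Y v)   ≤⟨ ∑-mono′ R (λ Y → 𝟙*𝟙≤ ((φ.φ² w ∥? Y) ×-dec generic? (φ.φ² w)) ((ψ.φ² v ∥? Y) ×-dec ¬? (generic? (ψ.φ² v)))
                                              (λ (f , _) _ → ≤-reflexive (sym (𝟙-yes (φ.φ² w ∥? Y) f)))) ⟩
            ∑[ Y ∈ R ] 𝟙 (φ.φ² w ∥? Y)  ≤⟨ representatives-≤1 {F = F} Xs gw ⟩
            1                             ≡⟨ 𝟙-yes ((φ.φ² w ∥? ψ.φ² v) ×-dec zero? i (ψ.φ² v)) (e , zi) ⟨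
            𝟙 ((φ.φ² w ∥? ψ.φ² v) ×-dec zero? i (ψ.φ² v)) ≤⟨ ∑-∈ (λ i → 𝟙 ((φ.φ² w ∥? ψ.φ² v) ×-dec zero? i (ψ.φ² v))) (∈-allFin i) ⟩
            ∑[ i ∈ allFin (suc s) ] 𝟙 ((φ.φ² w ∥? ψ.φ² v) ×-dec zero? i (ψ.φ² v)) ∎

    -- Images of residue vectors suffice, as `φ²` depends only on its argument modulo p; this leaves
    -- finitely many lines.
    classes : Coord n → List A²
    classes {n} φ = filter generic? (map (Coord.φ² φ) (Res (n + n)))

    classes-generic : ∀ (φ : Coord n) {X} → X ∈ classes φ → Generic X
    classes-generic {n} φ X∈ = proj₂ (∈-filter⁻ generic? {xs = map (Coord.φ² φ) (Res (n + n))} X∈)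

    classes-cover : ∀ (φ : Coord n) w → Generic (Coord.φ² φ w) → ∃ λ Y → Y ∈ representatives {F = F} (classes φ) × Coord.φ² φ w ∥ Y
    classes-cover {n} φ w gen = representatives-cover {F = F} (classes-generic φ)
      (∈-filter⁺ generic? (∈-map⁺ φ.φ² (red∈ w)) (λ i (z₁ , z₂) → gen i (F.trans i (F.sym i (e₁ i)) z₁ , F.trans i (F.sym i (e₂ i)) z₂)))
      (∥-resp {Z = φ.φ² (red w)} e₁ e₂ ∥-refl)
      where
      module φ = Coord φ
      open DualLines p prime using (take-≋; drop-≋)
      e₁ : φ.φ (take n (red w)) ≈ᴬ φ.φ (take n w)
      e₁ = φ.φ-cong (take-≋ n (red≋ w))
      e₂ : φ.φ (drop n (red w)) ≈ᴬ φ.φ (drop n w)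
      e₂ = φ.φ-cong (drop-≋ n (red≋ w))

    energy-split : ∀ (φ ψ : Coord n) M → energy (Coord.hom φ) (Coord.hom ψ) M ≤
      (∑[ Y ∈ representatives {F = F} (classes φ) ] (genericPoints {F = F} (Coord.hom φ) Y M * genericPoints {F = F} (Coord.hom ψ) Y M))
      + (degenerates (Coord.hom φ) (Coord.hom ψ) M + degenerates (Coord.hom ψ) (Coord.hom φ) M)
    energy-split {n} φ ψ M = begin
      ∑[ w ∈ B ] (∑[ v ∈ B ] 𝟙 (φ.φ² w ∥? ψ.φ² v))
        ≤⟨ ∑-mono′ B (λ w → ∑-mono′ B (λ v → pointwise w v)) ⟩
      ∑[ w ∈ B ] (∑[ v ∈ B ] ((∑[ Y ∈ R ] g Y w * g′ Y v) + (d w v + d′ v w)))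
        ≡⟨ trans (∑-cong B (λ w → trans (∑-+ B _ _) (cong ((∑[ v ∈ B ] (∑[ Y ∈ R ] g Y w * g′ Y v)) +_) (∑-+ B _ _))))
             (trans (∑-+ B _ _) (cong ((∑[ w ∈ B ] (∑[ v ∈ B ] (∑[ Y ∈ R ] g Y w * g′ Y v))) +_) (∑-+ B _ _))) ⟩
      (∑[ w ∈ B ] (∑[ v ∈ B ] (∑[ Y ∈ R ] g Y w * g′ Y v))) + ((∑[ w ∈ B ] (∑[ v ∈ B ] d w v)) + (∑[ w ∈ B ] (∑[ v ∈ B ] d′ v w)))
        ≡⟨ cong₂ _+_ (trans (∑-cong B (λ w → ∑-swap B R _)) (trans (∑-swap B R _) (∑-cong R (λ Y → sym (∑-*-∑ B B (g Y) (g′ Y))))))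
             (cong₂ _+_ (sym (degenerates-inside φ.hom ψ.hom M)) (trans (∑-swap B B _) (sym (degenerates-inside ψ.hom φ.hom M)))) ⟩
      (∑[ Y ∈ R ] (genericPoints {F = F} φ.hom Y M * genericPoints {F = F} ψ.hom Y M)) + (degenerates φ.hom ψ.hom M + degenerates ψ.hom φ.hom M) ∎
      where
      open ≤-Reasoning
      module φ = Coord φ
      module ψ = Coord ψ
      R = representatives {F = F} (classes φ)
      B = Ball (n + n) M
      g g′ : A² → Vec ℤ (n + n) → ℕ
      g Y w = 𝟙 ((φ.φ² w ∥? Y) ×-dec generic? (φ.φ² w))
      g′ Y v = 𝟙 ((ψ.φ² v ∥? Y) ×-dec generic? (ψ.φ² v))
      d d′ : Vec ℤ (n + n) → Vec ℤ (n + n) → ℕ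
      d w v = ∑[ i ∈ allFin (suc s) ] 𝟙 ((φ.φ² w ∥? ψ.φ² v) ×-dec zero? i (ψ.φ² v))
      d′ v w = ∑[ i ∈ allFin (suc s) ] 𝟙 ((ψ.φ² v ∥? φ.φ² w) ×-dec zero? i (φ.φ² w))
      pointwise : ∀ w v → 𝟙 (φ.φ² w ∥? ψ.φ² v) ≤ (∑[ Y ∈ R ] g Y w * g′ Y v) + (d w v + d′ v w)
      pointwise w v = 𝟙-≤ (φ.φ² w ∥? ψ.φ² v) (λ e → cases e (generic? (φ.φ² w)) (generic? (ψ.φ² v)))
        where
        cases : φ.φ² w ∥ ψ.φ² v → Dec (Generic (φ.φ² w)) → Dec (Generic (ψ.φ² v)) → 1 ≤ (∑[ Y ∈ R ] g Y w * g′ Y v) + (d w v + d′ v w)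
        cases e (no ¬gw) _ = let i , z = zero-component (φ.φ² w) ¬gw in
          ≤-trans (≤-trans (≤-reflexive (sym (𝟙-yes ((ψ.φ² v ∥? φ.φ² w) ×-dec zero? i (φ.φ² w)) (∥-sym {φ.φ² w} {ψ.φ² v} e , z))))
            (∑-∈ (λ i → 𝟙 ((ψ.φ² v ∥? φ.φ² w) ×-dec zero? i (φ.φ² w))) (∈-allFin i))) (≤-trans (m≤n+m (d′ v w) (d w v)) (m≤n+m (d w v + d′ v w) (∑[ Y ∈ R ] g Y w * g′ Y v)))
        cases e (yes _) (no ¬gv) = let i , z = zero-component (ψ.φ² v) ¬gv in
          ≤-trans (≤-trans (≤-reflexive (sym (𝟙-yes ((φ.φ² w ∥? ψ.φ² v) ×-dec zero? i (ψ.φ² v)) (e , z))))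
            (∑-∈ (λ i → 𝟙 ((φ.φ² w ∥? ψ.φ² v) ×-dec zero? i (ψ.φ² v))) (∈-allFin i))) (≤-trans (m≤m+n (d w v) (d′ v w)) (m≤n+m (d w v + d′ v w) (∑[ Y ∈ R ] g Y w * g′ Y v)))
        cases e (yes gw) (yes gv) = let Y , Y∈ , f = classes-cover φ w gw in
          ≤-trans (≤-trans (≤-reflexive (sym (cong₂ _*_ (𝟙-yes ((φ.φ² w ∥? Y) ×-dec generic? (φ.φ² w)) (f , gw))
              (𝟙-yes ((ψ.φ² v ∥? Y) ×-dec generic? (ψ.φ² v)) (∥-trans {X = ψ.φ² v} {Y = φ.φ² w} {Z = Y} gw (∥-sym {φ.φ² w} {ψ.φ² v} e) f , gv)))))
            (∑-∈ (λ Y → g Y w * g′ Y v) Y∈)) (m≤m+n _ _)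

-- The energy estimate

module EnergyEstimate where

  open Counting
  open Balls
  open Scales
  open import Data.Nat using (zero; suc; _+_; _*_; _^_; _∸_; _≤_; _<_; _≤?_; s≤s; z≤n; NonZero; >-nonZero)
  open import Data.Nat.Properties
  open import Data.Nat.Solver using (module +-*-Solver)
  open import Data.Empty using (⊥-elim)
  open import Data.Fin.Base as Fin using (Fin)
  open import Data.List.Base using (List; allFin; upTo)
  open import Data.List.Properties using (length-tabulate; length-upTo)
  open import Data.List.Membership.Propositional using (_∈_)
  open import Data.List.Membership.Propositional.Properties using (∈-upTo⁺; ∈-upTo⁻)
  open import Data.Product using (∃; _×_; _,_)
  open import Data.Sum using (_⊎_; inj₁; inj₂; [_,_]′)
  open import Function.Base using (_∘_; id)
  open import Level using (Level)
  open import Relation.Binary.PropositionalEquality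
  open import Relation.Nullary

  -- f = g + z counts all, generic and degenerate points; G and Z are g and z at a dilated scale.
  -- Descend from level h to the first level j + 1 at which a generic point appears.
  first-full : ∀ (V m : ℕ) (f g z G Z : ℕ → ℕ) h → 1 ≤ V →
    (∀ j → f j ≡ g j + z j) → (∀ j → f j ≤ f (suc j)) → (∀ j → z j ≤ Z (suc j)) →
    (∀ j → 1 ≤ g j → f j ≤ m * G j) → g 0 ≡ 0 → (∀ j → j < h → f (suc j) ≤ V * f j) → 1 ≤ g h →
    ∃ λ j → j < h × f h * f h ≤ V ^ (h ∸ j) * V ^ (h ∸ j) * (m * (G (suc j) * Z (suc j)))
  first-full V m f g z G Z h V⁺ f≡ f-mono z≤Z full g0 flat gh = descend h ≤-refl gh (≤-reflexive (trans (sym (+-identityʳ (f h))) (cong (λ d → V ^ d * f h) (sym (n∸n≡0 h)))))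
    where
    open ≤-Reasoning
    open +-*-Solver
    descend : ∀ i → i ≤ h → 1 ≤ g i → f h ≤ V ^ (h ∸ i) * f i → ∃ λ j → j < h × f h * f h ≤ V ^ (h ∸ j) * V ^ (h ∸ j) * (m * (G (suc j) * Z (suc j)))
    descend zero    _   g≥1 _  = ⊥-elim (≤⇒≯ g≥1 (s≤s (≤-reflexive g0)))
    descend (suc j) j<h g≥1 le with 1 ≤? g j
    ... | yes g≥1′ = descend j (<⇒≤ j<h) g≥1′ step
      where
      step : f h ≤ V ^ (h ∸ j) * f j
      step = begin
        f h                                ≤⟨ le ⟩
        V ^ (h ∸ suc j) * f (suc j)        ≤⟨ *-monoʳ-≤ (V ^ (h ∸ suc j)) (flat j j<h) ⟩
        V ^ (h ∸ suc j) * (V * f j)        ≡⟨ solve 3 (λ a b c → a :* (b :* c) := b :* a :* c) refl (V ^ (h ∸ suc j)) V (f j) ⟩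
        V ^ suc (h ∸ suc j) * f j          ≡⟨ cong (λ d → V ^ d * f j) (sym (+-∸-assoc 1 j<h)) ⟩
        V ^ (h ∸ j) * f j                  ∎
    -- One factor f j equals z j, as no generic point exists at level j. The other is at most f (j +
    -- 1), which the generic point at level j + 1 bounds by m G (j + 1).
    ... | no g≱1 = j , j<h , (begin
        f h * f h
          ≤⟨ *-mono-≤ step step ⟩
        V ^ (h ∸ j) * f j * (V ^ (h ∸ j) * f j)
          ≡⟨ solve 2 (λ a b → a :* b :* (a :* b) := a :* a :* (b :* b)) refl (V ^ (h ∸ j)) (f j) ⟩
        V ^ (h ∸ j) * V ^ (h ∸ j) * (f j * f j)
          ≤⟨ *-monoʳ-≤ (V ^ (h ∸ j) * V ^ (h ∸ j)) (*-mono-≤ (≤-trans (f-mono j) (full (suc j) g≥1)) (≤-trans (≤-reflexive f≡z) (z≤Z j))) ⟩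
        V ^ (h ∸ j) * V ^ (h ∸ j) * (m * G (suc j) * Z (suc j))
          ≡⟨ cong (V ^ (h ∸ j) * V ^ (h ∸ j) *_) (*-assoc m _ _) ⟩
        V ^ (h ∸ j) * V ^ (h ∸ j) * (m * (G (suc j) * Z (suc j))) ∎)
      where
      f≡z : f j ≡ z j
      f≡z = trans (f≡ j) (cong (_+ z j) (n≤0⇒n≡0 (<⇒≤pred (≰⇒> g≱1))))
      step : f h ≤ V ^ (h ∸ j) * f j
      step = begin
        f h                                ≤⟨ le ⟩
        V ^ (h ∸ suc j) * f (suc j)        ≤⟨ *-monoʳ-≤ (V ^ (h ∸ suc j)) (flat j j<h) ⟩
        V ^ (h ∸ suc j) * (V * f j)        ≡⟨ solve 3 (λ a b c → a :* (b :* c) := b :* a :* c) refl (V ^ (h ∸ suc j)) V (f j) ⟩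
        V ^ suc (h ∸ suc j) * f j          ≡⟨ cong (λ d → V ^ d * f j) (sym (+-∸-assoc 1 j<h)) ⟩
        V ^ (h ∸ j) * f j                  ∎

  -- On a fixed line this separates the two coordinate systems, in the role of the Cauchy-Schwarz
  -- inequality.
  product≤squares : ∀ {g g′ a a′} → g ≤ a → g′ ≤ a′ → g * g′ ≤ a * a + a′ * a′
  product≤squares {a = a} {a′} le le′ with ≤-total a a′
  ... | inj₁ a≤a′ = ≤-trans (*-mono-≤ (≤-trans le a≤a′) le′) (m≤n+m (a′ * a′) (a * a))
  ... | inj₂ a′≤a = ≤-trans (*-mono-≤ le (≤-trans le′ a′≤a)) (m≤m+n (a * a) (a′ * a′))

  private module Arithmetic where
    open +-*-Solver

    factor : ∀ w x a b → w * (x * a) + w * (x * b) ≡ w * (x * (a + b))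
    factor = solve 4 (λ w x a b → w :* (x :* a) :+ w :* (x :* b) := w :* (x :* (a :+ b))) refl

    triple : ∀ x → x + (x + x) ≡ 3 * x
    triple = solve 1 (λ x → x :+ (x :+ x) := con 3 :* x) refl

    gather : ∀ f q e r → f * q * (f * q) * (e * (r * r)) ≡ f * f * (e * (q * r * (q * r)))
    gather = solve 4 (λ f q e r → f :* q :* (f :* q) :* (e :* (r :* r)) := f :* f :* (e :* (q :* r :* (q :* r)))) refl

    pull : ∀ e p q → e * (p * q * (p * q)) ≡ p * p * (e * (q * q))
    pull = solve 3 (λ e p q → e :* (p :* q :* (p :* q)) := p :* p :* (e :* (q :* q))) refl

    six : ∀ w x n u → w * (x * (3 * (n * u) + 3 * (n * u))) ≡ x * (6 * (n * (w * u)))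
    six = solve 4 (λ w x n u → w :* (x :* (con 3 :* (n :* u) :+ con 3 :* (n :* u))) := x :* (con 6 :* (n :* (w :* u)))) refl

    combine : ∀ k x n f p u → k * (x * (6 * (n * (f * (p * u))))) + (n * (p * u) + n * (p * u)) ≡ n * (x * (k * (6 * f)) + 2) * p * u
    combine = solve 6 (λ k x n f p u → k :* (x :* (con 6 :* (n :* (f :* (p :* u))))) :+ (n :* (p :* u) :+ n :* (p :* u)) :=
      n :* (x :* (k :* (con 6 :* f)) :+ con 2) :* p :* u) refl

    regroup : ∀ a b c e f → a * b * (a * b) * (c * (c * (e * f))) ≡ a * a * (c * c) * e * (b * b * f)
    regroup = solve 5 (λ a b c e f → a :* b :* (a :* b) :* (c :* (c :* (e :* f))) := a :* a :* (c :* c) :* e :* (b :* b :* f)) refl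

    squares : ∀ x b → x * b * (x * b) ≡ x * x * (b * b)
    squares = solve 2 (λ x b → x :* b :* (x :* b) := x :* x :* (b :* b)) refl

    reorder : ∀ x w m q → x * (w * (m * q)) ≡ w * (m * x * q)
    reorder = solve 4 (λ x w m q → x :* (w :* (m :* q)) := w :* (m :* x :* q)) refl

    exchange : ∀ m g x z → m * g * (x * z) ≡ m * x * (g * z)
    exchange = solve 4 (λ m g x z → m :* g :* (x :* z) := m :* x :* (g :* z)) refl

  open Arithmetic

  module Constants (N K k : ℕ) (K⁺ : 1 ≤ K) where
    open ScaledDuality N K K⁺ public

    abstract
      -- `flatness` and `transfer` are the constants Y and X of the dichotomy, `spread` covers all
      -- cases of `Pointwise`, `recursion` is the loss of one inductive `step`, and `dilation` that
      -- of `degenerate-bound`. They are opaque and enter through the equations below.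
      flatness transfer spread recursion dilation : ℕ
      flatness  = 6 ^ (2 * N) + dualityConstant * dualityConstant * (K ^ N * K ^ N)
      transfer  = dualityConstant * K ^ N
      spread    = suc N * (suc transfer * suc transfer)
      recursion = N * (spread * (k * (6 * (flatness ^ k * flatness ^ k))) + 2)
      dilation  = (4 * (2 + N)) ^ (4 * N)

      flatness-≡ : 6 ^ (2 * N) + dualityConstant * dualityConstant * (K ^ N * K ^ N) ≡ flatness
      flatness-≡ = refl

      transfer-≡ : dualityConstant * K ^ N ≡ transfer
      transfer-≡ = refl

      spread-≡ : suc N * (suc transfer * suc transfer) ≡ spread
      spread-≡ = refl

      recursion-≡ : N * (spread * (k * (6 * (flatness ^ k * flatness ^ k))) + 2) ≡ recursion
      recursion-≡ = refl

      dilation-≡ : (4 * (2 + N)) ^ (4 * N) ≡ dilation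
      dilation-≡ = refl

      1≤flatness : 1 ≤ flatness
      1≤flatness = ≤-trans (m^n>0 6 (2 * N)) (m≤m+n _ _)

    sucN≤spread : suc N ≤ spread
    sucN≤spread = ≤-trans (m≤m*n (suc N) (suc transfer * suc transfer)) (≤-reflexive spread-≡)

    sucN*transfer≤spread : suc N * transfer ≤ spread
    sucN*transfer≤spread = ≤-trans (*-monoʳ-≤ (suc N) (≤-trans (n≤1+n transfer) (m≤m*n (suc transfer) (suc transfer)))) (≤-reflexive spread-≡)

    -- Each field costs a factor L ^ (2 N), because the first level with a generic point is known
    -- only up to one step.
    energyConstant : ℕ → ℕ → ℕ
    energyConstant L zero    = 1
    energyConstant L (suc s) = recursion * (L ^ N * L ^ N) * (dilation * energyConstant L s)

  module Energy (p : ℕ) (prime : Prime p) (N K L k : ℕ) (K⁺ : 1 ≤ K) (L⁺ : 1 ≤ L) (p≤Lᵏ : p ≤ L ^ k) (Lᵏ≤Kp : L ^ k ≤ K * p)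
    (c₀≤p : ScaledDuality.c₀ N K K⁺ ≤ p) (N<p : N < p) (fits : ∀ j → j + j ≤ k → 2 * ((2 + N) * L ^ j) ≤ p) where

    open Residues p prime
    open Fields p prime
    open Slicing p prime using (unit; unit-same)
    open Energies p prime
    open DualLines p prime
    open Filtration p prime
    open LineClasses p prime
    open import Data.Integer.Base as ℤ using (ℤ)
    open import Data.Vec.Base as Vec using (Vec; []; lookup)
    open Constants N K k K⁺ hiding (c₀)
    open Levels N K L k K⁺ L⁺ p≤Lᵏ Lᵏ≤Kp using (power-swap; 1≤Lⁱ; module Line)

    private
      -- The dilation of `full⇒points≤`, made uniform by bounding the number of fields by N.
      t : ℕ
      t = 2 + N
      instance
        L≢0 : NonZero L
        L≢0 = >-nonZero L⁺
      variable
        c ℓ : Level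
        n s : ℕ

    module _ {s} {F : Fin (suc s) → Fld c ℓ} (s<N : suc s ≤ N) where
      open Algebra F

      module Local {n} (n≤N : n ≤ N) where
        V : ℕ
        V = flatness * L ^ n

        1≤V : 1 ≤ V
        1≤V = *-mono-≤ 1≤flatness (m^n>0 L n)

        G Z : Coord n → A² → ℕ → ℕ
        G φ Y j = genericPoints {F = F} (Coord.hom φ) Y (t * L ^ j)
        Z φ Y j = degeneratePoints {F = F} (Coord.hom φ) Y (t * L ^ j)

        points : Coord n → A² → ℕ → ℕ
        points φ Y j = Lattice.points (Coord.line φ Y) (L ^ j)

        g : Coord n → A² → ℕ → ℕ
        g φ Y j = genericPoints {F = F} (Coord.hom φ) Y (L ^ j)

        genericPoints-mono : ∀ (φ : Coord n) Y {M M′} → M ≤ M′ → genericPoints {F = F} (Coord.hom φ) Y M ≤ genericPoints {F = F} (Coord.hom φ) Y M′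
        genericPoints-mono φ Y = #-Ball-mono (λ w → (Coord.φ² φ w ∥? Y) ×-dec generic? (Coord.φ² φ w))
          where open import Relation.Nullary.Decidable using (_×-dec_)

        degeneratePoints-mono : ∀ (φ : Coord n) Y {M M′} → M ≤ M′ → degeneratePoints {F = F} (Coord.hom φ) Y M ≤ degeneratePoints {F = F} (Coord.hom φ) Y M′
        degeneratePoints-mono φ Y = #-Ball-mono (λ w → (Coord.φ² φ w ∥? Y) ×-dec ¬? (generic? (Coord.φ² φ w)))
          where open import Relation.Nullary.Decidable using (_×-dec_; ¬?)

        full : ∀ (φ : Coord n) Y j → 1 ≤ g φ Y j → points φ Y j ≤ suc N * G φ Y j
        full φ Y j 1≤g = ≤-trans (full⇒points≤ {F = F} (Coord.hom φ) Y (≤-<-trans s<N N<p) (L ^ j) 1≤g)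
          (*-mono-≤ (s≤s s<N) (genericPoints-mono φ Y (*-monoˡ-≤ (L ^ j) (+-monoʳ-≤ 2 s<N))))

        Lʲ≤Lʲ⁺¹ : ∀ j → L ^ j ≤ L ^ suc j
        Lʲ≤Lʲ⁺¹ j = ^-monoʳ-≤ L (n≤1+n j)

        -- The only vector of sup norm less than 1 is 0.
        no-generic : ∀ (φ : Coord n) Y → g φ Y 0 ≡ 0
        no-generic φ Y = #-empty (λ w → (Coord.φ² φ w ∥? Y) ×-dec generic? (Coord.φ² φ w)) (λ (w , w∈ , _ , gen) → gen Fin.zero
          (null (Vec.take n w) (Small-take′ w∈) , null (Vec.drop n w) (Small-drop′ w∈)))
          where
          open import Relation.Nullary.Decidable using (_×-dec_)
          open Slicing p prime using (Small-take; Small-drop)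
          null : ∀ x → Small 1 x → F._≈_ Fin.zero (Coord.φ φ x Fin.zero) (F.0# Fin.zero)
          null x sx = Coord.φ-null φ (≋-reflexive (vec-ext (λ k → trans (Data.Integer.Properties.∣i∣≡0⇒i≡0 (n<1⇒n≡0 (entry sx k))) (sym (lookup-𝟎 k))))) Fin.zero
            where import Data.Integer.Properties
          Small-take′ : ∀ {w : Vec ℤ (n + n)} → w ∈ Ball (n + n) 1 → Small 1 (Vec.take n w)
          Small-take′ w∈ = Small-take n (∈-Ball⁻ w∈)
          Small-drop′ : ∀ {w : Vec ℤ (n + n)} → w ∈ Ball (n + n) 1 → Small 1 (Vec.drop n w)
          Small-drop′ w∈ = Small-drop n (∈-Ball⁻ w∈)

        chain : ∀ (φ : Coord n) Y h → (∀ j → j < h → points φ Y (suc j) ≤ V * points φ Y j) → 1 ≤ g φ Y h →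
          ∃ λ j → j < h × points φ Y h * points φ Y h ≤ V ^ (h ∸ j) * V ^ (h ∸ j) * (suc N * (G φ Y (suc j) * Z φ Y (suc j)))
        chain φ Y h flat 1≤g = first-full V (suc N) (points φ Y) (g φ Y) (λ j → degeneratePoints {F = F} (Coord.hom φ) Y (L ^ j)) (G φ Y) (Z φ Y) h 1≤V
          (λ j → points-split {F = F} (Coord.hom φ) Y (L ^ j)) (λ j → Lattice.points-mono (Coord.line φ Y) (Lʲ≤Lʲ⁺¹ j))
          (λ j → degeneratePoints-mono φ Y (≤-trans (Lʲ≤Lʲ⁺¹ j) (m≤n*m (L ^ suc j) t))) (full φ Y) (no-generic φ Y) flat 1≤g

        -- The products of a generic and a degenerate count that arise when the growth is slow for
        -- φ, when it is slow for the dual, and when the dual has no generic point.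
        Q : Coord n → A² → ℕ → ℕ
        Q φ Y j = G φ Y j * Z φ Y j + (G (dual φ) Y j * Z (dual φ) Y j + G φ Y j * Z (dual φ) Y j)

        abstract
          levels : ∀ (φ : Coord n) {Y} → Generic Y → ∀ h → h + h ≤ k →
            (∀ j → j < h → points φ Y (suc j) ≤ V * points φ Y j) ⊎
            ((∀ j → j < h → points (dual φ) Y (suc j) ≤ V * points (dual φ) Y j) × points φ Y h ≤ transfer * points (dual φ) Y h)
          levels φ {Y} gen h 2h≤k = subst₂ (λ y x →
              (∀ j → j < h → points φ Y (suc j) ≤ y * L ^ n * points φ Y j) ⊎
              ((∀ j → j < h → points (dual φ) Y (suc j) ≤ y * L ^ n * points (dual φ) Y j) × points φ Y h ≤ x * points (dual φ) Y h))
            flatness-≡ transfer-≡ (Line.Dich.dichotomy {F = F} n≤N c₀≤p φ (dual φ) (dual-Dual φ) Y gen h 2h≤k)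

        Pointwise : Coord n → A² → ℕ → Set
        Pointwise φ Y h = ∃ λ j → j < h × points φ Y h * points φ Y h ≤ V ^ (h ∸ j) * V ^ (h ∸ j) * (spread * Q φ Y (suc j))

        private
          open ≤-Reasoning
          open +-*-Solver

          flat-case : ∀ (φ : Coord n) Y h → (∀ j → j < h → points φ Y (suc j) ≤ V * points φ Y j) → 1 ≤ g φ Y h → Pointwise φ Y h
          flat-case φ Y h flat 1≤g = let j , j<h , le = chain φ Y h flat 1≤g in j , j<h , ≤-trans le (*-monoʳ-≤ (V ^ (h ∸ j) * V ^ (h ∸ j))
            (*-mono-≤ sucN≤spread (m≤m+n (G φ Y (suc j) * Z φ Y (suc j)) _)))

          dual-case : ∀ (φ : Coord n) Y h → (∀ j → j < h → points (dual φ) Y (suc j) ≤ V * points (dual φ) Y j) →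
            points φ Y h ≤ transfer * points (dual φ) Y h → 1 ≤ g (dual φ) Y h → Pointwise φ Y h
          dual-case φ Y h flat le 1≤g′ = let j , j<h , le′ = chain (dual φ) Y h flat 1≤g′ in j , j<h , (begin
            points φ Y h * points φ Y h
              ≤⟨ *-mono-≤ le le ⟩
            transfer * b * (transfer * b)
              ≡⟨ squares transfer b ⟩
            transfer * transfer * (b * b)
              ≤⟨ *-mono-≤ (*-mono-≤ (n≤1+n transfer) (n≤1+n transfer)) le′ ⟩
            suc transfer * suc transfer * (W j * (suc N * q (suc j)))
              ≡⟨ trans (reorder (suc transfer * suc transfer) (W j) (suc N) (q (suc j))) (cong (λ x → W j * (x * q (suc j))) spread-≡) ⟩
            W j * (spread * q (suc j))
              ≤⟨ *-monoʳ-≤ (W j) (*-monoʳ-≤ spread (≤-trans (m≤m+n (q (suc j)) _) (m≤n+m _ (G φ Y (suc j) * Z φ Y (suc j))))) ⟩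
            W j * (spread * Q φ Y (suc j)) ∎)
            where
            b = points (dual φ) Y h
            W : ℕ → ℕ
            W j = V ^ (h ∸ j) * V ^ (h ∸ j)
            q : ℕ → ℕ
            q j = G (dual φ) Y j * Z (dual φ) Y j

          degenerate-case : ∀ (φ : Coord n) Y h → 1 ≤ g φ Y h → points φ Y h ≤ transfer * points (dual φ) Y h → g (dual φ) Y h ≡ 0 → Pointwise φ Y h
          degenerate-case φ Y zero    1≤g _ _ = ⊥-elim (≤⇒≯ 1≤g (s≤s (≤-reflexive (no-generic φ Y))))
          degenerate-case φ Y (suc j) 1≤g le g≡0 = j , ≤-refl , (begin
            points φ Y (suc j) * points φ Y (suc j)
              ≤⟨ *-mono-≤ (full φ Y (suc j) 1≤g) (≤-trans le (*-monoʳ-≤ transfer b≤)) ⟩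
            suc N * G φ Y (suc j) * (transfer * Z (dual φ) Y (suc j))
              ≡⟨ exchange (suc N) (G φ Y (suc j)) transfer (Z (dual φ) Y (suc j)) ⟩
            suc N * transfer * q
              ≤⟨ *-monoˡ-≤ q sucN*transfer≤spread ⟩
            spread * q
              ≤⟨ *-monoʳ-≤ spread (≤-trans (m≤n+m q (G (dual φ) Y (suc j) * Z (dual φ) Y (suc j))) (m≤n+m _ (G φ Y (suc j) * Z φ Y (suc j)))) ⟩
            spread * Q φ Y (suc j)
              ≤⟨ m≤n*m _ W {{>-nonZero W⁺}} ⟩
            W * (spread * Q φ Y (suc j)) ∎)
            where
            q = G φ Y (suc j) * Z (dual φ) Y (suc j)
            W = V ^ (suc j ∸ j) * V ^ (suc j ∸ j)
            W⁺ : 1 ≤ W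
            W⁺ = *-mono-≤ (m^n>0 V {{>-nonZero 1≤V}} (suc j ∸ j)) (m^n>0 V {{>-nonZero 1≤V}} (suc j ∸ j))
            b≤ : points (dual φ) Y (suc j) ≤ Z (dual φ) Y (suc j)
            b≤ = ≤-trans (≤-reflexive (trans (points-split {F = F} (Coord.hom (dual φ)) Y (L ^ suc j)) (cong (_+ degeneratePoints {F = F} (Coord.hom (dual φ)) Y (L ^ suc j)) g≡0)))
              (degeneratePoints-mono (dual φ) Y (m≤n*m (L ^ suc j) t))

        pointwise : ∀ (φ : Coord n) {Y} → Generic Y → ∀ h → h + h ≤ k → 1 ≤ g φ Y h → Pointwise φ Y h
        pointwise φ {Y} gen h 2h≤k 1≤g = [ (λ flat → flat-case φ Y h flat 1≤g) , (λ (flat , le) → cases flat le (1 ≤? g (dual φ) Y h)) ]′ (levels φ gen h 2h≤k)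
          where
          cases : (∀ j → j < h → points (dual φ) Y (suc j) ≤ V * points (dual φ) Y j) → points φ Y h ≤ transfer * points (dual φ) Y h → Dec (1 ≤ g (dual φ) Y h) → Pointwise φ Y h
          cases flat le (yes 1≤g′) = dual-case φ Y h flat le 1≤g′
          cases flat le (no g≱1)   = degenerate-case φ Y h 1≤g le (n≤0⇒n≡0 (<⇒≤pred (≰⇒> g≱1)))

        P : ℕ
        P = L ^ n

        1≤P : 1 ≤ P
        1≤P = m^n>0 L n

        module Step (E₁ : ℕ) (few : ∀ (χ χ′ : Coord n) j → j + j ≤ k → degenerates (Coord.hom χ) (Coord.hom χ′) (t * L ^ j) ≤ N * (E₁ * (P ^ j * P ^ j)))
          (φ ψ : Coord n) (h : ℕ) (2h≤k : h + h ≤ k) where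

          private
            open ≤-Reasoning
            open +-*-Solver

            R : List A²
            R = representatives {F = F} (classes φ)

            T W : ℕ → ℕ
            T j = E₁ * (P ^ j * P ^ j)
            W j = V ^ (h ∸ j) * V ^ (h ∸ j)

            U : ℕ
            U = flatness ^ k * flatness ^ k * (P * P * T h)

            R-generic : ∀ {Y} → Y ∈ R → Generic Y
            R-generic Y∈ = classes-generic φ (representatives⊆ {F = F} Y∈)

            below : A² → ℕ → ℕ
            below Y j = W j * (spread * (Q φ Y (suc j) + Q ψ Y (suc j)))

            square≤∑ : ∀ (χ : Coord n) {Y} → Generic Y → 1 ≤ g χ Y h →
                       points χ Y h * points χ Y h ≤ ∑[ j ∈ upTo h ] (W j * (spread * Q χ Y (suc j)))
            square≤∑ χ {Y} gen 1≤g = sum-up (pointwise χ gen h 2h≤k 1≤g)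
              where
              sum-up : Pointwise χ Y h → points χ Y h * points χ Y h ≤ ∑[ j ∈ upTo h ] (W j * (spread * Q χ Y (suc j)))
              sum-up (j , j<h , le) = ≤-trans le (∑-∈ (λ j → W j * (spread * Q χ Y (suc j))) (∈-upTo⁺ j<h))

            -- The level that `Pointwise` provides depends on Y and on the coordinate system.
            -- Summing over all levels below h removes this dependence, so that the sum over Y can
            -- be taken inside.
            term : ∀ {Y} → Y ∈ R → g φ Y h * g ψ Y h ≤ ∑ (upTo h) (below Y)
            term {Y} Y∈ = cases (1 ≤? g φ Y h) (1 ≤? g ψ Y h)
              where
              g≤points : ∀ (χ : Coord n) → g χ Y h ≤ points χ Y h
              g≤points χ = ≤-trans (m≤m+n (g χ Y h) _) (≤-reflexive (sym (points-split {F = F} (Coord.hom χ) Y (L ^ h))))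
              cases : Dec (1 ≤ g φ Y h) → Dec (1 ≤ g ψ Y h) → g φ Y h * g ψ Y h ≤ ∑ (upTo h) (below Y)
              cases (no ≱1) _ = ≤-trans (≤-reflexive (cong (_* g ψ Y h) (n≤0⇒n≡0 (<⇒≤pred (≰⇒> ≱1))))) z≤n
              cases (yes _) (no ≱1) = ≤-trans (≤-reflexive (trans (cong (g φ Y h *_) (n≤0⇒n≡0 (<⇒≤pred (≰⇒> ≱1)))) (*-zeroʳ (g φ Y h)))) z≤n
              cases (yes 1≤g) (yes 1≤g′) = begin
                g φ Y h * g ψ Y h
                  ≤⟨ product≤squares (g≤points φ) (g≤points ψ) ⟩
                points φ Y h * points φ Y h + points ψ Y h * points ψ Y h
                  ≤⟨ +-mono-≤ (square≤∑ φ (R-generic Y∈) 1≤g) (square≤∑ ψ (R-generic Y∈) 1≤g′) ⟩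
                (∑[ j ∈ upTo h ] (W j * (spread * Q φ Y (suc j)))) + (∑[ j ∈ upTo h ] (W j * (spread * Q ψ Y (suc j))))
                  ≡⟨ ∑-+ (upTo h) _ _ ⟨
                ∑[ j ∈ upTo h ] (W j * (spread * Q φ Y (suc j)) + W j * (spread * Q ψ Y (suc j)))
                  ≡⟨ ∑-cong (upTo h) (λ j → factor (W j) spread (Q φ Y (suc j)) (Q ψ Y (suc j))) ⟩
                ∑ (upTo h) (below Y) ∎

            ∑Q : ∀ (χ : Coord n) j → j + j ≤ k → ∑[ Y ∈ R ] Q χ Y j ≤ 3 * (N * T j)
            ∑Q χ j 2j≤k = begin
              ∑[ Y ∈ R ] Q χ Y j
                ≡⟨ trans (∑-+ R _ _) (cong ((∑[ Y ∈ R ] (G χ Y j * Z χ Y j)) +_) (∑-+ R _ _)) ⟩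
              (∑[ Y ∈ R ] (G χ Y j * Z χ Y j)) + ((∑[ Y ∈ R ] (G (dual χ) Y j * Z (dual χ) Y j)) + (∑[ Y ∈ R ] (G χ Y j * Z (dual χ) Y j)))
                ≤⟨ +-mono-≤ (mixed χ χ) (+-mono-≤ (mixed (dual χ) (dual χ)) (mixed χ (dual χ))) ⟩
              N * T j + (N * T j + N * T j)
                ≡⟨ triple (N * T j) ⟩
              3 * (N * T j) ∎
              where
              mixed : ∀ (χ χ′ : Coord n) → ∑[ Y ∈ R ] (G χ Y j * Z χ′ Y j) ≤ N * T j
              mixed χ χ′ = ≤-trans (∑-mixed {F = F} (classes-generic φ) (Coord.hom χ) (Coord.hom χ′) (t * L ^ j)) (few χ χ′ j 2j≤k)

            -- Growth at rate V from j to h and the inductive bound at level j + 1 have exponents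
            -- adding to (h - j) + (j + 1) = h + 1. The bound is thus free of j, at the price of the
            -- factor P * P.
            WT≤U : ∀ {j} → j < h → W j * T (suc j) ≤ U
            WT≤U {j} j<h = begin
              V ^ (h ∸ j) * V ^ (h ∸ j) * (E₁ * (P ^ suc j * P ^ suc j))
                ≡⟨ cong (λ v → v * v * (E₁ * (P ^ suc j * P ^ suc j))) (*-^ flatness P (h ∸ j)) ⟩
              flatness ^ (h ∸ j) * P ^ (h ∸ j) * (flatness ^ (h ∸ j) * P ^ (h ∸ j)) * (E₁ * (P ^ suc j * P ^ suc j))
                ≡⟨ gather (flatness ^ (h ∸ j)) (P ^ (h ∸ j)) E₁ (P ^ suc j) ⟩
              flatness ^ (h ∸ j) * flatness ^ (h ∸ j) * (E₁ * (P ^ (h ∸ j) * P ^ suc j * (P ^ (h ∸ j) * P ^ suc j)))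
                ≡⟨ cong (λ z → flatness ^ (h ∸ j) * flatness ^ (h ∸ j) * (E₁ * (z * z))) join ⟩
              flatness ^ (h ∸ j) * flatness ^ (h ∸ j) * (E₁ * (P * P ^ h * (P * P ^ h)))
                ≡⟨ cong (flatness ^ (h ∸ j) * flatness ^ (h ∸ j) *_) (pull E₁ P (P ^ h)) ⟩
              flatness ^ (h ∸ j) * flatness ^ (h ∸ j) * (P * P * T h)
                ≤⟨ *-monoˡ-≤ (P * P * T h) (*-mono-≤ f≤ f≤) ⟩
              U ∎
              where
              join : P ^ (h ∸ j) * P ^ suc j ≡ P * P ^ h
              join = trans (sym (^-distribˡ-+-* P (h ∸ j) (suc j))) (cong (P ^_) (trans (+-suc (h ∸ j) j) (cong suc (m∸n+n≡m (<⇒≤ j<h)))))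
              f≤ : flatness ^ (h ∸ j) ≤ flatness ^ k
              f≤ = ^-monoʳ-≤ flatness {{>-nonZero 1≤flatness}} (≤-trans (m∸n≤m h j) (≤-trans (m≤m+n h h) 2h≤k))

            column : ∀ {j} → j < h → ∑[ Y ∈ R ] below Y j ≤ spread * (6 * (N * U))
            column {j} j<h = begin
              ∑[ Y ∈ R ] (W j * (spread * (Q φ Y (suc j) + Q ψ Y (suc j))))
                ≡⟨ trans (∑-*ˡ R (W j) _) (cong (W j *_) (trans (∑-*ˡ R spread _) (cong (spread *_) (∑-+ R _ _)))) ⟩
              W j * (spread * ((∑[ Y ∈ R ] Q φ Y (suc j)) + (∑[ Y ∈ R ] Q ψ Y (suc j))))
                ≤⟨ *-monoʳ-≤ (W j) (*-monoʳ-≤ spread (+-mono-≤ (∑Q φ (suc j) 2j≤k) (∑Q ψ (suc j) 2j≤k))) ⟩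
              W j * (spread * (3 * (N * T (suc j)) + 3 * (N * T (suc j))))
                ≡⟨ six (W j) spread N (T (suc j)) ⟩
              spread * (6 * (N * (W j * T (suc j))))
                ≤⟨ *-monoʳ-≤ spread (*-monoʳ-≤ 6 (*-monoʳ-≤ N (WT≤U j<h))) ⟩
              spread * (6 * (N * U)) ∎
              where
              2j≤k : suc j + suc j ≤ k
              2j≤k = ≤-trans (+-mono-≤ j<h j<h) 2h≤k

            few′ : ∀ (χ χ′ : Coord n) → degenerates (Coord.hom χ) (Coord.hom χ′) (L ^ h) ≤ N * T h
            few′ χ χ′ = ≤-trans (∑-mono′ (allFin (suc s)) (λ i → degenerate-mono i (Coord.hom χ) (Coord.hom χ′) (m≤n*m (L ^ h) t))) (few χ χ′ h 2h≤k)

          step : energy (Coord.hom φ) (Coord.hom ψ) (L ^ h) ≤ recursion * (P * P) * T h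
          step = begin
            energy (Coord.hom φ) (Coord.hom ψ) (L ^ h)
              ≤⟨ energy-split φ ψ (L ^ h) ⟩
            (∑[ Y ∈ R ] (g φ Y h * g ψ Y h)) + (degenerates (Coord.hom φ) (Coord.hom ψ) (L ^ h) + degenerates (Coord.hom ψ) (Coord.hom φ) (L ^ h))
              ≤⟨ +-mono-≤ (≤-trans (∑-mono R term) (≤-reflexive (∑-swap R (upTo h) below))) (+-mono-≤ (few′ φ ψ) (few′ ψ φ)) ⟩
            (∑[ j ∈ upTo h ] (∑[ Y ∈ R ] below Y j)) + (N * T h + N * T h)
              ≤⟨ +-monoˡ-≤ _ (≤-trans (∑-≤const (upTo h) (spread * (6 * (N * U))) (λ j∈ → column (∈-upTo⁻ j∈)))
                   (*-monoˡ-≤ _ (≤-trans (≤-reflexive (length-upTo h)) (≤-trans (m≤m+n h h) 2h≤k)))) ⟩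
            k * (spread * (6 * (N * U))) + (N * T h + N * T h)
              ≤⟨ +-monoʳ-≤ (k * (spread * (6 * (N * U)))) (+-mono-≤ NT≤ NT≤) ⟩
            k * (spread * (6 * (N * U))) + (N * (P * P * T h) + N * (P * P * T h))
              ≡⟨ trans (combine k spread N (flatness ^ k * flatness ^ k) (P * P) (T h)) (cong (λ r → r * (P * P) * T h) recursion-≡) ⟩
            recursion * (P * P) * T h ∎
            where
            NT≤ : N * T h ≤ N * (P * P * T h)
            NT≤ = *-monoʳ-≤ N (m≤n*m (T h) (P * P) {{>-nonZero (*-mono-≤ 1≤P 1≤P)}})

      -- The free coordinates give x ^ (2 (n - m)) and the induction x ^ (2 m). All constants are
      -- powers of u = 4 t with total exponent 2 (n - m) + 4 m, at most 4 N.
      degenerate-bound : ∀ E {n} → n ≤ N → (∀ i {m} → m ≤ N → (φ ψ : Algebra.Coord (F ∘ Fin.punchIn i) m) → ∀ j → j + j ≤ k →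
          energy (Algebra.Coord.hom φ) (Algebra.Coord.hom ψ) (L ^ j) ≤ E * (L ^ j) ^ (m + m)) →
        ∀ i (φ ψ : Coord n) j → j + j ≤ k → degenerate i (Coord.hom φ) (Coord.hom ψ) (t * L ^ j) ≤ dilation * E * (L ^ j) ^ (n + n)
      degenerate-bound E {n} n≤N IH i φ ψ j 2j≤k = let m , m≤n , φ′ , ψ′ , le = degenerate-≤ i φ ψ in
        ≤-trans (le (t * L ^ j) (fits j 2j≤k)) (estimate m≤n φ′ ψ′)
        where
        open ≤-Reasoning
        open +-*-Solver
        x u : ℕ
        x = L ^ j
        u = 4 * t
        estimate : ∀ {m} → m ≤ n → (φ′ ψ′ : Algebra.Coord (F ∘ Fin.punchIn i) m) →
          (2 * (t * x)) ^ (n ∸ m) * (2 * (t * x)) ^ (n ∸ m) * energy (Algebra.Coord.hom φ′) (Algebra.Coord.hom ψ′) (2 * (t * x)) ≤ dilation * E * x ^ (n + n)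
        estimate {m} m≤n φ′ ψ′ = begin
          (2 * (t * x)) ^ d * (2 * (t * x)) ^ d * e (2 * (t * x))
            ≤⟨ *-mono-≤ (*-mono-≤ pow pow) dilated ⟩
          u ^ d * x ^ d * (u ^ d * x ^ d) * (u ^ (m + m) * (u ^ (m + m) * (E * x ^ (m + m))))
            ≡⟨ regroup (u ^ d) (x ^ d) (u ^ (m + m)) E (x ^ (m + m)) ⟩
          u ^ d * u ^ d * (u ^ (m + m) * u ^ (m + m)) * E * (x ^ d * x ^ d * x ^ (m + m))
            ≡⟨ cong₂ (λ a b → a * E * b) (trans (cong₂ _*_ (sym (^-distribˡ-+-* u d d)) (sym (^-distribˡ-+-* u (m + m) (m + m)))) (sym (^-distribˡ-+-* u (d + d) (m + m + (m + m)))))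
                 (trans (cong (_* x ^ (m + m)) (sym (^-distribˡ-+-* x d d))) (trans (sym (^-distribˡ-+-* x (d + d) (m + m))) (cong (x ^_) (trans
                   (solve 2 (λ d m → d :+ d :+ (m :+ m) := d :+ m :+ (d :+ m)) refl d m) (cong₂ _+_ d+m≡n d+m≡n))))) ⟩
          u ^ (d + d + (m + m + (m + m))) * E * x ^ (n + n)
            ≤⟨ *-monoˡ-≤ (x ^ (n + n)) (*-monoˡ-≤ E (≤-trans (^-monoʳ-≤ u exponent) (≤-reflexive dilation-≡))) ⟩
          dilation * E * x ^ (n + n) ∎
          where
          d = n ∸ m
          e : ℕ → ℕ
          e = energy (Algebra.Coord.hom φ′) (Algebra.Coord.hom ψ′)
          d+m≡n : d + m ≡ n
          d+m≡n = m∸n+n≡m m≤n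
          exponent : d + d + (m + m + (m + m)) ≤ 4 * N
          exponent = ≤-trans (≤-reflexive (trans (solve 2 (λ d m → d :+ d :+ (m :+ m :+ (m :+ m)) := d :+ m :+ (d :+ m) :+ (m :+ m)) refl d m) (cong (λ z → z + z + (m + m)) d+m≡n)))
            (≤-trans (+-mono-≤ (+-mono-≤ n≤N n≤N) (+-mono-≤ (≤-trans m≤n n≤N) (≤-trans m≤n n≤N))) (≤-reflexive (solve 1 (λ n → n :+ n :+ (n :+ n) := con 4 :* n) refl N)))
          pow : (2 * (t * x)) ^ d ≤ u ^ d * x ^ d
          pow = ≤-trans (^-monoˡ-≤ d (≤-trans (≤-reflexive (sym (*-assoc 2 t x))) (*-monoˡ-≤ x (*-monoˡ-≤ t {2} {4} (s≤s (s≤s z≤n)))))) (≤-reflexive (*-^ u x d))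
          dilated : e (2 * (t * x)) ≤ u ^ (m + m) * (u ^ (m + m) * (E * x ^ (m + m)))
          dilated = begin
            e (2 * (t * x))                                     ≡⟨ cong e (sym (*-assoc 2 t x)) ⟩
            e (2 * t * x)                                       ≤⟨ energy-dilate (Algebra.Coord.hom φ′) (Algebra.Coord.hom ψ′) (2 * t) x ⟩
            (2 * (2 * t)) ^ (m + m) * ((2 * (2 * t)) ^ (m + m) * e x) ≡⟨ cong (λ z → z ^ (m + m) * (z ^ (m + m) * e x)) (sym (*-assoc 2 2 t)) ⟩
            u ^ (m + m) * (u ^ (m + m) * e x)                   ≤⟨ *-monoʳ-≤ (u ^ (m + m)) (*-monoʳ-≤ (u ^ (m + m)) (IH i (≤-trans m≤n n≤N) φ′ ψ′ j 2j≤k)) ⟩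
            u ^ (m + m) * (u ^ (m + m) * (E * x ^ (m + m)))     ∎

    -- Induction on the number of fields, uniform in the dimension up to N and in both coordinate
    -- systems: the step leads to smaller dimensions, to dual coordinates and to mixed pairs.
    energy-bound : ∀ s {F : Fin s → Fld c ℓ} → s ≤ N → ∀ {n} → n ≤ N → (φ ψ : Algebra.Coord F n) → ∀ h → h + h ≤ k →
                   energy (Algebra.Coord.hom φ) (Algebra.Coord.hom ψ) (L ^ h) ≤ energyConstant L s * (L ^ h) ^ (n + n)
    energy-bound zero    {F} _ {zero} _ φ ψ h _ = ≤-trans (+-monoˡ-≤ 0 (+-monoˡ-≤ 0 (𝟙≤1 (Algebra._∥?_ F (Algebra.Coord.φ² φ []) (Algebra.Coord.φ² ψ []))))) ≤-refl
    -- A product of no fields is a point, so injectivity would make a unit vector congruent to `𝟎`.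
    energy-bound zero    {F} _ {suc n} _ φ ψ h _ = ⊥-elim (1≁0 (∼-trans (∼-reflexive (sym (unit-same (Fin.zero {n}) (ℤ.+ 1)))) (at (Algebra.Coord.injective φ {unit (Fin.zero {n}) (ℤ.+ 1)} (λ ())) Fin.zero)))
    energy-bound (suc s) {F} s<N {n} n≤N φ ψ h 2h≤k = begin
      energy (Algebra.Coord.hom φ) (Algebra.Coord.hom ψ) (L ^ h)
        ≤⟨ Local.Step.step s<N n≤N E₁ few φ ψ h 2h≤k ⟩
      recursion * (L ^ n * L ^ n) * (E₁ * ((L ^ n) ^ h * (L ^ n) ^ h))
        ≤⟨ *-monoˡ-≤ _ (*-monoʳ-≤ recursion (*-mono-≤ (^-monoʳ-≤ L n≤N) (^-monoʳ-≤ L n≤N))) ⟩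
      recursion * (L ^ N * L ^ N) * (E₁ * ((L ^ n) ^ h * (L ^ n) ^ h))
        ≡⟨ trans (sym (*-assoc (recursion * (L ^ N * L ^ N)) E₁ _)) (cong (energyConstant L (suc s) *_) (sym (power-swap h n))) ⟩
      energyConstant L (suc s) * (L ^ h) ^ (n + n) ∎
      where
      open ≤-Reasoning
      E₁ : ℕ
      E₁ = dilation * energyConstant L s
      few : ∀ (χ χ′ : Algebra.Coord F n) j → j + j ≤ k → degenerates (Algebra.Coord.hom χ) (Algebra.Coord.hom χ′) (t * L ^ j) ≤ N * (E₁ * ((L ^ n) ^ j * (L ^ n) ^ j))
      few χ χ′ j 2j≤k = ≤-trans (∑-≤const (allFin (suc s)) (E₁ * (L ^ j) ^ (n + n)) (λ {i} _ →
          degenerate-bound s<N (energyConstant L s) n≤N (λ i → energy-bound s (<⇒≤ s<N)) i χ χ′ j 2j≤k))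
        (*-mono-≤ (≤-trans (≤-reflexive (length-tabulate {n = suc s} id)) s<N) (≤-reflexive (cong (E₁ *_) (power-swap j n))))

-- Coordinates from Galois fields and independent linear forms

module FieldCoordinates (p : ℕ) (prime : Prime p) where

  open Balls
  open Residues p prime
  open Discrepancy p prime using (dot; dot-⊕ʳ; dot-≋)
  open Fields p prime
  open Slicing p prime using (unit)
  open DualLines p prime using (dot-unit; dot-comm; dot-𝟎ˡ)
  open import Algebra.Bundles using (CommutativeRing)
  import Algebra.Properties.Ring as RingProperties
  open import Algebra.Morphism.Structures using (module RingMorphisms)
  open import Defs using (GaloisField; 𝔽ₚ; linearCombination; IsBasis; LinearlyIndependent; freeModule; LinearForm; evaluate; flatten; λᴸ)
  open import Data.Fin.Base as Fin using (Fin; zero; suc)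
  import Data.Fin.Properties as Fin
  open import Data.Integer.Base as ℤ using (ℤ; +_)
  import Data.Integer.Properties as ℤ
  open import Data.Nat.Base as ℕ using (zero; suc; _≤_)
  open import Data.Product using (∃; _×_; _,_; proj₁; proj₂)
  open import Data.Vec.Base as Vec using (Vec; []; _∷_; lookup; tabulate)
  import Data.Vec.Properties as Vec
  open import Data.Vec.Functional as Vector using (Vector)
  import Data.Vec.Functional.Properties as Vector
  import Data.Integer.Solver as ℤ
  open import Data.Sum using (inj₁; inj₂)
  open import Function.Base using (_∘_)
  open import Function.Bundles using (Inverse)
  open import Level using (Level)
  open import Relation.Binary.PropositionalEquality as ≡ using (_≡_)
  open import Relation.Nullary
  open import Relation.Nullary.Decidable using (decidable-stable)

  private variable
    c ℓ₁ ℓ₂ : Level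

  module Combination {d} (K : GaloisField p d c ℓ₁ ℓ₂) where
    open GaloisField K using (Carrier; _≈_; _+_; _*_; 0#; 1#; commutativeRing; ι; ι-isHom; vectorSpace; powers; cardinality; _≟_; tight; #⇒invertible)
    open CommutativeRing commutativeRing using (distribʳ; zeroˡ; +-commutativeMonoid; ring; -‿inverseʳ; -‿cong)
    open RingProperties ring using (-‿distribˡ-*; -‿+-comm; -0#≈0#; x∙y⁻¹≈ε⇒x≈y)
    private
      module K = CommutativeRing commutativeRing
      module ι = RingMorphisms.IsRingHomomorphism ι-isHom

    combination : ∀ {m} → Vector ℤ m → Vector Carrier m → Carrier
    combination = linearCombination vectorSpace

    combination-cong : ∀ {m} {a b : Vector ℤ m} (v : Vector Carrier m) → (∀ j → a j ∼ b j) → combination a v ≈ combination b v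
    combination-cong {zero}  v e = K.refl
    combination-cong {suc m} {a} {b} v e = K.+-cong (K.*-congʳ (ι.⟦⟧-cong {a zero} {b zero} (difference (e zero)))) (combination-cong (v ∘ suc) (e ∘ suc))

    combination-+ : ∀ {m} (a b : Vector ℤ m) (v : Vector Carrier m) → combination (λ j → a j ℤ.+ b j) v ≈ combination a v + combination b v
    combination-+ {zero}  a b v = K.sym (K.+-identityˡ 0#)
    combination-+ {suc m} a b v = K.trans (K.+-cong (K.trans (K.*-congʳ (ι.+-homo (a zero) (b zero))) (distribʳ (v zero) _ _)) (combination-+ (a ∘ suc) (b ∘ suc) (v ∘ suc)))
      (interchange (ι (a zero) * v zero) (ι (b zero) * v zero) _ _)
      where open import Algebra.Properties.CommutativeSemigroup K.+-commutativeSemigroup using (interchange)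

    combination-zero : ∀ {m} {a : Vector ℤ m} (v : Vector Carrier m) → (∀ j → a j ∼ + 0) → combination a v ≈ 0#
    combination-zero {zero}  v e = K.refl
    combination-zero {suc m} {a} v e = K.trans (K.+-cong (K.trans (K.*-congʳ (K.trans (ι.⟦⟧-cong {a zero} {+ 0} (difference (e zero))) ι.0#-homo)) (zeroˡ (v zero)))
      (combination-zero (v ∘ suc) (e ∘ suc))) (K.+-identityˡ 0#)

    module Basis (ω : Carrier) (basis : IsBasis vectorSpace (powers ω)) where

      value : Vector ℤ d → Carrier
      value a = combination a (powers ω)

      coordinates : Carrier → Vector ℤ d
      coordinates x = proj₁ (proj₂ basis x)

      value-coordinates : ∀ x → x ≈ value (coordinates x)
      value-coordinates x = proj₂ (proj₂ basis x)

      value-zero : ∀ {a} → value a ≈ 0# → ∀ j → a j ∼ + 0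
      value-zero {a} e j = mod (proj₁ basis a e j)

      value-injective : ∀ {a b} → value a ≈ value b → ∀ j → a j ∼ b j
      value-injective {a} {b} e j = ∼0⇒∼ (value-zero {λ j → a j ℤ.- b j} (K.trans (K.sym (K.+-identityʳ _))
        (K.trans (K.+-congˡ (K.sym (-‿inverseʳ (value b)))) (K.trans (K.sym (K.+-assoc _ _ _))
        (K.trans (K.+-congʳ (K.trans (K.sym (combination-+ (λ j → a j ℤ.- b j) b (powers ω))) (combination-cong (powers ω) (λ j → ∼-reflexive (back (a j) (b j))))))
        (K.trans (K.+-congʳ e) (-‿inverseʳ (value b)))))) ) j)
        where
        back : ∀ x y → x ℤ.- y ℤ.+ y ≡ x
        back x y = ≡.trans (ℤ.+-assoc x (ℤ.- y) y) (≡.trans (≡.cong (λ z → x ℤ.+ z) (ℤ.+-inverseˡ y)) (ℤ.+-identityʳ x))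

  module Inverses {d} (K : GaloisField p d c ℓ₁ ℓ₂) where
    open GaloisField K using (Carrier; _≈_; _+_; _*_; 0#; 1#; commutativeRing; cardinality; _≟_; tight; #⇒invertible)
    private module K = CommutativeRing commutativeRing

    ¬¬inverse : ∀ {x} → ¬ x ≈ 0# → ¬ ¬ (∃ λ u → u * x ≈ 1#)
    ¬¬inverse {x} x≉0 none = x≉0 (proj₁ (tight x 0#) λ x#0 → let u , ux≈1 , _ = #⇒invertible x#0 in
      none (u , K.trans (K.*-congˡ (K.trans (K.sym (K.+-identityʳ x)) (K.+-congˡ (K.sym -0#≈0#)))) ux≈1))
      where open RingProperties K.ring using (-0#≈0#)

    -- A Heyting field inverts what is apart from 0, and being unequal to 0 gives apartness only
    -- under double negation. A search through the finitely many elements makes the existence of an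
    -- inverse decidable, hence stable.
    field-inverse : ∀ {x} → ¬ x ≈ 0# → ∃ λ u → u * x ≈ 1#
    field-inverse {x} x≉0 = let i , e = decidable-stable (Fin.any? (λ i → Inverse.from cardinality i * x ≟ 1#))
                                  (λ none → ¬¬inverse x≉0 (λ (u , ux≈1) → none (Inverse.to cardinality u , K.trans (K.*-congʳ (Inverse.strictlyInverseʳ cardinality u)) ux≈1)))
                            in Inverse.from cardinality i , e

    integral : ∀ {x y} → x * y ≈ 0# → ¬ x ≈ 0# → y ≈ 0#
    integral {x} {y} xy≈0 x≉0 = let u , ux≈1 = field-inverse x≉0 in
      K.trans (K.sym (K.*-identityˡ y)) (K.trans (K.*-congʳ (K.sym ux≈1)) (K.trans (K.*-assoc u x y) (K.trans (K.*-congˡ xy≈0) (K.zeroʳ u))))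

  -- The functional is the coefficient of ω ^ 0 = 1 in the basis of powers. For nonzero y the choice
  -- of x as the inverse of y gives it the value 1.
  functional : ∀ {d} → 1 ≤ d → (K : GaloisField p d c ℓ₁ ℓ₂) (ω : GaloisField.Carrier K) → IsBasis (GaloisField.vectorSpace K) (GaloisField.powers K ω) →
    let open GaloisField K using (Carrier; _≈_; _+_; _*_; 0#) in
    ∃ λ (τ : Carrier → ℤ) → (∀ {x y} → x ≈ y → τ x ∼ τ y) × (∀ x y → τ (x + y) ∼ τ x ℤ.+ τ y) × (∀ y → ¬ y ≈ 0# → ∃ λ x → ¬ τ (x * y) ∼ + 0)
  functional {d = suc d} _ K ω basis = τ
    , (λ {x} {y} e → value-injective {coordinates x} {coordinates y} (K.trans (K.sym (value-coordinates x)) (K.trans e (value-coordinates y))) zero)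
    , (λ x y → value-injective {coordinates (x + y)} {λ j → coordinates x j ℤ.+ coordinates y j}
        (K.trans (K.sym (value-coordinates (x + y))) (K.trans (K.+-cong (value-coordinates x) (value-coordinates y))
          (K.sym (combination-+ (coordinates x) (coordinates y) (powers ω))))) zero)
    , (λ y y≉0 → let u , uy≈1 = field-inverse y≉0 in
        u , λ τ≈0 → 1≁0 (∼-trans (∼-sym (value-injective {coordinates (u * y)} {e₀} (K.trans (K.sym (value-coordinates (u * y))) (K.trans uy≈1 (K.sym value-e₀))) zero)) τ≈0))
    where
    open GaloisField K using (Carrier; _≈_; _+_; _*_; 0#; 1#; commutativeRing; ι; ι-isHom; powers)
    open Combination K
    open Basis ω basis
    open Inverses K
    module K = CommutativeRing commutativeRing
    module ι = RingMorphisms.IsRingHomomorphism ι-isHom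

    τ : Carrier → ℤ
    τ x = coordinates x zero

    e₀ : Vector ℤ (suc d)
    e₀ zero    = + 1
    e₀ (suc _) = + 0

    value-e₀ : value e₀ ≈ 1#
    value-e₀ = K.trans (K.+-cong (K.trans (K.*-congʳ ι.1#-homo) (K.*-identityˡ 1#)) (combination-zero (powers ω ∘ suc) (λ _ → ∼-refl))) (K.+-identityʳ 1#)

  toFld : ∀ {d} → 1 ≤ d → (K : GaloisField p d c ℓ₁ ℓ₂) (ω : GaloisField.Carrier K) → IsBasis (GaloisField.vectorSpace K) (GaloisField.powers K ω) → Fld c ℓ₁
  toFld 1≤d K ω basis = record
    { commutativeRing = GaloisField.commutativeRing K
    ; _≟_             = GaloisField._≟_ K
    ; domain          = Inverses.integral K
    ; τ               = proj₁ τ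
    ; τ-cong          = proj₁ (proj₂ τ)
    ; τ-+             = proj₁ (proj₂ (proj₂ τ))
    ; nondegenerate   = proj₂ (proj₂ (proj₂ τ))
    }
    where τ = functional 1≤d K ω basis

  module Matrix {n} (ℓ : Vector (LinearForm p n) n) (independent : LinearlyIndependent (freeModule (𝔽ₚ p) n) ℓ) where

    private
      open ℤ.+-*-Solver

      evaluate-dot : ∀ {m} (f : LinearForm p m) x → evaluate p f x ≡ dot (tabulate f) x
      evaluate-dot f []      = ≡.refl
      evaluate-dot f (a ∷ x) = ≡.cong (λ z → f zero ℤ.* a ℤ.+ z) (evaluate-dot (f ∘ suc) x)

      dot-linear : ∀ {m} a (f g : Vector ℤ m) x → dot (tabulate (λ k → a ℤ.* f k ℤ.+ g k)) x ≡ a ℤ.* dot (tabulate f) x ℤ.+ dot (tabulate g) x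
      dot-linear a f g []      = ≡.trans (≡.sym (ℤ.*-zeroʳ a)) (≡.sym (ℤ.+-identityʳ _))
      dot-linear a f g (b ∷ x) = ≡.trans (≡.cong (λ z → (a ℤ.* f zero ℤ.+ g zero) ℤ.* b ℤ.+ z) (dot-linear a (f ∘ suc) (g ∘ suc) x))
        (solve 6 (λ a f g b u v → (a :* f :+ g) :* b :+ (a :* u :+ v) := a :* (f :* b :+ u) :+ (g :* b :+ v)) ≡.refl a (f zero) (g zero) b (dot (tabulate (f ∘ suc)) x) (dot (tabulate (g ∘ suc)) x))

      rows : ∀ {r} → Vector ℤ r → Vector (LinearForm p n) r → LinearForm p n
      rows = linearCombination (freeModule (𝔽ₚ p) n)

      dot-0 : ∀ {m} (x : Vec ℤ m) → dot (tabulate (λ _ → + 0)) x ≡ + 0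
      dot-0 []      = ≡.refl
      dot-0 (a ∷ x) = ≡.cong₂ ℤ._+_ (ℤ.*-zeroˡ a) (dot-0 x)

      dot-rows : ∀ {r} (c : Vector ℤ r) (f : Vector (LinearForm p n) r) x → dot (tabulate (rows c f)) x ≡ dot (tabulate c) (tabulate (λ j → evaluate p (f j) x))
      dot-rows {zero}  c f x = dot-0 x
      dot-rows {suc r} c f x = ≡.trans (dot-linear (c zero) (f zero) (rows (c ∘ suc) (f ∘ suc)) x)
        (≡.cong₂ ℤ._+_ (≡.cong (c zero ℤ.*_) (≡.sym (evaluate-dot (f zero) x))) (dot-rows (c ∘ suc) (f ∘ suc) x))

      rows-⊖ : ∀ {r} (c d : Vector ℤ r) (f : Vector (LinearForm p n) r) k → rows (λ j → c j ℤ.- d j) f k ≡ rows c f k ℤ.- rows d f k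
      rows-⊖ {zero}  c d f k = ≡.refl
      rows-⊖ {suc r} c d f k = ≡.trans (≡.cong (λ z → (c zero ℤ.- d zero) ℤ.* f zero k ℤ.+ z) (rows-⊖ (c ∘ suc) (d ∘ suc) (f ∘ suc) k))
        (solve 5 (λ c d f u v → (c :- d) :* f :+ (u :- v) := (c :* f :+ u) :- (d :* f :+ v)) ≡.refl (c zero) (d zero) (f zero k) (rows (c ∘ suc) (f ∘ suc) k) (rows (d ∘ suc) (f ∘ suc) k))

      transpose : Vec ℤ n → Vec ℤ n
      transpose y = tabulate (rows (lookup y) ℓ)

      transpose-injective : ∀ {y z} → transpose y ≋ transpose z → y ≋ z
      transpose-injective {y} {z} e = congruent λ j → ∼0⇒∼ (mod (independent (λ j → lookup y j ℤ.- lookup z j) (λ k → difference (null k)) j))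
        where
        null : ∀ k → rows (λ j → lookup y j ℤ.- lookup z j) ℓ k ∼ + 0
        null k = ∼-trans (∼-reflexive (rows-⊖ (lookup y) (lookup z) ℓ k)) (∼⇒∼0 (∼-trans (∼-reflexive (≡.sym (Vec.lookup∘tabulate (rows (lookup y) ℓ) k)))
          (∼-trans (at e k) (∼-reflexive (Vec.lookup∘tabulate (rows (lookup z) ℓ) k)))))

      values : Vec ℤ n → Vec ℤ n
      values x = tabulate (λ j → evaluate p (ℓ j) x)

    evaluate-⊕ : ∀ (f : LinearForm p n) x y → evaluate p f (x ⊕ y) ≡ evaluate p f x ℤ.+ evaluate p f y
    evaluate-⊕ f x y = ≡.trans (evaluate-dot f (x ⊕ y)) (≡.trans (dot-⊕ʳ (tabulate f) x y) (≡.sym (≡.cong₂ ℤ._+_ (evaluate-dot f x) (evaluate-dot f y))))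

    evaluate-null : ∀ (f : LinearForm p n) {x} → x ≋ 𝟎 → evaluate p f x ∼ + 0
    evaluate-null f {x} e = ∼-trans (∼-reflexive (evaluate-dot f x)) (∼-trans (dot-≋ (tabulate f) e) (∼-reflexive (≡.trans (dot-comm (tabulate f) 𝟎) (dot-𝟎ˡ (tabulate f)))))

    -- Independence of the forms makes the transposed matrix injective, hence onto by counting. So
    -- every coordinate function is a combination of the forms and vanishes where they all do.
    evaluate-injective : ∀ {x} → (∀ j → evaluate p (ℓ j) x ∼ + 0) → x ≋ 𝟎
    evaluate-injective {x} e = congruent λ k → let y , _ , ey = injective⇒surjective {f = transpose} transpose-injective ≡.refl (unit k (+ 1)) in
      ∼-trans (∼-reflexive (≡.trans (≡.sym (ℤ.*-identityˡ (lookup x k))) (≡.trans (≡.sym (dot-unit k (+ 1) x)) (dot-comm (unit k (+ 1)) x))))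
      (∼-trans (dot-≋ x (≋-sym ey)) (∼-trans (∼-reflexive (≡.trans (dot-comm x (transpose y)) (dot-rows (lookup y) ℓ x)))
      (∼-trans (dot-≋ (tabulate (lookup y)) {values x} {𝟎} (congruent λ j → ∼-trans (∼-reflexive (Vec.lookup∘tabulate (λ j → evaluate p (ℓ j) x) j)) (∼-trans (e j) (∼-reflexive (≡.sym (lookup-𝟎 j))))))
      (∼-reflexive (≡.trans (dot-comm (tabulate (lookup y)) 𝟎) (≡.trans (dot-𝟎ˡ (tabulate (lookup y))) (≡.sym (lookup-𝟎 k))))))))

    evaluate-surjective : ∀ (c : Vector ℤ n) → ∃ λ x → ∀ j → evaluate p (ℓ j) x ∼ c j
    evaluate-surjective c = let x , _ , e = injective⇒surjective {f = values} values-injective ≡.refl (tabulate c) in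
      x , λ j → ∼-trans (∼-reflexive (≡.sym (Vec.lookup∘tabulate (λ j → evaluate p (ℓ j) x) j))) (∼-trans (at e j) (∼-reflexive (Vec.lookup∘tabulate c j)))
      where
      back : ∀ (x y : Vec ℤ n) → (x ⊖ y) ⊕ y ≡ x
      back x y = vec-ext (λ k → ≡.trans (lookup-⊕ k (x ⊖ y) y) (≡.trans (≡.cong (ℤ._+ lookup y k) (lookup-⊖ k x y))
        (solve 2 (λ x y → x :- y :+ y := x) ≡.refl (lookup x k) (lookup y k))))
      values-injective : ∀ {x y} → values x ≋ values y → x ≋ y
      values-injective {x} {y} e = ⊖-≋𝟎⁻ (evaluate-injective (λ j → ∼-trans
        (∼-reflexive (≡.trans (solve 2 (λ a b → a := (a :+ b) :- b) ≡.refl (evaluate p (ℓ j) (x ⊖ y)) (evaluate p (ℓ j) y))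
          (≡.cong (ℤ._- evaluate p (ℓ j) y) (≡.trans (≡.sym (evaluate-⊕ (ℓ j) (x ⊖ y) y)) (≡.cong (evaluate p (ℓ j)) (back x y))))))
        (∼⇒∼0 (∼-trans (∼-reflexive (≡.sym (Vec.lookup∘tabulate (λ j → evaluate p (ℓ j) x) j))) (∼-trans (at e j) (∼-reflexive (Vec.lookup∘tabulate (λ j → evaluate p (ℓ j) y) j)))))))

  flatten⁻ : ∀ {a b r} {A : Set a} {B : Set b} (R : A → B → Set r) {s} {ns : Vector ℕ s} (f : ∀ i → Vector A (ns i)) (g : ∀ i → Vector B (ns i)) →
             (∀ j → R (flatten f j) (flatten g j)) → ∀ i j → R (f i j) (g i j)
  flatten⁻ R {suc s} {ns} f g r zero    j = ≡.subst₂ R (Vector.lookup-++ˡ (f zero) (flatten (f ∘ suc)) j) (Vector.lookup-++ˡ (g zero) (flatten (g ∘ suc)) j) (r (j Fin.↑ˡ _))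
  flatten⁻ R {suc s} {ns} f g r (suc i) j = flatten⁻ R (f ∘ suc) (g ∘ suc) (λ j → ≡.subst₂ R (Vector.lookup-++ʳ (f zero) (flatten (f ∘ suc)) j) (Vector.lookup-++ʳ (g zero) (flatten (g ∘ suc)) j) (r (ns zero Fin.↑ʳ j))) i j

  flatten⁺ : ∀ {a r} {A : Set a} (R : A → Set r) {s} {ns : Vector ℕ s} (f : ∀ i → Vector A (ns i)) → (∀ i j → R (f i j)) → ∀ j → R (flatten f j)
  flatten⁺ R {zero}       f r ()
  flatten⁺ R {suc s} {ns} f r j with Fin.splitAt (ns zero) j
  ... | inj₁ i = r zero i
  ... | inj₂ i = flatten⁺ R (f ∘ suc) (λ i → r (suc i)) i

  module Coordinates {s} {ns : Vector ℕ s} (positive : ∀ i → 1 ≤ ns i)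
    (K : ∀ i → GaloisField p (ns i) c ℓ₁ ℓ₂) (ω : ∀ i → GaloisField.Carrier (K i))
    (basis : ∀ i → IsBasis (GaloisField.vectorSpace (K i)) (GaloisField.powers (K i) (ω i)))
    (L : ∀ i → Vector (LinearForm p (Vector.foldr ℕ._+_ 0 ns)) (ns i))
    (independent : LinearlyIndependent (freeModule (𝔽ₚ p) (Vector.foldr ℕ._+_ 0 ns)) (flatten L)) where

    private
      n : ℕ
      n = Vector.foldr ℕ._+_ 0 ns
      module M = Matrix (flatten L) independent
      module K i = CommutativeRing (GaloisField.commutativeRing (K i))
      module C i = Combination (K i)
      module B i = C.Basis i (ω i) (basis i)

    F : Fin s → Fld c ℓ₁
    F i = toFld (positive i) (K i) (ω i) (basis i)

    open Algebra F

    λ-coordinates : Coord n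
    λ-coordinates = record
      { hom = record
        { φ      = λ x i → λᴸ K ω L i x
        ; φ-⊕    = λ x y i → K.trans i (C.combination-cong i (GaloisField.powers (K i) (ω i)) (λ j → ∼-reflexive (M.evaluate-⊕ (L i j) x y)))
                     (C.combination-+ i (λ j → evaluate p (L i j) x) (λ j → evaluate p (L i j) y) (GaloisField.powers (K i) (ω i)))
        ; φ-null = λ {x} e i → C.combination-zero i (GaloisField.powers (K i) (ω i)) (λ j → M.evaluate-null (L i j) e)
        }
      ; injective  = λ {x} e → M.evaluate-injective (flatten⁺ (λ f → evaluate p f x ∼ + 0) L (λ i → B.value-zero i {λ j → evaluate p (L i j) x} (e i)))
      ; surjective = λ X → let x , e = M.evaluate-surjective (flatten (λ i → B.coordinates i (X i))) in
          x , λ i → K.trans i (C.combination-cong i (GaloisField.powers (K i) (ω i)) (flatten⁻ (λ f a → evaluate p f x ∼ a) L (λ i → B.coordinates i (X i)) e i))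
                (K.sym i (B.value-coordinates i (X i)))
      }

-- From the energy of balls to the theorem: choice of the parameters

module Conclusion where

  open Counting
  open Balls
  open Scales using (*-^)
  open EnergyEstimate
  open import Defs
  open import Data.Empty using (⊥-elim)
  open import Data.Fin.Base as Fin using (Fin)
  open import Data.Integer.Base as ℤ using (ℤ)
  open import Data.List.Base using (List; length; cartesianProduct)
  open import Data.List.Properties using (length-filter)
  open import Data.Nat
  open import Data.Nat.Properties
  open import Data.Nat.Primality using (Prime; prime⇒nonTrivial; prime⇒nonZero)
  open import Data.Nat.Solver using (module +-*-Solver)
  open import Data.Product using (∃; _×_; _,_; ∃-syntax)
  open import Data.Rational.Base as ℚ using (ℚ; 0ℚ; mkℚ; ↥_)
  open import Data.Vec.Base as Vec using (Vec; []; _∷_; lookup; replicate)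
  import Data.Vec.Properties as Vec
  open import Data.Vec.Functional as Vector using (Vector)
  open import Function.Base using (_∘_)
  open import Level using (Level)
  open import Relation.Binary.PropositionalEquality
  open import Relation.Nullary

  private variable
    c ℓ₁ ℓ₂ : Level

  ∑-box-++′ : ∀ {m n} (N : Vec ℤ m) H (N′ : Vec ℤ n) H′ f → ∑ (box (N Vec.++ N′) (H Vec.++ H′)) f ≡ ∑[ x ∈ box N H ] (∑[ y ∈ box N′ H′ ] f (x Vec.++ y))
  ∑-box-++′ []      []      N′ H′ f = sym (+-identityʳ _)
  ∑-box-++′ (a ∷ N) (h ∷ H) N′ H′ f = trans (∑-box-∷ a (N Vec.++ N′) h (H Vec.++ H′) f)
    (trans (∑-cong (interval a h) (λ t → ∑-box-++′ N H N′ H′ (f ∘ (t ∷_)))) (sym (∑-box-∷ a N h H _)))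

  ++-≤ : ∀ {m n M} (H : Vec ℕ m) (H′ : Vec ℕ n) → (∀ k → lookup H k ≤ M) → (∀ k → lookup H′ k ≤ M) → ∀ k → lookup (H Vec.++ H′) k ≤ M
  ++-≤ []      H′ le le′ k           = le′ k
  ++-≤ (h ∷ H) H′ le le′ Fin.zero    = le Fin.zero
  ++-≤ (h ∷ H) H′ le le′ (Fin.suc k) = ++-≤ H H′ (le ∘ Fin.suc) le′ k

  module Count (p : ℕ) (prime : Prime p) {s} {ns : Vector ℕ s} (positive : ∀ i → 1 ≤ ns i)
    (K : ∀ i → GaloisField p (ns i) c ℓ₁ ℓ₂) (ω : ∀ i → GaloisField.Carrier (K i))
    (basis : ∀ i → IsBasis (GaloisField.vectorSpace (K i)) (GaloisField.powers (K i) (ω i)))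
    (L : ∀ i → Vector (LinearForm p (Vector.foldr _+_ 0 ns)) (ns i))
    (independent : LinearlyIndependent (freeModule (𝔽ₚ p) (Vector.foldr _+_ 0 ns)) (flatten L)) where

    open Fields p prime
    open Slicing p prime using (take-++; drop-++)
    open Energies p prime using (energy)
    open FieldCoordinates p prime using (module Coordinates)
    open Coordinates positive K ω basis L independent public using (F; λ-coordinates)
    open Algebra F

    private
      n : ℕ
      n = Vector.foldr _+_ 0 ns
      module φ = Coord λ-coordinates

    -- The equations of a solution are `∥` for the concatenations (x , x′) and (y , y′). With either
    -- one fixed the other satisfies a lattice condition, so differencing moves each in turn from
    -- the box to the centred ball.
    E≤energy : ∀ N Hs M → (∀ k → lookup Hs k ≤ M) → E K ω L N Hs ≤ energy φ.hom φ.hom M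
    E≤energy N Hs M Hs≤ = begin
      length (Data.List.Base.filter (solution? K ω L) (cartesianProduct B (cartesianProduct B (cartesianProduct B B))))
        ≡⟨ length-filter-∑ (solution? K ω L) (cartesianProduct B (cartesianProduct B (cartesianProduct B B))) ⟩
      ∑[ q ∈ cartesianProduct B (cartesianProduct B (cartesianProduct B B)) ] 𝟙 (solution? K ω L q)
        ≡⟨ trans (∑-product _,_ B _ _) (∑-cong B (λ x → trans (∑-product _,_ B _ _) (∑-cong B (λ x′ → ∑-product _,_ B B _)))) ⟩
      ∑[ x ∈ B ] (∑[ x′ ∈ B ] (∑[ y ∈ B ] (∑[ y′ ∈ B ] 𝟙 (solution? K ω L (x , x′ , y , y′)))))
        ≡⟨ ∑-cong B (λ x → ∑-cong B (λ x′ → ∑-cong B (λ y → ∑-cong B (λ y′ → 𝟙-cong (solution? K ω L (x , x′ , y , y′)) (φ.φ² (x Vec.++ x′) ∥? φ.φ² (y Vec.++ y′))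
             (subst₂ (λ X Y → X ∥ Y) (sym (φ²-++ x x′)) (sym (φ²-++ y y′))) (subst₂ (λ X Y → X ∥ Y) (φ²-++ x x′) (φ²-++ y y′)))))) ⟩
      ∑[ x ∈ B ] (∑[ x′ ∈ B ] (∑[ y ∈ B ] (∑[ y′ ∈ B ] 𝟙 (φ.φ² (x Vec.++ x′) ∥? φ.φ² (y Vec.++ y′)))))
        ≡⟨ trans (∑-box-++′ N Hs N Hs _) (∑-cong B (λ x → ∑-cong B (λ x′ → ∑-box-++′ N Hs N Hs _))) ⟨
      ∑[ w ∈ B² ] (∑[ v ∈ B² ] 𝟙 (φ.φ² w ∥? φ.φ² v))
        ≤⟨ ∑-mono′ B² (λ w → #-diff (λ v → φ.φ² w ∥? φ.φ² v) (λ v → φ.φ² w ∥? φ.φ² v) B²-unique (λ {v} {v′} v∈ v′∈ e e′ →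
             ∈-Ball⁺ (near v∈ v′∈) , ∥-sym {φ.φ² (v ⊖ v′)} {φ.φ² w} (φ.φ²-⊖ {v} {v′} (∥-sym {φ.φ² w} {φ.φ² v} e) (∥-sym {φ.φ² w} {φ.φ² v′} e′)))) ⟩
      ∑[ w ∈ B² ] (∑[ v ∈ Ball (n + n) M ] 𝟙 (φ.φ² w ∥? φ.φ² v))
        ≡⟨ ∑-swap B² (Ball (n + n) M) _ ⟩
      ∑[ v ∈ Ball (n + n) M ] (∑[ w ∈ B² ] 𝟙 (φ.φ² w ∥? φ.φ² v))
        ≤⟨ ∑-mono′ (Ball (n + n) M) (λ v → #-diff (λ w → φ.φ² w ∥? φ.φ² v) (λ w → φ.φ² w ∥? φ.φ² v) B²-unique (λ {w} {w′} w∈ w′∈ e e′ →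
             ∈-Ball⁺ (near w∈ w′∈) , φ.φ²-⊖ {w} {w′} e e′)) ⟩
      ∑[ v ∈ Ball (n + n) M ] (∑[ w ∈ Ball (n + n) M ] 𝟙 (φ.φ² w ∥? φ.φ² v))
        ≡⟨ ∑-swap (Ball (n + n) M) (Ball (n + n) M) _ ⟩
      energy φ.hom φ.hom M ∎
      where
      open ≤-Reasoning
      B  = box N Hs
      B² = box (N Vec.++ N) (Hs Vec.++ Hs)
      B²-unique = box-unique (N Vec.++ N) (Hs Vec.++ Hs)
      φ²-++ : ∀ x x′ → φ.φ² (x Vec.++ x′) ≡ (φ.φ x , φ.φ x′)
      φ²-++ x x′ = cong₂ (λ a b → φ.φ a , φ.φ b) (take-++ x x′) (drop-++ x x′)
      near = λ {v} {v′} → box-diff (N Vec.++ N) (Hs Vec.++ Hs) {M} {v} {v′} (++-≤ Hs Hs Hs≤ Hs≤)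

  -- The number of all quadruples, which is good enough for primes below a constant.
  E-trivial : ∀ {p n s} {ns : Vector ℕ s} (K : ∀ i → GaloisField p (ns i) c ℓ₁ ℓ₂) ω (L : ∀ i → Vector (LinearForm p n) (ns i)) N Hs M →
              Prime p → (∀ k → lookup Hs k ≤ M) → E K ω L N Hs ≤ (M ^ n) ^ 4
  E-trivial {p = p} {n} K ω L N Hs M p-prime Hs≤ = begin
    E K ω L N Hs
      ≤⟨ length-filter (solution? K ω L) (cartesianProduct B (cartesianProduct B (cartesianProduct B B))) ⟩
    length (cartesianProduct B (cartesianProduct B (cartesianProduct B B)))
      ≡⟨ trans (length-× B _) (cong (length B *_) (trans (length-× B _) (cong (length B *_) (length-× B B)))) ⟩
    length B * (length B * (length B * length B))
      ≤⟨ *-mono-≤ B≤ (*-mono-≤ B≤ (*-mono-≤ B≤ (≤-trans B≤ (≤-reflexive (sym (*-identityʳ (M ^ n))))))) ⟩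
    (M ^ n) ^ 4 ∎
    where
    open ≤-Reasoning
    open Residues p p-prime using (∑-box-const)
    B = box N Hs
    length-∑ : ∀ {a} {A : Set a} (xs : List A) → length xs ≡ ∑[ x ∈ xs ] 1
    length-∑ xs = sym (trans (∑-const xs 1) (*-identityʳ (length xs)))
    length-× : ∀ {a b} {A : Set a} {B : Set b} (xs : List A) (ys : List B) → length (cartesianProduct xs ys) ≡ length xs * length ys
    length-× xs ys = trans (length-∑ (cartesianProduct xs ys)) (trans (∑-product _,_ xs ys (λ _ → 1)) (trans (∑-cong xs (λ _ → sym (length-∑ ys))) (∑-const xs (length ys))))
    B≤ : length B ≤ M ^ n
    B≤ = ≤-trans (≤-reflexive (length-∑ B)) (≤-trans (∑-box-mono N Hs (replicate n M) (λ _ → 1) (λ k → ≤-trans (Hs≤ k) (≤-reflexive (sym (Vec.lookup-replicate k M)))))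
      (≤-reflexive (trans (∑-box-const n N M 1) (*-identityʳ (M ^ n)))))

  -- The least L with p ≤ L ^ k: then (L - 1) ^ k < p, and L ≤ 2 (L - 1) because p ≥ 2 excludes L =
  -- 1.
  root : ∀ p k → 1 ≤ k → 2 ≤ p → ∃ λ L → 1 ≤ L × p ≤ L ^ k × L ^ k ≤ 2 ^ k * p
  root p k 1≤k 2≤p = search p (≤-trans (≤-reflexive (sym (^-identityʳ p))) (^-monoʳ-≤ p {{>-nonZero (≤-trans (s≤s z≤n) 2≤p)}} 1≤k))
    where
    search : ∀ m → p ≤ m ^ k → ∃ λ L → 1 ≤ L × p ≤ L ^ k × L ^ k ≤ 2 ^ k * p
    search zero p≤ = ⊥-elim (≤⇒≯ (≤-trans p≤ (≤-reflexive (0^k 1≤k))) (≤-trans (s≤s z≤n) 2≤p))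
      where
      0^k : ∀ {k} → 1 ≤ k → 0 ^ k ≡ 0
      0^k (s≤s _) = refl
    search (suc m) p≤ with p ≤? m ^ k
    ... | yes p≤′ = search m p≤′
    ... | no p≰ = suc m , s≤s z≤n , p≤ , ≤-trans (^-monoˡ-≤ k (double m p≤ )) (≤-trans (≤-reflexive (*-^ 2 m k)) (*-monoʳ-≤ (2 ^ k) (<⇒≤ (≰⇒> p≰))))
      where
      double : ∀ m → p ≤ suc m ^ k → suc m ≤ 2 * m
      double zero    p≤ = ⊥-elim (≤⇒≯ (≤-trans p≤ (≤-reflexive (^-zeroˡ k))) 2≤p)
      double (suc m) _  = ≤-trans (s≤s (s≤s (m≤m+n m _))) (≤-reflexive (cong suc (sym (trans (cong (λ z → m + suc z) (+-identityʳ m)) (+-suc m m)))))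

  level : ∀ {H L} → 1 ≤ H → 1 ≤ L → ∀ i → H ≤ L ^ i → ∃ λ h → h ≤ i × H ≤ L ^ h × L ^ h ≤ L * H
  level 1≤H 1≤L zero H≤ = zero , z≤n , H≤ , *-mono-≤ 1≤L 1≤H
  level {H} {L} 1≤H 1≤L (suc i) H≤ with H ≤? L ^ i
  ... | yes H≤′ = let h , h≤i , rest = level 1≤H 1≤L i H≤′ in h , m≤n⇒m≤1+n h≤i , rest
  ... | no H≰ = suc i , ≤-refl , H≤ , *-monoʳ-≤ L (<⇒≤ (≰⇒> H≰))

  square-cancel-≤ : ∀ {a b} → a * a ≤ b * b → a ≤ b
  square-cancel-≤ le = ≮⇒≥ (λ b<a → ≤⇒≯ le (*-mono-< b<a b<a))

  parts≤ : ∀ {s} (ns : Vector ℕ s) → (∀ i → 1 ≤ ns i) → s ≤ Vector.foldr _+_ 0 ns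
  parts≤ {zero}  ns pos = z≤n
  parts≤ {suc s} ns pos = +-mono-≤ (pos Fin.zero) (parts≤ (ns ∘ Fin.suc) (pos ∘ Fin.suc))

  numerator-positive : ∀ ε → 0ℚ ℚ.< ε → 1 ≤ ℤ.∣ ↥ ε ∣
  numerator-positive (mkℚ (ℤ.+ zero) d _)  (ℚ.*<* (ℤ.+<+ ()))
  numerator-positive (mkℚ (ℤ.+ suc u) d _) _ = s≤s z≤n
  numerator-positive (mkℚ ℤ.-[1+ u ] d _)  (ℚ.*<* ())

  -- The exponent of L accumulated in the energy estimate, made to match L ^ k ≈ p by the choice of k.
  module Parameters (n v : ℕ) where

    κ k K : ℕ
    κ = (n * n + n) * v
    k = κ + κ
    K = 2 ^ k

    1≤K : 1 ≤ K
    1≤K = m^n>0 2 k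

    open Constants n K k 1≤K

    -- The summands of `threshold` secure c₀ ≤ p for duality, n < p for the shifts by multiples, and
    -- `fits`, by which the balls used stay below p / 2.
    threshold largeConstant smallConstant totalConstant : ℕ
    threshold     = suc (c₀ + (suc n + (2 * (2 + n)) * (2 * (2 + n)) * K))
    largeConstant = 4 ^ (n + n) * (4 ^ (n + n) * suc (recursion * dilation) ^ n)
    smallConstant = ((2 * threshold) ^ n) ^ 4
    totalConstant = largeConstant * K + smallConstant

    -- The successor keeps the base positive, so that the exponent s can be raised to n and the
    -- constant no longer depends on the number of parts.
    energyConstant-≤ : ∀ L s → 1 ≤ L → s ≤ n → energyConstant L s ≤ suc (recursion * dilation) ^ n * (L ^ n * L ^ n) ^ n
    energyConstant-≤ L s 1≤L s≤n = ≤-trans (≤-trans (≤-reflexive (closed s)) (≤-trans (^-monoˡ-≤ s base≤)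
      (^-monoʳ-≤ (suc (recursion * dilation) * (L ^ n * L ^ n)) {{>-nonZero (*-mono-≤ (s≤s (z≤n {recursion * dilation})) (*-mono-≤ 1≤Lⁿ 1≤Lⁿ))}} s≤n))) (≤-reflexive (*-^ (suc (recursion * dilation)) (L ^ n * L ^ n) n))
      where
      open +-*-Solver
      1≤Lⁿ : 1 ≤ L ^ n
      1≤Lⁿ = m^n>0 L {{>-nonZero 1≤L}} n
      rearrange : ∀ r l d e → r * l * (d * e) ≡ r * d * l * e
      rearrange = solve 4 (λ r l d e → r :* l :* (d :* e) := r :* d :* l :* e) refl
      base≤ : recursion * dilation * (L ^ n * L ^ n) ≤ suc (recursion * dilation) * (L ^ n * L ^ n)
      base≤ = m≤n+m (recursion * dilation * (L ^ n * L ^ n)) (L ^ n * L ^ n)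
      closed : ∀ s → energyConstant L s ≡ (recursion * dilation * (L ^ n * L ^ n)) ^ s
      closed zero    = refl
      closed (suc s) = trans (rearrange recursion (L ^ n * L ^ n) dilation (energyConstant L s)) (cong (recursion * dilation * (L ^ n * L ^ n) *_) (closed s))

  module _ {p s : ℕ} {ns : Vector ℕ s} (prime′ : Prime p) (positive : ∀ i → 1 ≤ ns i)
    (K′ : ∀ i → GaloisField p (ns i) c ℓ₁ ℓ₂) (ω : ∀ i → GaloisField.Carrier (K′ i))
    (basis : ∀ i → IsBasis (GaloisField.vectorSpace (K′ i)) (GaloisField.powers (K′ i) (ω i)))
    (forms : ∀ i → Vector (LinearForm p (Vector.foldr _+_ 0 ns)) (ns i))
    (independent : LinearlyIndependent (freeModule (𝔽ₚ p) (Vector.foldr _+_ 0 ns)) (flatten forms))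
    (H : ℕ) (1≤H : 1 ≤ H) (H²≤p : H * H ≤ p)
    (N : Vec ℤ (Vector.foldr _+_ 0 ns)) (Hs : Vec ℕ (Vector.foldr _+_ 0 ns)) (Hs≤ : ∀ i → lookup Hs i ≤ 2 * H)
    (v : ℕ) (1≤v : 1 ≤ v) (1≤n : 1 ≤ Vector.foldr _+_ 0 ns) where

    private
      n : ℕ
      n = Vector.foldr _+_ 0 ns
      open Parameters n v
      open +-*-Solver
      open ≤-Reasoning
      module C = Count p prime′ positive K′ ω basis forms independent

      e : ℕ
      e = E K′ ω forms N Hs

      2≤p : 2 ≤ p
      2≤p = nonTrivial⇒n>1 p {{prime⇒nonTrivial prime′}}

      1≤κ : 1 ≤ κ
      1≤κ = *-mono-≤ (≤-trans 1≤n (m≤n+m n (n * n))) 1≤v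

    large : threshold ≤ p → e ^ v ≤ (largeConstant * H ^ (n + n)) ^ v * (K * p)
    large threshold≤p = bound (root p k (≤-trans 1≤κ (m≤m+n κ κ)) 2≤p)
      where
      open Constants n K k 1≤K
      -- The energy constant contributes L ^ (2 n²) and the rounding of H up to a power of L
      -- contributes L ^ (2 n); times v these exponents add up to exactly k.
      exponent : ∀ L → ((L ^ n * L ^ n) ^ n * L ^ (n + n)) ^ v ≡ L ^ k
      exponent L = trans (cong (_^ v) (trans (cong (λ z → z ^ n * L ^ (n + n)) (sym (^-distribˡ-+-* L n n))) (trans (cong (_* L ^ (n + n)) (^-*-assoc L (n + n) n)) (sym (^-distribˡ-+-* L ((n + n) * n) (n + n))))))
        (trans (^-*-assoc L ((n + n) * n + (n + n)) v) (cong (L ^_) (solve 2 (λ n v → ((n :+ n) :* n :+ (n :+ n)) :* v := (n :* n :+ n) :* v :+ (n :* n :+ n) :* v) refl n v)))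
      regroup′ : ∀ a b l m h → a * (a * (b * l * (m * h))) ≡ a * (a * b) * h * (l * m)
      regroup′ = solve 5 (λ a b l m h → a :* (a :* (b :* l :* (m :* h))) := a :* (a :* b) :* h :* (l :* m)) refl
      bound : (∃ λ L → 1 ≤ L × p ≤ L ^ k × L ^ k ≤ 2 ^ k * p) → e ^ v ≤ (largeConstant * H ^ (n + n)) ^ v * (K * p)
      -- Since k = κ + κ, the bounds H * H ≤ p ≤ L ^ κ * L ^ κ give H ≤ L ^ κ. So the level h of H
      -- satisfies h + h ≤ k, the range in which the dichotomy holds.
      bound (L , 1≤L , p≤Lᵏ , Lᵏ≤Kp) = at-level (level 1≤H 1≤L κ (square-cancel-≤ (≤-trans H²≤p (≤-trans p≤Lᵏ (≤-reflexive (^-distribˡ-+-* L κ κ))))))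
        where
        fits : ∀ j → j + j ≤ k → 2 * ((2 + n) * L ^ j) ≤ p
        fits j 2j≤k = square-cancel-≤ (begin
          2 * ((2 + n) * L ^ j) * (2 * ((2 + n) * L ^ j))
            ≡⟨ solve 3 (λ t n x → t :* (n :* x) :* (t :* (n :* x)) := t :* n :* (t :* n) :* (x :* x)) refl 2 (2 + n) (L ^ j) ⟩
          2 * (2 + n) * (2 * (2 + n)) * (L ^ j * L ^ j)
            ≤⟨ *-monoʳ-≤ (2 * (2 + n) * (2 * (2 + n))) (≤-trans (≤-reflexive (sym (^-distribˡ-+-* L j j))) (≤-trans (^-monoʳ-≤ L {{>-nonZero 1≤L}} 2j≤k) Lᵏ≤Kp)) ⟩
          2 * (2 + n) * (2 * (2 + n)) * (K * p)
            ≡⟨ *-assoc (2 * (2 + n) * (2 * (2 + n))) K p ⟨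
          2 * (2 + n) * (2 * (2 + n)) * K * p
            ≤⟨ *-monoˡ-≤ p (≤-trans (≤-trans (m≤n+m _ (suc n)) (m≤n+m _ (suc c₀))) threshold≤p) ⟩
          p * p ∎)
        module En = Energy p prime′ n K L k 1≤K 1≤L p≤Lᵏ Lᵏ≤Kp
          (≤-trans (≤-trans (m≤m+n c₀ _) (n≤1+n _)) threshold≤p)
          (≤-trans (≤-trans (m≤m+n (suc n) _) (m≤n+m _ (suc c₀))) threshold≤p) fits
        open Fields p prime′ using (module Algebra)
        open Energies p prime′ using (energy)
        open LineClasses p prime′ using (energy-mono; energy-dilate)
        open Algebra C.F using (module Coord)
        φ = Coord.hom C.λ-coordinates
        X : ℕ
        X = (L ^ n * L ^ n) ^ n * L ^ (n + n)
        at-level : (∃ λ h → h ≤ κ × H ≤ L ^ h × L ^ h ≤ L * H) → e ^ v ≤ (largeConstant * H ^ (n + n)) ^ v * (K * p)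
        at-level (h , h≤κ , H≤Lʰ , Lʰ≤LH) = begin
          e ^ v
            ≤⟨ ^-monoˡ-≤ v estimate ⟩
          (largeConstant * H ^ (n + n) * X) ^ v
            ≡⟨ *-^ (largeConstant * H ^ (n + n)) X v ⟩
          (largeConstant * H ^ (n + n)) ^ v * X ^ v
            ≤⟨ *-monoʳ-≤ ((largeConstant * H ^ (n + n)) ^ v) (≤-trans (≤-reflexive (exponent L)) Lᵏ≤Kp) ⟩
          (largeConstant * H ^ (n + n)) ^ v * (K * p) ∎
          where
          estimate : e ≤ largeConstant * H ^ (n + n) * X
          estimate = begin
            e
              ≤⟨ C.E≤energy N Hs (2 * H) Hs≤ ⟩
            energy φ φ (2 * H)
              ≤⟨ ≤-trans (energy-mono φ φ (*-monoʳ-≤ 2 H≤Lʰ)) (energy-dilate φ φ 2 (L ^ h)) ⟩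
            4 ^ (n + n) * (4 ^ (n + n) * energy φ φ (L ^ h))
              ≤⟨ *-monoʳ-≤ (4 ^ (n + n)) (*-monoʳ-≤ (4 ^ (n + n)) (≤-trans (En.energy-bound s (parts≤ ns positive) ≤-refl C.λ-coordinates C.λ-coordinates h (+-mono-≤ h≤κ h≤κ))
                   (*-mono-≤ (energyConstant-≤ L s 1≤L (parts≤ ns positive)) (≤-trans (^-monoˡ-≤ (n + n) Lʰ≤LH) (≤-reflexive (*-^ L H (n + n))))))) ⟩
            4 ^ (n + n) * (4 ^ (n + n) * (suc (recursion * dilation) ^ n * (L ^ n * L ^ n) ^ n * (L ^ (n + n) * H ^ (n + n))))
              ≡⟨ regroup′ (4 ^ (n + n)) (suc (recursion * dilation) ^ n) ((L ^ n * L ^ n) ^ n) (L ^ (n + n)) (H ^ (n + n)) ⟩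
            largeConstant * H ^ (n + n) * X ∎

    small-case : p ≤ threshold → e ≤ smallConstant
    small-case p≤ = E-trivial K′ ω forms N Hs (2 * threshold) prime′ (λ i → ≤-trans (Hs≤ i) (*-monoʳ-≤ 2 (≤-trans (m≤m*n H H {{>-nonZero 1≤H}}) (≤-trans H²≤p p≤))))

    -- For ε = u / v the loss raised to the power v is K p, and K p ≤ K ^ v * p ^ u. So the
    -- constants depend on ε through its denominator only.
    E-bound : ∀ u → 1 ≤ u → e ^ v ≤ (totalConstant * H ^ (n + n)) ^ v * p ^ u
    E-bound u 1≤u = cases (≤-total threshold p)
      where
      open import Data.Sum using (_⊎_; inj₁; inj₂)
      open Constants n K k 1≤K
      p≤pᵘ : p ≤ p ^ u
      p≤pᵘ = ≤-trans (≤-reflexive (sym (^-identityʳ p))) (^-monoʳ-≤ p {{prime⇒nonZero prime′}} 1≤u)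
      1≤Hᴰ : 1 ≤ H ^ (n + n)
      1≤Hᴰ = m^n>0 H {{>-nonZero 1≤H}} (n + n)
      K≤Kᵛ : K ≤ K ^ v
      K≤Kᵛ = ≤-trans (≤-reflexive (sym (^-identityʳ K))) (^-monoʳ-≤ K {{>-nonZero 1≤K}} 1≤v)
      cases : threshold ≤ p ⊎ p ≤ threshold → e ^ v ≤ (totalConstant * H ^ (n + n)) ^ v * p ^ u
      cases (inj₁ le) = begin
        e ^ v
          ≤⟨ large le ⟩
        (largeConstant * H ^ (n + n)) ^ v * (K * p)
          ≤⟨ *-monoʳ-≤ ((largeConstant * H ^ (n + n)) ^ v) (*-mono-≤ K≤Kᵛ p≤pᵘ) ⟩
        (largeConstant * H ^ (n + n)) ^ v * (K ^ v * p ^ u)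
          ≡⟨ trans (sym (*-assoc ((largeConstant * H ^ (n + n)) ^ v) (K ^ v) (p ^ u))) (cong (_* p ^ u) (sym (*-^ (largeConstant * H ^ (n + n)) K v))) ⟩
        (largeConstant * H ^ (n + n) * K) ^ v * p ^ u
          ≤⟨ *-monoˡ-≤ (p ^ u) (^-monoˡ-≤ v (≤-trans (≤-reflexive (swap largeConstant (H ^ (n + n)) K)) (*-monoˡ-≤ (H ^ (n + n)) (m≤m+n (largeConstant * K) smallConstant)))) ⟩
        (totalConstant * H ^ (n + n)) ^ v * p ^ u ∎
        where
        swap : ∀ a b c → a * b * c ≡ a * c * b
        swap = solve 3 (λ a b c → a :* b :* c := a :* c :* b) refl
      cases (inj₂ le) = begin
        e ^ v
          ≤⟨ ^-monoˡ-≤ v (≤-trans (small-case le) (≤-trans (m≤n+m smallConstant (largeConstant * K)) (m≤m*n totalConstant (H ^ (n + n)) {{>-nonZero 1≤Hᴰ}}))) ⟩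
        (totalConstant * H ^ (n + n)) ^ v
          ≤⟨ m≤m*n _ (p ^ u) {{m^n≢0 p u {{prime⇒nonZero prime′}}}} ⟩
        (totalConstant * H ^ (n + n)) ^ v * p ^ u ∎

  E-bound′ : ∀ {p s n} {ns : Vector ℕ s} → Prime p → ns IsPartitionOf n → 1 ≤ n →
    ∀ (K : ∀ i → GaloisField p (ns i) c ℓ₁ ℓ₂) (ω : ∀ i → GaloisField.Carrier (K i)) →
    (∀ i → IsBasis (GaloisField.vectorSpace (K i)) (GaloisField.powers (K i) (ω i))) →
    ∀ (L : ∀ i → Vector (LinearForm p n) (ns i)) → LinearlyIndependent (freeModule (𝔽ₚ p) n) (flatten L) →
    ∀ H → 1 ≤ H → H * H ≤ p → ∀ (N : Vec ℤ n) (Hs : Vec ℕ n) → (∀ k → lookup Hs k ≤ 2 * H) →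
    ∀ u v → 1 ≤ u → 1 ≤ v → E K ω L N Hs ^ v ≤ (Parameters.totalConstant n v * H ^ (2 * n)) ^ v * p ^ u
  E-bound′ {p = p} {ns = ns} prime′ (positive , refl) 1≤n K ω basis L independent H 1≤H H²≤p N Hs Hs≤ u v 1≤u 1≤v =
    ≤-trans (E-bound prime′ positive K ω basis L independent H 1≤H H²≤p N Hs Hs≤ v 1≤v 1≤n u 1≤u)
      (≤-reflexive (cong (λ d → (Parameters.totalConstant n v * H ^ d) ^ v * p ^ u) (cong (λ z → n + z) (sym (+-identityʳ n)))))
    where n = Vector.foldr _+_ 0 ns

open import Defs
open import Data.Integer using (ℤ)
open import Data.Nat using (ℕ; _*_; _^_; _≤_)
open import Data.Product using (∃-syntax; _×_; _,_; proj₂)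
open import Data.Rational using (ℚ; 0ℚ; ↥_; ↧ₙ_) renaming (_<_ to _<ᵠ_)
open import Data.Vec using (Vec; lookup)
open import Data.Vec.Functional using (Vector)
open import Function using (_∘_)
open Conclusion using (module Parameters; E-bound′; numerator-positive)

theorem1p3 : ∀ {c ℓ₁ ℓ₂} (n : ℕ) → 1 ≤ n → (ε : ℚ) → 0ℚ <ᵠ ε →
    ∃[ C ] (∀ (p : ℕ) → Prime p →
    ∀ (s : ℕ) (ns : Vector ℕ s) → ns IsPartitionOf n →
    ∀ (K : ∀ i → GaloisField p (ns i) c ℓ₁ ℓ₂)
    (ω : ∀ i → GaloisField.Carrier (K i)) →
    (∀ i → IsBasis (GaloisField.vectorSpace (K i)) (GaloisField.powers (K i) (ω i))) →
    ∀ (L : ∀ i → Vector (LinearForm p n) (ns i)) →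
    LinearlyIndependent (freeModule (𝔽ₚ p) n) (flatten L) →
    ∀ (H : ℕ) → 1 ≤ H → H * H ≤ p →
    ∀ (N : Vec ℤ n) (Hs : Vec ℕ n) →
    (∀ k → H ≤ lookup Hs k × lookup Hs k ≤ 2 * H) →
    E K ω L N Hs ≤ (C * H ^ (2 * n)) · p ^ᵠ ε)
theorem1p3 n 1≤n ε 0<ε = Parameters.totalConstant n (↧ₙ ε) ,
  λ p p-prime s ns partition K ω basis L independent H 1≤H H²≤p N Hs Hs-bounds →
    E-bound′ p-prime partition 1≤n K ω basis L independent H 1≤H H²≤p N Hs (proj₂ ∘ Hs-bounds)
      Data.Integer.∣ ↥ ε ∣ (↧ₙ ε) (numerator-positive ε 0<ε) (Data.Nat.s≤s Data.Nat.z≤n)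
  where
  import Data.Integer
  import Data.Nat
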